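{- Let $n\geq 6$ be an integer such that $p=(2n-1)(2n+1)$, $q=(2n-1)(2n+3)$ and $r=(2n+1)(2n+3)$ are square-free integers, and let $K=\mathbb{Q}(\sqrt{p},\sqrt{q})$. If $\alpha\in\mathcal{O}_K^{+}$ is indecomposable in $\mathcal{O}_K$, then $N(\alpha)\leq 16n^4+64n^3+16n^2-96n+36$.
   Context: $\mathcal{O}_K$ is the ring of integers of $K$; $\mathcal{O}_K^{+}$ is the set of totally positive elements of $\mathcal{O}_K$ (all real embeddings positive). An element $\alpha\in\mathcal{O}_K^{+}$ is indecomposable if it cannot be written as $\beta+\gamma$ with $\beta,\gamma\in\mathcal{O}_K^{+}$. $N(\alpha)$ is the field norm (product of all conjugates). -}

module Defs where

open import Data.Bool using (Bool; true; false)
open import Data.Nat as ℕ using (ℕ)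
open import Data.Nat.Divisibility using (_∣_)
open import Data.Integer as ℤ using (ℤ)
open import Data.Rational as ℚ using (ℚ; 0ℚ; 1ℚ; _/_)
open import Data.List using (List; []; _∷_)
open import Data.Product using (_×_; Σ; ∃; _,_)
open import Data.Sum using (_⊎_)
open import Relation.Binary.PropositionalEquality using (_≡_; _≢_)
open import Relation.Nullary using (¬_)

SquareFree : ℕ → Set
SquareFree x = ∀ (m : ℕ) → m ℕ.* m ∣ x → m ≡ 1

ℕtoℚ : ℕ → ℚ
ℕtoℚ x = ℤ.+ x / 1

ℤtoℚ : ℤ → ℚ
ℤtoℚ z = z / 1

-- Q(√d) for a rational radicand d (assumed positive, non-square):
-- the pair (a , b) represents a + b √d, with √d the positive real root.

record Qd : Set where
  constructor ⟨_,_⟩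
  field
    re : ℚ
    im : ℚ
open Qd public

module QuadExt (d : ℚ) where
  infixl 6 _⊕_ _⊖_
  infixl 7 _⊗_
  _⊕_ : Qd → Qd → Qd
  ⟨ a , b ⟩ ⊕ ⟨ c , e ⟩ = ⟨ a ℚ.+ c , b ℚ.+ e ⟩
  _⊖_ : Qd → Qd → Qd
  ⟨ a , b ⟩ ⊖ ⟨ c , e ⟩ = ⟨ a ℚ.- c , b ℚ.- e ⟩
  _⊗_ : Qd → Qd → Qd
  ⟨ a , b ⟩ ⊗ ⟨ c , e ⟩ = ⟨ a ℚ.* c ℚ.+ b ℚ.* e ℚ.* d , a ℚ.* e ℚ.+ b ℚ.* c ⟩
  𝟘 𝟙 : Qd
  𝟘 = ⟨ 0ℚ , 0ℚ ⟩
  𝟙 = ⟨ 1ℚ , 0ℚ ⟩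
  -- a + b√d > 0 in ℝ (for d > 0 not a square), decided by cases on signs.
  Pos : Qd → Set
  Pos ⟨ a , b ⟩ =
      (0ℚ ℚ.≤ a × 0ℚ ℚ.≤ b × (a ≢ 0ℚ ⊎ b ≢ 0ℚ))
    ⊎ (0ℚ ℚ.< a × b ℚ.< 0ℚ × b ℚ.* b ℚ.* d ℚ.< a ℚ.* a)
    ⊎ (a ℚ.< 0ℚ × 0ℚ ℚ.< b × a ℚ.* a ℚ.< b ℚ.* b ℚ.* d)
  infix 4 _<′_
  _<′_ : Qd → Qd → Set
  x <′ y = Pos (y ⊖ x)

-- K = Q(√p, √q) = Q(√p)(√q): the pair (u , v) with u v ∈ Q(√p)
-- represents u + v √q.  (Basis 1, √p, √q, √p√q over ℚ.)

record Kel : Set where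
  constructor ⟪_,_⟫
  field
    fst : Qd
    snd : Qd
open Kel public

module Biquad (p q : ℚ) where
  open QuadExt p public
  infixl 6 _+K_
  infixl 7 _*K_
  _+K_ : Kel → Kel → Kel
  ⟪ u , v ⟫ +K ⟪ w , z ⟫ = ⟪ u ⊕ w , v ⊕ z ⟫
  _*K_ : Kel → Kel → Kel
  ⟪ u , v ⟫ *K ⟪ w , z ⟫ = ⟪ u ⊗ w ⊕ v ⊗ z ⊗ ⟨ q , 0ℚ ⟩ , u ⊗ z ⊕ v ⊗ w ⟫
  0K 1K : Kel
  0K = ⟪ 𝟘 , 𝟘 ⟫
  1K = ⟪ 𝟙 , 𝟘 ⟫
  ℤtoK : ℤ → Kel
  ℤtoK z = ⟪ ⟨ ℤtoℚ z , 0ℚ ⟩ , 𝟘 ⟫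

  -- u + v√q > 0 in ℝ under the standard embedding (√p, √q ↦ positive roots),
  -- using the ordering of Q(√p) ⊂ ℝ.
  PosK : Kel → Set
  PosK ⟪ u , v ⟫ =
      ((u ≡ 𝟘 ⊎ 𝟘 <′ u) × (v ≡ 𝟘 ⊎ 𝟘 <′ v) × (u ≢ 𝟘 ⊎ v ≢ 𝟘))
    ⊎ (𝟘 <′ u × v <′ 𝟘 × v ⊗ v ⊗ ⟨ q , 0ℚ ⟩ <′ u ⊗ u)
    ⊎ (u <′ 𝟘 × 𝟘 <′ v × u ⊗ u <′ v ⊗ v ⊗ ⟨ q , 0ℚ ⟩)

  sgn : Bool → ℚ → ℚ
  sgn true x = x
  sgn false x = ℚ.- x
  conj : Bool → Bool → Kel → Kel
  conj e₁ e₂ ⟪ ⟨ a , b ⟩ , ⟨ c , d ⟩ ⟫ =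
    ⟪ ⟨ a , sgn e₁ b ⟩ , ⟨ sgn e₂ c , sgn e₁ (sgn e₂ d) ⟩ ⟫

  TotallyPositive : Kel → Set
  TotallyPositive α = ∀ (e₁ e₂ : Bool) → PosK (conj e₁ e₂ α)

  -- Evaluation of the monic polynomial x^k + c₁ x^(k-1) + … + c_k
  -- (coefficient list c₁ … c_k) at α, by Horner's rule.
  evalMonic : List ℤ → Kel → Kel
  evalMonic cs α = go 1K cs
    where
    go : Kel → List ℤ → Kel
    go acc [] = acc
    go acc (c ∷ cs) = go (acc *K α +K ℤtoK c) cs

  InOK : Kel → Set
  InOK α = Σ (List ℤ) λ cs → evalMonic cs α ≡ 0K

  InOK⁺ : Kel → Set
  InOK⁺ α = InOK α × TotallyPositive α

  Indecomposable : Kel → Set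
  Indecomposable α = InOK⁺ α × ¬ (Σ Kel λ β → Σ Kel λ γ → InOK⁺ β × InOK⁺ γ × α ≡ β +K γ)

  -- Norm: product of the four conjugates; this lies in ℚ, so we read off its
  -- rational (basis-1) coordinate.
  normK : Kel → Kel
  normK α = conj true true α *K conj true false α *K conj false true α *K conj false false α
  N : Kel → ℚ
  N α = re (fst (normK α))

{-# OPTIONS --safe #-}
module Submission where

open import Defs
open import Data.Nat as ℕ using (ℕ; zero; suc)
open import Data.Integer as ℤ using (ℤ; +_; -[1+_]) renaming (_-_ to _-ℤ_)
open import Data.Rational as ℚ using (ℚ; 0ℚ; 1ℚ; ½; mkℚ) renaming (_≤_ to _≤ℚ_)
open import Algebra.Bundles using (CommutativeRing)
open import Algebra.Core using (Op₁; Op₂)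
import Algebra.Solver.Ring
open import Algebra.Solver.Ring.AlmostCommutativeRing using (fromCommutativeRing; _-Raw-AlmostCommutative⟶_)
open import Algebra.Structures using (IsCommutativeRing)
open import Data.Bool using (Bool; true; false; if_then_else_; not; _xor_)
open import Data.Empty using (⊥; ⊥-elim)
import Data.Integer.Properties as ℤP
open import Data.List using (List; []; _∷_; length)
open import Data.Maybe using (just; nothing)
open import Data.Nat.Coprimality as Coprimality using (Coprime; coprime-divisor)
open import Data.Nat.Divisibility using (_∣_; divides; ∣-trans; ∣1⇒≡1; ∣⇒≤)
import Data.Nat.Properties as ℕP
open import Data.Product using (_×_; _,_; proj₁; proj₂; ∃)
import Data.Rational.Properties as ℚP
import Data.Rational.Unnormalised as ℚᵘ
import Data.Rational.Unnormalised.Properties as ℚᵘP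
open import Data.Sum using (_⊎_; inj₁; inj₂; [_,_]′)
open import Data.Vec as Vec using (Vec)
open import Data.Vec.N-ary using (N-ary; curryⁿ; _$ⁿ_; Eq; Eqʰ; Eqʰ-to-Eq; curryⁿ-cong; curryⁿ-cong⁻¹)
open import Function using (_∘_; id; case_of_)
open import Level using (0ℓ)
open import Relation.Binary.Definitions using (tri<; tri≈; tri>)
open import Relation.Binary.PropositionalEquality using (_≡_; _≢_; refl; sym; trans; cong; cong₂; subst; subst₂; isEquivalence; module ≡-Reasoning)
open import Relation.Nullary using (¬_; yes; no)
open import Relation.Nullary.Decidable using (decidable-stable)

-- Put a = 2n - 1, b = 2n + 1, c = 2n + 3, so p = ab, q = ac and r = bc.  The
-- units ε_p = b - 1 + √p, ε_q = (b + √q)/2 and ε_r = b + 1 + √r are totally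
-- positive.  Clearing denominators by squarefreeness shows that the ring of
-- integers is a lattice with an explicit basis c₁, ε_q c₁, ξ, η.  In the
-- coordinates (f , g , X , Y) of α, the height f + g is up to a positive factor
-- the trace of (b - √p)(c - √r)α, hence a positive integer if α is totally
-- positive.  Units and Galois automorphisms preserve indecomposability and norm,
-- so one may take α of minimal height in its orbit.  Comparing α with its
-- multiples by products of the units then places α either in a polyhedral cone of
-- totally positive elements or in the cone spanned by 1, ε_p, 1/ε_q and ε_p/ε_q.
-- In the second cone a generator can be subtracted unless α is one of the points
-- with norm (3b - 2 + 2k(a - k))².  In the first, a totally positive element of
-- height 1 can be subtracted unless f , g ≤ 1, and the finitely many lines of
-- points that remain have norm at most (r - 9)², which is the bound.

-- The weight (b - √p)(c - √r) in the height is chosen for its conjugates: (b + √p)/(b - √p) = ε_p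
-- and (c + √r)/(c - √r) = ε_r, so every conjugate is the weight times a unit. A Galois automorphism
-- followed by multiplication by that unit therefore preserves the height. These maps form the
-- four-group generated by `S` and `W`, and the whole configuration is symmetric under it. Comparing
-- α with uα for a unit u gives one linear inequality. Those from ε_q, ε_p ε_q and their images are
-- faces of the first cone. The obstacle is that they do not bound f + mg + (Y - X) from below:
-- minimal points where this form is negative lie in the second cone, and it takes ε_r and ε_r ε_q
-- to show it. The constant 9 comes from the points (1, 1, 0, Y), whose norm is (r - Y²)². For 0 ≤ Y
-- ≤ 2 they are sums of two elements of height 1, so that Y = 3 gives the bound.

-- Ring identities with integer coefficients.

-- The library's ring solvers over an abstract ring take the coefficients in
-- that ring, where 1 - 1 does not reduce to 0.  With integer coefficients
-- cancellation is decided.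
module IntegerCoefficients (R : CommutativeRing 0ℓ 0ℓ) where
  open CommutativeRing R renaming (refl to ≈-refl; sym to ≈-sym; trans to ≈-trans)
  open import Algebra.Properties.Ring ring using (-0#≈0#; -‿involutive; -‿+-comm; -‿distribˡ-*; -‿distribʳ-*)
  open import Algebra.Properties.Semiring.Mult semiring using (×-homo-+; ×1-homo-*) renaming (_×_ to _·_)
  open import Relation.Binary.Reasoning.Setoid setoid

  ⟦_⟧ℤ : ℤ → Carrier
  ⟦ + n ⟧ℤ = n · 1#
  ⟦ -[1+ n ] ⟧ℤ = - (suc n · 1#)

  private
    cancel-1 : ∀ x y → (1# + x) + - (1# + y) ≈ x + - y
    cancel-1 x y = begin
      (1# + x) + - (1# + y)     ≈⟨ +-cong (+-comm 1# x) (≈-sym (-‿+-comm 1# y)) ⟩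
      (x + 1#) + (- 1# + - y)   ≈⟨ +-assoc x 1# _ ⟩
      x + (1# + (- 1# + - y))   ≈⟨ +-congˡ (≈-sym (+-assoc 1# (- 1#) _)) ⟩
      x + ((1# + - 1#) + - y)   ≈⟨ +-congˡ (+-congʳ (-‿inverseʳ 1#)) ⟩
      x + (0# + - y)            ≈⟨ +-congˡ (+-identityˡ _) ⟩
      x + - y                   ∎

    ⊖-homo : ∀ m n → ⟦ m ℤ.⊖ n ⟧ℤ ≈ m · 1# + - (n · 1#)
    ⊖-homo m zero = ≈-sym (≈-trans (+-congˡ -0#≈0#) (+-identityʳ _))
    ⊖-homo zero (suc n) = ≈-sym (+-identityˡ _)
    ⊖-homo (suc m) (suc n) = begin
      ⟦ suc m ℤ.⊖ suc n ⟧ℤ              ≡⟨ cong ⟦_⟧ℤ (ℤP.[1+m]⊖[1+n]≡m⊖n m n) ⟩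
      ⟦ m ℤ.⊖ n ⟧ℤ                      ≈⟨ ⊖-homo m n ⟩
      m · 1# + - (n · 1#)               ≈⟨ ≈-sym (cancel-1 _ _) ⟩
      suc m · 1# + - (suc n · 1#)       ∎

    +ℤ-homo : ∀ i j → ⟦ i ℤ.+ j ⟧ℤ ≈ ⟦ i ⟧ℤ + ⟦ j ⟧ℤ
    +ℤ-homo (+ m) (+ n) = ×-homo-+ 1# m n
    +ℤ-homo (+ m) -[1+ n ] = ⊖-homo m (suc n)
    +ℤ-homo -[1+ m ] (+ n) = ≈-trans (⊖-homo n (suc m)) (+-comm _ _)
    +ℤ-homo -[1+ m ] -[1+ n ] = begin
      - (suc (suc (m ℕ.+ n)) · 1#)      ≡⟨ cong (λ k → - (suc k · 1#)) (sym (ℕP.+-suc m n)) ⟩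
      - ((suc m ℕ.+ suc n) · 1#)        ≈⟨ -‿cong (×-homo-+ 1# (suc m) (suc n)) ⟩
      - (suc m · 1# + suc n · 1#)       ≈⟨ ≈-sym (-‿+-comm _ _) ⟩
      - (suc m · 1#) + - (suc n · 1#)   ∎

    -ℤ-homo : ∀ i → ⟦ ℤ.- i ⟧ℤ ≈ - ⟦ i ⟧ℤ
    -ℤ-homo (+ zero) = ≈-sym -0#≈0#
    -ℤ-homo (+ suc n) = ≈-refl
    -ℤ-homo -[1+ n ] = ≈-sym (-‿involutive _)

    *ℕ-homo : ∀ m n → ⟦ + m ℤ.* + n ⟧ℤ ≈ m · 1# * n · 1#
    *ℕ-homo m n = ≈-trans (reflexive (cong ⟦_⟧ℤ (sym (ℤP.pos-* m n)))) (×1-homo-* m n)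

    +*-homo : ∀ m j → ⟦ + m ℤ.* j ⟧ℤ ≈ m · 1# * ⟦ j ⟧ℤ
    +*-homo m (+ n) = *ℕ-homo m n
    +*-homo m -[1+ n ] = begin
      ⟦ + m ℤ.* -[1+ n ] ⟧ℤ             ≡⟨ cong ⟦_⟧ℤ (sym (ℤP.neg-distribʳ-* (+ m) (+ suc n))) ⟩
      ⟦ ℤ.- (+ m ℤ.* + suc n) ⟧ℤ        ≈⟨ -ℤ-homo (+ m ℤ.* + suc n) ⟩
      - ⟦ + m ℤ.* + suc n ⟧ℤ            ≈⟨ -‿cong (*ℕ-homo m (suc n)) ⟩
      - (m · 1# * suc n · 1#)           ≈⟨ -‿distribʳ-* _ _ ⟩
      m · 1# * - (suc n · 1#)           ∎

    *ℤ-homo : ∀ i j → ⟦ i ℤ.* j ⟧ℤ ≈ ⟦ i ⟧ℤ * ⟦ j ⟧ℤ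
    *ℤ-homo (+ m) j = +*-homo m j
    *ℤ-homo -[1+ m ] j = begin
      ⟦ -[1+ m ] ℤ.* j ⟧ℤ               ≡⟨ cong ⟦_⟧ℤ (sym (ℤP.neg-distribˡ-* (+ suc m) j)) ⟩
      ⟦ ℤ.- (+ suc m ℤ.* j) ⟧ℤ          ≈⟨ -ℤ-homo (+ suc m ℤ.* j) ⟩
      - ⟦ + suc m ℤ.* j ⟧ℤ              ≈⟨ -‿cong (+*-homo (suc m) j) ⟩
      - (suc m · 1# * ⟦ j ⟧ℤ)           ≈⟨ -‿distribˡ-* _ _ ⟩
      - (suc m · 1#) * ⟦ j ⟧ℤ           ∎

    morphism : CommutativeRing.rawRing ℤP.+-*-commutativeRing -Raw-AlmostCommutative⟶ fromCommutativeRing R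
    morphism = record
      { ⟦_⟧ = ⟦_⟧ℤ ; +-homo = +ℤ-homo ; *-homo = *ℤ-homo ; -‿homo = -ℤ-homo
      ; 0-homo = ≈-refl ; 1-homo = +-identityʳ 1# }

    _≟c_ : ∀ i j → _
    i ≟c j with i ℤ.≟ j
    ... | yes i≡j = just (reflexive (cong ⟦_⟧ℤ i≡j))
    ... | no _ = nothing

  open Algebra.Solver.Ring (CommutativeRing.rawRing ℤP.+-*-commutativeRing) (fromCommutativeRing R) morphism _≟c_ public
    using (Polynomial; var; ⟦_⟧; ⟦_⟧↓; prove; solve; _:=_; _:+_; _:*_; _:-_; :-_; con)

  infix 9 #_
  #_ : ∀ {n} → ℕ → Polynomial n
  # n = con (+ n)

-- Quadratic extensions as commutative rings.

-- The pair type and its operations are parameters tied together by equations, because the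
-- construction is used twice: for `Qd` over ℚ and for `Kel` over `Qd`.
module QuadraticRing {A : Set} {_+_ _*_ : Op₂ A} { -_ : Op₁ A} {0# 1# : A}
  (isCR : IsCommutativeRing _≡_ _+_ _*_ -_ 0# 1#) (d : A)
  {S : Set} (mk : A → A → S) (elim : ∀ {P : S → Set} → (∀ a b → P (mk a b)) → ∀ s → P s)
  (_⊕_ _⊗_ : Op₂ S)
  (⊕-mk : ∀ a b c e → mk a b ⊕ mk c e ≡ mk (a + c) (b + e))
  (⊗-mk : ∀ a b c e → mk a b ⊗ mk c e ≡ mk ((a * c) + ((b * e) * d)) ((a * e) + (b * c)))
  (neg : Op₁ S) (neg-mk : ∀ a b → neg (mk a b) ≡ mk (- a) (- b))
  where

  private
    R : CommutativeRing 0ℓ 0ℓ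
    R = record { isCommutativeRing = isCR }
    open CommutativeRing R using (+-assoc; +-comm; +-identityˡ; -‿inverseˡ)
    open IntegerCoefficients R

    ⊕-assoc : ∀ x y z → (x ⊕ y) ⊕ z ≡ x ⊕ (y ⊕ z)
    ⊕-assoc = elim λ a b → elim λ c e → elim λ f g → begin
      (mk a b ⊕ mk c e) ⊕ mk f g             ≡⟨ cong (_⊕ mk f g) (⊕-mk a b c e) ⟩
      mk (a + c) (b + e) ⊕ mk f g            ≡⟨ ⊕-mk _ _ _ _ ⟩
      mk ((a + c) + f) ((b + e) + g)         ≡⟨ cong₂ mk (+-assoc a c f) (+-assoc b e g) ⟩
      mk (a + (c + f)) (b + (e + g))         ≡⟨ sym (⊕-mk _ _ _ _) ⟩
      mk a b ⊕ mk (c + f) (e + g)            ≡⟨ cong (mk a b ⊕_) (sym (⊕-mk c e f g)) ⟩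
      mk a b ⊕ (mk c e ⊕ mk f g)             ∎
      where open ≡-Reasoning

    ⊕-comm : ∀ x y → x ⊕ y ≡ y ⊕ x
    ⊕-comm = elim λ a b → elim λ c e →
      trans (⊕-mk a b c e) (trans (cong₂ mk (+-comm a c) (+-comm b e)) (sym (⊕-mk c e a b)))

    ⊕-identityˡ : ∀ x → mk 0# 0# ⊕ x ≡ x
    ⊕-identityˡ = elim λ a b → trans (⊕-mk 0# 0# a b) (cong₂ mk (+-identityˡ a) (+-identityˡ b))

    neg-inverseˡ : ∀ x → neg x ⊕ x ≡ mk 0# 0#
    neg-inverseˡ = elim λ a b → trans (cong (_⊕ mk a b) (neg-mk a b))
      (trans (⊕-mk (- a) (- b) a b) (cong₂ mk (-‿inverseˡ a) (-‿inverseˡ b)))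

    ⊗-assoc : ∀ x y z → (x ⊗ y) ⊗ z ≡ x ⊗ (y ⊗ z)
    ⊗-assoc = elim λ a b → elim λ c e → elim λ f g → begin
      (mk a b ⊗ mk c e) ⊗ mk f g             ≡⟨ cong (_⊗ mk f g) (⊗-mk a b c e) ⟩
      mk _ _ ⊗ mk f g                        ≡⟨ ⊗-mk _ _ _ _ ⟩
      mk _ _                                 ≡⟨ cong₂ mk
        (solve 7 (λ a b c e f g d → (a :* c :+ b :* e :* d) :* f :+ (a :* e :+ b :* c) :* g :* d
           := a :* (c :* f :+ e :* g :* d) :+ b :* (c :* g :+ e :* f) :* d) refl a b c e f g d)
        (solve 7 (λ a b c e f g d → (a :* c :+ b :* e :* d) :* g :+ (a :* e :+ b :* c) :* f
           := a :* (c :* g :+ e :* f) :+ b :* (c :* f :+ e :* g :* d)) refl a b c e f g d) ⟩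
      mk _ _                                 ≡⟨ sym (⊗-mk _ _ _ _) ⟩
      mk a b ⊗ mk _ _                        ≡⟨ cong (mk a b ⊗_) (sym (⊗-mk c e f g)) ⟩
      mk a b ⊗ (mk c e ⊗ mk f g)             ∎
      where open ≡-Reasoning

    ⊗-comm : ∀ x y → x ⊗ y ≡ y ⊗ x
    ⊗-comm = elim λ a b → elim λ c e → trans (⊗-mk a b c e) (trans (cong₂ mk
      (solve 5 (λ a b c e d → a :* c :+ b :* e :* d := c :* a :+ e :* b :* d) refl a b c e d)
      (solve 4 (λ a b c e → a :* e :+ b :* c := c :* b :+ e :* a) refl a b c e)) (sym (⊗-mk c e a b)))

    ⊗-identityˡ : ∀ x → mk 1# 0# ⊗ x ≡ x
    ⊗-identityˡ = elim λ a b → trans (⊗-mk 1# 0# a b) (cong₂ mk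
      (trans (cong₂ _+_ (CommutativeRing.*-identityˡ R a) (trans (cong (_* d) (CommutativeRing.zeroˡ R b)) (CommutativeRing.zeroˡ R d)))
        (CommutativeRing.+-identityʳ R a))
      (trans (cong₂ _+_ (CommutativeRing.*-identityˡ R b) (CommutativeRing.zeroˡ R a)) (CommutativeRing.+-identityʳ R b)))

    distribʳ : ∀ x y z → (y ⊕ z) ⊗ x ≡ (y ⊗ x) ⊕ (z ⊗ x)
    distribʳ = elim λ a b → elim λ c e → elim λ f g → begin
      (mk c e ⊕ mk f g) ⊗ mk a b             ≡⟨ cong (_⊗ mk a b) (⊕-mk c e f g) ⟩
      mk (c + f) (e + g) ⊗ mk a b            ≡⟨ ⊗-mk _ _ _ _ ⟩
      mk _ _                                 ≡⟨ cong₂ mk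
        (solve 7 (λ a b c e f g d → (c :+ f) :* a :+ (e :+ g) :* b :* d
           := (c :* a :+ e :* b :* d) :+ (f :* a :+ g :* b :* d)) refl a b c e f g d)
        (solve 6 (λ a b c e f g → (c :+ f) :* b :+ (e :+ g) :* a
           := (c :* b :+ e :* a) :+ (f :* b :+ g :* a)) refl a b c e f g) ⟩
      mk _ _                                 ≡⟨ sym (⊕-mk _ _ _ _) ⟩
      mk _ _ ⊕ mk _ _                        ≡⟨ sym (cong₂ _⊕_ (⊗-mk c e a b) (⊗-mk f g a b)) ⟩
      (mk c e ⊗ mk a b) ⊕ (mk f g ⊗ mk a b)  ∎
      where open ≡-Reasoning

  isCommutativeRing : IsCommutativeRing _≡_ _⊕_ _⊗_ neg (mk 0# 0#) (mk 1# 0#)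
  isCommutativeRing = record
    { isRing = record
      { +-isAbelianGroup = record
        { isGroup = record
          { isMonoid = record
            { isSemigroup = record
              { isMagma = record { isEquivalence = isEquivalence ; ∙-cong = cong₂ _⊕_ }
              ; assoc = ⊕-assoc }
            ; identity = ⊕-identityˡ , λ x → trans (⊕-comm x _) (⊕-identityˡ x) }
          ; inverse = neg-inverseˡ , λ x → trans (⊕-comm x _) (neg-inverseˡ x)
          ; ⁻¹-cong = cong neg }
        ; comm = ⊕-comm }
      ; *-cong = cong₂ _⊗_
      ; *-assoc = ⊗-assoc
      ; *-identity = ⊗-identityˡ , λ x → trans (⊗-comm x _) (⊗-identityˡ x)
      ; distrib = (λ x y z → trans (⊗-comm x _) (trans (distribʳ x y z) (cong₂ _⊕_ (⊗-comm y x) (⊗-comm z x)))) , distribʳ }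
    ; *-comm = ⊗-comm }

-- Orderings and their extension to quadratic extensions.

-- An ordering is given by its positive elements, so that one theory serves ℚ, ℚ(√p) and K. The
-- trichotomy `P-tri` lets every later sign be decided.
record PositiveCone {A : Set} {_+_ _*_ : Op₂ A} { -_ : Op₁ A} {0# 1# : A}
  (isCR : IsCommutativeRing _≡_ _+_ _*_ -_ 0# 1#) (P : A → Set) : Set where
  field
    P-+ : ∀ {x y} → P x → P y → P (x + y)
    P-* : ∀ {x y} → P x → P y → P (x * y)
    P-irrefl : ¬ P 0#
    P-tri : ∀ x → P x ⊎ x ≡ 0# ⊎ P (- x)

module _ {A : Set} {_+_ _*_ : Op₂ A} { -_ : Op₁ A} {0# 1# : A}
  (isCR : IsCommutativeRing _≡_ _+_ _*_ -_ 0# 1#) {P : A → Set} (cone : PositiveCone isCR P) where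

  private
    R : CommutativeRing 0ℓ 0ℓ
    R = record { isCommutativeRing = isCR }
    open CommutativeRing R using (zeroˡ; zeroʳ)
  open IntegerCoefficients R
  open PositiveCone cone

  -- A positive product forces equal signs, and two negative elements cannot have a positive sum. It
  -- reduces the positivity of an irrational number to its trace and norm.
  sumProduct⇒P : ∀ {x y} → P (x + y) → P (x * y) → P x
  sumProduct⇒P {x} {y} p+ p* with P-tri x | P-tri y
  ... | inj₁ px | _ = px
  ... | inj₂ (inj₁ refl) | _ = ⊥-elim (P-irrefl (subst P (zeroˡ y) p*))
  ... | inj₂ (inj₂ p-x) | inj₂ (inj₁ refl) = ⊥-elim (P-irrefl (subst P (zeroʳ x) p*))
  ... | inj₂ (inj₂ p-x) | inj₁ py = ⊥-elim (P-irrefl (subst P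
        (solve 2 (λ x y → x :* y :+ :- x :* y := # 0) refl x y) (P-+ p* (P-* p-x py))))
  ... | inj₂ (inj₂ p-x) | inj₂ (inj₂ p-y) = ⊥-elim (P-irrefl (subst P
        (solve 2 (λ x y → x :+ y :+ (:- x :+ :- y) := # 0) refl x y) (P-+ p+ (P-+ p-x p-y))))

  P-cancelˡ : ∀ {x y} → P x → P (x * y) → P y
  P-cancelˡ {x} {y} px p* with P-tri y
  ... | inj₁ py = py
  ... | inj₂ (inj₁ refl) = ⊥-elim (P-irrefl (subst P (zeroʳ x) p*))
  ... | inj₂ (inj₂ p-y) = ⊥-elim (P-irrefl (subst P
        (solve 2 (λ x y → x :* y :+ x :* :- y := # 0) refl x y) (P-+ p* (P-* px p-y))))

-- For a non-square d > 0, the element u + v√d is positive if and only if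
-- u > 0 and its norm u² - v²d is positive, or v > 0 and its norm is negative.
module QuadraticOrder {A : Set} {_+_ _*_ : Op₂ A} { -_ : Op₁ A} {0# 1# : A}
  (isCR : IsCommutativeRing _≡_ _+_ _*_ -_ 0# 1#) {P : A → Set} (cone : PositiveCone isCR P)
  (d : A) (Pd : P d) (nonsquare : ∀ u v → u * u ≡ (v * v) * d → v ≡ 0#)
  where

  R : CommutativeRing 0ℓ 0ℓ
  R = record { isCommutativeRing = isCR }
  open CommutativeRing R using (zeroˡ; +-identityˡ; +-identityʳ; +-comm; *-comm)
  open import Algebra.Properties.Ring (CommutativeRing.ring R) using (-‿involutive; -0#≈0#)
  open IntegerCoefficients R
  open PositiveCone cone

  N : A → A → A
  N u v = (u * u) + (- ((v * v) * d))

  data Pos (u v : A) : Set where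
    outer : P u → P (N u v) → Pos u v
    inner : P v → P (- N u v) → Pos u v

  P-asym : ∀ {x} → P x → P (- x) → ⊥
  P-asym {x} px p-x = P-irrefl (subst P (CommutativeRing.-‿inverseʳ R x) (P-+ px p-x))

  P≢0 : ∀ {x} → P x → x ≢ 0#
  P≢0 px refl = P-irrefl px

  square-P : ∀ {x} → x ≢ 0# → P (x * x)
  square-P {x} x≢0 with P-tri x
  ... | inj₁ px = P-* px px
  ... | inj₂ (inj₁ x≡0) = ⊥-elim (x≢0 x≡0)
  ... | inj₂ (inj₂ p-x) = subst P (solve 1 (λ x → :- x :* :- x := x :* x) refl x) (P-* p-x p-x)

  P≥ : A → Set
  P≥ x = x ≡ 0# ⊎ P x

  P≥⇒¬P- : ∀ {x} → P≥ x → ¬ P (- x)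
  P≥⇒¬P- (inj₁ refl) p = P-irrefl (subst P -0#≈0# p)
  P≥⇒¬P- (inj₂ px) p = P-asym px p

  P-+-P≥ : ∀ {x y} → P x → P≥ y → P (x + y)
  P-+-P≥ {x} px (inj₁ refl) = subst P (sym (+-identityʳ x)) px
  P-+-P≥ px (inj₂ py) = P-+ px py

  square*-P≥ : ∀ x {y} → P y → P≥ ((x * x) * y)
  square*-P≥ x {y} py with P-tri x
  ... | inj₁ px = inj₂ (P-* (P-* px px) py)
  ... | inj₂ (inj₁ refl) = inj₁ (trans (cong (_* y) (zeroˡ x)) (zeroˡ y))
  ... | inj₂ (inj₂ p-x) = inj₂ (P-* (square-P λ x≡0 → P-irrefl (subst P (trans (cong -_ x≡0) -0#≈0#) p-x)) py)

  -- If w exceeded u, then w² - u² = (w - u)((w - u) + 2u) would be positive. The sign of w is left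
  -- open, which the applications to products such as vzd need.
  square-<⇒ : ∀ {u w} → P u → P ((u * u) + (- (w * w))) → P (u + (- w))
  square-<⇒ {u} {w} pu lt with P-tri (u + (- w))
  ... | inj₁ p = p
  ... | inj₂ (inj₁ eq) = ⊥-elim (P-irrefl (subst P (trans
          (solve 2 (λ u w → u :* u :- w :* w := (u :- w) :* (u :+ w)) refl u w)
          (trans (cong (_* (u + w)) eq) (zeroˡ _))) lt))
  ... | inj₂ (inj₂ p) = ⊥-elim (P-asym lt (subst P
          (solve 2 (λ u w → :- (u :- w) :* (:- (u :- w) :+ (u :+ u)) := :- (u :* u :- w :* w)) refl u w)
          (P-* p (P-+ p (P-+ pu pu)))))

  N-* : ∀ u v w z → N u v * N w z ≡ N ((u * w) + ((v * z) * d)) ((u * z) + (v * w))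
  N-* u v w z = solve 5 (λ u v w z d → (u :* u :- v :* v :* d) :* (w :* w :- z :* z :* d)
      := (u :* w :+ v :* z :* d) :* (u :* w :+ v :* z :* d) :- (u :* z :+ v :* w) :* (u :* z :+ v :* w) :* d) refl u v w z d

  -- A vanishing norm says u² = v²d, which `nonsquare` excludes unless v = 0.
  N≡0 : ∀ {u v} → N u v ≡ 0# → u ≡ 0# × v ≡ 0#
  N≡0 {u} {v} eq = u≡0 , v≡0
    where
    sq : u * u ≡ (v * v) * d
    sq = trans (solve 2 (λ x y → x := (x :- y) :+ y) refl _ _) (trans (cong (_+ ((v * v) * d)) eq) (+-identityˡ _))
    v≡0 : v ≡ 0#
    v≡0 = nonsquare u v sq
    u≡0 : u ≡ 0#
    u≡0 with P-tri u
    ... | inj₁ pu = ⊥-elim (P≢0 (P-* pu pu) (trans sq (trans (cong (λ v → (v * v) * d) v≡0) (trans (cong (_* d) (zeroˡ 0#)) (zeroˡ d)))))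
    ... | inj₂ (inj₁ eq) = eq
    ... | inj₂ (inj₂ p-u) = ⊥-elim (P≢0 (P-* p-u p-u) (trans (solve 1 (λ x → :- x :* :- x := x :* x) refl u) (trans sq (trans (cong (λ v → (v * v) * d) v≡0) (trans (cong (_* d) (zeroˡ 0#)) (zeroˡ d))))))

  N≢0,u≡0 : ∀ {v} → ¬ P (N 0# v)
  N≢0,u≡0 {v} p = P-irrefl (subst P (solve 2 (λ v d → # 0 :* # 0 :- v :* v :* d :+ v :* v :* d := # 0) refl v d) (P-+-P≥ p (square*-P≥ v Pd)))

  N≢0,v≡0 : ∀ {u} → ¬ P (- N u 0#)
  N≢0,v≡0 {u} p with P-tri u
  ... | inj₂ (inj₁ refl) = P-irrefl (subst P (solve 1 (λ d → :- (# 0 :* # 0 :- # 0 :* # 0 :* d) := # 0) refl d) p)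
  ... | inj₁ pu = P-irrefl (subst P (solve 2 (λ u d → :- (u :* u :- # 0 :* # 0 :* d) :+ u :* u := # 0) refl u d) (P-+ p (P-* pu pu)))
  ... | inj₂ (inj₂ pu) = P-irrefl (subst P (solve 2 (λ u d → :- (u :* u :- # 0 :* # 0 :* d) :+ :- u :* :- u := # 0) refl u d) (P-+ p (P-* pu pu)))

  -- Compare squares: (uw)² - (vzd)² = u²(w² - z²d) + z²d(u² - v²d), a positive term plus a
  -- nonnegative one.
  outer-< : ∀ {u v w z} → P u → P (N u v) → P w → P (N w z) → P ((u * w) + (- ((v * z) * d)))
  outer-< {u} {v} {w} {z} pu pN pw pM = square-<⇒ (P-* pu pw) (subst P
    (solve 5 (λ u v w z d → u :* u :* (w :* w :- z :* z :* d) :+ z :* z :* (d :* (u :* u :- v :* v :* d))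
       := u :* w :* (u :* w) :- v :* z :* d :* (v :* z :* d)) refl u v w z d)
    (P-+-P≥ (P-* (P-* pu pu) pM) (square*-P≥ z (P-* Pd pN))))

  inner-< : ∀ {u v w z} → P v → P (- N u v) → P z → P (- N w z) → P (((v * z) * d) + (- (u * w)))
  inner-< {u} {v} {w} {z} pv pN pz pM = square-<⇒ (P-* (P-* pv pz) Pd) (subst P
    (solve 5 (λ u v w z d → v :* v :* (d :* (:- (w :* w :- z :* z :* d))) :+ w :* w :* (:- (u :* u :- v :* v :* d))
       := v :* z :* d :* (v :* z :* d) :- u :* w :* (u :* w)) refl u v w z d)
    (P-+-P≥ (P-* (P-* pv pv) (P-* Pd pM)) (square*-P≥ w pN)))

  -- Norms multiply, so the product is outer exactly when both factors are of the same kind. The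
  -- sign of its leading coordinate comes from a comparison of squares, with z or w negated because
  -- a sum is wanted.
  Pos-* : ∀ {u v w z} → Pos u v → Pos w z → Pos ((u * w) + ((v * z) * d)) ((u * z) + (v * w))
  Pos-* {u} {v} {w} {z} (outer pu pN) (outer pw pM) = outer
    (subst P (solve 5 (λ u v w z d → u :* w :- v :* (:- z) :* d := u :* w :+ v :* z :* d) refl u v w z d)
      (outer-< pu pN pw (subst P (solve 3 (λ w z d → w :* w :- z :* z :* d := w :* w :- :- z :* :- z :* d) refl w z d) pM)))
    (subst P (N-* u v w z) (P-* pN pM))
  Pos-* {u} {v} {w} {z} (inner pv pN) (inner pz pM) = outer
    (subst P (solve 5 (λ u v w z d → v :* z :* d :- u :* (:- w) := u :* w :+ v :* z :* d) refl u v w z d)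
      (inner-< pv pN pz (subst P (solve 3 (λ w z d → :- (w :* w :- z :* z :* d) := :- (:- w :* :- w :- z :* z :* d)) refl w z d) pM)))
    (subst P (trans (solve 2 (λ x y → :- x :* :- y := x :* y) refl _ _) (N-* u v w z)) (P-* pN pM))
  Pos-* {u} {v} {w} {z} (outer pu pN) (inner pz pM) = inner
    (subst P (solve 4 (λ u v w z → u :* z :- v :* (:- w) := u :* z :+ v :* w) refl u v w z)
      (square-<⇒ (P-* pu pz) (subst P
        (solve 5 (λ u v w z d → z :* z :* (u :* u :- v :* v :* d) :+ v :* v :* (:- (w :* w :- z :* z :* d))
           := u :* z :* (u :* z) :- v :* (:- w) :* (v :* (:- w))) refl u v w z d)
        (P-+-P≥ (P-* (P-* pz pz) pN) (square*-P≥ v pM)))))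
    (subst P (trans (solve 2 (λ x y → x :* :- y := :- (x :* y)) refl _ _) (cong -_ (N-* u v w z))) (P-* pN pM))
  Pos-* {u} {v} {w} {z} x@(inner _ _) y@(outer _ _) = subst₂′
    (solve 5 (λ u v w z d → w :* u :+ z :* v :* d := u :* w :+ v :* z :* d) refl u v w z d)
    (solve 4 (λ u v w z → w :* v :+ z :* u := u :* z :+ v :* w) refl u v w z) (Pos-* y x)
    where
    subst₂′ : ∀ {a b a′ b′} → a ≡ a′ → b ≡ b′ → Pos a b → Pos a′ b′
    subst₂′ refl refl p = p

  -- N(x + y) = N(x) + N(y) + 2(uw - vzd), and the last term is positive by `outer-<`.
  outer-+ : ∀ {u v w z} → P u → P (N u v) → P w → P (N w z) → P (N (u + w) (v + z))
  outer-+ {u} {v} {w} {z} pu pN pw pM = subst P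
    (solve 5 (λ u v w z d → (u :* u :- v :* v :* d) :+ (w :* w :- z :* z :* d) :+ ((u :* w :- v :* z :* d) :+ (u :* w :- v :* z :* d))
       := (u :+ w) :* (u :+ w) :- (v :+ z) :* (v :+ z) :* d) refl u v w z d)
    (P-+ (P-+ pN pM) (P-+ (outer-< pu pN pw pM) (outer-< pu pN pw pM)))

  inner-+ : ∀ {u v w z} → P v → P (- N u v) → P z → P (- N w z) → P (- N (u + w) (v + z))
  inner-+ {u} {v} {w} {z} pv pN pz pM = subst P
    (solve 5 (λ u v w z d → :- (u :* u :- v :* v :* d) :+ :- (w :* w :- z :* z :* d) :+ ((v :* z :* d :- u :* w) :+ (v :* z :* d :- u :* w))
       := :- ((u :+ w) :* (u :+ w) :- (v :+ z) :* (v :+ z) :* d)) refl u v w z d)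
    (P-+ (P-+ pN pM) (P-+ (inner-< pv pN pz pM) (inner-< pv pN pz pM)))

  N-neg : ∀ u v → N u v ≡ N (- u) (- v)
  N-neg u v = solve 3 (λ u v d → u :* u :- v :* v :* d := :- u :* :- u :- :- v :* :- v :* d) refl u v d

  -- If the sum x + y had the wrong sign, then x or y would be a sum of two
  -- elements of the same kind and hence of the opposite kind.
  mixed-+ : ∀ {u v w z} → P u → P (N u v) → P z → P (- N w z) → Pos (u + w) (v + z)
  mixed-+ {u} {v} {w} {z} pu pN pz pM with P-tri (N (u + w) (v + z))
  ... | inj₁ pS with P-tri (u + w)
  ...   | inj₁ ps = outer ps pS
  ...   | inj₂ (inj₁ s≡0) = ⊥-elim (N≢0,u≡0 (subst (λ s → P (N s (v + z))) s≡0 pS))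
  ...   | inj₂ (inj₂ p-s) = ⊥-elim (P-asym (subst P
            (solve 5 (λ u v w z d → (:- (u :+ w) :+ u) :* (:- (u :+ w) :+ u) :- (:- (v :+ z) :+ v) :* (:- (v :+ z) :+ v) :* d
               := w :* w :- z :* z :* d) refl u v w z d)
            (outer-+ p-s (subst P (N-neg _ _) pS) pu pN)) pM)
  mixed-+ {u} {v} {w} {z} pu pN pz pM | inj₂ (inj₂ p-S) with P-tri (v + z)
  ...   | inj₁ pt = inner pt p-S
  ...   | inj₂ (inj₁ t≡0) = ⊥-elim (N≢0,v≡0 (subst (λ t → P (- N (u + w) t)) t≡0 p-S))
  ...   | inj₂ (inj₂ p-t) = ⊥-elim (P-asym pN (subst P
            (solve 5 (λ u v w z d → :- ((:- (u :+ w) :+ w) :* (:- (u :+ w) :+ w) :- (:- (v :+ z) :+ z) :* (:- (v :+ z) :+ z) :* d)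
               := :- (u :* u :- v :* v :* d)) refl u v w z d)
            (inner-+ p-t (subst (λ x → P (- x)) (N-neg _ _) p-S) pz pM)))
  mixed-+ {u} {v} {w} {z} pu pN pz pM | inj₂ (inj₁ S≡0) = ⊥-elim (P-asym pN (subst P N-eq pM))
    where
    opp : ∀ {x y} → x + y ≡ 0# → y ≡ - x
    opp {x} {y} eq = trans (solve 2 (λ x y → y := (x :+ y) :- x) refl x y) (trans (cong (_+ (- x)) eq) (+-identityˡ _))
    N-eq : - N w z ≡ - N u v
    N-eq = cong -_ (trans (cong₂ N (opp (proj₁ (N≡0 S≡0))) (opp (proj₂ (N≡0 S≡0)))) (sym (N-neg u v)))

  Pos-+ : ∀ {u v w z} → Pos u v → Pos w z → Pos (u + w) (v + z)
  Pos-+ (outer pu pN) (outer pw pM) = outer (P-+ pu pw) (outer-+ pu pN pw pM)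
  Pos-+ (inner pv pN) (inner pz pM) = inner (P-+ pv pz) (inner-+ pv pN pz pM)
  Pos-+ (outer pu pN) (inner pz pM) = mixed-+ pu pN pz pM
  Pos-+ {u} {v} {w} {z} (inner pv pN) (outer pw pM) rewrite +-comm u w | +-comm v z = mixed-+ pw pM pv pN

  Pos-irrefl : ¬ Pos 0# 0#
  Pos-irrefl (outer p _) = P-irrefl p
  Pos-irrefl (inner p _) = P-irrefl p

  Pos-tri : ∀ u v → Pos u v ⊎ (u ≡ 0# × v ≡ 0#) ⊎ Pos (- u) (- v)
  Pos-tri u v with P-tri (N u v)
  ... | inj₂ (inj₁ eq) = inj₂ (inj₁ (N≡0 eq))
  ... | inj₁ pN with P-tri u
  ...   | inj₁ pu = inj₁ (outer pu pN)
  ...   | inj₂ (inj₁ refl) = ⊥-elim (N≢0,u≡0 pN)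
  ...   | inj₂ (inj₂ p-u) = inj₂ (inj₂ (outer p-u (subst P (N-neg u v) pN)))
  Pos-tri u v | inj₂ (inj₂ p-N) with P-tri v
  ...   | inj₁ pv = inj₁ (inner pv p-N)
  ...   | inj₂ (inj₁ refl) = ⊥-elim (N≢0,v≡0 p-N)
  ...   | inj₂ (inj₂ p-v) = inj₂ (inj₂ (inner p-v (subst (λ x → P (- x)) (N-neg u v) p-N)))

  -- This is the shape in which the orderings of `Qd` and `Kel` are defined; `Pos` is the shape in
  -- which sums and products can be handled.
  SignCases : A → A → Set
  SignCases u v = (P≥ u × P≥ v × (u ≢ 0# ⊎ v ≢ 0#))
    ⊎ (P u × P (- v) × P (N u v))
    ⊎ (P (- u) × P v × P (- N u v))

  Pos⇒SignCases : ∀ {u v} → Pos u v → SignCases u v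
  Pos⇒SignCases {u} {v} (outer pu pN) with P-tri v
  ... | inj₁ pv = inj₁ (inj₂ pu , inj₂ pv , inj₁ (P≢0 pu))
  ... | inj₂ (inj₁ v≡0) = inj₁ (inj₂ pu , inj₁ v≡0 , inj₁ (P≢0 pu))
  ... | inj₂ (inj₂ p-v) = inj₂ (inj₁ (pu , p-v , pN))
  Pos⇒SignCases {u} {v} (inner pv pN) with P-tri u
  ... | inj₁ pu = inj₁ (inj₂ pu , inj₂ pv , inj₁ (P≢0 pu))
  ... | inj₂ (inj₁ u≡0) = inj₁ (inj₁ u≡0 , inj₂ pv , inj₂ (P≢0 pv))
  ... | inj₂ (inj₂ p-u) = inj₂ (inj₂ (p-u , pv , pN))

  SignCases⇒Pos : ∀ {u v} → SignCases u v → Pos u v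
  SignCases⇒Pos (inj₂ (inj₁ (pu , _ , pN))) = outer pu pN
  SignCases⇒Pos (inj₂ (inj₂ (_ , pv , pN))) = inner pv pN
  SignCases⇒Pos {u} {v} (inj₁ (u≥0 , v≥0 , nz)) with Pos-tri u v | nz
  ... | inj₁ p | _ = p
  ... | inj₂ (inj₁ (u≡0 , _)) | inj₁ u≢0 = ⊥-elim (u≢0 u≡0)
  ... | inj₂ (inj₁ (_ , v≡0)) | inj₂ v≢0 = ⊥-elim (v≢0 v≡0)
  ... | inj₂ (inj₂ (outer p-u _)) | _ = ⊥-elim (P≥⇒¬P- u≥0 p-u)
  ... | inj₂ (inj₂ (inner p-v _)) | _ = ⊥-elim (P≥⇒¬P- v≥0 p-v)

-- Integers inside ℚ, integral rationals and squarefree radicands.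

private
  toℚᵘ-ℤtoℚ : ∀ z → ℚ.toℚᵘ (ℤtoℚ z) ℚᵘ.≃ ℚᵘ.mkℚᵘ z 0
  toℚᵘ-ℤtoℚ z = ℚP.toℚᵘ-fromℚᵘ (ℚᵘ.mkℚᵘ z 0)

ℤtoℚ-+ : ∀ x y → ℤtoℚ (x ℤ.+ y) ≡ ℤtoℚ x ℚ.+ ℤtoℚ y
ℤtoℚ-+ x y = ℚP.toℚᵘ-injective (begin
  ℚ.toℚᵘ (ℤtoℚ (x ℤ.+ y))                       ≈⟨ toℚᵘ-ℤtoℚ (x ℤ.+ y) ⟩
  ℚᵘ.mkℚᵘ (x ℤ.+ y) 0                           ≡⟨ cong (λ z → ℚᵘ.mkℚᵘ z 0) (sym (cong₂ ℤ._+_ (ℤP.*-identityʳ x) (ℤP.*-identityʳ y))) ⟩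
  ℚᵘ.mkℚᵘ x 0 ℚᵘ.+ ℚᵘ.mkℚᵘ y 0                  ≈⟨ ℚᵘP.+-cong (toℚᵘ-ℤtoℚ x) (toℚᵘ-ℤtoℚ y) ⟨
  ℚ.toℚᵘ (ℤtoℚ x) ℚᵘ.+ ℚ.toℚᵘ (ℤtoℚ y)          ≈⟨ ℚP.toℚᵘ-homo-+ (ℤtoℚ x) (ℤtoℚ y) ⟨
  ℚ.toℚᵘ (ℤtoℚ x ℚ.+ ℤtoℚ y)                    ∎)
  where open ℚᵘP.≃-Reasoning

ℤtoℚ-* : ∀ x y → ℤtoℚ (x ℤ.* y) ≡ ℤtoℚ x ℚ.* ℤtoℚ y
ℤtoℚ-* x y = ℚP.toℚᵘ-injective (begin
  ℚ.toℚᵘ (ℤtoℚ (x ℤ.* y))                       ≈⟨ toℚᵘ-ℤtoℚ (x ℤ.* y) ⟩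
  ℚᵘ.mkℚᵘ x 0 ℚᵘ.* ℚᵘ.mkℚᵘ y 0                  ≈⟨ ℚᵘP.*-cong (toℚᵘ-ℤtoℚ x) (toℚᵘ-ℤtoℚ y) ⟨
  ℚ.toℚᵘ (ℤtoℚ x) ℚᵘ.* ℚ.toℚᵘ (ℤtoℚ y)          ≈⟨ ℚP.toℚᵘ-homo-* (ℤtoℚ x) (ℤtoℚ y) ⟨
  ℚ.toℚᵘ (ℤtoℚ x ℚ.* ℤtoℚ y)                    ∎)
  where open ℚᵘP.≃-Reasoning

ℤtoℚ-injective : ∀ {x y} → ℤtoℚ x ≡ ℤtoℚ y → x ≡ y
ℤtoℚ-injective {x} {y} eq with ℚP.fromℚᵘ-injective {ℚᵘ.mkℚᵘ x 0} {ℚᵘ.mkℚᵘ y 0} eq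
... | ℚᵘ.*≡* e = trans (sym (ℤP.*-identityʳ x)) (trans e (ℤP.*-identityʳ y))

ℤtoℚ-neg : ∀ x → ℤtoℚ (ℤ.- x) ≡ ℚ.- ℤtoℚ x
ℤtoℚ-neg x = ∙-cancelˡ (ℤtoℚ x) _ _ (begin
  ℤtoℚ x ℚ.+ ℤtoℚ (ℤ.- x)     ≡⟨ sym (ℤtoℚ-+ x (ℤ.- x)) ⟩
  ℤtoℚ (x ℤ.+ ℤ.- x)          ≡⟨ cong ℤtoℚ (ℤP.+-inverseʳ x) ⟩
  0ℚ                          ≡⟨ sym (ℚP.+-inverseʳ (ℤtoℚ x)) ⟩
  ℤtoℚ x ℚ.+ ℚ.- ℤtoℚ x       ∎)
  where
  open ≡-Reasoning
  open import Algebra.Properties.Group ℚP.+-0-group using (∙-cancelˡ)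

ℤtoℚ-< : ∀ {x y} → x ℤ.< y → ℤtoℚ x ℚ.< ℤtoℚ y
ℤtoℚ-< {x} {y} x<y = ℚP.toℚᵘ-cancel-< (ℚᵘP.<-respˡ-≃ (ℚᵘP.≃-sym (toℚᵘ-ℤtoℚ x)) (ℚᵘP.<-respʳ-≃ (ℚᵘP.≃-sym (toℚᵘ-ℤtoℚ y))
  (ℚᵘ.*<* (subst₂ ℤ._<_ (sym (ℤP.*-identityʳ x)) (sym (ℤP.*-identityʳ y)) x<y))))

ℤtoℚ-≤ : ∀ {x y} → x ℤ.≤ y → ℤtoℚ x ℚ.≤ ℤtoℚ y
ℤtoℚ-≤ {x} {y} x≤y with x ℤ.≟ y
... | yes refl = ℚP.≤-refl
... | no x≢y = ℚP.<⇒≤ (ℤtoℚ-< (ℤP.≤∧≢⇒< x≤y x≢y))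

ℤtoℚ-cancel-< : ∀ {x y} → ℤtoℚ x ℚ.< ℤtoℚ y → x ℤ.< y
ℤtoℚ-cancel-< {x} {y} lt with x ℤ.<? y
... | yes x<y = x<y
... | no x≮y = ⊥-elim (ℚP.<-irrefl refl (ℚP.<-≤-trans lt (ℤtoℚ-≤ (ℤP.≮⇒≥ x≮y))))

fraction : ∀ (x : ℚ) → x ℚ.* ℤtoℚ (ℚ.↧ x) ≡ ℤtoℚ (ℚ.↥ x)
fraction x@record{} = ℚP.toℚᵘ-injective (begin
  ℚ.toℚᵘ (x ℚ.* ℤtoℚ (ℚ.↧ x))            ≈⟨ ℚP.toℚᵘ-homo-* x (ℤtoℚ (ℚ.↧ x)) ⟩
  ℚ.toℚᵘ x ℚᵘ.* ℚ.toℚᵘ (ℤtoℚ (ℚ.↧ x))    ≈⟨ ℚᵘP.*-congˡ {ℚ.toℚᵘ x} (toℚᵘ-ℤtoℚ (ℚ.↧ x)) ⟩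
  ℚ.toℚᵘ x ℚᵘ.* ℚᵘ.mkℚᵘ (ℚ.↧ x) 0        ≈⟨ ℚᵘ.*≡* (trans (ℤP.*-identityʳ _) (cong (ℚ.↥ x ℤ.*_) (sym (ℤP.*-identityʳ (ℚ.↧ x))))) ⟩
  ℚᵘ.mkℚᵘ (ℚ.↥ x) 0                      ≈⟨ toℚᵘ-ℤtoℚ (ℚ.↥ x) ⟨
  ℚ.toℚᵘ (ℤtoℚ (ℚ.↥ x))                  ∎)
  where open ℚᵘP.≃-Reasoning

Integral : ℚ → Set
Integral x = ∃ λ z → x ≡ ℤtoℚ z

↧≡1⇒Integral : ∀ x → ℚ.↧ₙ x ≡ 1 → Integral x
↧≡1⇒Integral x ↧≡1 = ℚ.↥ x , (begin
  x                             ≡⟨ sym (ℚP.*-identityʳ x) ⟩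
  x ℚ.* ℤtoℚ (+ 1)              ≡⟨ cong (λ t → x ℚ.* ℤtoℚ (+ t)) (sym ↧≡1) ⟩
  x ℚ.* ℤtoℚ (ℚ.↧ x)            ≡⟨ fraction x ⟩
  ℤtoℚ (ℚ.↥ x)                  ∎)
  where open ≡-Reasoning

coprime-^ : ∀ {s t} → Coprime t s → ∀ k → Coprime (t ℕ.^ k) s
coprime-^ c zero = Coprimality.1-coprimeTo _
coprime-^ {s} {t} c (suc k) {d} (d∣t^ , d∣s) = coprime-^ c k (coprime-divisor d-t d∣t^ , d∣s)
  where
  d-t : Coprime d t
  d-t (e∣d , e∣t) = c (e∣t , ∣-trans e∣d d∣s)

coprime-divisor-^ : ∀ {s t D} → Coprime t s → ∀ k → t ∣ s ℕ.^ k ℕ.* D → t ∣ D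
coprime-divisor-^ {D = D} c zero t∣ = subst (_ ∣_) (ℕP.*-identityˡ D) t∣
coprime-divisor-^ {s} {t} {D} c (suc k) t∣ = coprime-divisor-^ c k (coprime-divisor c (subst (t ∣_) (ℕP.*-assoc s (s ℕ.^ k) D) t∣))

coprime-num-den : ∀ (x : ℚ) → Coprime (ℚ.↧ₙ x) ℤ.∣ ℚ.↥ x ∣
coprime-num-den (mkℚ _ _ c) = Coprimality.sym (Coprimality.recompute c)

_^ℚ_ : ℚ → ℕ → ℚ
x ^ℚ zero = 1ℚ
x ^ℚ suc k = x ℚ.* x ^ℚ k

module ℚ-Solver = IntegerCoefficients ℚP.+-*-commutativeRing
module ℤ-Solver = IntegerCoefficients ℤP.+-*-commutativeRing

fraction-^ : ∀ (x : ℚ) k → x ^ℚ k ℚ.* ℤtoℚ (ℚ.↧ x ℤ.^ k) ≡ ℤtoℚ (ℚ.↥ x ℤ.^ k)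
fraction-^ x zero = ℚP.*-identityˡ _
fraction-^ x (suc k) = begin
  (x ℚ.* x ^ℚ k) ℚ.* ℤtoℚ (t ℤ.* t ℤ.^ k)                    ≡⟨ cong ((x ℚ.* x ^ℚ k) ℚ.*_) (ℤtoℚ-* t (t ℤ.^ k)) ⟩
  (x ℚ.* x ^ℚ k) ℚ.* (ℤtoℚ t ℚ.* ℤtoℚ (t ℤ.^ k))             ≡⟨ solve 4 (λ a b c d → a :* b :* (c :* d) := a :* c :* (b :* d)) refl x _ _ _ ⟩
  (x ℚ.* ℤtoℚ t) ℚ.* (x ^ℚ k ℚ.* ℤtoℚ (t ℤ.^ k))             ≡⟨ cong₂ ℚ._*_ (fraction x) (fraction-^ x k) ⟩
  ℤtoℚ s ℚ.* ℤtoℚ (s ℤ.^ k)                                  ≡⟨ sym (ℤtoℚ-* s (s ℤ.^ k)) ⟩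
  ℤtoℚ (s ℤ.* s ℤ.^ k)                                       ∎
  where
  open ≡-Reasoning
  open ℚ-Solver
  s = ℚ.↥ x
  t = ℚ.↧ x

abs-^ : ∀ z k → ℤ.∣ z ℤ.^ k ∣ ≡ ℤ.∣ z ∣ ℕ.^ k
abs-^ z zero = refl
abs-^ z (suc k) = trans (ℤP.abs-* z (z ℤ.^ k)) (cong (ℤ.∣ z ∣ ℕ.*_) (abs-^ z k))

-- The denominator t satisfies t ^ k ∣ D for all k.
boundedDenominator⇒Integral : ∀ (x : ℚ) (D : ℤ) → D ≢ + 0 → (∀ k → Integral (ℤtoℚ D ℚ.* x ^ℚ k)) → Integral x
boundedDenominator⇒Integral x D D≢0 bd = ↧≡1⇒Integral x t≡1
  where
  s = ℚ.↥ x
  t = ℚ.↧ₙ x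
  eq : ∀ k → s ℤ.^ k ℤ.* D ≡ proj₁ (bd k) ℤ.* (+ t) ℤ.^ k
  eq k = ℤtoℚ-injective (begin
    ℤtoℚ (s ℤ.^ k ℤ.* D)                              ≡⟨ ℤtoℚ-* (s ℤ.^ k) D ⟩
    ℤtoℚ (s ℤ.^ k) ℚ.* ℤtoℚ D                         ≡⟨ cong (ℚ._* ℤtoℚ D) (sym (fraction-^ x k)) ⟩
    x ^ℚ k ℚ.* ℤtoℚ ((+ t) ℤ.^ k) ℚ.* ℤtoℚ D          ≡⟨ solve 3 (λ a b c → a :* b :* c := c :* a :* b) refl (x ^ℚ k) _ _ ⟩
    ℤtoℚ D ℚ.* x ^ℚ k ℚ.* ℤtoℚ ((+ t) ℤ.^ k)          ≡⟨ cong (ℚ._* ℤtoℚ ((+ t) ℤ.^ k)) (proj₂ (bd k)) ⟩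
    ℤtoℚ (proj₁ (bd k)) ℚ.* ℤtoℚ ((+ t) ℤ.^ k)        ≡⟨ sym (ℤtoℚ-* (proj₁ (bd k)) ((+ t) ℤ.^ k)) ⟩
    ℤtoℚ (proj₁ (bd k) ℤ.* (+ t) ℤ.^ k)               ∎)
    where
    open ≡-Reasoning
    open ℚ-Solver
  t^k∣D : ∀ k → t ℕ.^ k ∣ ℤ.∣ D ∣
  t^k∣D k = divide-out k (divides ℤ.∣ proj₁ (bd k) ∣ (begin
    ℤ.∣ s ∣ ℕ.^ k ℕ.* ℤ.∣ D ∣              ≡⟨ cong (ℕ._* ℤ.∣ D ∣) (sym (abs-^ s k)) ⟩
    ℤ.∣ s ℤ.^ k ∣ ℕ.* ℤ.∣ D ∣              ≡⟨ sym (ℤP.abs-* (s ℤ.^ k) D) ⟩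
    ℤ.∣ s ℤ.^ k ℤ.* D ∣                    ≡⟨ cong ℤ.∣_∣ (eq k) ⟩
    ℤ.∣ proj₁ (bd k) ℤ.* (+ t) ℤ.^ k ∣     ≡⟨ ℤP.abs-* (proj₁ (bd k)) _ ⟩
    ℤ.∣ proj₁ (bd k) ∣ ℕ.* ℤ.∣ (+ t) ℤ.^ k ∣ ≡⟨ cong (ℤ.∣ proj₁ (bd k) ∣ ℕ.*_) (abs-^ (+ t) k) ⟩
    ℤ.∣ proj₁ (bd k) ∣ ℕ.* t ℕ.^ k         ∎))
    where
    open ≡-Reasoning
    divide-out : ∀ k → t ℕ.^ k ∣ ℤ.∣ s ∣ ℕ.^ k ℕ.* ℤ.∣ D ∣ → t ℕ.^ k ∣ ℤ.∣ D ∣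
    divide-out k = coprime-divisor-^ (coprime-^ (coprime-num-den x) k) k
  k<2^k : ∀ k → k ℕ.< 2 ℕ.^ k
  k<2^k zero = ℕ.s≤s ℕ.z≤n
  k<2^k (suc k) = ℕP.≤-trans (ℕ.s≤s (k<2^k k)) (ℕP.≤-trans (ℕP.+-monoˡ-≤ (2 ℕ.^ k) (ℕP.m^n>0 2 k)) (ℕP.≤-reflexive (cong (2 ℕ.^ k ℕ.+_) (sym (ℕP.+-identityʳ (2 ℕ.^ k))))))
  t≡1 : t ≡ 1
  t≡1 with t ℕP.≟ 1
  ... | yes e = e
  -- The exponent ∣D∣ suffices: t ^ ∣D∣ divides ∣D∣, whereas t ≥ 2 gives t ^ ∣D∣ ≥ 2 ^ ∣D∣ > ∣D∣.
  ... | no t≢1 = ⊥-elim (ℕP.<⇒≱ (k<2^k ℤ.∣ D ∣) (ℕP.≤-trans (ℕP.^-monoˡ-≤ ℤ.∣ D ∣ 2≤t) (∣⇒≤ {{nz}} (t^k∣D ℤ.∣ D ∣))))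
    where
    2≤t : 2 ℕ.≤ t
    2≤t = ℕP.≤∧≢⇒< (ℕ.s≤s ℕ.z≤n) (t≢1 ∘ sym)
    nz : ℕ.NonZero ℤ.∣ D ∣
    nz = ℕ.≢-nonZero (D≢0 ∘ ℤP.∣i∣≡0⇒i≡0)

-- With x = s/t in lowest terms, s²m = zt². Since t² is coprime to s, it divides m, and
-- squarefreeness forces t = 1.
ℚ-integrallyClosed-√ : ∀ (x : ℚ) (m : ℕ) → SquareFree m → Integral (x ℚ.* x ℚ.* ℕtoℚ m) → Integral x
ℚ-integrallyClosed-√ x m sf (z , e) = ↧≡1⇒Integral x (sf t (coprime-divisor-^ {s = ℤ.∣ s ∣} (λ {d} → c² {d}) 2
    (divides ℤ.∣ z ∣ (begin
      ℤ.∣ s ∣ ℕ.^ 2 ℕ.* m                  ≡⟨ cong (ℕ._* m) (sym (abs-^ s 2)) ⟩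
      ℤ.∣ s ℤ.^ 2 ∣ ℕ.* m                  ≡⟨ sym (ℤP.abs-* (s ℤ.^ 2) (+ m)) ⟩
      ℤ.∣ s ℤ.^ 2 ℤ.* + m ∣                ≡⟨ cong ℤ.∣_∣ eq ⟩
      ℤ.∣ z ℤ.* (+ t ℤ.* + t) ∣            ≡⟨ ℤP.abs-* z _ ⟩
      ℤ.∣ z ∣ ℕ.* ℤ.∣ + t ℤ.* + t ∣        ≡⟨ cong (ℤ.∣ z ∣ ℕ.*_) (ℤP.abs-* (+ t) (+ t)) ⟩
      ℤ.∣ z ∣ ℕ.* (t ℕ.* t)                ∎))))
  where
  open ≡-Reasoning
  s = ℚ.↥ x
  t = ℚ.↧ₙ x
  c² : Coprime (t ℕ.* t) ℤ.∣ s ∣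
  c² = subst (λ u → Coprime (t ℕ.* u) ℤ.∣ s ∣) (ℕP.*-identityʳ t) (coprime-^ (coprime-num-den x) 2)
  eq : s ℤ.^ 2 ℤ.* + m ≡ z ℤ.* (+ t ℤ.* + t)
  eq = ℤtoℚ-injective (begin
    ℤtoℚ (s ℤ.* (s ℤ.* + 1) ℤ.* + m)                   ≡⟨ cong (λ u → ℤtoℚ (s ℤ.* u ℤ.* + m)) (ℤP.*-identityʳ s) ⟩
    ℤtoℚ (s ℤ.* s ℤ.* + m)                             ≡⟨ trans (ℤtoℚ-* (s ℤ.* s) (+ m)) (cong (ℚ._* ℕtoℚ m) (ℤtoℚ-* s s)) ⟩
    ℤtoℚ s ℚ.* ℤtoℚ s ℚ.* ℕtoℚ m                       ≡⟨ cong (λ u → u ℚ.* u ℚ.* ℕtoℚ m) (sym (fraction x)) ⟩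
    x ℚ.* ℤtoℚ (+ t) ℚ.* (x ℚ.* ℤtoℚ (+ t)) ℚ.* ℕtoℚ m ≡⟨ solve 3 (λ x t m → x :* t :* (x :* t) :* m := x :* x :* m :* (t :* t)) refl x (ℤtoℚ (+ t)) (ℕtoℚ m) ⟩
    x ℚ.* x ℚ.* ℕtoℚ m ℚ.* (ℤtoℚ (+ t) ℚ.* ℤtoℚ (+ t)) ≡⟨ cong₂ ℚ._*_ e (sym (ℤtoℚ-* (+ t) (+ t))) ⟩
    ℤtoℚ z ℚ.* ℤtoℚ (+ t ℤ.* + t)                      ≡⟨ sym (ℤtoℚ-* z (+ t ℤ.* + t)) ⟩
    ℤtoℚ (z ℤ.* (+ t ℤ.* + t))                         ∎)
    where open ℚ-Solver

-- If u ≠ 0, then x = v/u satisfies x²m = 1, so x is an integer and m divides 1. If u = 0 and v ≠ 0,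
-- then m = 0, which is divisible by 2².
squareFree⇒nonsquare : ∀ m → SquareFree m → m ≢ 1 → ∀ u v → u ℚ.* u ≡ v ℚ.* v ℚ.* ℕtoℚ m → v ≡ 0ℚ
squareFree⇒nonsquare m sf m≢1 u v u²≡v²m with u ℚP.≟ 0ℚ
... | yes refl = case v ℚP.≟ 0ℚ of λ where
    (yes v≡0) → v≡0
    (no v≢0) → ⊥-elim (m≢0 (m≡0 v≢0))
  where
  open ≡-Reasoning
  open ℚ-Solver
  m≢0 : m ≢ 0
  m≢0 refl with sf 2 (divides 0 refl)
  ... | ()
  m≡0 : v ≢ 0ℚ → m ≡ 0
  m≡0 v≢0 = ℤP.+-injective (ℤtoℚ-injective (begin
    ℕtoℚ m                                             ≡⟨ sym (ℚP.*-identityˡ _) ⟩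
    1ℚ ℚ.* ℕtoℚ m                                      ≡⟨ cong (λ y → y ℚ.* y ℚ.* ℕtoℚ m) (sym (ℚP.*-inverseˡ v)) ⟩
    w ℚ.* v ℚ.* (w ℚ.* v) ℚ.* ℕtoℚ m                   ≡⟨ solve 3 (λ w v m → w :* v :* (w :* v) :* m := w :* w :* (v :* v :* m)) refl w v (ℕtoℚ m) ⟩
    w ℚ.* w ℚ.* (v ℚ.* v ℚ.* ℕtoℚ m)                   ≡⟨ cong (w ℚ.* w ℚ.*_) (sym u²≡v²m) ⟩
    w ℚ.* w ℚ.* 0ℚ                                     ≡⟨ ℚP.*-zeroʳ (w ℚ.* w) ⟩
    0ℚ                                                 ∎))
    where
    instance
      v-nonZero : ℚ.NonZero v
      v-nonZero = ℚ.≢-nonZero v≢0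
    w = ℚ.1/ v
... | no u≢0 = ⊥-elim (m≢1 (∣1⇒≡1 (divides ℤ.∣ z ℤ.* z ∣ (trans (cong ℤ.∣_∣ (sym z²m≡1)) (ℤP.abs-* (z ℤ.* z) (+ m))))))
  where
  open ≡-Reasoning
  open ℚ-Solver
  instance
    u-nonZero : ℚ.NonZero u
    u-nonZero = ℚ.≢-nonZero u≢0
  w = ℚ.1/ u
  x = v ℚ.* w
  x²m≡1 : x ℚ.* x ℚ.* ℕtoℚ m ≡ 1ℚ
  x²m≡1 = begin
    v ℚ.* w ℚ.* (v ℚ.* w) ℚ.* ℕtoℚ m                   ≡⟨ solve 3 (λ w v m → v :* w :* (v :* w) :* m := w :* w :* (v :* v :* m)) refl w v (ℕtoℚ m) ⟩
    w ℚ.* w ℚ.* (v ℚ.* v ℚ.* ℕtoℚ m)                   ≡⟨ cong (w ℚ.* w ℚ.*_) (sym u²≡v²m) ⟩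
    w ℚ.* w ℚ.* (u ℚ.* u)                              ≡⟨ solve 2 (λ w u → w :* w :* (u :* u) := w :* u :* (w :* u)) refl w u ⟩
    w ℚ.* u ℚ.* (w ℚ.* u)                              ≡⟨ cong (λ y → y ℚ.* y) (ℚP.*-inverseˡ u) ⟩
    1ℚ                                                 ∎
  integral : Integral x
  integral = ℚ-integrallyClosed-√ x m sf (+ 1 , x²m≡1)
  z = proj₁ integral
  z²m≡1 : z ℤ.* z ℤ.* + m ≡ + 1
  z²m≡1 = ℤtoℚ-injective (begin
    ℤtoℚ (z ℤ.* z ℤ.* + m)               ≡⟨ trans (ℤtoℚ-* (z ℤ.* z) (+ m)) (cong (ℚ._* ℕtoℚ m) (ℤtoℚ-* z z)) ⟩
    ℤtoℚ z ℚ.* ℤtoℚ z ℚ.* ℕtoℚ m         ≡⟨ cong (λ y → y ℚ.* y ℚ.* ℕtoℚ m) (sym (proj₂ integral)) ⟩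
    x ℚ.* x ℚ.* ℕtoℚ m                   ≡⟨ x²m≡1 ⟩
    1ℚ                                   ∎)

-- The ordering and the conjugations of the biquadratic field.

ℚ-positiveCone : PositiveCone (CommutativeRing.isCommutativeRing ℚP.+-*-commutativeRing) (0ℚ ℚ.<_)
ℚ-positiveCone = record
  { P-+ = ℚP.+-mono-<
  ; P-* = λ {x} {y} 0<x 0<y → subst (ℚ._< x ℚ.* y) (ℚP.*-zeroʳ x) (ℚP.*-monoʳ-<-pos x {{ℚ.positive 0<x}} 0<y)
  ; P-irrefl = ℚP.<-irrefl refl
  ; P-tri = tri }
  where
  tri : ∀ x → 0ℚ ℚ.< x ⊎ x ≡ 0ℚ ⊎ 0ℚ ℚ.< ℚ.- x
  tri x with ℚP.<-cmp 0ℚ x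
  ... | tri< 0<x _ _ = inj₁ 0<x
  ... | tri≈ _ 0≡x _ = inj₂ (inj₁ (sym 0≡x))
  ... | tri> _ _ x<0 = inj₂ (inj₂ (ℚP.neg-antimono-< x<0))

private
  ℚ-isCR = CommutativeRing.isCommutativeRing ℚP.+-*-commutativeRing

<⇒0<- : ∀ {x y} → y ℚ.< x → 0ℚ ℚ.< x ℚ.+ ℚ.- y
<⇒0<- {x} {y} y<x = subst (ℚ._< x ℚ.+ ℚ.- y) (ℚP.+-inverseʳ y) (ℚP.+-monoˡ-< (ℚ.- y) y<x)

0<-⇒< : ∀ {x y} → 0ℚ ℚ.< x ℚ.+ ℚ.- y → y ℚ.< x
0<-⇒< {x} {y} lt = subst₂ ℚ._<_ (ℚP.+-identityˡ y) (solve 2 (λ x y → x :- y :+ y := x) refl x y) (ℚP.+-monoˡ-< y lt)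
  where open ℚ-Solver

0<neg⇒<0 : ∀ {x} → 0ℚ ℚ.< ℚ.- x → x ℚ.< 0ℚ
0<neg⇒<0 {x} lt = 0<-⇒< (subst (0ℚ ℚ.<_) (sym (ℚP.+-identityˡ (ℚ.- x))) lt)

≤⇒≡⊎< : ∀ {x} → 0ℚ ℚ.≤ x → x ≡ 0ℚ ⊎ 0ℚ ℚ.< x
≤⇒≡⊎< {x} 0≤x with PositiveCone.P-tri ℚ-positiveCone x
... | inj₁ 0<x = inj₂ 0<x
... | inj₂ (inj₁ x≡0) = inj₁ x≡0
... | inj₂ (inj₂ 0<-x) = ⊥-elim (ℚP.<-irrefl refl (ℚP.≤-<-trans 0≤x (0<neg⇒<0 0<-x)))

≡⊎<⇒≤ : ∀ {x} → x ≡ 0ℚ ⊎ 0ℚ ℚ.< x → 0ℚ ℚ.≤ x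
≡⊎<⇒≤ (inj₁ refl) = ℚP.≤-refl
≡⊎<⇒≤ (inj₂ 0<x) = ℚP.<⇒≤ 0<x

Nonsquare : ℚ → Set
Nonsquare d = ∀ u v → u ℚ.* u ≡ v ℚ.* v ℚ.* d → v ≡ 0ℚ

-- Stated over an arbitrary ring, so that at ℚ(√p) and at K the solver treats elements as atoms
-- instead of expanding pairs.
module RingIdentities (R : CommutativeRing 0ℓ 0ℓ) where
  open CommutativeRing R using (Carrier; _+_; _*_; -_; _≈_)
  open CommutativeRing R using () renaming (refl to ≈-refl)
  open IntegerCoefficients R

  x-y≈-[y-x] : ∀ x y → x + - y ≈ - (y + - x)
  x-y≈-[y-x] = solve 2 (λ x y → x :- y := :- (y :- x)) ≈-refl

  -[x+y]≈-x-y : ∀ x y → - (x + y) ≈ - x + - y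
  -[x+y]≈-x-y = solve 2 (λ x y → :- (x :+ y) := :- x :+ :- y) ≈-refl

  neg-neg : ∀ x → - (- x) ≈ x
  neg-neg = solve 1 (λ x → :- :- x := x) ≈-refl

  conjugate-re : ∀ u v w z d → u * w + v * z * d ≈ u * w + - v * - z * d
  conjugate-re = solve 5 (λ u v w z d → u :* w :+ v :* z :* d := u :* w :+ :- v :* :- z :* d) ≈-refl

  conjugate-im : ∀ u v w z → - (u * z + v * w) ≈ u * - z + - v * w
  conjugate-im = solve 4 (λ u v w z → :- (u :* z :+ v :* w) := u :* :- z :+ :- v :* w) ≈-refl

  interchange₄ : ∀ x₁ x₂ x₃ x₄ y₁ y₂ y₃ y₄ → x₁ * y₁ * (x₂ * y₂) * (x₃ * y₃) * (x₄ * y₄) ≈ x₁ * x₂ * x₃ * x₄ * (y₁ * y₂ * y₃ * y₄)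
  interchange₄ = solve 8 (λ x₁ x₂ x₃ x₄ y₁ y₂ y₃ y₄ → x₁ :* y₁ :* (x₂ :* y₂) :* (x₃ :* y₃) :* (x₄ :* y₄) := x₁ :* x₂ :* x₃ :* x₄ :* (y₁ :* y₂ :* y₃ :* y₄)) ≈-refl

-- The interface between the construction of the ordered field and all later arguments.
record BiquadraticTheory (p q : ℚ) : Set where
  open Biquad p q
  field
    -K_ : Kel → Kel
    K-isCR : IsCommutativeRing _≡_ _+K_ _*K_ -K_ 0K 1K
    PosK-+ : ∀ {x y} → PosK x → PosK y → PosK (x +K y)
    PosK-* : ∀ {x y} → PosK x → PosK y → PosK (x *K y)
    PosK-cancelˡ : ∀ {x y} → PosK x → PosK (x *K y) → PosK y
    K-sumProduct⇒Pos : ∀ {x y} → PosK (x +K y) → PosK (x *K y) → PosK x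
    PosK-fst : ∀ {u} → Pos u → PosK ⟪ u , 𝟘 ⟫
    PosK-snd : ∀ {v} → Pos v → PosK ⟪ 𝟘 , v ⟫
    PosK-rational⁻¹ : ∀ {x} → PosK ⟪ ⟨ x , 0ℚ ⟩ , 𝟘 ⟫ → 0ℚ ℚ.< x
    TotallyPositive-+ : ∀ {x y} → TotallyPositive x → TotallyPositive y → TotallyPositive (x +K y)
    TotallyPositive-* : ∀ {x y} → TotallyPositive x → TotallyPositive y → TotallyPositive (x *K y)
    TotallyPositive-cancelˡ : ∀ {x y} → TotallyPositive x → TotallyPositive (x *K y) → TotallyPositive y
    TotallyPositive-conj : ∀ {x} e₁ e₂ → TotallyPositive x → TotallyPositive (conj e₁ e₂ x)
    conj-* : ∀ e₁ e₂ x y → conj e₁ e₂ (x *K y) ≡ conj e₁ e₂ x *K conj e₁ e₂ y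
    normK-* : ∀ x y → normK (x *K y) ≡ normK x *K normK y

-- K has degree 4 over ℚ when none of p, q and pq is a square; pq = a²r turns the last condition
-- into one on r.
module BiquadraticField (p q r a : ℚ) (0<p : 0ℚ ℚ.< p) (0<q : 0ℚ ℚ.< q)
  (p-nonsquare : Nonsquare p) (q-nonsquare : Nonsquare q) (r-nonsquare : Nonsquare r)
  (a≢0 : a ≢ 0ℚ) (pq≡a²r : p ℚ.* q ≡ a ℚ.* a ℚ.* r)
  where

  open Biquad p q

  negQ : Qd → Qd
  negQ ⟨ a , b ⟩ = ⟨ ℚ.- a , ℚ.- b ⟩

  Qd-isCR : IsCommutativeRing _≡_ _⊕_ _⊗_ negQ 𝟘 𝟙
  Qd-isCR = QuadraticRing.isCommutativeRing ℚ-isCR p ⟨_,_⟩ (λ { f ⟨ a , b ⟩ → f a b }) _⊕_ _⊗_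
    (λ _ _ _ _ → refl) (λ _ _ _ _ → refl) negQ (λ _ _ → refl)

  Qd-ring : CommutativeRing 0ℓ 0ℓ
  Qd-ring = record { isCommutativeRing = Qd-isCR }

  -K_ : Kel → Kel
  -K ⟪ u , v ⟫ = ⟪ negQ u , negQ v ⟫

  K-isCR : IsCommutativeRing _≡_ _+K_ _*K_ -K_ 0K 1K
  K-isCR = QuadraticRing.isCommutativeRing Qd-isCR ⟨ q , 0ℚ ⟩ ⟪_,_⟫ (λ { f ⟪ u , v ⟫ → f u v }) _+K_ _*K_
    (λ _ _ _ _ → refl) (λ _ _ _ _ → refl) -K_ (λ _ _ → refl)

  K-ring : CommutativeRing 0ℓ 0ℓ
  K-ring = record { isCommutativeRing = K-isCR }

  private
    module O = QuadraticOrder ℚ-isCR ℚ-positiveCone p 0<p p-nonsquare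

  Pos⇒ : ∀ {a b} → Pos ⟨ a , b ⟩ → O.Pos a b
  Pos⇒ (inj₁ (0≤a , 0≤b , nz)) = O.SignCases⇒Pos (inj₁ (≤⇒≡⊎< 0≤a , ≤⇒≡⊎< 0≤b , nz))
  Pos⇒ (inj₂ (inj₁ (0<a , b<0 , lt))) = O.outer 0<a (<⇒0<- lt)
  Pos⇒ {a} {b} (inj₂ (inj₂ (a<0 , 0<b , lt))) = O.inner 0<b (subst (0ℚ ℚ.<_)
    (solve 2 (λ x y → y :- x := :- (x :- y)) refl (a ℚ.* a) (b ℚ.* b ℚ.* p)) (<⇒0<- lt))
    where open ℚ-Solver

  ⇒Pos : ∀ {a b} → O.Pos a b → Pos ⟨ a , b ⟩
  ⇒Pos {a} {b} pos with O.Pos⇒SignCases pos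
  ... | inj₁ (0≤a , 0≤b , nz) = inj₁ (≡⊎<⇒≤ 0≤a , ≡⊎<⇒≤ 0≤b , nz)
  ... | inj₂ (inj₁ (0<a , 0<-b , 0<N)) = inj₂ (inj₁ (0<a , 0<neg⇒<0 0<-b , 0<-⇒< 0<N))
  ... | inj₂ (inj₂ (0<-a , 0<b , 0<-N)) = inj₂ (inj₂ (0<neg⇒<0 0<-a , 0<b , 0<-⇒< (subst (0ℚ ℚ.<_)
    (solve 2 (λ x y → :- (x :- y) := y :- x) refl (a ℚ.* a) (b ℚ.* b ℚ.* p)) 0<-N)))
    where open ℚ-Solver

  Qd-positiveCone : PositiveCone Qd-isCR Pos
  Qd-positiveCone = record
    { P-+ = λ { {⟨ _ , _ ⟩} {⟨ _ , _ ⟩} x y → ⇒Pos (O.Pos-+ (Pos⇒ x) (Pos⇒ y)) }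
    ; P-* = λ { {⟨ _ , _ ⟩} {⟨ _ , _ ⟩} x y → ⇒Pos (O.Pos-* (Pos⇒ x) (Pos⇒ y)) }
    ; P-irrefl = λ x → O.Pos-irrefl (Pos⇒ x)
    ; P-tri = λ { ⟨ a , b ⟩ → tri a b } }
    where
    tri : ∀ a b → Pos ⟨ a , b ⟩ ⊎ ⟨ a , b ⟩ ≡ 𝟘 ⊎ Pos (negQ ⟨ a , b ⟩)
    tri a b with O.Pos-tri a b
    ... | inj₁ pos = inj₁ (⇒Pos pos)
    ... | inj₂ (inj₁ (a≡0 , b≡0)) = inj₂ (inj₁ (cong₂ ⟨_,_⟩ a≡0 b≡0))
    ... | inj₂ (inj₂ neg) = inj₂ (inj₂ (⇒Pos neg))

  -- If u² = v²q in ℚ(√p), then s + t√p = u v̄ satisfies st = 0 and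
  -- s² + t²p = (v v̄)²q; so v v̄ ≠ 0 would make q or pq a square in ℚ.
  private
    noZeroDivisors : ∀ x y → x ℚ.* y ≡ 0ℚ → x ≡ 0ℚ ⊎ y ≡ 0ℚ
    noZeroDivisors x y xy≡0 with x ℚP.≟ 0ℚ
    ... | yes x≡0 = inj₁ x≡0
    ... | no x≢0 = inj₂ (begin
        y                    ≡⟨ sym (ℚP.*-identityˡ y) ⟩
        1ℚ ℚ.* y             ≡⟨ cong (ℚ._* y) (sym (ℚP.*-inverseˡ x)) ⟩
        ℚ.1/ x ℚ.* x ℚ.* y   ≡⟨ ℚP.*-assoc (ℚ.1/ x) x y ⟩
        ℚ.1/ x ℚ.* (x ℚ.* y) ≡⟨ cong (ℚ.1/ x ℚ.*_) xy≡0 ⟩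
        ℚ.1/ x ℚ.* 0ℚ        ≡⟨ ℚP.*-zeroʳ (ℚ.1/ x) ⟩
        0ℚ                   ∎)
      where
      open ≡-Reasoning
      instance
        x-nonZero : ℚ.NonZero x
        x-nonZero = ℚ.≢-nonZero x≢0

  q-nonsquare-Qd : ∀ u v → u ⊗ u ≡ v ⊗ v ⊗ ⟨ q , 0ℚ ⟩ → v ≡ 𝟘
  q-nonsquare-Qd ⟨ f , b ⟩ ⟨ c , e ⟩ eq = cong₂ ⟨_,_⟩ (proj₁ v≡0) (proj₂ v≡0)
    where
    open ≡-Reasoning
    open ℚ-Solver
    s = f ℚ.* c ℚ.+ ℚ.- (b ℚ.* e ℚ.* p)
    t = b ℚ.* c ℚ.+ ℚ.- (f ℚ.* e)
    M = c ℚ.* c ℚ.+ ℚ.- (e ℚ.* e ℚ.* p)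
    eqr : f ℚ.* f ℚ.+ b ℚ.* b ℚ.* p ≡ (c ℚ.* c ℚ.+ e ℚ.* e ℚ.* p) ℚ.* q ℚ.+ (c ℚ.* e ℚ.+ e ℚ.* c) ℚ.* 0ℚ ℚ.* p
    eqr = cong re eq
    eqi : f ℚ.* b ℚ.+ b ℚ.* f ≡ (c ℚ.* c ℚ.+ e ℚ.* e ℚ.* p) ℚ.* 0ℚ ℚ.+ (c ℚ.* e ℚ.+ e ℚ.* c) ℚ.* q
    eqi = cong im eq
    norm-eq : s ℚ.* s ℚ.+ t ℚ.* t ℚ.* p ≡ M ℚ.* M ℚ.* q
    norm-eq = begin
      s ℚ.* s ℚ.+ t ℚ.* t ℚ.* p
        ≡⟨ solve 5 (λ a b c e p → (a :* c :- b :* e :* p) :* (a :* c :- b :* e :* p) :+ (b :* c :- a :* e) :* (b :* c :- a :* e) :* p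
             := (a :* a :+ b :* b :* p) :* (c :* c :+ e :* e :* p) :- (a :* b :+ b :* a) :* (c :* e :+ e :* c) :* p) refl f b c e p ⟩
      (f ℚ.* f ℚ.+ b ℚ.* b ℚ.* p) ℚ.* (c ℚ.* c ℚ.+ e ℚ.* e ℚ.* p) ℚ.+ ℚ.- ((f ℚ.* b ℚ.+ b ℚ.* f) ℚ.* (c ℚ.* e ℚ.+ e ℚ.* c) ℚ.* p)
        ≡⟨ cong₂ (λ x y → x ℚ.* (c ℚ.* c ℚ.+ e ℚ.* e ℚ.* p) ℚ.+ ℚ.- (y ℚ.* (c ℚ.* e ℚ.+ e ℚ.* c) ℚ.* p)) eqr eqi ⟩
      _ ≡⟨ solve 4 (λ c e p q → ((c :* c :+ e :* e :* p) :* q :+ (c :* e :+ e :* c) :* # 0 :* p) :* (c :* c :+ e :* e :* p)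
               :- ((c :* c :+ e :* e :* p) :* # 0 :+ (c :* e :+ e :* c) :* q) :* (c :* e :+ e :* c) :* p
             := (c :* c :- e :* e :* p) :* (c :* c :- e :* e :* p) :* q) refl c e p q ⟩
      M ℚ.* M ℚ.* q ∎
    st≡0 : s ℚ.* t ≡ 0ℚ
    st≡0 = [ (λ ()) , id ]′ (noZeroDivisors (1ℚ ℚ.+ 1ℚ) (s ℚ.* t) (begin
      (1ℚ ℚ.+ 1ℚ) ℚ.* (s ℚ.* t)
        ≡⟨ solve 5 (λ a b c e p → (# 1 :+ # 1) :* ((a :* c :- b :* e :* p) :* (b :* c :- a :* e))
             := (a :* b :+ b :* a) :* (c :* c :+ e :* e :* p) :- (a :* a :+ b :* b :* p) :* (c :* e :+ e :* c)) refl f b c e p ⟩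
      (f ℚ.* b ℚ.+ b ℚ.* f) ℚ.* (c ℚ.* c ℚ.+ e ℚ.* e ℚ.* p) ℚ.+ ℚ.- ((f ℚ.* f ℚ.+ b ℚ.* b ℚ.* p) ℚ.* (c ℚ.* e ℚ.+ e ℚ.* c))
        ≡⟨ cong₂ (λ x y → x ℚ.* (c ℚ.* c ℚ.+ e ℚ.* e ℚ.* p) ℚ.+ ℚ.- (y ℚ.* (c ℚ.* e ℚ.+ e ℚ.* c))) eqi eqr ⟩
      _ ≡⟨ solve 4 (λ c e p q → ((c :* c :+ e :* e :* p) :* # 0 :+ (c :* e :+ e :* c) :* q) :* (c :* c :+ e :* e :* p)
               :- ((c :* c :+ e :* e :* p) :* q :+ (c :* e :+ e :* c) :* # 0 :* p) :* (c :* e :+ e :* c)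
             := # 0) refl c e p q ⟩
      0ℚ ∎))
    t≡0⇒M≡0 : t ≡ 0ℚ → M ≡ 0ℚ
    t≡0⇒M≡0 t≡0 = q-nonsquare s M (begin
        s ℚ.* s                          ≡⟨ solve 2 (λ s p → s :* s := s :* s :+ # 0 :* # 0 :* p) refl s p ⟩
        s ℚ.* s ℚ.+ 0ℚ ℚ.* 0ℚ ℚ.* p      ≡⟨ cong (λ t → s ℚ.* s ℚ.+ t ℚ.* t ℚ.* p) (sym t≡0) ⟩
        s ℚ.* s ℚ.+ t ℚ.* t ℚ.* p        ≡⟨ norm-eq ⟩
        M ℚ.* M ℚ.* q                    ∎)
    s≡0⇒M≡0 : s ≡ 0ℚ → M ≡ 0ℚ
    s≡0⇒M≡0 s≡0 = [ ⊥-elim ∘ a≢0 , id ]′ (noZeroDivisors a M (trans (ℚP.*-comm a M) (r-nonsquare (t ℚ.* p) (M ℚ.* a) (begin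
        t ℚ.* p ℚ.* (t ℚ.* p)                               ≡⟨ solve 2 (λ t p → t :* p :* (t :* p) := (# 0 :* # 0 :+ t :* t :* p) :* p) refl t p ⟩
        (0ℚ ℚ.* 0ℚ ℚ.+ t ℚ.* t ℚ.* p) ℚ.* p                 ≡⟨ cong (λ s → (s ℚ.* s ℚ.+ t ℚ.* t ℚ.* p) ℚ.* p) (sym s≡0) ⟩
        (s ℚ.* s ℚ.+ t ℚ.* t ℚ.* p) ℚ.* p                   ≡⟨ cong (ℚ._* p) norm-eq ⟩
        M ℚ.* M ℚ.* q ℚ.* p                                 ≡⟨ solve 3 (λ M p q → M :* M :* q :* p := M :* M :* (p :* q)) refl M p q ⟩
        M ℚ.* M ℚ.* (p ℚ.* q)                               ≡⟨ cong (M ℚ.* M ℚ.*_) pq≡a²r ⟩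
        M ℚ.* M ℚ.* (a ℚ.* a ℚ.* r)          ≡⟨ solve 3 (λ M a r → M :* M :* (a :* a :* r) := M :* a :* (M :* a) :* r) refl M a (r) ⟩
        M ℚ.* a ℚ.* (M ℚ.* a) ℚ.* r          ∎))))
    v≡0 : c ≡ 0ℚ × e ≡ 0ℚ
    v≡0 = O.N≡0 ([ s≡0⇒M≡0 , t≡0⇒M≡0 ]′ (noZeroDivisors s t st≡0))

  private
    Pos-q : Pos ⟨ q , 0ℚ ⟩
    Pos-q = inj₁ (ℚP.<⇒≤ 0<q , ℚP.≤-refl , inj₁ (O.P≢0 0<q))

    module OK = QuadraticOrder Qd-isCR Qd-positiveCone ⟨ q , 0ℚ ⟩ Pos-q q-nonsquare-Qd

  open OK public using () renaming (N to relativeNorm; outer to outerK; inner to innerK; Pos to PositiveK)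
  open O public using () renaming (N to quadraticNorm; outer to outerQ; inner to innerQ; Pos to PositiveQ)

  private
    u⊖𝟘 : ∀ u → u ⊖ 𝟘 ≡ u
    u⊖𝟘 ⟨ a , b ⟩ = cong₂ ⟨_,_⟩ (ℚP.+-identityʳ a) (ℚP.+-identityʳ b)
    𝟘⊖u : ∀ u → 𝟘 ⊖ u ≡ negQ u
    𝟘⊖u ⟨ a , b ⟩ = cong₂ ⟨_,_⟩ (ℚP.+-identityˡ (ℚ.- a)) (ℚP.+-identityˡ (ℚ.- b))
    ⊖-⊕ : ∀ u v → u ⊖ v ≡ u ⊕ negQ v
    ⊖-⊕ ⟨ _ , _ ⟩ ⟨ _ , _ ⟩ = refl
    module QI = RingIdentities Qd-ring

  private
    v²q : Qd → Qd
    v²q v = v ⊗ v ⊗ ⟨ q , 0ℚ ⟩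

    u²⊖v²q : ∀ u v → u ⊗ u ⊖ v²q v ≡ OK.N u v
    u²⊖v²q u v = ⊖-⊕ (u ⊗ u) (v²q v)

    v²q⊖u² : ∀ u v → v²q v ⊖ u ⊗ u ≡ negQ (OK.N u v)
    v²q⊖u² u v = trans (⊖-⊕ (v²q v) (u ⊗ u)) (QI.x-y≈-[y-x] (v²q v) (u ⊗ u))

    ≥0⇒ : ∀ x → x ≡ 𝟘 ⊎ 𝟘 <′ x → x ≡ 𝟘 ⊎ Pos x
    ≥0⇒ x (inj₁ x≡𝟘) = inj₁ x≡𝟘
    ≥0⇒ x (inj₂ 𝟘<x) = inj₂ (subst Pos (u⊖𝟘 x) 𝟘<x)

    ⇒≥0 : ∀ x → x ≡ 𝟘 ⊎ Pos x → x ≡ 𝟘 ⊎ 𝟘 <′ x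
    ⇒≥0 x (inj₁ x≡𝟘) = inj₁ x≡𝟘
    ⇒≥0 x (inj₂ 𝟘<x) = inj₂ (subst Pos (sym (u⊖𝟘 x)) 𝟘<x)

  PosK⇒ : ∀ {u v} → PosK ⟪ u , v ⟫ → PositiveK u v
  PosK⇒ {u} {v} (inj₁ (u≥0 , v≥0 , nz)) = OK.SignCases⇒Pos (inj₁ (≥0⇒ u u≥0 , ≥0⇒ v v≥0 , nz))
  PosK⇒ {u} {v} (inj₂ (inj₁ (u>0 , _ , lt))) = OK.outer (subst Pos (u⊖𝟘 u) u>0) (subst Pos (u²⊖v²q u v) lt)
  PosK⇒ {u} {v} (inj₂ (inj₂ (_ , v>0 , lt))) = OK.inner (subst Pos (u⊖𝟘 v) v>0) (subst Pos (v²q⊖u² u v) lt)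

  ⇒PosK : ∀ {u v} → PositiveK u v → PosK ⟪ u , v ⟫
  ⇒PosK {u} {v} pos = [ case₁ , [ case₂ , case₃ ]′ ]′ (OK.Pos⇒SignCases pos)
    where
    case₁ : _ → PosK ⟪ u , v ⟫
    case₁ (u≥0 , v≥0 , nz) = inj₁ (⇒≥0 u u≥0 , ⇒≥0 v v≥0 , nz)
    case₂ : _ → PosK ⟪ u , v ⟫
    case₂ (u>0 , v<0 , 0<N) = inj₂ (inj₁ (subst Pos (sym (u⊖𝟘 u)) u>0 , subst Pos (sym (𝟘⊖u v)) v<0 , subst Pos (sym (u²⊖v²q u v)) 0<N))
    case₃ : _ → PosK ⟪ u , v ⟫
    case₃ (u<0 , v>0 , N<0) = inj₂ (inj₂ (subst Pos (sym (𝟘⊖u u)) u<0 , subst Pos (sym (u⊖𝟘 v)) v>0 , subst Pos (sym (v²q⊖u² u v)) N<0))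

  K-positiveCone : PositiveCone K-isCR PosK
  K-positiveCone = record
    { P-+ = λ { {⟪ _ , _ ⟫} {⟪ _ , _ ⟫} x y → ⇒PosK (OK.Pos-+ (PosK⇒ x) (PosK⇒ y)) }
    ; P-* = λ { {⟪ _ , _ ⟫} {⟪ _ , _ ⟫} x y → ⇒PosK (OK.Pos-* (PosK⇒ x) (PosK⇒ y)) }
    ; P-irrefl = λ x → OK.Pos-irrefl (PosK⇒ x)
    ; P-tri = λ { ⟪ u , v ⟫ → tri (OK.Pos-tri u v) } }
    where
    tri : ∀ {u v} → PositiveK u v ⊎ (u ≡ 𝟘 × v ≡ 𝟘) ⊎ PositiveK (negQ u) (negQ v) → PosK ⟪ u , v ⟫ ⊎ ⟪ u , v ⟫ ≡ 0K ⊎ PosK (-K ⟪ u , v ⟫)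
    tri (inj₁ pos) = inj₁ (⇒PosK pos)
    tri (inj₂ (inj₁ (u≡𝟘 , v≡𝟘))) = inj₂ (inj₁ (cong₂ ⟪_,_⟫ u≡𝟘 v≡𝟘))
    tri (inj₂ (inj₂ neg)) = inj₂ (inj₂ (⇒PosK neg))

  open PositiveCone K-positiveCone public using () renaming (P-+ to PosK-+; P-* to PosK-*; P-irrefl to PosK-irrefl)

  PosK-fst : ∀ {u} → Pos u → PosK ⟪ u , 𝟘 ⟫
  PosK-fst {u} pos = inj₁ (⇒≥0 u (inj₂ pos) , inj₁ refl , inj₁ λ u≡𝟘 → PositiveCone.P-irrefl Qd-positiveCone (subst Pos u≡𝟘 pos))

  PosK-snd : ∀ {v} → Pos v → PosK ⟪ 𝟘 , v ⟫
  PosK-snd {v} pos = inj₁ (inj₁ refl , ⇒≥0 v (inj₂ pos) , inj₂ λ v≡𝟘 → PositiveCone.P-irrefl Qd-positiveCone (subst Pos v≡𝟘 pos))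

  PosK-rational⁻¹ : ∀ {x} → PosK ⟪ ⟨ x , 0ℚ ⟩ , 𝟘 ⟫ → 0ℚ ℚ.< x
  PosK-rational⁻¹ {x} pos with PositiveCone.P-tri ℚ-positiveCone x
  ... | inj₁ 0<x = 0<x
  ... | inj₂ (inj₁ refl) = ⊥-elim (PosK-irrefl pos)
  ... | inj₂ (inj₂ 0<-x) = ⊥-elim (PosK-irrefl (subst PosK (CommutativeRing.-‿inverseʳ K-ring ⟪ ⟨ x , 0ℚ ⟩ , 𝟘 ⟫)
        (PosK-+ pos (PosK-fst {⟨ ℚ.- x , ℚ.- 0ℚ ⟩} (inj₁ (ℚP.<⇒≤ 0<-x , ℚP.≤-refl , inj₁ (O.P≢0 0<-x)))))))

  K-sumProduct⇒Pos : ∀ {x y} → PosK (x +K y) → PosK (x *K y) → PosK x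
  K-sumProduct⇒Pos {x} {y} = sumProduct⇒P K-isCR K-positiveCone {x} {y}

  PosK-cancelˡ : ∀ {x y} → PosK x → PosK (x *K y) → PosK y
  PosK-cancelˡ {x} {y} = P-cancelˡ K-isCR K-positiveCone {x} {y}

  bar : Qd → Qd
  bar ⟨ a , b ⟩ = ⟨ a , ℚ.- b ⟩

  private
    module KI = RingIdentities K-ring

    bar-⊕ : ∀ u v → bar (u ⊕ v) ≡ bar u ⊕ bar v
    bar-⊕ ⟨ a , b ⟩ ⟨ c , e ⟩ = cong₂ ⟨_,_⟩ refl (ℚP.neg-distrib-+ b e)

    bar-⊗ : ∀ u v → bar (u ⊗ v) ≡ bar u ⊗ bar v
    bar-⊗ ⟨ a , b ⟩ ⟨ c , e ⟩ = cong₂ ⟨_,_⟩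
      (solve 5 (λ a b c e p → a :* c :+ b :* e :* p := a :* c :+ :- b :* :- e :* p) refl a b c e p)
      (solve 4 (λ a b c e → :- (a :* e :+ b :* c) := a :* :- e :+ :- b :* c) refl a b c e)
      where open ℚ-Solver

    negQ-negQ : ∀ v → negQ (negQ v) ≡ v
    negQ-negQ v = QI.neg-neg v

  σ τ : Kel → Kel
  σ ⟪ u , v ⟫ = ⟪ bar u , bar v ⟫
  τ ⟪ u , v ⟫ = ⟪ u , negQ v ⟫

  private
    τ-* : ∀ x y → τ (x *K y) ≡ τ x *K τ y
    τ-* ⟪ u , v ⟫ ⟪ w , z ⟫ = cong₂ ⟪_,_⟫
      (QI.conjugate-re u v w z ⟨ q , 0ℚ ⟩) (QI.conjugate-im u v w z)

    σ-* : ∀ x y → σ (x *K y) ≡ σ x *K σ y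
    σ-* ⟪ u , v ⟫ ⟪ w , z ⟫ = cong₂ ⟪_,_⟫
      (trans (bar-⊕ (u ⊗ w) (v ⊗ z ⊗ ⟨ q , 0ℚ ⟩)) (cong₂ _⊕_ (bar-⊗ u w) (trans (bar-⊗ (v ⊗ z) ⟨ q , 0ℚ ⟩) (cong₂ _⊗_ (bar-⊗ v z) refl))))
      (trans (bar-⊕ (u ⊗ z) (v ⊗ w)) (cong₂ _⊕_ (bar-⊗ u z) (bar-⊗ v w)))

    ττ : ∀ x → τ (τ x) ≡ x
    ττ ⟪ u , v ⟫ = cong₂ ⟪_,_⟫ refl (negQ-negQ v)

    bar-bar : ∀ u → bar (bar u) ≡ u
    bar-bar ⟨ a , b ⟩ = cong₂ ⟨_,_⟩ refl (solve 1 (λ b → :- :- b := b) refl b)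
      where open ℚ-Solver

    σσ : ∀ x → σ (σ x) ≡ x
    σσ ⟪ u , v ⟫ = cong₂ ⟪_,_⟫ (bar-bar u) (bar-bar v)

    στ : ∀ x → σ (τ x) ≡ τ (σ x)
    στ ⟪ ⟨ _ , _ ⟩ , ⟨ _ , _ ⟩ ⟫ = refl

  -- Factoring every conjugation through `σ` and `τ` reduces the homomorphism laws to these two
  -- generators.
  conj-στ : ∀ e₁ e₂ x → conj e₁ e₂ x ≡ (if e₁ then id else σ) ((if e₂ then id else τ) x)
  conj-στ true true ⟪ ⟨ _ , _ ⟩ , ⟨ _ , _ ⟩ ⟫ = refl
  conj-στ true false ⟪ ⟨ _ , _ ⟩ , ⟨ _ , _ ⟩ ⟫ = refl
  conj-στ false true ⟪ ⟨ _ , _ ⟩ , ⟨ _ , _ ⟩ ⟫ = refl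
  conj-στ false false ⟪ ⟨ _ , _ ⟩ , ⟨ _ , _ ⟩ ⟫ = refl

  conj-* : ∀ e₁ e₂ x y → conj e₁ e₂ (x *K y) ≡ conj e₁ e₂ x *K conj e₁ e₂ y
  conj-* e₁ e₂ x y = trans (conj-στ e₁ e₂ (x *K y)) (trans (hom e₁ e₂) (sym (cong₂ _*K_ (conj-στ e₁ e₂ x) (conj-στ e₁ e₂ y))))
    where
    hom : ∀ e₁ e₂ → (if e₁ then id else σ) ((if e₂ then id else τ) (x *K y))
      ≡ (if e₁ then id else σ) ((if e₂ then id else τ) x) *K (if e₁ then id else σ) ((if e₂ then id else τ) y)
    hom true true = refl
    hom true false = τ-* x y
    hom false true = σ-* x y
    hom false false = trans (cong σ (τ-* x y)) (σ-* (τ x) (τ y))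

  normK-* : ∀ x y → normK (x *K y) ≡ normK x *K normK y
  normK-* x y = trans (cong₂ _*K_ (cong₂ _*K_ (cong₂ _*K_ (conj-* true true x y) (conj-* true false x y)) (conj-* false true x y)) (conj-* false false x y))
    (KI.interchange₄ (conj true true x) (conj true false x) (conj false true x) (conj false false x)
      (conj true true y) (conj true false y) (conj false true y) (conj false false y))

  -- Here `true` marks a root that is fixed, so signs compose by the negation of exclusive or.
  conj-conj : ∀ e₁ e₂ d₁ d₂ x → conj e₁ e₂ (conj d₁ d₂ x) ≡ conj (not (e₁ xor d₁)) (not (e₂ xor d₂)) x
  conj-conj e₁ e₂ d₁ d₂ x = trans (trans (cong (conj e₁ e₂) (conj-στ d₁ d₂ x)) (conj-στ e₁ e₂ _)) (trans (go e₁ e₂ d₁ d₂) (sym (conj-στ (not (e₁ xor d₁)) (not (e₂ xor d₂)) x)))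
    where
    go : ∀ e₁ e₂ d₁ d₂ → (if e₁ then id else σ) ((if e₂ then id else τ) ((if d₁ then id else σ) ((if d₂ then id else τ) x)))
      ≡ (if not (e₁ xor d₁) then id else σ) ((if not (e₂ xor d₂) then id else τ) x)
    go true true d₁ d₂ = same d₁ d₂
      where
      same : ∀ d₁ d₂ → (if d₁ then id else σ) ((if d₂ then id else τ) x) ≡ (if not (not d₁) then id else σ) ((if not (not d₂) then id else τ) x)
      same true true = refl
      same true false = refl
      same false true = refl
      same false false = refl
    go false true true true = refl
    go false true true false = refl
    go false true false true = σσ x
    go false true false false = σσ (τ x)
    go true false true true = refl
    go true false true false = ττ x
    go true false false true = sym (στ x)
    go true false false false = trans (sym (στ (τ x))) (cong σ (ττ x))
    go false false true true = refl
    go false false true false = cong σ (ττ x)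
    go false false false true = trans (cong σ (sym (στ x))) (σσ (τ x))
    go false false false false = trans (cong σ (trans (sym (στ (τ x))) (cong σ (ττ x)))) (σσ x)

  conj-+ : ∀ e₁ e₂ x y → conj e₁ e₂ (x +K y) ≡ conj e₁ e₂ x +K conj e₁ e₂ y
  conj-+ e₁ e₂ x y = trans (conj-στ e₁ e₂ (x +K y)) (trans (hom e₁ e₂) (sym (cong₂ _+K_ (conj-στ e₁ e₂ x) (conj-στ e₁ e₂ y))))
    where
    τ-+ : ∀ x y → τ (x +K y) ≡ τ x +K τ y
    τ-+ ⟪ u , v ⟫ ⟪ w , z ⟫ = cong₂ ⟪_,_⟫ refl (QI.-[x+y]≈-x-y v z)
    σ-+ : ∀ x y → σ (x +K y) ≡ σ x +K σ y
    σ-+ ⟪ u , v ⟫ ⟪ w , z ⟫ = cong₂ ⟪_,_⟫ (bar-⊕ u w) (bar-⊕ v z)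
    hom : ∀ e₁ e₂ → (if e₁ then id else σ) ((if e₂ then id else τ) (x +K y))
      ≡ (if e₁ then id else σ) ((if e₂ then id else τ) x) +K (if e₁ then id else σ) ((if e₂ then id else τ) y)
    hom true true = refl
    hom true false = τ-+ x y
    hom false true = σ-+ x y
    hom false false = trans (cong σ (τ-+ x y)) (σ-+ (τ x) (τ y))

  TotallyPositive-+ : ∀ {x y} → TotallyPositive x → TotallyPositive y → TotallyPositive (x +K y)
  TotallyPositive-+ {x} {y} tx ty e₁ e₂ = subst PosK (sym (conj-+ e₁ e₂ x y)) (PosK-+ (tx e₁ e₂) (ty e₁ e₂))

  TotallyPositive-* : ∀ {x y} → TotallyPositive x → TotallyPositive y → TotallyPositive (x *K y)
  TotallyPositive-* {x} {y} tx ty e₁ e₂ = subst PosK (sym (conj-* e₁ e₂ x y)) (PosK-* (tx e₁ e₂) (ty e₁ e₂))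

  TotallyPositive-conj : ∀ {x} d₁ d₂ → TotallyPositive x → TotallyPositive (conj d₁ d₂ x)
  TotallyPositive-conj {x} d₁ d₂ tx e₁ e₂ = subst PosK (sym (conj-conj e₁ e₂ d₁ d₂ x)) (tx (not (e₁ xor d₁)) (not (e₂ xor d₂)))

  TotallyPositive-cancelˡ : ∀ {x y} → TotallyPositive x → TotallyPositive (x *K y) → TotallyPositive y
  TotallyPositive-cancelˡ {x} {y} tx txy e₁ e₂ = PosK-cancelˡ {conj e₁ e₂ x} {conj e₁ e₂ y} (tx e₁ e₂) (subst PosK (conj-* e₁ e₂ x y) (txy e₁ e₂))

  theory : BiquadraticTheory p q
  theory = record
    { -K_ = -K_
    ; K-isCR = K-isCR
    ; PosK-+ = λ {x} {y} → PosK-+ {x} {y}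
    ; PosK-* = λ {x} {y} → PosK-* {x} {y}
    ; PosK-cancelˡ = λ {x} {y} → PosK-cancelˡ {x} {y}
    ; K-sumProduct⇒Pos = λ {x} {y} → K-sumProduct⇒Pos {x} {y}
    ; PosK-fst = λ {u} → PosK-fst {u}
    ; PosK-snd = λ {v} → PosK-snd {v}
    ; PosK-rational⁻¹ = λ {x} → PosK-rational⁻¹ {x}
    ; TotallyPositive-+ = λ {x} {y} → TotallyPositive-+ {x} {y}
    ; TotallyPositive-* = λ {x} {y} → TotallyPositive-* {x} {y}
    ; TotallyPositive-cancelˡ = λ {x} {y} → TotallyPositive-cancelˡ {x} {y}
    ; TotallyPositive-conj = λ {x} → TotallyPositive-conj {x}
    ; conj-* = conj-*
    ; normK-* = normK-*
    }

biquadraticTheory : ∀ p q r a → 0ℚ ℚ.< p → 0ℚ ℚ.< q → Nonsquare p → Nonsquare q → Nonsquare r →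
  a ≢ 0ℚ → p ℚ.* q ≡ a ℚ.* a ℚ.* r → BiquadraticTheory p q
biquadraticTheory = BiquadraticField.theory

-- Doubled integer coordinates, units and lattice identities.

record Quad (A : Set) : Set where
  constructor quad
  field
    c₀ c₁ c₂ c₃ : A
open Quad public

ℤ⁴ : Set
ℤ⁴ = Quad ℤ

quad-cong : ∀ {A : Set} {a a′ b b′ c c′ d d′ : A} → a ≡ a′ → b ≡ b′ → c ≡ c′ → d ≡ d′ → quad a b c d ≡ quad a′ b′ c′ d′
quad-cong refl refl refl refl = refl

record Operations (A : Set) : Set where
  infixl 6 _+_
  infixl 7 _*_
  infix 8 -_
  field
    _+_ _*_ : A → A → A
    -_ : A → A
    int : ℤ → A

ℤ-operations : Operations ℤ
ℤ-operations = record { _+_ = ℤ._+_ ; _*_ = ℤ._*_ ; -_ = ℤ.-_ ; int = id }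

-- Polymorphic in the carrier so that the same formulas serve both for
-- integers and for the syntactic polynomials of the ring solver.
-- Here b = 2n + 1, and (x₀ , x₁ , x₂ , x₃) stands for (x₀ + x₁√p + x₂√q + x₃√r) / 2.
module Formulas {A : Set} (operations : Operations A) (b : A) where
  open Operations operations

  a c m p q r : A
  a = b + int -[1+ 1 ]
  c = b + int (+ 2)
  m = b + int -[1+ 0 ]
  p = a * b
  q = a * c
  r = b * c

  infixl 6 _⊞_
  infixr 7 _⊡_

  _⊞_ : Quad A → Quad A → Quad A
  quad x₀ x₁ x₂ x₃ ⊞ quad y₀ y₁ y₂ y₃ = quad (x₀ + y₀) (x₁ + y₁) (x₂ + y₂) (x₃ + y₃)

  _⊡_ : A → Quad A → Quad A
  k ⊡ quad x₀ x₁ x₂ x₃ = quad (k * x₀) (k * x₁) (k * x₂) (k * x₃)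

  -- Two factors 1/2 leave 1/4, so the quadruple of the product is half of this one. The mixed terms
  -- come from √p√q = a√r, √p√r = b√q and √q√r = c√p.
  twiceProduct : Quad A → Quad A → Quad A
  twiceProduct (quad x₀ x₁ x₂ x₃) (quad y₀ y₁ y₂ y₃) = quad
    (x₀ * y₀ + p * (x₁ * y₁) + q * (x₂ * y₂) + r * (x₃ * y₃))
    (x₀ * y₁ + x₁ * y₀ + c * (x₂ * y₃ + x₃ * y₂))
    (x₀ * y₂ + x₂ * y₀ + b * (x₁ * y₃ + x₃ * y₁))
    (x₀ * y₃ + x₃ * y₀ + a * (x₁ * y₂ + x₂ * y₁))

  -- The basis is c₁ = b + (√p + √r)/2, ε_q c₁, (√p - √r)/2 - 1 and √(ε_p ε_r).
  coords : Quad A → Quad A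
  coords (quad f g X Y) = quad
    (int (+ 2) * b * f + b * b * g + - (int (+ 2) * X) + b * Y)
    (f + (b + int (+ 1)) * g + X + Y)
    (b * g + Y)
    (f + m * g + - X + Y)

  ε-p ε-p⁻¹ ε-q ε-q⁻¹ ε-r ε-r⁻¹ ε-pr : Quad A
  ε-p = quad (int (+ 2) * m) (int (+ 2)) (int (+ 0)) (int (+ 0))
  ε-p⁻¹ = quad (int (+ 2) * m) (int -[1+ 1 ]) (int (+ 0)) (int (+ 0))
  ε-q = quad b (int (+ 0)) (int (+ 1)) (int (+ 0))
  ε-q⁻¹ = quad b (int (+ 0)) (int -[1+ 0 ]) (int (+ 0))
  ε-r = quad (int (+ 2) * (b + int (+ 1))) (int (+ 0)) (int (+ 0)) (int (+ 2))
  ε-r⁻¹ = quad (int (+ 2) * (b + int (+ 1))) (int (+ 0)) (int (+ 0)) (int -[1+ 1 ])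
  ε-pr = quad (int (+ 2) * (b * b + int -[1+ 0 ])) (int (+ 2) * (b + int (+ 1))) (int (+ 2) * b) (int (+ 2) * m)

  -- Multiplication by the fundamental units, in the coordinates (f , g , X , Y).
  E-p E-p⁻¹ E-q E-q⁻¹ E-r E-r⁻¹ S W : Quad A → Quad A
  E-p (quad f g X Y) = quad (m * f + m * X + - Y) (m * g + - X + Y) (b * f + b * g + m * X) (b * f + b * m * g + m * Y)
  E-p⁻¹ (quad f g X Y) = quad (m * f + - (m * X) + Y) (m * g + X + - Y) (- (b * f) + - (b * g) + m * X) (- (b * f) + - (b * m * g) + m * Y)
  E-q (quad f g X Y) = quad (- g) (f + b * g) Y (- X + b * Y)
  E-q⁻¹ (quad f g X Y) = quad (b * f + g) (- f) (b * X + - Y) X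
  E-r (quad f g X Y) = quad ((b + int (+ 1)) * f + - ((b + int (+ 1)) * X) + Y) ((b + int (+ 1)) * g + X + Y)
    (- (b * f) + b * g + (b + int (+ 1)) * X) (b * f + b * (b + int (+ 1)) * g + (b + int (+ 1)) * Y)
  E-r⁻¹ (quad f g X Y) = quad ((b + int (+ 1)) * f + (b + int (+ 1)) * X + - Y) ((b + int (+ 1)) * g + - X + - Y)
    (b * f + - (b * g) + (b + int (+ 1)) * X) (- (b * f) + - (b * (b + int (+ 1)) * g) + (b + int (+ 1)) * Y)
  -- Galois automorphisms followed by multiplication by ε_p ε_r and by ε_p.
  S (quad f g X Y) = quad f g (- X) (- Y)
  W (quad f g X Y) = quad g f (- X) (Y + - (b * X))

  -- The norm of x relative to ℚ(√q) is (normA + 2 normE √q)/4.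
  normA normE normForm : Quad A → A
  normA (quad x₀ x₁ x₂ x₃) = x₀ * x₀ + - (p * (x₁ * x₁)) + q * (x₂ * x₂) + - (r * (x₃ * x₃))
  normE (quad x₀ x₁ x₂ x₃) = x₀ * x₂ + - (b * (x₁ * x₃))
  -- 16 times the norm
  normForm x = normA x * normA x + - (int (+ 4) * q * (normE x * normE x))

  -- The nontrivial cases of `flip`, in a form that also exists for the polynomials of the solver.
  negate₁₂ negate₁₃ negate₂₃ : Quad A → Quad A
  negate₁₂ (quad x₀ x₁ x₂ x₃) = quad x₀ (- x₁) (- x₂) x₃
  negate₁₃ (quad x₀ x₁ x₂ x₃) = quad x₀ (- x₁) x₂ (- x₃)
  negate₂₃ (quad x₀ x₁ x₂ x₃) = quad x₀ x₁ (- x₂) (- x₃)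

IsProduct : ℤ → ℤ⁴ → ℤ⁴ → ℤ⁴ → Set
IsProduct b x y z = let open Formulas ℤ-operations b in twiceProduct x y ≡ + 2 ⊡ z

NormForm-multiplicative : ℤ → Set
NormForm-multiplicative b = let open Formulas ℤ-operations b in ∀ x y z → IsProduct b x y z → + 16 ℤ.* normForm z ≡ normForm x ℤ.* normForm y

flip : Bool → Bool → ℤ⁴ → ℤ⁴
flip true true x = x
flip true false (quad x₀ x₁ x₂ x₃) = quad x₀ x₁ (ℤ.- x₂) (ℤ.- x₃)
flip false true (quad x₀ x₁ x₂ x₃) = quad x₀ (ℤ.- x₁) x₂ (ℤ.- x₃)
flip false false (quad x₀ x₁ x₂ x₃) = quad x₀ (ℤ.- x₁) (ℤ.- x₂) x₃

module Embedding (b : ℤ) (p q : ℚ)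
  (p≡ : p ≡ ℤtoℚ ((b ℤ.+ -[1+ 1 ]) ℤ.* b)) (q≡ : q ≡ ℤtoℚ ((b ℤ.+ -[1+ 1 ]) ℤ.* (b ℤ.+ + 2)))
  (a≢0 : ℤtoℚ (b ℤ.+ -[1+ 1 ]) ≢ 0ℚ)
  where

  open Biquad p q
  open Formulas ℤ-operations b using (a; c; r; _⊞_; twiceProduct)

  instance
    a-nonZero : ℚ.NonZero (ℤtoℚ a)
    a-nonZero = ℚ.≢-nonZero a≢0

  1/a : ℚ
  1/a = ℚ.1/ ℤtoℚ a

  -- The fourth basis vector of `Kel` is √p√q = a√r, hence the factor 1/a in the last coordinate.
  κ : ℤ⁴ → Kel
  κ (quad x₀ x₁ x₂ x₃) = ⟪ ⟨ ½ ℚ.* ℤtoℚ x₀ , ½ ℚ.* ℤtoℚ x₁ ⟩ , ⟨ ½ ℚ.* ℤtoℚ x₂ , ½ ℚ.* 1/a ℚ.* ℤtoℚ x₃ ⟩ ⟫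

  κ-⊞ : ∀ x y → κ x +K κ y ≡ κ (x ⊞ y)
  κ-⊞ (quad x₀ x₁ x₂ x₃) (quad y₀ y₁ y₂ y₃) = cong₂ ⟪_,_⟫ (cong₂ ⟨_,_⟩ (add ½ x₀ y₀) (add ½ x₁ y₁)) (cong₂ ⟨_,_⟩ (add ½ x₂ y₂) (add (½ ℚ.* 1/a) x₃ y₃))
    where
    add : ∀ h x y → h ℚ.* ℤtoℚ x ℚ.+ h ℚ.* ℤtoℚ y ≡ h ℚ.* ℤtoℚ (x ℤ.+ y)
    add h x y = trans (sym (ℚP.*-distribˡ-+ h (ℤtoℚ x) (ℤtoℚ y))) (cong (h ℚ.*_) (sym (ℤtoℚ-+ x y)))

  ap≡b : 1/a ℚ.* p ≡ ℤtoℚ b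
  ap≡b = begin
    1/a ℚ.* p                        ≡⟨ cong (1/a ℚ.*_) (trans p≡ (ℤtoℚ-* a b)) ⟩
    1/a ℚ.* (ℤtoℚ a ℚ.* ℤtoℚ b)      ≡⟨ sym (ℚP.*-assoc 1/a (ℤtoℚ a) (ℤtoℚ b)) ⟩
    1/a ℚ.* ℤtoℚ a ℚ.* ℤtoℚ b        ≡⟨ cong (ℚ._* ℤtoℚ b) (ℚP.*-inverseˡ (ℤtoℚ a)) ⟩
    1ℚ ℚ.* ℤtoℚ b                    ≡⟨ ℚP.*-identityˡ (ℤtoℚ b) ⟩
    ℤtoℚ b                           ∎
    where open ≡-Reasoning

  aq≡c : 1/a ℚ.* q ≡ ℤtoℚ c
  aq≡c = begin
    1/a ℚ.* q                        ≡⟨ cong (1/a ℚ.*_) (trans q≡ (ℤtoℚ-* a c)) ⟩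
    1/a ℚ.* (ℤtoℚ a ℚ.* ℤtoℚ c)      ≡⟨ sym (ℚP.*-assoc 1/a (ℤtoℚ a) (ℤtoℚ c)) ⟩
    1/a ℚ.* ℤtoℚ a ℚ.* ℤtoℚ c        ≡⟨ cong (ℚ._* ℤtoℚ c) (ℚP.*-inverseˡ (ℤtoℚ a)) ⟩
    1ℚ ℚ.* ℤtoℚ c                    ≡⟨ ℚP.*-identityˡ (ℤtoℚ c) ⟩
    ℤtoℚ c                           ∎
    where open ≡-Reasoning

  private
    push : ∀ x y k z w → ℤtoℚ (x ℤ.+ y ℤ.+ k ℤ.* (z ℤ.+ w)) ≡ ℤtoℚ x ℚ.+ ℤtoℚ y ℚ.+ ℤtoℚ k ℚ.* (ℤtoℚ z ℚ.+ ℤtoℚ w)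
    push x y k z w = trans (ℤtoℚ-+ (x ℤ.+ y) (k ℤ.* (z ℤ.+ w))) (cong₂ ℚ._+_ (ℤtoℚ-+ x y) (trans (ℤtoℚ-* k (z ℤ.+ w)) (cong (ℤtoℚ k ℚ.*_) (ℤtoℚ-+ z w))))

    halve : ∀ z → ½ ℚ.* ℤtoℚ (+ 2 ℤ.* z) ≡ ℤtoℚ z
    halve z = trans (cong (½ ℚ.*_) (ℤtoℚ-* (+ 2) z)) (trans (sym (ℚP.*-assoc ½ (ℤtoℚ (+ 2)) (ℤtoℚ z))) (ℚP.*-identityˡ (ℤtoℚ z)))

  -- Wherever 1/a meets p or q it becomes b or c, which yields the coefficients of `twiceProduct`.
  -- In the last coordinate the coefficient a appears by writing 1 as (1/a)·a.
  κ-* : ∀ x y z → twiceProduct x y ≡ quad (+ 2 ℤ.* c₀ z) (+ 2 ℤ.* c₁ z) (+ 2 ℤ.* c₂ z) (+ 2 ℤ.* c₃ z) → κ x *K κ y ≡ κ z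
  κ-* (quad x₀ x₁ x₂ x₃) (quad y₀ y₁ y₂ y₃) (quad z₀ z₁ z₂ z₃) eq =
    cong₂ ⟪_,_⟫ (cong₂ ⟨_,_⟩ e₀ e₁) (cong₂ ⟨_,_⟩ e₂ e₃)
    where
    open ≡-Reasoning
    open ℚ-Solver
    X₀ = ℤtoℚ x₀
    X₁ = ℤtoℚ x₁
    X₂ = ℤtoℚ x₂
    X₃ = ℤtoℚ x₃
    Y₀ = ℤtoℚ y₀
    Y₁ = ℤtoℚ y₁
    Y₂ = ℤtoℚ y₂
    Y₃ = ℤtoℚ y₃
    finish : ∀ w z → w ≡ + 2 ℤ.* z → ½ ℚ.* (½ ℚ.* ℤtoℚ w) ≡ ½ ℚ.* ℤtoℚ z
    finish w z w≡2z = cong (½ ℚ.*_) (trans (cong (λ u → ½ ℚ.* ℤtoℚ u) w≡2z) (halve z))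
    e₀ : (½ ℚ.* X₀) ℚ.* (½ ℚ.* Y₀) ℚ.+ (½ ℚ.* X₁) ℚ.* (½ ℚ.* Y₁) ℚ.* p
        ℚ.+ (((½ ℚ.* X₂) ℚ.* (½ ℚ.* Y₂) ℚ.+ (½ ℚ.* 1/a ℚ.* X₃) ℚ.* (½ ℚ.* 1/a ℚ.* Y₃) ℚ.* p) ℚ.* q
             ℚ.+ ((½ ℚ.* X₂) ℚ.* (½ ℚ.* 1/a ℚ.* Y₃) ℚ.+ (½ ℚ.* 1/a ℚ.* X₃) ℚ.* (½ ℚ.* Y₂)) ℚ.* 0ℚ ℚ.* p)
        ≡ ½ ℚ.* ℤtoℚ z₀
    e₀ = begin
      _ ≡⟨ solve 12 (λ h i p q x₀ x₁ x₂ x₃ y₀ y₁ y₂ y₃ →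
             (h :* x₀) :* (h :* y₀) :+ (h :* x₁) :* (h :* y₁) :* p
               :+ (((h :* x₂) :* (h :* y₂) :+ (h :* i :* x₃) :* (h :* i :* y₃) :* p) :* q
               :+ ((h :* x₂) :* (h :* i :* y₃) :+ (h :* i :* x₃) :* (h :* y₂)) :* # 0 :* p)
             := h :* (h :* (x₀ :* y₀ :+ p :* (x₁ :* y₁) :+ q :* (x₂ :* y₂) :+ (i :* p) :* (i :* q) :* (x₃ :* y₃)))) refl ½ 1/a p q X₀ X₁ X₂ X₃ Y₀ Y₁ Y₂ Y₃ ⟩
      ½ ℚ.* (½ ℚ.* (X₀ ℚ.* Y₀ ℚ.+ p ℚ.* (X₁ ℚ.* Y₁) ℚ.+ q ℚ.* (X₂ ℚ.* Y₂) ℚ.+ (1/a ℚ.* p) ℚ.* (1/a ℚ.* q) ℚ.* (X₃ ℚ.* Y₃)))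
        ≡⟨ cong (λ u → ½ ℚ.* (½ ℚ.* u)) (sym push₀) ⟩
      ½ ℚ.* (½ ℚ.* ℤtoℚ (x₀ ℤ.* y₀ ℤ.+ a ℤ.* b ℤ.* (x₁ ℤ.* y₁) ℤ.+ a ℤ.* c ℤ.* (x₂ ℤ.* y₂) ℤ.+ b ℤ.* c ℤ.* (x₃ ℤ.* y₃)))
        ≡⟨ finish _ z₀ (cong c₀ eq) ⟩
      ½ ℚ.* ℤtoℚ z₀ ∎
      where
      term : ∀ k x y K → ℤtoℚ k ≡ K → ℤtoℚ (k ℤ.* (x ℤ.* y)) ≡ K ℚ.* (ℤtoℚ x ℚ.* ℤtoℚ y)
      term k x y K k≡K = trans (ℤtoℚ-* k (x ℤ.* y)) (cong₂ ℚ._*_ k≡K (ℤtoℚ-* x y))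
      push₀ : ℤtoℚ (x₀ ℤ.* y₀ ℤ.+ a ℤ.* b ℤ.* (x₁ ℤ.* y₁) ℤ.+ a ℤ.* c ℤ.* (x₂ ℤ.* y₂) ℤ.+ b ℤ.* c ℤ.* (x₃ ℤ.* y₃))
        ≡ X₀ ℚ.* Y₀ ℚ.+ p ℚ.* (X₁ ℚ.* Y₁) ℚ.+ q ℚ.* (X₂ ℚ.* Y₂) ℚ.+ (1/a ℚ.* p) ℚ.* (1/a ℚ.* q) ℚ.* (X₃ ℚ.* Y₃)
      push₀ = trans (ℤtoℚ-+ (x₀ ℤ.* y₀ ℤ.+ a ℤ.* b ℤ.* (x₁ ℤ.* y₁) ℤ.+ a ℤ.* c ℤ.* (x₂ ℤ.* y₂)) (b ℤ.* c ℤ.* (x₃ ℤ.* y₃)))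
        (cong₂ ℚ._+_ (trans (ℤtoℚ-+ (x₀ ℤ.* y₀ ℤ.+ a ℤ.* b ℤ.* (x₁ ℤ.* y₁)) (a ℤ.* c ℤ.* (x₂ ℤ.* y₂)))
          (cong₂ ℚ._+_ (trans (ℤtoℚ-+ (x₀ ℤ.* y₀) (a ℤ.* b ℤ.* (x₁ ℤ.* y₁)))
            (cong₂ ℚ._+_ (ℤtoℚ-* x₀ y₀) (term (a ℤ.* b) x₁ y₁ p (sym p≡)))) (term (a ℤ.* c) x₂ y₂ q (sym q≡))))
          (term (b ℤ.* c) x₃ y₃ ((1/a ℚ.* p) ℚ.* (1/a ℚ.* q)) (trans (ℤtoℚ-* b c) (sym (cong₂ ℚ._*_ ap≡b aq≡c)))))
    push′ : ∀ x y x′ y′ k z w z′ w′ K → K ≡ ℤtoℚ k → ℤtoℚ x ℚ.* ℤtoℚ y ℚ.+ ℤtoℚ x′ ℚ.* ℤtoℚ y′ ℚ.+ K ℚ.* (ℤtoℚ z ℚ.* ℤtoℚ w ℚ.+ ℤtoℚ z′ ℚ.* ℤtoℚ w′)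
      ≡ ℤtoℚ (x ℤ.* y ℤ.+ x′ ℤ.* y′ ℤ.+ k ℤ.* (z ℤ.* w ℤ.+ z′ ℤ.* w′))
    push′ x y x′ y′ k z w z′ w′ K K≡k = sym (trans (push (x ℤ.* y) (x′ ℤ.* y′) k (z ℤ.* w) (z′ ℤ.* w′))
      (cong₂ ℚ._+_ (cong₂ ℚ._+_ (ℤtoℚ-* x y) (ℤtoℚ-* x′ y′)) (cong₂ ℚ._*_ (sym K≡k) (cong₂ ℚ._+_ (ℤtoℚ-* z w) (ℤtoℚ-* z′ w′)))))
    e₁ : (½ ℚ.* X₀) ℚ.* (½ ℚ.* Y₁) ℚ.+ (½ ℚ.* X₁) ℚ.* (½ ℚ.* Y₀)
        ℚ.+ (((½ ℚ.* X₂) ℚ.* (½ ℚ.* Y₂) ℚ.+ (½ ℚ.* 1/a ℚ.* X₃) ℚ.* (½ ℚ.* 1/a ℚ.* Y₃) ℚ.* p) ℚ.* 0ℚ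
             ℚ.+ ((½ ℚ.* X₂) ℚ.* (½ ℚ.* 1/a ℚ.* Y₃) ℚ.+ (½ ℚ.* 1/a ℚ.* X₃) ℚ.* (½ ℚ.* Y₂)) ℚ.* q)
        ≡ ½ ℚ.* ℤtoℚ z₁
    e₁ = begin
      _ ≡⟨ solve 12 (λ h i p q x₀ x₁ x₂ x₃ y₀ y₁ y₂ y₃ →
             (h :* x₀) :* (h :* y₁) :+ (h :* x₁) :* (h :* y₀)
               :+ (((h :* x₂) :* (h :* y₂) :+ (h :* i :* x₃) :* (h :* i :* y₃) :* p) :* # 0
               :+ ((h :* x₂) :* (h :* i :* y₃) :+ (h :* i :* x₃) :* (h :* y₂)) :* q)
             := h :* (h :* (x₀ :* y₁ :+ x₁ :* y₀ :+ (i :* q) :* (x₂ :* y₃ :+ x₃ :* y₂)))) refl ½ 1/a p q X₀ X₁ X₂ X₃ Y₀ Y₁ Y₂ Y₃ ⟩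
      ½ ℚ.* (½ ℚ.* (X₀ ℚ.* Y₁ ℚ.+ X₁ ℚ.* Y₀ ℚ.+ (1/a ℚ.* q) ℚ.* (X₂ ℚ.* Y₃ ℚ.+ X₃ ℚ.* Y₂)))
        ≡⟨ cong (λ u → ½ ℚ.* (½ ℚ.* u)) (push′ x₀ y₁ x₁ y₀ c x₂ y₃ x₃ y₂ (1/a ℚ.* q) aq≡c) ⟩
      ½ ℚ.* (½ ℚ.* ℤtoℚ (x₀ ℤ.* y₁ ℤ.+ x₁ ℤ.* y₀ ℤ.+ c ℤ.* (x₂ ℤ.* y₃ ℤ.+ x₃ ℤ.* y₂)))
        ≡⟨ finish _ z₁ (cong c₁ eq) ⟩
      ½ ℚ.* ℤtoℚ z₁ ∎
    e₂ : (½ ℚ.* X₀) ℚ.* (½ ℚ.* Y₂) ℚ.+ (½ ℚ.* X₁) ℚ.* (½ ℚ.* 1/a ℚ.* Y₃) ℚ.* p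
        ℚ.+ ((½ ℚ.* X₂) ℚ.* (½ ℚ.* Y₀) ℚ.+ (½ ℚ.* 1/a ℚ.* X₃) ℚ.* (½ ℚ.* Y₁) ℚ.* p)
        ≡ ½ ℚ.* ℤtoℚ z₂
    e₂ = begin
      _ ≡⟨ solve 11 (λ h i p x₀ x₁ x₂ x₃ y₀ y₁ y₂ y₃ →
             (h :* x₀) :* (h :* y₂) :+ (h :* x₁) :* (h :* i :* y₃) :* p :+ ((h :* x₂) :* (h :* y₀) :+ (h :* i :* x₃) :* (h :* y₁) :* p)
             := h :* (h :* (x₀ :* y₂ :+ x₂ :* y₀ :+ (i :* p) :* (x₁ :* y₃ :+ x₃ :* y₁)))) refl ½ 1/a p X₀ X₁ X₂ X₃ Y₀ Y₁ Y₂ Y₃ ⟩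
      ½ ℚ.* (½ ℚ.* (X₀ ℚ.* Y₂ ℚ.+ X₂ ℚ.* Y₀ ℚ.+ (1/a ℚ.* p) ℚ.* (X₁ ℚ.* Y₃ ℚ.+ X₃ ℚ.* Y₁)))
        ≡⟨ cong (λ u → ½ ℚ.* (½ ℚ.* u)) (push′ x₀ y₂ x₂ y₀ b x₁ y₃ x₃ y₁ (1/a ℚ.* p) ap≡b) ⟩
      ½ ℚ.* (½ ℚ.* ℤtoℚ (x₀ ℤ.* y₂ ℤ.+ x₂ ℤ.* y₀ ℤ.+ b ℤ.* (x₁ ℤ.* y₃ ℤ.+ x₃ ℤ.* y₁)))
        ≡⟨ finish _ z₂ (cong c₂ eq) ⟩
      ½ ℚ.* ℤtoℚ z₂ ∎
    e₃ : (½ ℚ.* X₀) ℚ.* (½ ℚ.* 1/a ℚ.* Y₃) ℚ.+ (½ ℚ.* X₁) ℚ.* (½ ℚ.* Y₂)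
        ℚ.+ ((½ ℚ.* X₂) ℚ.* (½ ℚ.* Y₁) ℚ.+ (½ ℚ.* 1/a ℚ.* X₃) ℚ.* (½ ℚ.* Y₀))
        ≡ ½ ℚ.* 1/a ℚ.* ℤtoℚ z₃
    e₃ = begin
      _ ≡⟨ solve 10 (λ h i x₀ x₁ x₂ x₃ y₀ y₁ y₂ y₃ →
             (h :* x₀) :* (h :* i :* y₃) :+ (h :* x₁) :* (h :* y₂) :+ ((h :* x₂) :* (h :* y₁) :+ (h :* i :* x₃) :* (h :* y₀))
             := h :* (h :* (i :* (x₀ :* y₃ :+ x₃ :* y₀) :+ # 1 :* (x₁ :* y₂ :+ x₂ :* y₁)))) refl ½ 1/a X₀ X₁ X₂ X₃ Y₀ Y₁ Y₂ Y₃ ⟩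
      ½ ℚ.* (½ ℚ.* (1/a ℚ.* (X₀ ℚ.* Y₃ ℚ.+ X₃ ℚ.* Y₀) ℚ.+ 1ℚ ℚ.* (X₁ ℚ.* Y₂ ℚ.+ X₂ ℚ.* Y₁)))
        ≡⟨ cong (λ u → ½ ℚ.* (½ ℚ.* (1/a ℚ.* (X₀ ℚ.* Y₃ ℚ.+ X₃ ℚ.* Y₀) ℚ.+ u ℚ.* (X₁ ℚ.* Y₂ ℚ.+ X₂ ℚ.* Y₁)))) (sym (ℚP.*-inverseˡ (ℤtoℚ a))) ⟩
      ½ ℚ.* (½ ℚ.* (1/a ℚ.* (X₀ ℚ.* Y₃ ℚ.+ X₃ ℚ.* Y₀) ℚ.+ 1/a ℚ.* ℤtoℚ a ℚ.* (X₁ ℚ.* Y₂ ℚ.+ X₂ ℚ.* Y₁)))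
        ≡⟨ solve 5 (λ h i a u v → h :* (h :* (i :* u :+ i :* a :* v)) := i :* (h :* (h :* (u :+ a :* v)))) refl ½ 1/a (ℤtoℚ a) (X₀ ℚ.* Y₃ ℚ.+ X₃ ℚ.* Y₀) (X₁ ℚ.* Y₂ ℚ.+ X₂ ℚ.* Y₁) ⟩
      1/a ℚ.* (½ ℚ.* (½ ℚ.* (X₀ ℚ.* Y₃ ℚ.+ X₃ ℚ.* Y₀ ℚ.+ ℤtoℚ a ℚ.* (X₁ ℚ.* Y₂ ℚ.+ X₂ ℚ.* Y₁))))
        ≡⟨ cong (λ u → 1/a ℚ.* (½ ℚ.* (½ ℚ.* u))) (push′ x₀ y₃ x₃ y₀ a x₁ y₂ x₂ y₁ (ℤtoℚ a) refl) ⟩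
      1/a ℚ.* (½ ℚ.* (½ ℚ.* ℤtoℚ (x₀ ℤ.* y₃ ℤ.+ x₃ ℤ.* y₀ ℤ.+ a ℤ.* (x₁ ℤ.* y₂ ℤ.+ x₂ ℤ.* y₁))))
        ≡⟨ cong (1/a ℚ.*_) (finish _ z₃ (cong c₃ eq)) ⟩
      1/a ℚ.* (½ ℚ.* ℤtoℚ z₃) ≡⟨ solve 3 (λ i h z → i :* (h :* z) := h :* i :* z) refl 1/a ½ (ℤtoℚ z₃) ⟩
      ½ ℚ.* 1/a ℚ.* ℤtoℚ z₃ ∎

  private
    neg : ∀ h x → ℚ.- (h ℚ.* ℤtoℚ x) ≡ h ℚ.* ℤtoℚ (ℤ.- x)
    neg h x = trans (ℚP.neg-distribʳ-* h (ℤtoℚ x)) (cong (h ℚ.*_) (sym (ℤtoℚ-neg x)))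
    open import Algebra.Properties.Group ℚP.+-0-group using () renaming (⁻¹-involutive to ℚ-neg-involutive)

  conj-κ : ∀ e₁ e₂ x → conj e₁ e₂ (κ x) ≡ κ (flip e₁ e₂ x)
  conj-κ true true x = refl
  conj-κ true false (quad x₀ x₁ x₂ x₃) = cong₂ ⟪_,_⟫ refl (cong₂ ⟨_,_⟩ (neg ½ x₂) (neg (½ ℚ.* 1/a) x₃))
  conj-κ false true (quad x₀ x₁ x₂ x₃) = cong₂ ⟪_,_⟫ (cong₂ ⟨_,_⟩ refl (neg ½ x₁)) (cong₂ ⟨_,_⟩ refl (neg (½ ℚ.* 1/a) x₃))
  conj-κ false false (quad x₀ x₁ x₂ x₃) = cong₂ ⟪_,_⟫ (cong₂ ⟨_,_⟩ refl (neg ½ x₁))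
    (cong₂ ⟨_,_⟩ (neg ½ x₂) (ℚ-neg-involutive (½ ℚ.* 1/a ℚ.* ℤtoℚ x₃)))

module SyntacticFormulas where
  open ℤ-Solver public

  polynomial-operations : ∀ {n} → Operations (Polynomial n)
  polynomial-operations = record { _+_ = _:+_ ; _*_ = _:*_ ; -_ = :-_ ; int = con }

  module F {n} = Formulas {Polynomial n} polynomial-operations

  infix 4 _≐_
  _≐_ : ∀ {n} → Quad (Polynomial n) → Quad (Polynomial n) → Quad (Polynomial n) × Quad (Polynomial n)
  _≐_ = _,_

  private
    module _ {n : ℕ} (e : Quad (Polynomial n)) (ρ : Vec ℤ n) where
      evaluate normalise : ℤ⁴
      evaluate = quad (⟦ c₀ e ⟧ ρ) (⟦ c₁ e ⟧ ρ) (⟦ c₂ e ⟧ ρ) (⟦ c₃ e ⟧ ρ)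
      normalise = quad (⟦ c₀ e ⟧↓ ρ) (⟦ c₁ e ⟧↓ ρ) (⟦ c₂ e ⟧↓ ρ) (⟦ c₃ e ⟧↓ ρ)

    module _ (n : ℕ) (s : N-ary n (Polynomial n) (Quad (Polynomial n) × Quad (Polynomial n))) where
      lhs rhs : Quad (Polynomial n)
      lhs = proj₁ (s $ⁿ Vec.map var (Vec.allFin n))
      rhs = proj₂ (s $ⁿ Vec.map var (Vec.allFin n))

  -- An identity of quadruples is stated once and checked by a single `refl` between normal forms;
  -- the solver's correctness is then applied to each component.
  solve₄ : ∀ n s → Eqʰ n _≡_ (curryⁿ (normalise (lhs n s))) (curryⁿ (normalise (rhs n s))) →
    Eq n _≡_ (curryⁿ (evaluate (lhs n s))) (curryⁿ (evaluate (rhs n s)))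
  solve₄ n s eq = curryⁿ-cong _≡_ (evaluate (lhs n s)) (evaluate (rhs n s)) λ ρ →
    let eq′ = curryⁿ-cong⁻¹ _≡_ (normalise (lhs n s)) (normalise (rhs n s)) (Eqʰ-to-Eq n _≡_ eq) ρ
        component = λ (c : ∀ {A} → Quad A → A) → prove ρ (c (lhs n s)) (c (rhs n s))
    in quad-cong (component c₀ (cong c₀ eq′)) (component c₁ (cong c₁ eq′)) (component c₂ (cong c₂ eq′)) (component c₃ (cong c₃ eq′))

rational : ℤ → ℤ⁴
rational k = quad k (+ 0) (+ 0) (+ 0)

module CoordinateIdentities (b : ℤ) where
  open SyntacticFormulas
  module Z = Formulas ℤ-operations b

  twiceProduct-2⊡ : ∀ x y → let open Z in twiceProduct (+ 2 ⊡ x) y ≡ + 2 ⊡ twiceProduct x y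
  twiceProduct-2⊡ (quad x₀ x₁ x₂ x₃) (quad y₀ y₁ y₂ y₃) = solve₄ 9 (λ b x₀ x₁ x₂ x₃ y₀ y₁ y₂ y₃ → let open F b; x = quad x₀ x₁ x₂ x₃; y = quad y₀ y₁ y₂ y₃ in twiceProduct (# 2 ⊡ x) y ≐ # 2 ⊡ twiceProduct x y) refl b x₀ x₁ x₂ x₃ y₀ y₁ y₂ y₃

  rational·⊡ : ∀ k x → let open Z in twiceProduct (rational (+ 2 ℤ.* k)) x ≡ + 2 ⊡ (k ⊡ x)
  rational·⊡ k (quad x₀ x₁ x₂ x₃) = solve₄ 6 (λ b k x₀ x₁ x₂ x₃ → let open F b; x = quad x₀ x₁ x₂ x₃ in
    twiceProduct (quad (# 2 :* k) (# 0) (# 0) (# 0)) x ≐ # 2 ⊡ (k ⊡ x)) refl b k x₀ x₁ x₂ x₃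

  ε-p·coords : ∀ v → let open Z in twiceProduct ε-p (coords v) ≡ + 2 ⊡ coords (E-p v)
  ε-p·coords (quad f g X Y) = solve₄ 5 (λ b f g X Y → let open F b; v = quad f g X Y in twiceProduct ε-p (coords v) ≐ # 2 ⊡ coords (E-p v)) refl b f g X Y

  ε-p⁻¹·coords : ∀ v → let open Z in twiceProduct ε-p⁻¹ (coords v) ≡ + 2 ⊡ coords (E-p⁻¹ v)
  ε-p⁻¹·coords (quad f g X Y) = solve₄ 5 (λ b f g X Y → let open F b; v = quad f g X Y in twiceProduct ε-p⁻¹ (coords v) ≐ # 2 ⊡ coords (E-p⁻¹ v)) refl b f g X Y

  -- The lattice is ℤ[ε_q] c₁ + ℤ[ε_q] ξ with η = -ε_q ξ. Hence ε_q acts on (f, g) and on (X, Y)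
  -- separately, by ε_q² = b ε_q - 1.
  ε-q·coords : ∀ v → let open Z in twiceProduct ε-q (coords v) ≡ + 2 ⊡ coords (E-q v)
  ε-q·coords (quad f g X Y) = solve₄ 5 (λ b f g X Y → let open F b; v = quad f g X Y in twiceProduct ε-q (coords v) ≐ # 2 ⊡ coords (E-q v)) refl b f g X Y

  ε-q⁻¹·coords : ∀ v → let open Z in twiceProduct ε-q⁻¹ (coords v) ≡ + 2 ⊡ coords (E-q⁻¹ v)
  ε-q⁻¹·coords (quad f g X Y) = solve₄ 5 (λ b f g X Y → let open F b; v = quad f g X Y in twiceProduct ε-q⁻¹ (coords v) ≐ # 2 ⊡ coords (E-q⁻¹ v)) refl b f g X Y

  ε-r·coords : ∀ v → let open Z in twiceProduct ε-r (coords v) ≡ + 2 ⊡ coords (E-r v)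
  ε-r·coords (quad f g X Y) = solve₄ 5 (λ b f g X Y → let open F b; v = quad f g X Y in twiceProduct ε-r (coords v) ≐ # 2 ⊡ coords (E-r v)) refl b f g X Y

  ε-r⁻¹·coords : ∀ v → let open Z in twiceProduct ε-r⁻¹ (coords v) ≡ + 2 ⊡ coords (E-r⁻¹ v)
  ε-r⁻¹·coords (quad f g X Y) = solve₄ 5 (λ b f g X Y → let open F b; v = quad f g X Y in twiceProduct ε-r⁻¹ (coords v) ≐ # 2 ⊡ coords (E-r⁻¹ v)) refl b f g X Y

  ε-r·conj : ∀ v → let open Z in twiceProduct ε-r (flip true false (coords v)) ≡ + 2 ⊡ coords (S (W v))
  ε-r·conj (quad f g X Y) = solve₄ 5 (λ b f g X Y → let open F b; v = quad f g X Y in twiceProduct ε-r (negate₂₃ (coords v)) ≐ # 2 ⊡ coords (S (W v))) refl b f g X Y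

  ε-pr·conj : ∀ v → let open Z in twiceProduct ε-pr (flip false true (coords v)) ≡ + 2 ⊡ coords (S v)
  ε-pr·conj (quad f g X Y) = solve₄ 5 (λ b f g X Y → let open F b; v = quad f g X Y in twiceProduct ε-pr (negate₁₃ (coords v)) ≐ # 2 ⊡ coords (S v)) refl b f g X Y

  ε-p·conj : ∀ v → let open Z in twiceProduct ε-p (flip false false (coords v)) ≡ + 2 ⊡ coords (W v)
  ε-p·conj (quad f g X Y) = solve₄ 5 (λ b f g X Y → let open F b; v = quad f g X Y in twiceProduct ε-p (negate₁₂ (coords v)) ≐ # 2 ⊡ coords (W v)) refl b f g X Y

  E-p⁻¹∘E-p : ∀ v → let open Z in E-p⁻¹ (E-p v) ≡ v
  E-p⁻¹∘E-p (quad f g X Y) = solve₄ 5 (λ b f g X Y → let open F b; v = quad f g X Y in E-p⁻¹ (E-p v) ≐ v) refl b f g X Y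

  E-q⁻¹∘E-q : ∀ v → let open Z in E-q⁻¹ (E-q v) ≡ v
  E-q⁻¹∘E-q (quad f g X Y) = solve₄ 5 (λ b f g X Y → let open F b; v = quad f g X Y in E-q⁻¹ (E-q v) ≐ v) refl b f g X Y

  E-r⁻¹∘E-r : ∀ v → let open Z in E-r⁻¹ (E-r v) ≡ v
  E-r⁻¹∘E-r (quad f g X Y) = solve₄ 5 (λ b f g X Y → let open F b; v = quad f g X Y in E-r⁻¹ (E-r v) ≐ v) refl b f g X Y

  S∘S : ∀ v → let open Z in S (S v) ≡ v
  S∘S (quad f g X Y) = solve₄ 5 (λ b f g X Y → let open F b; v = quad f g X Y in S (S v) ≐ v) refl b f g X Y

  W∘W : ∀ v → let open Z in W (W v) ≡ v
  W∘W (quad f g X Y) = solve₄ 5 (λ b f g X Y → let open F b; v = quad f g X Y in W (W v) ≐ v) refl b f g X Y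

  coords-⊞ : ∀ v w → let open Z in coords (v ⊞ w) ≡ coords v ⊞ coords w
  coords-⊞ (quad f g X Y) (quad f′ g′ X′ Y′) = solve₄ 9 (λ b f g X Y f′ g′ X′ Y′ → let open F b in coords (quad f g X Y ⊞ quad f′ g′ X′ Y′) ≐ coords (quad f g X Y) ⊞ coords (quad f′ g′ X′ Y′)) refl b f g X Y f′ g′ X′ Y′

  E-p⁻¹-⊞ : ∀ v w → let open Z in E-p⁻¹ (v ⊞ w) ≡ E-p⁻¹ v ⊞ E-p⁻¹ w
  E-p⁻¹-⊞ (quad f g X Y) (quad f′ g′ X′ Y′) = solve₄ 9 (λ b f g X Y f′ g′ X′ Y′ → let open F b in E-p⁻¹ (quad f g X Y ⊞ quad f′ g′ X′ Y′) ≐ E-p⁻¹ (quad f g X Y) ⊞ E-p⁻¹ (quad f′ g′ X′ Y′)) refl b f g X Y f′ g′ X′ Y′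

  E-q⁻¹-⊞ : ∀ v w → let open Z in E-q⁻¹ (v ⊞ w) ≡ E-q⁻¹ v ⊞ E-q⁻¹ w
  E-q⁻¹-⊞ (quad f g X Y) (quad f′ g′ X′ Y′) = solve₄ 9 (λ b f g X Y f′ g′ X′ Y′ → let open F b in E-q⁻¹ (quad f g X Y ⊞ quad f′ g′ X′ Y′) ≐ E-q⁻¹ (quad f g X Y) ⊞ E-q⁻¹ (quad f′ g′ X′ Y′)) refl b f g X Y f′ g′ X′ Y′

  E-r⁻¹-⊞ : ∀ v w → let open Z in E-r⁻¹ (v ⊞ w) ≡ E-r⁻¹ v ⊞ E-r⁻¹ w
  E-r⁻¹-⊞ (quad f g X Y) (quad f′ g′ X′ Y′) = solve₄ 9 (λ b f g X Y f′ g′ X′ Y′ → let open F b in E-r⁻¹ (quad f g X Y ⊞ quad f′ g′ X′ Y′) ≐ E-r⁻¹ (quad f g X Y) ⊞ E-r⁻¹ (quad f′ g′ X′ Y′)) refl b f g X Y f′ g′ X′ Y′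

  S-⊞ : ∀ v w → let open Z in S (v ⊞ w) ≡ S v ⊞ S w
  S-⊞ (quad f g X Y) (quad f′ g′ X′ Y′) = solve₄ 9 (λ b f g X Y f′ g′ X′ Y′ → let open F b in S (quad f g X Y ⊞ quad f′ g′ X′ Y′) ≐ S (quad f g X Y) ⊞ S (quad f′ g′ X′ Y′)) refl b f g X Y f′ g′ X′ Y′

  W-⊞ : ∀ v w → let open Z in W (v ⊞ w) ≡ W v ⊞ W w
  W-⊞ (quad f g X Y) (quad f′ g′ X′ Y′) = solve₄ 9 (λ b f g X Y f′ g′ X′ Y′ → let open F b in W (quad f g X Y ⊞ quad f′ g′ X′ Y′) ≐ W (quad f g X Y) ⊞ W (quad f′ g′ X′ Y′)) refl b f g X Y f′ g′ X′ Y′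

-- Certificates for inequalities, and positivity of lattice points.

-- All inequalities are brought to this form so that a proof is a certificate: the solver checks
-- that the target equals a sum of products of terms already known to be nonnegative. The hypothesis
-- on b enters such certificates through b - 13.
NonNeg : ℤ → Set
NonNeg x = + 0 ℤ.≤ x

NonNeg-+ : ∀ {x y} → NonNeg x → NonNeg y → NonNeg (x ℤ.+ y)
NonNeg-+ = ℤP.+-mono-≤

NonNeg-* : ∀ {x y} → NonNeg x → NonNeg y → NonNeg (x ℤ.* y)
NonNeg-* {+ m} {+ n} _ _ = subst NonNeg (ℤP.pos-* m n) (ℤ.+≤+ ℕ.z≤n)

NonNeg-ℕ : ∀ n → NonNeg (+ n)
NonNeg-ℕ n = ℤ.+≤+ ℕ.z≤n

¬NonNeg-1 : ¬ NonNeg -[1+ 0 ]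
¬NonNeg-1 ()

NonNeg-by : ∀ {x y} → x ≡ y → NonNeg x → NonNeg y
NonNeg-by = subst NonNeg

≤⇒NonNeg : ∀ {x y} → x ℤ.≤ y → NonNeg (y ℤ.- x)
≤⇒NonNeg = ℤP.i≤j⇒0≤j-i

NonNeg⇒≤ : ∀ {x y} → NonNeg (y ℤ.- x) → x ℤ.≤ y
NonNeg⇒≤ = ℤP.0≤i-j⇒j≤i

-- x > 0 is expressed as 0 ≤ x - 1.
Pos⇒< : ∀ x → NonNeg (x ℤ.- + 1) → + 0 ℤ.< x
Pos⇒< x h = ℤP.suc[i]≤j⇒i<j (NonNeg⇒≤ h)

<⇒Pos : ∀ {x} → + 0 ℤ.< x → NonNeg (x ℤ.- + 1)
<⇒Pos {x} h = ≤⇒NonNeg (ℤP.i<j⇒suc[i]≤j h)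

¬NonNeg⇒ : ∀ {x} → ¬ NonNeg x → NonNeg (ℤ.- x ℤ.- + 1)
¬NonNeg⇒ {+ n} h = ⊥-elim (h (NonNeg-ℕ n))
¬NonNeg⇒ { -[1+ n ]} h = subst (λ z → NonNeg z) (sym (ℤP.m-n≡m⊖n (suc n) 1)) (NonNeg-ℕ n)

-- Positivity of quadruples as an interface, so that the cone, the symmetries and the decompositions
-- are studied with integers alone.
record LatticeOrder (b : ℤ) : Set₁ where
  open Formulas ℤ-operations b
  field
    Positive TP : ℤ⁴ → Set
    TP⇒Positive : ∀ {x} → TP x → ∀ e₁ e₂ → Positive (flip e₁ e₂ x)
    Positive⇒TP : ∀ {x} → (∀ e₁ e₂ → Positive (flip e₁ e₂ x)) → TP x
    TP-flip : ∀ {x} e₁ e₂ → TP x → TP (flip e₁ e₂ x)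
    Positive-⊞ : ∀ {x y} → Positive x → Positive y → Positive (x ⊞ y)
    TP-⊞ : ∀ {x y} → TP x → TP y → TP (x ⊞ y)
    TP-* : ∀ {x y z} → twiceProduct x y ≡ + 2 ⊡ z → TP x → TP y → TP z
    TP-cancelˡ : ∀ {x y z} → twiceProduct x y ≡ + 2 ⊡ z → TP x → TP z → TP y
    Positive-* : ∀ {x y z} → twiceProduct x y ≡ + 2 ⊡ z → Positive x → Positive y → Positive z
    Positive-cancelˡ : ∀ {x y z} → twiceProduct x y ≡ + 2 ⊡ z → Positive x → Positive z → Positive y
    Positive-root : ∀ {x y} z → twiceProduct x y ≡ + 2 ⊡ z → Positive (x ⊞ y) → Positive z → Positive x
    Positive-rational : ∀ {k} → NonNeg (k ℤ.- + 1) → Positive (rational k)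
    Positive-rational⁻¹ : ∀ {k} → Positive (rational k) → NonNeg (k ℤ.- + 1)
    Positive-√p : Positive (quad (+ 0) (+ 1) (+ 0) (+ 0))
    Positive-√q : Positive (quad (+ 0) (+ 0) (+ 1) (+ 0))
    Positive-√r : Positive (quad (+ 0) (+ 0) (+ 0) (+ 1))

b>0⇒ : ∀ b → NonNeg (b ℤ.- + 13) → NonNeg (b ℤ.- + 1)
b>0⇒ b 13≤b = NonNeg-by (solve 1 (λ b → b :- # 13 :+ # 12 := b :- # 1) refl b) (NonNeg-+ 13≤b (NonNeg-ℕ 12))
  where open ℤ-Solver

a>0⇒ : ∀ b → NonNeg (b ℤ.- + 13) → NonNeg (b ℤ.+ -[1+ 1 ] ℤ.- + 1)
a>0⇒ b 13≤b = NonNeg-by (solve 1 (λ b → b :- # 13 :+ # 10 := b :+ con -[1+ 1 ] :- # 1) refl b) (NonNeg-+ 13≤b (NonNeg-ℕ 10))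
  where open ℤ-Solver

Pos-*-ℤ : ∀ x y → NonNeg (x ℤ.- + 1) → NonNeg (y ℤ.- + 1) → NonNeg (x ℤ.* y ℤ.- + 1)
Pos-*-ℤ x y hx hy = NonNeg-by (solve 2 (λ x y → (x :- # 1) :* (y :- # 1) :+ (x :- # 1) :+ (y :- # 1) := x :* y :- # 1) refl x y)
  (NonNeg-+ (NonNeg-+ (NonNeg-* hx hy) hx) hy)
  where open ℤ-Solver

module _ (b : ℤ) (13≤b : NonNeg (b ℤ.- + 13)) (p q : ℚ)
  (p≡ : p ≡ ℤtoℚ ((b ℤ.+ -[1+ 1 ]) ℤ.* b)) (q≡ : q ≡ ℤtoℚ ((b ℤ.+ -[1+ 1 ]) ℤ.* (b ℤ.+ + 2)))
  (theory : BiquadraticTheory p q)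
  where

  open Biquad p q
  open Formulas ℤ-operations b renaming (p to pℤ; q to qℤ)
  open BiquadraticTheory theory

  a≢0 : ℤtoℚ a ≢ 0ℚ
  a≢0 a≡0 = ℤP.<-irrefl (sym (ℤtoℚ-injective {a} {+ 0} a≡0)) (Pos⇒< a (a>0⇒ b 13≤b))

  open Embedding b p q p≡ q≡ a≢0

  private
    0<½ : 0ℚ ℚ.< ½
    0<½ = ℚP.positive⁻¹ ½

    ½*-pos : ∀ k → NonNeg (k ℤ.- + 1) → 0ℚ ℚ.< ½ ℚ.* ℤtoℚ k
    ½*-pos k h = PositiveCone.P-* ℚ-positiveCone {½} {ℤtoℚ k} 0<½ (ℤtoℚ-< {+ 0} {k} (Pos⇒< k h))

    0<1/a : 0ℚ ℚ.< 1/a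
    0<1/a = P-cancelˡ _ ℚ-positiveCone {ℤtoℚ a} {1/a} (ℤtoℚ-< {+ 0} {a} (Pos⇒< a (a>0⇒ b 13≤b))) (subst (0ℚ ℚ.<_) (sym (ℚP.*-inverseʳ (ℤtoℚ a))) (ℚP.positive⁻¹ 1ℚ))

    κ-rational : ∀ k → κ (rational k) ≡ ⟪ ⟨ ½ ℚ.* ℤtoℚ k , 0ℚ ⟩ , 𝟘 ⟫
    κ-rational k = cong₂ ⟪_,_⟫ (cong₂ ⟨_,_⟩ refl refl) (cong₂ ⟨_,_⟩ refl (ℚP.*-zeroʳ (½ ℚ.* 1/a)))

    Pos-re : ∀ {x} → 0ℚ ℚ.< x → Pos ⟨ x , 0ℚ ⟩
    Pos-re 0<x = inj₁ (ℚP.<⇒≤ 0<x , ℚP.≤-refl , inj₁ λ x≡0 → ℚP.<-irrefl (sym x≡0) 0<x)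

    Pos-im : ∀ {x} → 0ℚ ℚ.< x → Pos ⟨ 0ℚ , x ⟩
    Pos-im 0<x = inj₁ (ℚP.≤-refl , ℚP.<⇒≤ 0<x , inj₂ λ x≡0 → ℚP.<-irrefl (sym x≡0) 0<x)

  latticeOrder : LatticeOrder b
  latticeOrder = record
    { Positive = λ x → PosK (κ x)
    ; TP = λ x → TotallyPositive (κ x)
    ; TP⇒Positive = λ {x} t e₁ e₂ → subst PosK (conj-κ e₁ e₂ x) (t e₁ e₂)
    ; Positive⇒TP = λ {x} h e₁ e₂ → subst PosK (sym (conj-κ e₁ e₂ x)) (h e₁ e₂)
    ; TP-flip = λ {x} e₁ e₂ t → subst TotallyPositive (conj-κ e₁ e₂ x) (TotallyPositive-conj {κ x} e₁ e₂ t)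
    ; Positive-⊞ = λ {x} {y} h k → subst PosK (κ-⊞ x y) (PosK-+ {κ x} {κ y} h k)
    ; TP-⊞ = λ {x} {y} h k → subst TotallyPositive (κ-⊞ x y) (TotallyPositive-+ {κ x} {κ y} h k)
    ; TP-* = λ {x} {y} {z} eq h k → subst TotallyPositive (κ-* x y z eq) (TotallyPositive-* {κ x} {κ y} h k)
    ; TP-cancelˡ = λ {x} {y} {z} eq h k → TotallyPositive-cancelˡ {κ x} {κ y} h (subst TotallyPositive (sym (κ-* x y z eq)) k)
    ; Positive-* = λ {x} {y} {z} eq h k → subst PosK (κ-* x y z eq) (PosK-* {κ x} {κ y} h k)
    ; Positive-cancelˡ = λ {x} {y} {z} eq h k → PosK-cancelˡ {κ x} {κ y} h (subst PosK (sym (κ-* x y z eq)) k)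
    ; Positive-root = λ {x} {y} z eq h k →
        K-sumProduct⇒Pos {κ x} {κ y} (subst PosK (sym (κ-⊞ x y)) h) (subst PosK (sym (κ-* x y z eq)) k)
    ; Positive-rational = λ {k} h → subst PosK (sym (κ-rational k)) (PosK-fst {⟨ ½ ℚ.* ℤtoℚ k , 0ℚ ⟩} (Pos-re (½*-pos k h)))
    ; Positive-rational⁻¹ = λ {k} h → <⇒Pos {k} (ℤtoℚ-cancel-< {+ 0} {k} (P-cancelˡ _ ℚ-positiveCone {½} {ℤtoℚ k} 0<½
        (PosK-rational⁻¹ {½ ℚ.* ℤtoℚ k} (subst PosK (κ-rational k) h))))
    ; Positive-√p = subst PosK (cong₂ ⟪_,_⟫ refl (cong₂ ⟨_,_⟩ refl (sym (ℚP.*-zeroʳ (½ ℚ.* 1/a))))) (PosK-fst {⟨ 0ℚ , ½ ⟩} (Pos-im 0<½))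
    ; Positive-√q = subst PosK (cong₂ ⟪_,_⟫ refl (cong₂ ⟨_,_⟩ refl (sym (ℚP.*-zeroʳ (½ ℚ.* 1/a))))) (PosK-snd {⟨ ½ , 0ℚ ⟩} (Pos-re 0<½))
    ; Positive-√r = PosK-snd {⟨ 0ℚ , ½ ℚ.* 1/a ℚ.* 1ℚ ⟩} (Pos-im (PositiveCone.P-* ℚ-positiveCone (PositiveCone.P-* ℚ-positiveCone 0<½ 0<1/a) (ℚP.positive⁻¹ 1ℚ)))
    }

module LatticeOrderProperties (b : ℤ) (13≤b : NonNeg (b ℤ.- + 13)) (order : LatticeOrder b) where
  open LatticeOrder order
  open Formulas ℤ-operations b renaming (p to pℤ; q to qℤ)

  open SyntacticFormulas

  private
    2*-pos : ∀ k → NonNeg (k ℤ.- + 1) → NonNeg (+ 2 ℤ.* k ℤ.- + 1)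
    2*-pos k h = Pos-*-ℤ (+ 2) k (NonNeg-ℕ 1) h

  TP-rational : ∀ {k} → NonNeg (k ℤ.- + 1) → TP (rational k)
  TP-rational {k} h = Positive⇒TP λ where
    true true → Positive-rational {k} h
    true false → Positive-rational {k} h
    false true → Positive-rational {k} h
    false false → Positive-rational {k} h

  Positive-⊡ : ∀ k {x} → NonNeg (k ℤ.- + 1) → Positive x → Positive (k ⊡ x)
  Positive-⊡ k {x} h px = Positive-* {y = x} {z = k ⊡ x} (CoordinateIdentities.rational·⊡ b k x) (Positive-rational {+ 2 ℤ.* k} (2*-pos k h)) px

  TP-⊡ : ∀ k {x} → NonNeg (k ℤ.- + 1) → TP x → TP (k ⊡ x)
  TP-⊡ k {x} h px = TP-* {y = x} {z = k ⊡ x} (CoordinateIdentities.rational·⊡ b k x) (TP-rational {+ 2 ℤ.* k} (2*-pos k h)) px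

  TP-⊡⁻¹ : ∀ k x → NonNeg (k ℤ.- + 1) → TP (k ⊡ x) → TP x
  TP-⊡⁻¹ k x h px = TP-cancelˡ {y = x} {z = k ⊡ x} (CoordinateIdentities.rational·⊡ b k x) (TP-rational {+ 2 ℤ.* k} (2*-pos k h)) px

  private
    ⊞-0⊡ : ∀ x y → x ⊞ + 0 ⊡ y ≡ x
    ⊞-0⊡ (quad x₀ x₁ x₂ x₃) (quad y₀ y₁ y₂ y₃) = quad-cong (z x₀ y₀) (z x₁ y₁) (z x₂ y₂) (z x₃ y₃)
      where
      z : ∀ x y → x ℤ.+ + 0 ℤ.* y ≡ x
      z = solve 2 (λ x y → x :+ # 0 :* y := x) refl

    split : ∀ k → NonNeg k → k ≡ + 0 ⊎ NonNeg (k ℤ.- + 1)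
    split (+ zero) _ = inj₁ refl
    split (+ suc n) _ = inj₂ (subst NonNeg (sym (ℤP.m-n≡m⊖n (suc n) 1)) (NonNeg-ℕ n))

  -- The coefficient 0 is treated apart because zero is not positive.
  Positive-⊞-⊡ : ∀ k {x y} → NonNeg k → Positive x → Positive y → Positive (x ⊞ k ⊡ y)
  Positive-⊞-⊡ k {x} {y} h px py with split k h
  ... | inj₁ refl = subst Positive (sym (⊞-0⊡ x y)) px
  ... | inj₂ k>0 = Positive-⊞ px (Positive-⊡ k k>0 py)

  TP-⊞-⊡ : ∀ k {x y} → NonNeg k → TP x → TP y → TP (x ⊞ k ⊡ y)
  TP-⊞-⊡ k {x} {y} h px py with split k h
  ... | inj₁ refl = subst TP (sym (⊞-0⊡ x y)) px
  ... | inj₂ k>0 = TP-⊞ px (TP-⊡ k k>0 py)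

-- The polyhedral cone and its total positivity.

-- The last eight forms are the images of `a⁻` and `b⁻` under the four-group of `S` and `W`: `S`
-- exchanges the superscripts, and `W` carries a and b to c and d.
record Region (b : ℤ) (v : ℤ⁴) : Set where
  constructor region
  open Quad v renaming (c₀ to f; c₁ to g; c₂ to X; c₃ to Y)
  m = b ℤ.+ -[1+ 0 ]
  field
    f≥0 : NonNeg f
    g≥0 : NonNeg g
    f+g≥1 : NonNeg (f ℤ.+ g ℤ.- + 1)
    a⁺ : NonNeg (f ℤ.+ b ℤ.* g ℤ.- Y)
    a⁻ : NonNeg (f ℤ.+ b ℤ.* g ℤ.+ Y)
    b⁺ : NonNeg (f ℤ.+ m ℤ.* g ℤ.- (Y ℤ.- X))
    b⁻ : NonNeg (f ℤ.+ m ℤ.* g ℤ.+ (Y ℤ.- X))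
    c⁺ : NonNeg (g ℤ.+ b ℤ.* f ℤ.- (Y ℤ.- b ℤ.* X))
    c⁻ : NonNeg (g ℤ.+ b ℤ.* f ℤ.+ (Y ℤ.- b ℤ.* X))
    d⁺ : NonNeg (g ℤ.+ m ℤ.* f ℤ.- (Y ℤ.- m ℤ.* X))
    d⁻ : NonNeg (g ℤ.+ m ℤ.* f ℤ.+ (Y ℤ.- m ℤ.* X))

module TotallyPositiveRegion (b : ℤ) (13≤b : NonNeg (b ℤ.- + 13)) (order : LatticeOrder b) where
  open LatticeOrder order
  open LatticeOrderProperties b 13≤b order
  open CoordinateIdentities b
  open SyntacticFormulas

  private
    linear : ∀ k l → NonNeg (+ k ℤ.* (b ℤ.- + 13) ℤ.+ + l)
    linear k l = NonNeg-+ (NonNeg-* (NonNeg-ℕ k) 13≤b) (NonNeg-ℕ l)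

  TP-twiceProduct : ∀ {x y} → TP x → TP y → TP (Z.twiceProduct x y)
  TP-twiceProduct {x} {y} tx ty = TP-* {z = Z.twiceProduct x y} (twiceProduct-2⊡ x y) (TP-⊡ (+ 2) {x} (NonNeg-ℕ 1) tx) ty

  -- Both elements have positive trace and norm relative to their conjugate.
  private
    positive-p : ∀ s t k → + 4 ℤ.* (s ℤ.* s) ℤ.- Z.p ℤ.* (t ℤ.* t) ≡ + 2 ℤ.* k →
      NonNeg (s ℤ.- + 1) → NonNeg (k ℤ.- + 1) → Positive (quad (+ 2 ℤ.* s) t (+ 0) (+ 0))
    positive-p s t k norm s>0 k>0 = Positive-root {y = quad (+ 2 ℤ.* s) (ℤ.- t) (+ 0) (+ 0)} (rational k)
      (quad-cong
        (trans (solve 3 (λ b s t → let open F b in # 2 :* s :* (# 2 :* s) :+ p :* (t :* :- t) :+ q :* (# 0 :* # 0) :+ r :* (# 0 :* # 0)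
          := # 4 :* (s :* s) :- p :* (t :* t)) refl b s t) norm)
        (solve 3 (λ b s t → let open F b in # 2 :* s :* :- t :+ t :* (# 2 :* s) :+ c :* (# 0 :* # 0 :+ # 0 :* # 0) := # 0) refl b s t)
        (solve 3 (λ b s t → let open F b in # 2 :* s :* # 0 :+ # 0 :* (# 2 :* s) :+ b :* (t :* # 0 :+ # 0 :* :- t) := # 0) refl b s t)
        (solve 3 (λ b s t → let open F b in # 2 :* s :* # 0 :+ # 0 :* (# 2 :* s) :+ a :* (t :* # 0 :+ # 0 :* :- t) := # 0) refl b s t))
      (subst Positive (quad-cong refl (sym (ℤP.+-inverseʳ t)) refl refl) (Positive-rational {+ 2 ℤ.* s ℤ.+ + 2 ℤ.* s}
        (NonNeg-by (solve 1 (λ s → # 4 :* (s :- # 1) :+ # 3 := # 2 :* s :+ # 2 :* s :- # 1) refl s) (NonNeg-+ (NonNeg-* (NonNeg-ℕ 4) s>0) (NonNeg-ℕ 3)))))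
      (Positive-rational {k} k>0)

    positive-r : ∀ s t k → + 4 ℤ.* (s ℤ.* s) ℤ.- Z.r ℤ.* (t ℤ.* t) ≡ + 2 ℤ.* k →
      NonNeg (s ℤ.- + 1) → NonNeg (k ℤ.- + 1) → Positive (quad (+ 2 ℤ.* s) (+ 0) (+ 0) t)
    positive-r s t k norm s>0 k>0 = Positive-root {y = quad (+ 2 ℤ.* s) (+ 0) (+ 0) (ℤ.- t)} (rational k)
      (quad-cong
        (trans (solve 3 (λ b s t → let open F b in # 2 :* s :* (# 2 :* s) :+ p :* (# 0 :* # 0) :+ q :* (# 0 :* # 0) :+ r :* (t :* :- t)
          := # 4 :* (s :* s) :- r :* (t :* t)) refl b s t) norm)
        (solve 3 (λ b s t → let open F b in # 2 :* s :* # 0 :+ # 0 :* (# 2 :* s) :+ c :* (# 0 :* :- t :+ t :* # 0) := # 0) refl b s t)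
        (solve 3 (λ b s t → let open F b in # 2 :* s :* # 0 :+ # 0 :* (# 2 :* s) :+ b :* (# 0 :* :- t :+ t :* # 0) := # 0) refl b s t)
        (solve 3 (λ b s t → let open F b in # 2 :* s :* :- t :+ t :* (# 2 :* s) :+ a :* (# 0 :* # 0 :+ # 0 :* # 0) := # 0) refl b s t))
      (subst Positive (quad-cong refl refl refl (sym (ℤP.+-inverseʳ t))) (Positive-rational {+ 2 ℤ.* s ℤ.+ + 2 ℤ.* s}
        (NonNeg-by (solve 1 (λ s → # 4 :* (s :- # 1) :+ # 3 := # 2 :* s :+ # 2 :* s :- # 1) refl s) (NonNeg-+ (NonNeg-* (NonNeg-ℕ 4) s>0) (NonNeg-ℕ 3)))))
      (Positive-rational {k} k>0)

    m>0 : NonNeg (Z.m ℤ.- + 1)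
    m>0 = NonNeg-by (solve 1 (λ b → # 1 :* (b :- # 13) :+ # 11 := F.m b :- # 1) refl b) (linear 1 11)

    b+1>0 : NonNeg (b ℤ.+ + 1 ℤ.- + 1)
    b+1>0 = NonNeg-by (solve 1 (λ b → # 1 :* (b :- # 13) :+ # 13 := b :+ # 1 :- # 1) refl b) (linear 1 13)

    c>0 : NonNeg (Z.c ℤ.- + 1)
    c>0 = NonNeg-by (solve 1 (λ b → # 1 :* (b :- # 13) :+ # 14 := F.c b :- # 1) refl b) (linear 1 14)

    4b>0 : NonNeg (+ 4 ℤ.* b ℤ.- + 1)
    4b>0 = NonNeg-by (solve 1 (λ b → # 4 :* (b :- # 13) :+ # 51 := # 4 :* b :- # 1) refl b) (linear 4 51)

    4c>0 : NonNeg (+ 4 ℤ.* Z.c ℤ.- + 1)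
    4c>0 = NonNeg-by (solve 1 (λ b → # 4 :* (b :- # 13) :+ # 59 := # 4 :* F.c b :- # 1) refl b) (linear 4 59)

  Positive-ε-p : Positive Z.ε-p
  Positive-ε-p = positive-p Z.m (+ 2) (+ 2) (solve 1 (λ b → let open F b in # 4 :* (m :* m) :- p :* (# 2 :* # 2) := # 2 :* # 2) refl b) m>0 (NonNeg-ℕ 1)

  Positive-ε-p⁻¹ : Positive Z.ε-p⁻¹
  Positive-ε-p⁻¹ = positive-p Z.m -[1+ 1 ] (+ 2) (solve 1 (λ b → let open F b in # 4 :* (m :* m) :- p :* (con -[1+ 1 ] :* con -[1+ 1 ]) := # 2 :* # 2) refl b) m>0 (NonNeg-ℕ 1)

  Positive-ε-r : Positive Z.ε-r
  Positive-ε-r = positive-r (b ℤ.+ + 1) (+ 2) (+ 2) (solve 1 (λ b → let open F b in # 4 :* ((b :+ # 1) :* (b :+ # 1)) :- r :* (# 2 :* # 2) := # 2 :* # 2) refl b) b+1>0 (NonNeg-ℕ 1)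

  Positive-ε-r⁻¹ : Positive Z.ε-r⁻¹
  Positive-ε-r⁻¹ = positive-r (b ℤ.+ + 1) -[1+ 1 ] (+ 2) (solve 1 (λ b → let open F b in # 4 :* ((b :+ # 1) :* (b :+ # 1)) :- r :* (con -[1+ 1 ] :* con -[1+ 1 ]) := # 2 :* # 2) refl b) b+1>0 (NonNeg-ℕ 1)

  private
    ε-q·ε-q⁻¹ : let open Z in twiceProduct ε-q ε-q⁻¹ ≡ + 2 ⊡ rational (+ 2)
    ε-q·ε-q⁻¹ = solve₄ 1 (λ b → let open F b in twiceProduct ε-q ε-q⁻¹ ≐ quad (# 4) (# 0) (# 0) (# 0)) refl b

    ε-q⁻¹·ε-q : let open Z in twiceProduct ε-q⁻¹ ε-q ≡ + 2 ⊡ rational (+ 2)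
    ε-q⁻¹·ε-q = solve₄ 1 (λ b → let open F b in twiceProduct ε-q⁻¹ ε-q ≐ quad (# 4) (# 0) (# 0) (# 0)) refl b

    2b>0 : NonNeg (b ℤ.+ b ℤ.- + 1)
    2b>0 = NonNeg-by (solve 1 (λ b → # 2 :* (b :- # 13) :+ # 25 := b :+ b :- # 1) refl b) (linear 2 25)

  Positive-ε-q : Positive Z.ε-q
  Positive-ε-q = Positive-root {y = Z.ε-q⁻¹} (rational (+ 2)) ε-q·ε-q⁻¹ (Positive-rational {b ℤ.+ b} 2b>0) (Positive-rational {+ 2} (NonNeg-ℕ 1))

  Positive-ε-q⁻¹ : Positive Z.ε-q⁻¹
  Positive-ε-q⁻¹ = Positive-root {y = Z.ε-q} (rational (+ 2)) ε-q⁻¹·ε-q (Positive-rational {b ℤ.+ b} 2b>0) (Positive-rational {+ 2} (NonNeg-ℕ 1))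

  private
    ε-p·ε-r : let open Z in twiceProduct ε-p ε-r ≡ + 2 ⊡ ε-pr
    ε-p·ε-r = solve₄ 1 (λ b → let open F b in twiceProduct ε-p ε-r ≐ # 2 ⊡ ε-pr) refl b

  Positive-ε-pr : Positive Z.ε-pr
  Positive-ε-pr = Positive-* ε-p·ε-r Positive-ε-p Positive-ε-r

  TP-ε-p : TP Z.ε-p
  TP-ε-p = Positive⇒TP λ where
    true true → Positive-ε-p
    true false → Positive-ε-p
    false true → Positive-ε-p⁻¹
    false false → Positive-ε-p⁻¹

  TP-ε-p⁻¹ : TP Z.ε-p⁻¹
  TP-ε-p⁻¹ = Positive⇒TP λ where
    true true → Positive-ε-p⁻¹
    true false → Positive-ε-p⁻¹
    false true → Positive-ε-p
    false false → Positive-ε-p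

  TP-ε-q : TP Z.ε-q
  TP-ε-q = Positive⇒TP λ where
    true true → Positive-ε-q
    true false → Positive-ε-q⁻¹
    false true → Positive-ε-q
    false false → Positive-ε-q⁻¹

  TP-ε-q⁻¹ : TP Z.ε-q⁻¹
  TP-ε-q⁻¹ = Positive⇒TP λ where
    true true → Positive-ε-q⁻¹
    true false → Positive-ε-q
    false true → Positive-ε-q⁻¹
    false false → Positive-ε-q

  TP-ε-r : TP Z.ε-r
  TP-ε-r = Positive⇒TP λ where
    true true → Positive-ε-r
    true false → Positive-ε-r⁻¹
    false true → Positive-ε-r⁻¹
    false false → Positive-ε-r

  TP-ε-r⁻¹ : TP Z.ε-r⁻¹
  TP-ε-r⁻¹ = Positive⇒TP λ where
    true true → Positive-ε-r⁻¹
    true false → Positive-ε-r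
    false true → Positive-ε-r
    false false → Positive-ε-r⁻¹

  TP-ε-pr : TP Z.ε-pr
  TP-ε-pr = TP-* ε-p·ε-r TP-ε-p TP-ε-r

  -- b - √p and c - √r
  private
    δ₁ δ₂ : ℤ⁴
    δ₁ = quad (+ 2 ℤ.* b) -[1+ 1 ] (+ 0) (+ 0)
    δ₂ = quad (+ 2 ℤ.* Z.c) (+ 0) (+ 0) -[1+ 1 ]

    δ₁⁺ : ∀ t → t ℤ.* t ≡ + 4 → Positive (quad (+ 2 ℤ.* b) t (+ 0) (+ 0))
    δ₁⁺ t t²≡4 = positive-p b t (+ 4 ℤ.* b) (trans (cong (λ u → + 4 ℤ.* (b ℤ.* b) ℤ.- Z.p ℤ.* u) t²≡4)
      (solve 1 (λ b → let open F b in # 4 :* (b :* b) :- p :* # 4 := # 2 :* (# 4 :* b)) refl b)) (b>0⇒ b 13≤b) 4b>0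

    δ₂⁺ : ∀ t → t ℤ.* t ≡ + 4 → Positive (quad (+ 2 ℤ.* Z.c) (+ 0) (+ 0) t)
    δ₂⁺ t t²≡4 = positive-r Z.c t (+ 4 ℤ.* Z.c) (trans (cong (λ u → + 4 ℤ.* (Z.c ℤ.* Z.c) ℤ.- Z.r ℤ.* u) t²≡4)
      (solve 1 (λ b → let open F b in # 4 :* (c :* c) :- r :* # 4 := # 2 :* (# 4 :* c)) refl b)) c>0 4c>0

    TP-δ₁ : TP δ₁
    TP-δ₁ = Positive⇒TP λ where
      true true → δ₁⁺ -[1+ 1 ] refl
      true false → δ₁⁺ -[1+ 1 ] refl
      false true → δ₁⁺ (+ 2) refl
      false false → δ₁⁺ (+ 2) refl

    TP-δ₂ : TP δ₂
    TP-δ₂ = Positive⇒TP λ where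
      true true → δ₂⁺ -[1+ 1 ] refl
      true false → δ₂⁺ (+ 2) refl
      false true → δ₂⁺ (+ 2) refl
      false false → δ₂⁺ -[1+ 1 ] refl

  trace>0 : ∀ {x} → TP x → NonNeg (c₀ x ℤ.- + 1)
  trace>0 {x@(quad x₀ x₁ x₂ x₃)} tx with + 1 ℤ.≤? x₀
  ... | yes 1≤x₀ = ≤⇒NonNeg 1≤x₀
  ... | no 1≰x₀ = ⊥-elim (¬NonNeg-1 (NonNeg-by (solve 1 (λ x → # 4 :* x :- # 1 :+ # 4 :* (# 0 :- x) := con -[1+ 0 ]) refl x₀)
        (NonNeg-+ (Positive-rational⁻¹ {+ 4 ℤ.* x₀} (subst Positive sum
          (Positive-⊞ (Positive-⊞ (TP⇒Positive tx true true) (TP⇒Positive tx true false)) (Positive-⊞ (TP⇒Positive tx false true) (TP⇒Positive tx false false)))))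
          (NonNeg-* (NonNeg-ℕ 4) (≤⇒NonNeg (ℤP.i<j⇒i≤pred[j] (ℤP.≰⇒> 1≰x₀)))))))
    where
    sum : let open Z in (x ⊞ flip true false x) ⊞ (flip false true x ⊞ flip false false x) ≡ rational (+ 4 ℤ.* x₀)
    sum = quad-cong
      (solve 1 (λ x → (x :+ x) :+ (x :+ x) := # 4 :* x) refl x₀)
      (solve 1 (λ x → (x :+ x) :+ (:- x :+ :- x) := # 0) refl x₁)
      (solve 1 (λ x → (x :+ :- x) :+ (x :+ :- x) := # 0) refl x₂)
      (solve 1 (λ x → (x :+ :- x) :+ (:- x :+ x) := # 0) refl x₃)

  -- Up to a positive factor, f + g is the trace of (b - √p)(c - √r)α.
  height>0 : ∀ v → TP (Z.coords v) → NonNeg (c₀ v ℤ.+ c₁ v ℤ.- + 1)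
  height>0 v@(quad f g X Y) tv with + 1 ℤ.≤? f ℤ.+ g
  ... | yes 1≤h = ≤⇒NonNeg 1≤h
  ... | no 1≰h = ⊥-elim (¬NonNeg-1 (NonNeg-by
        (solve 3 (λ b f g → let open F b in # 8 :* (b :* c) :* (f :+ g) :- # 1 :+ # 8 :* (b :* c) :* (# 0 :- (f :+ g)) := con -[1+ 0 ]) refl b f g)
        (NonNeg-+ (NonNeg-by (cong (ℤ._- + 1) (solve 5 (λ b f g X Y → let open F b in
              c₀ (twiceProduct (twiceProduct (quad (# 2 :* b) (con -[1+ 1 ]) (# 0) (# 0)) (quad (# 2 :* c) (# 0) (# 0) (con -[1+ 1 ]))) (coords (quad f g X Y)))
              := # 8 :* (b :* c) :* (f :+ g)) refl b f g X Y)) (trace>0 (TP-twiceProduct (TP-twiceProduct TP-δ₁ TP-δ₂) tv)))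
          (NonNeg-* (NonNeg-* (NonNeg-ℕ 8) (NonNeg-* b≥0 c≥0)) (≤⇒NonNeg (ℤP.i<j⇒i≤pred[j] (ℤP.≰⇒> 1≰h)))))))
    where
    b≥0 : NonNeg b
    b≥0 = NonNeg-by (solve 1 (λ b → # 1 :* (b :- # 13) :+ # 13 := b) refl b) (linear 1 13)
    c≥0 : NonNeg Z.c
    c≥0 = NonNeg-by (solve 1 (λ b → # 1 :* (b :- # 13) :+ # 15 := F.c b) refl b) (linear 1 15)

  private
    η -ξ ξ+η : ℤ⁴
    η = quad b (+ 1) (+ 1) (+ 1)
    -ξ = quad (+ 2) -[1+ 0 ] (+ 0) (+ 1)
    ξ+η = quad Z.a (+ 2) (+ 1) (+ 0)

    Positive-η : Positive η
    Positive-η = subst Positive (quad-cong (solve 1 (λ b → b :+ # 0 :+ (# 0 :+ # 0) := b) refl b) refl refl refl)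
      (Positive-⊞ (Positive-⊞ (Positive-rational {b} (b>0⇒ b 13≤b)) Positive-√p) (Positive-⊞ Positive-√q Positive-√r))

    Positive-ξ+η : Positive ξ+η
    Positive-ξ+η = subst Positive (quad-cong (solve 1 (λ b → F.a b :+ # 0 :+ (# 0 :+ # 0) := F.a b) refl b) refl refl refl)
      (Positive-⊞ (Positive-⊞ (Positive-rational {Z.a} (a>0⇒ b 13≤b)) Positive-√p) (Positive-⊞ Positive-√p Positive-√q))

    -- (√r - √p)/2
    Positive-√r-√p : Positive (quad (+ 0) -[1+ 0 ] (+ 0) (+ 1))
    Positive-√r-√p = Positive-root {y = quad (+ 0) (+ 1) (+ 0) (+ 1)} (rational (+ 2 ℤ.* b))
      (solve₄ 1 (λ b → let open F b in twiceProduct (quad (# 0) (con -[1+ 0 ]) (# 0) (# 1)) (quad (# 0) (# 1) (# 0) (# 1)) ≐ quad (# 2 :* (# 2 :* b)) (# 0) (# 0) (# 0)) refl b)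
      (Positive-⊞ Positive-√r Positive-√r)
      (Positive-rational {+ 2 ℤ.* b} (NonNeg-by (solve 1 (λ b → # 2 :* (b :- # 13) :+ # 25 := # 2 :* b :- # 1) refl b) (linear 2 25)))

    Positive--ξ : Positive -ξ
    Positive--ξ = Positive-⊞ (Positive-rational {+ 2} (NonNeg-ℕ 1)) Positive-√r-√p

    -- Each coefficient may vanish, but f + g ≥ 1 leaves a positive one with which the sum can
    -- start.
    combination : ∀ f g {x y} → NonNeg f → NonNeg g → NonNeg (f ℤ.+ g ℤ.- + 1) → Positive x → Positive y → let open Z in Positive (f ⊡ x ⊞ g ⊡ y)
    combination (+ suc n) g {x} {y} _ g≥0 _ px py = Positive-⊞-⊡ g g≥0 (Positive-⊡ (+ suc n) (NonNeg-ℕ n) px) py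
    combination (+ zero) g {x} {quad y₀ y₁ y₂ y₃} _ g≥0 h px py = subst Positive (quad-cong (z (c₀ x) y₀) (z (c₁ x) y₁) (z (c₂ x) y₂) (z (c₃ x) y₃))
      (Positive-⊡ g (NonNeg-by (solve 1 (λ g → # 0 :+ g :- # 1 := g :- # 1) refl g) h) py)
      where
      z : ∀ x y → g ℤ.* y ≡ + 0 ℤ.* x ℤ.+ g ℤ.* y
      z x y = solve 3 (λ g x y → g :* y := # 0 :* x :+ g :* y) refl g x y

  -- In the standard embedding the cone is bounded by 1/ε_q , 1 , -ξ , η and ξ + η.
  halfRegion⇒Positive : ∀ v → let open Quad v renaming (c₀ to f; c₁ to g; c₂ to X; c₃ to Y) in
    NonNeg f → NonNeg g → NonNeg (f ℤ.+ g ℤ.- + 1) →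
    NonNeg (f ℤ.+ b ℤ.* g ℤ.+ Y) → NonNeg (f ℤ.+ Z.m ℤ.* g ℤ.+ (Y ℤ.- X)) → Positive (Z.coords v)
  -- The plane X + g = 0 cuts the cone into two parts. On either side v is a combination, with
  -- nonnegative coefficients, of four of the five generators.
  halfRegion⇒Positive (quad f g X Y) f≥0 g≥0 h≥1 a⁻ b⁻ with + 0 ℤ.≤? X ℤ.+ g
  ... | yes B≥0 = subst Positive (quad-cong e₀ e₁ e₂ e₃)
        (Positive-⊞-⊡ (f ℤ.+ Z.m ℤ.* g ℤ.+ (Y ℤ.- X)) b⁻ (Positive-⊞-⊡ (X ℤ.+ g) B≥0 (combination f g f≥0 g≥0 h≥1 Positive-ε-q⁻¹ (Positive-rational {+ 2} (NonNeg-ℕ 1))) Positive-ξ+η) Positive-η)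
    where
    v′ : ∀ {n} (b f g X Y : Polynomial n) → Quad (Polynomial n)
    v′ b f g X Y = let open F b in
      (f ⊡ ε-q⁻¹ ⊞ g ⊡ quad (# 2) (# 0) (# 0) (# 0) ⊞ (X :+ g) ⊡ quad a (# 2) (# 1) (# 0))
        ⊞ (f :+ m :* g :+ (Y :- X)) ⊡ quad b (# 1) (# 1) (# 1)
    e₀ = solve 5 (λ b f g X Y → c₀ (v′ b f g X Y) := c₀ (F.coords b (quad f g X Y))) refl b f g X Y
    e₁ = solve 5 (λ b f g X Y → c₁ (v′ b f g X Y) := c₁ (F.coords b (quad f g X Y))) refl b f g X Y
    e₂ = solve 5 (λ b f g X Y → c₂ (v′ b f g X Y) := c₂ (F.coords b (quad f g X Y))) refl b f g X Y
    e₃ = solve 5 (λ b f g X Y → c₃ (v′ b f g X Y) := c₃ (F.coords b (quad f g X Y))) refl b f g X Y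
  ... | no B≱0 = subst Positive (quad-cong e₀ e₁ e₂ e₃)
        (Positive-⊞-⊡ (f ℤ.+ b ℤ.* g ℤ.+ Y) a⁻ (Positive-⊞-⊡ (ℤ.- (X ℤ.+ g)) -B≥0 (combination f g f≥0 g≥0 h≥1 Positive-ε-q⁻¹ (Positive-rational {+ 2} (NonNeg-ℕ 1))) Positive--ξ) Positive-η)
    where
    -B≥0 : NonNeg (ℤ.- (X ℤ.+ g))
    -B≥0 = NonNeg-by (solve 1 (λ x → :- x :- # 1 :+ # 1 := :- x) refl (X ℤ.+ g)) (NonNeg-+ (¬NonNeg⇒ B≱0) (NonNeg-ℕ 1))
    v′ : ∀ {n} (b f g X Y : Polynomial n) → Quad (Polynomial n)
    v′ b f g X Y = let open F b in
      (f ⊡ ε-q⁻¹ ⊞ g ⊡ quad (# 2) (# 0) (# 0) (# 0) ⊞ (:- (X :+ g)) ⊡ quad (# 2) (con -[1+ 0 ]) (# 0) (# 1))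
        ⊞ (f :+ b :* g :+ Y) ⊡ quad b (# 1) (# 1) (# 1)
    e₀ = solve 5 (λ b f g X Y → c₀ (v′ b f g X Y) := c₀ (F.coords b (quad f g X Y))) refl b f g X Y
    e₁ = solve 5 (λ b f g X Y → c₁ (v′ b f g X Y) := c₁ (F.coords b (quad f g X Y))) refl b f g X Y
    e₂ = solve 5 (λ b f g X Y → c₂ (v′ b f g X Y) := c₂ (F.coords b (quad f g X Y))) refl b f g X Y
    e₃ = solve 5 (λ b f g X Y → c₃ (v′ b f g X Y) := c₃ (F.coords b (quad f g X Y))) refl b f g X Y

  -- In each of the other three embeddings, the conjugate of `coords v` times a positive unit is
  -- `coords` of `S v`, `W v` or `S (W v)`. These points satisfy the hypotheses of
  -- `halfRegion⇒Positive` because the symmetries permute the faces.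
  Region⇒TP : ∀ v → Region b v → TP (Z.coords v)
  Region⇒TP v@(quad f g X Y) (region f≥0 g≥0 h≥1 a⁺ a⁻ b⁺ b⁻ c⁺ c⁻ d⁺ d⁻) = Positive⇒TP λ where
      true true → halfRegion⇒Positive v f≥0 g≥0 h≥1 a⁻ b⁻
      true false → Positive-cancelˡ (ε-r·conj v) Positive-ε-r (halfRegion⇒Positive (Z.S (Z.W v)) g≥0 f≥0 h≥1′
        (NonNeg-by (solve 5 (λ b f g X Y → g :+ b :* f :- (Y :- b :* X) := g :+ b :* f :+ :- (Y :+ :- (b :* X))) refl b f g X Y) c⁺)
        (NonNeg-by (solve 5 (λ b f g X Y → let open F b in g :+ m :* f :- (Y :- m :* X) := g :+ m :* f :+ (:- (Y :+ :- (b :* X)) :- :- (:- X))) refl b f g X Y) d⁺))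
      false true → Positive-cancelˡ (ε-pr·conj v) Positive-ε-pr (halfRegion⇒Positive (Z.S v) f≥0 g≥0 h≥1 a⁺
        (NonNeg-by (solve 5 (λ b f g X Y → let open F b in f :+ m :* g :- (Y :- X) := f :+ m :* g :+ (:- Y :- :- X)) refl b f g X Y) b⁺))
      false false → Positive-cancelˡ (ε-p·conj v) Positive-ε-p (halfRegion⇒Positive (Z.W v) g≥0 f≥0 h≥1′ c⁻
        (NonNeg-by (solve 5 (λ b f g X Y → let open F b in g :+ m :* f :+ (Y :- m :* X) := g :+ m :* f :+ (Y :+ :- (b :* X) :- :- X)) refl b f g X Y) d⁻))
    where
    h≥1′ : NonNeg (g ℤ.+ f ℤ.- + 1)
    h≥1′ = NonNeg-by (cong (ℤ._- + 1) (ℤP.+-comm f g)) h≥1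

-- Unit actions and minimal height.

height : ℤ⁴ → ℤ
height v = c₀ v ℤ.+ c₁ v

NonNeg-cancelˡ : ∀ k x → NonNeg (k ℤ.- + 1) → NonNeg (k ℤ.* x) → NonNeg x
NonNeg-cancelˡ k x k>0 kx≥0 = ℤP.*-cancelˡ-≤-pos (+ 0) x k {{ℤ.positive (Pos⇒< k k>0)}} (subst (ℤ._≤ k ℤ.* x) (sym (ℤP.*-zeroʳ k)) kx≥0)

module Symmetries (b : ℤ) (13≤b : NonNeg (b ℤ.- + 13)) (order : LatticeOrder b)
  (norm-* : NormForm-multiplicative b)
  (bound : ℤ)
  where
  open LatticeOrder order
  open LatticeOrderProperties b 13≤b order
  open TotallyPositiveRegion b 13≤b order
  open CoordinateIdentities b
  open SyntacticFormulas

  -- A lattice point contradicting the theorem.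
  record Bad (v : ℤ⁴) : Set where
    field
      totallyPositive : TP (Z.coords v)
      indecomposable : ∀ w w′ → TP (Z.coords w) → TP (Z.coords w′) → v ≡ w Z.⊞ w′ → ⊥
      large : ¬ (Z.normForm (Z.coords v) ℤ.≤ bound)
  open Bad public

  private
    normForm-cong : ∀ {x y} → Z.normA x ≡ Z.normA y → Z.normE x ℤ.* Z.normE x ≡ Z.normE y ℤ.* Z.normE y → Z.normForm x ≡ Z.normForm y
    normForm-cong A≡ E²≡ = cong₂ (λ A E² → A ℤ.* A ℤ.+ ℤ.- (+ 4 ℤ.* Z.q ℤ.* E²)) A≡ E²≡

  normForm-flip : ∀ e₁ e₂ x → Z.normForm (flip e₁ e₂ x) ≡ Z.normForm x
  normForm-flip true true x = refl
  normForm-flip true false x@(quad x₀ x₁ x₂ x₃) = normForm-cong {flip true false x} {x}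
    (solve 5 (λ b x₀ x₁ x₂ x₃ → let open F b; x = quad x₀ x₁ x₂ x₃ in normA (negate₂₃ x) := normA x) refl b x₀ x₁ x₂ x₃)
    (solve 5 (λ b x₀ x₁ x₂ x₃ → let open F b; x = quad x₀ x₁ x₂ x₃ in normE (negate₂₃ x) :* normE (negate₂₃ x) := normE x :* normE x) refl b x₀ x₁ x₂ x₃)
  normForm-flip false true x@(quad x₀ x₁ x₂ x₃) = normForm-cong {flip false true x} {x}
    (solve 5 (λ b x₀ x₁ x₂ x₃ → let open F b; x = quad x₀ x₁ x₂ x₃ in normA (negate₁₃ x) := normA x) refl b x₀ x₁ x₂ x₃)
    (solve 5 (λ b x₀ x₁ x₂ x₃ → let open F b; x = quad x₀ x₁ x₂ x₃ in normE (negate₁₃ x) :* normE (negate₁₃ x) := normE x :* normE x) refl b x₀ x₁ x₂ x₃)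
  normForm-flip false false x@(quad x₀ x₁ x₂ x₃) = normForm-cong {flip false false x} {x}
    (solve 5 (λ b x₀ x₁ x₂ x₃ → let open F b; x = quad x₀ x₁ x₂ x₃ in normA (negate₁₂ x) := normA x) refl b x₀ x₁ x₂ x₃)
    (solve 5 (λ b x₀ x₁ x₂ x₃ → let open F b; x = quad x₀ x₁ x₂ x₃ in normE (negate₁₂ x) :* normE (negate₁₂ x) := normE x :* normE x) refl b x₀ x₁ x₂ x₃)

  record UnitAction (T : ℤ⁴ → ℤ⁴) : Set where
    field
      unit : ℤ⁴
      e₁ e₂ : Bool
      TP-unit : TP unit
      norm-unit : Z.normForm unit ≡ + 16
      acts : ∀ v → Z.twiceProduct unit (flip e₁ e₂ (Z.coords v)) ≡ + 2 Z.⊡ Z.coords (T v)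

    TP-action : ∀ v → TP (Z.coords v) → TP (Z.coords (T v))
    TP-action v tv = TP-* {z = Z.coords (T v)} (acts v) TP-unit (TP-flip e₁ e₂ tv)

    norm-action : ∀ v → Z.normForm (Z.coords (T v)) ≡ Z.normForm (Z.coords v)
    norm-action v = ℤP.*-cancelˡ-≡ (+ 16) _ _ (trans (norm-* unit (flip e₁ e₂ (Z.coords v)) (Z.coords (T v)) (acts v))
      (cong₂ ℤ._*_ norm-unit (normForm-flip e₁ e₂ (Z.coords v))))

  -- A decomposition of T v is pulled back along T⁻¹, so it is the inverse whose additivity is
  -- required.
  Bad-action : ∀ {T T⁻¹} → UnitAction T → UnitAction T⁻¹ → (∀ v → T⁻¹ (T v) ≡ v) →
    (∀ v w → T⁻¹ (v Z.⊞ w) ≡ T⁻¹ v Z.⊞ T⁻¹ w) → ∀ v → Bad v → Bad (T v)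
  Bad-action {T} {T⁻¹} A A⁻¹ inverse additive v bad = record
    { totallyPositive = UnitAction.TP-action A v (totallyPositive bad)
    ; indecomposable = λ w w′ tw tw′ eq → indecomposable bad (T⁻¹ w) (T⁻¹ w′) (UnitAction.TP-action A⁻¹ w tw) (UnitAction.TP-action A⁻¹ w′ tw′)
        (trans (sym (inverse v)) (trans (cong T⁻¹ eq) (additive w w′)))
    ; large = λ small → large bad (subst (ℤ._≤ bound) (UnitAction.norm-action A v) small)
    }

  private
    unitAction : ∀ {T} u e₁ e₂ → TP u → Z.normForm u ≡ + 16 →
      (∀ v → Z.twiceProduct u (flip e₁ e₂ (Z.coords v)) ≡ + 2 Z.⊡ Z.coords (T v)) → UnitAction T
    unitAction u e₁ e₂ tu nu acts = record { unit = u ; e₁ = e₁ ; e₂ = e₂ ; TP-unit = tu ; norm-unit = nu ; acts = acts }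

    A-p : UnitAction Z.E-p
    A-p = unitAction Z.ε-p true true TP-ε-p (solve 1 (λ b → let open F b in normForm ε-p := # 16) refl b) ε-p·coords
    A-p⁻¹ : UnitAction Z.E-p⁻¹
    A-p⁻¹ = unitAction Z.ε-p⁻¹ true true TP-ε-p⁻¹ (solve 1 (λ b → let open F b in normForm ε-p⁻¹ := # 16) refl b) ε-p⁻¹·coords
    A-q : UnitAction Z.E-q
    A-q = unitAction Z.ε-q true true TP-ε-q (solve 1 (λ b → let open F b in normForm ε-q := # 16) refl b) ε-q·coords
    A-q⁻¹ : UnitAction Z.E-q⁻¹
    A-q⁻¹ = unitAction Z.ε-q⁻¹ true true TP-ε-q⁻¹ (solve 1 (λ b → let open F b in normForm ε-q⁻¹ := # 16) refl b) ε-q⁻¹·coords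
    A-r : UnitAction Z.E-r
    A-r = unitAction Z.ε-r true true TP-ε-r (solve 1 (λ b → let open F b in normForm ε-r := # 16) refl b) ε-r·coords
    A-r⁻¹ : UnitAction Z.E-r⁻¹
    A-r⁻¹ = unitAction Z.ε-r⁻¹ true true TP-ε-r⁻¹ (solve 1 (λ b → let open F b in normForm ε-r⁻¹ := # 16) refl b) ε-r⁻¹·coords
    A-S : UnitAction Z.S
    A-S = unitAction Z.ε-pr false true TP-ε-pr (solve 1 (λ b → let open F b in normForm ε-pr := # 16) refl b) ε-pr·conj
    A-W : UnitAction Z.W
    A-W = unitAction Z.ε-p false false TP-ε-p (solve 1 (λ b → let open F b in normForm ε-p := # 16) refl b) ε-p·conj

  Bad-E-p : ∀ v → Bad v → Bad (Z.E-p v)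
  Bad-E-p = Bad-action A-p A-p⁻¹ E-p⁻¹∘E-p E-p⁻¹-⊞

  Bad-E-q : ∀ v → Bad v → Bad (Z.E-q v)
  Bad-E-q = Bad-action A-q A-q⁻¹ E-q⁻¹∘E-q E-q⁻¹-⊞

  Bad-E-r : ∀ v → Bad v → Bad (Z.E-r v)
  Bad-E-r = Bad-action A-r A-r⁻¹ E-r⁻¹∘E-r E-r⁻¹-⊞

  Bad-S : ∀ v → Bad v → Bad (Z.S v)
  Bad-S = Bad-action A-S A-S S∘S S-⊞

  Bad-W : ∀ v → Bad v → Bad (Z.W v)
  Bad-W = Bad-action A-W A-W W∘W W-⊞

  -- Minimality is required among all bad points and not just within an orbit. It then passes to
  -- `S v` and `W v`, which have the same height, without any description of orbits.
  Minimal : ℤ⁴ → Set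
  Minimal v = ∀ w → Bad w → NonNeg (height w ℤ.- height v)

  Minimal-S : ∀ v → Minimal v → Minimal (Z.S v)
  Minimal-S v min w bad = min w bad

  Minimal-W : ∀ v → Minimal v → Minimal (Z.W v)
  Minimal-W v min w bad = NonNeg-by (cong (λ h → height w ℤ.- h) (ℤP.+-comm (c₀ v) (c₁ v))) (min w bad)

  private
    a>0 : NonNeg (Z.a ℤ.- + 1)
    a>0 = a>0⇒ b 13≤b

  -- Multiplication by ε_q changes the height by ag, so minimality confines v to a half-space. The
  -- lemmas that follow do the same for other units.
  minimal-q : ∀ v → Bad v → Minimal v → NonNeg (c₁ v)
  minimal-q v@(quad f g X Y) bad min = NonNeg-cancelˡ Z.a g a>0 (NonNeg-by
    (solve 5 (λ b f g X Y → let open F b in c₀ (E-q (quad f g X Y)) :+ c₁ (E-q (quad f g X Y)) :- (f :+ g) := a :* g) refl b f g X Y)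
    (min (Z.E-q v) (Bad-E-q v bad)))

  minimal-p : ∀ v → Bad v → Minimal v → NonNeg (c₀ v ℤ.+ c₁ v ℤ.+ c₂ v)
  minimal-p v@(quad f g X Y) bad min = NonNeg-cancelˡ Z.a (f ℤ.+ g ℤ.+ X) a>0 (NonNeg-by
    (solve 5 (λ b f g X Y → let open F b in c₀ (E-p (quad f g X Y)) :+ c₁ (E-p (quad f g X Y)) :- (f :+ g) := a :* (f :+ g :+ X)) refl b f g X Y)
    (min (Z.E-p v) (Bad-E-p v bad)))

  minimal-pq : ∀ v → Bad v → Minimal v → NonNeg (c₀ v ℤ.+ b ℤ.* c₁ v ℤ.+ c₃ v)
  minimal-pq v@(quad f g X Y) bad min = NonNeg-cancelˡ Z.a (f ℤ.+ b ℤ.* g ℤ.+ Y) a>0 (NonNeg-by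
    (solve 5 (λ b f g X Y → let open F b; w = E-p (E-q (quad f g X Y)) in c₀ w :+ c₁ w :- (f :+ g) := a :* (f :+ b :* g :+ Y)) refl b f g X Y)
    (min (Z.E-p (Z.E-q v)) (Bad-E-p (Z.E-q v) (Bad-E-q v bad))))

  -- Together with `minimal-q` and `minimal-rq` it makes the coordinates with respect to the second
  -- cone positive.
  minimal-r : ∀ v → Bad v → Minimal v → NonNeg (b ℤ.* (c₀ v ℤ.+ c₁ v) ℤ.+ + 2 ℤ.* c₃ v ℤ.- b ℤ.* c₂ v)
  minimal-r v@(quad f g X Y) bad min = NonNeg-by
    (solve 5 (λ b f g X Y → let open F b; w = E-r (quad f g X Y) in c₀ w :+ c₁ w :- (f :+ g) := b :* (f :+ g) :+ # 2 :* Y :- b :* X) refl b f g X Y)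
    (min (Z.E-r v) (Bad-E-r v bad))

  minimal-rq : ∀ v → Bad v → Minimal v → let open Quad v renaming (c₀ to f; c₁ to g; c₂ to X; c₃ to Y) in
    NonNeg (b ℤ.* f ℤ.+ b ℤ.* Y ℤ.+ (b ℤ.* b ℤ.- + 2) ℤ.* g ℤ.- + 2 ℤ.* X)
  minimal-rq v@(quad f g X Y) bad min = NonNeg-by
    (solve 5 (λ b f g X Y → let open F b; w = E-r (E-q (quad f g X Y)) in c₀ w :+ c₁ w :- (f :+ g)
      := b :* f :+ b :* Y :+ (b :* b :- # 2) :* g :- # 2 :* X) refl b f g X Y)
    (min (Z.E-r (Z.E-q v)) (Bad-E-r (Z.E-q v) (Bad-E-q v bad)))

-- Splitting off elements of height 1.

16*maxNorm : ℤ → ℤ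
16*maxNorm b = let open Formulas ℤ-operations b in + 16 ℤ.* ((r ℤ.- + 9) ℤ.* (r ℤ.- + 9))

module Decomposition (b : ℤ) (13≤b : NonNeg (b ℤ.- + 13)) (order : LatticeOrder b)
  (norm-* : NormForm-multiplicative b)
  where
  open LatticeOrder order
  open LatticeOrderProperties b 13≤b order
  open TotallyPositiveRegion b 13≤b order
  open CoordinateIdentities b
  open SyntacticFormulas
  open Symmetries b 13≤b order norm-* (16*maxNorm b) public

  infixl 6 _⊟_
  _⊟_ : ℤ⁴ → ℤ⁴ → ℤ⁴
  quad f g X Y ⊟ quad f′ g′ X′ Y′ = quad (f ℤ.- f′) (g ℤ.- g′) (X ℤ.- X′) (Y ℤ.- Y′)

  ⊟-⊞ : ∀ v w → v ≡ w Z.⊞ (v ⊟ w)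
  ⊟-⊞ (quad f g X Y) (quad f′ g′ X′ Y′) = quad-cong (e f f′) (e g g′) (e X X′) (e Y Y′)
    where
    e : ∀ x y → x ≡ y ℤ.+ (x ℤ.- y)
    e = solve 2 (λ x y → x := y :+ (x :- y)) refl

  decompose : ∀ {v} → Bad v → ∀ w → Region b w → Region b (v ⊟ w) → ⊥
  decompose {v} bad w rw rv = indecomposable bad w (v ⊟ w) (Region⇒TP w rw) (Region⇒TP (v ⊟ w) rv) (⊟-⊞ v w)

  -- For f = 0 and g = 1 the cone contains seven lattice points. In the (X, Y)-plane they are a
  -- hexagon with its centre: (0, 0), ±(0, 1), ±(1, m) and ±(1, b). Up to the sign change `S` they
  -- are covered here and in `hex₀′`.
  hex₀ : ∀ t → NonNeg (t ℤ.+ + 1) → NonNeg (+ 1 ℤ.- t) → Region b (quad (+ 0) (+ 1) (+ 0) t)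
  hex₀ t lo hi = region
    (NonNeg-ℕ 0)
    (NonNeg-ℕ 1)
    (NonNeg-by (solve 1 (λ b → # 0 := # 0 :+ # 1 :- # 1) refl b) (NonNeg-ℕ 0))
    (NonNeg-by (solve 2 (λ b t → (# 1 :- t) :+ (b :- # 13) :+ # 12 := # 0 :+ b :* # 1 :- t) refl b t) (NonNeg-+ (NonNeg-+ hi 13≤b) (NonNeg-ℕ 12)))
    (NonNeg-by (solve 2 (λ b t → (t :+ # 1) :+ (b :- # 13) :+ # 12 := # 0 :+ b :* # 1 :+ t) refl b t) (NonNeg-+ (NonNeg-+ lo 13≤b) (NonNeg-ℕ 12)))
    (NonNeg-by (solve 2 (λ b t → (# 1 :- t) :+ (b :- # 13) :+ # 11 := # 0 :+ F.m b :* # 1 :- (t :- # 0)) refl b t) (NonNeg-+ (NonNeg-+ hi 13≤b) (NonNeg-ℕ 11)))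
    (NonNeg-by (solve 2 (λ b t → (t :+ # 1) :+ (b :- # 13) :+ # 11 := # 0 :+ F.m b :* # 1 :+ (t :- # 0)) refl b t) (NonNeg-+ (NonNeg-+ lo 13≤b) (NonNeg-ℕ 11)))
    (NonNeg-by (solve 2 (λ b t → (# 1 :- t) := # 1 :+ b :* # 0 :- (t :- b :* # 0)) refl b t) hi)
    (NonNeg-by (solve 2 (λ b t → (t :+ # 1) := # 1 :+ b :* # 0 :+ (t :- b :* # 0)) refl b t) lo)
    (NonNeg-by (solve 2 (λ b t → (# 1 :- t) := # 1 :+ F.m b :* # 0 :- (t :- F.m b :* # 0)) refl b t) hi)
    (NonNeg-by (solve 2 (λ b t → (t :+ # 1) := # 1 :+ F.m b :* # 0 :+ (t :- F.m b :* # 0)) refl b t) lo)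

  hex₀′ : ∀ s → NonNeg s → NonNeg (+ 1 ℤ.- s) → Region b (quad (+ 0) (+ 1) (+ 1) (Z.m ℤ.+ s))
  hex₀′ s lo hi = region
    (NonNeg-ℕ 0)
    (NonNeg-ℕ 1)
    (NonNeg-by (solve 1 (λ b → # 0 := # 0 :+ # 1 :- # 1) refl b) (NonNeg-ℕ 0))
    (NonNeg-by (solve 2 (λ b s → (# 1 :- s) := # 0 :+ b :* # 1 :- (F.m b :+ s)) refl b s) hi)
    (NonNeg-by (solve 2 (λ b s → # 2 :* (b :- # 13) :+ s :+ # 25 := # 0 :+ b :* # 1 :+ (F.m b :+ s)) refl b s) (NonNeg-+ (NonNeg-+ (NonNeg-* (NonNeg-ℕ 2) 13≤b) lo) (NonNeg-ℕ 25)))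
    (NonNeg-by (solve 2 (λ b s → (# 1 :- s) := # 0 :+ F.m b :* # 1 :- (F.m b :+ s :- # 1)) refl b s) hi)
    (NonNeg-by (solve 2 (λ b s → # 2 :* (b :- # 13) :+ s :+ # 23 := # 0 :+ F.m b :* # 1 :+ (F.m b :+ s :- # 1)) refl b s) (NonNeg-+ (NonNeg-+ (NonNeg-* (NonNeg-ℕ 2) 13≤b) lo) (NonNeg-ℕ 23)))
    (NonNeg-by (solve 2 (λ b s → (# 1 :- s) :+ # 1 := # 1 :+ b :* # 0 :- (F.m b :+ s :- b :* # 1)) refl b s) (NonNeg-+ hi (NonNeg-ℕ 1)))
    (NonNeg-by (solve 2 (λ b s → s := # 1 :+ b :* # 0 :+ (F.m b :+ s :- b :* # 1)) refl b s) lo)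
    (NonNeg-by (solve 2 (λ b s → (# 1 :- s) := # 1 :+ F.m b :* # 0 :- (F.m b :+ s :- F.m b :* # 1)) refl b s) hi)
    (NonNeg-by (solve 2 (λ b s → s :+ # 1 := # 1 :+ F.m b :* # 0 :+ (F.m b :+ s :- F.m b :* # 1)) refl b s) (NonNeg-+ lo (NonNeg-ℕ 1)))

  -- The hexagon for f = 1 and g = 0 has the vertices ±(0, 1), ±(1, 0) and ±(1, 1); `hex₁⁺` and
  -- `hex₁⁻` treat those with X = 1 and X = -1.
  hex₁ : ∀ t → NonNeg (t ℤ.+ + 1) → NonNeg (+ 1 ℤ.- t) → Region b (quad (+ 1) (+ 0) (+ 0) t)
  hex₁ t lo hi = region
    (NonNeg-ℕ 1)
    (NonNeg-ℕ 0)
    (NonNeg-by (solve 1 (λ b → # 0 := # 1 :+ # 0 :- # 1) refl b) (NonNeg-ℕ 0))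
    (NonNeg-by (solve 2 (λ b t → (# 1 :- t) := # 1 :+ b :* # 0 :- t) refl b t) hi)
    (NonNeg-by (solve 2 (λ b t → (t :+ # 1) := # 1 :+ b :* # 0 :+ t) refl b t) lo)
    (NonNeg-by (solve 2 (λ b t → (# 1 :- t) := # 1 :+ F.m b :* # 0 :- (t :- # 0)) refl b t) hi)
    (NonNeg-by (solve 2 (λ b t → (t :+ # 1) := # 1 :+ F.m b :* # 0 :+ (t :- # 0)) refl b t) lo)
    (NonNeg-by (solve 2 (λ b t → (# 1 :- t) :+ (b :- # 13) :+ # 12 := # 0 :+ b :* # 1 :- (t :- b :* # 0)) refl b t) (NonNeg-+ (NonNeg-+ hi 13≤b) (NonNeg-ℕ 12)))
    (NonNeg-by (solve 2 (λ b t → (t :+ # 1) :+ (b :- # 13) :+ # 12 := # 0 :+ b :* # 1 :+ (t :- b :* # 0)) refl b t) (NonNeg-+ (NonNeg-+ lo 13≤b) (NonNeg-ℕ 12)))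
    (NonNeg-by (solve 2 (λ b t → (# 1 :- t) :+ (b :- # 13) :+ # 11 := # 0 :+ F.m b :* # 1 :- (t :- F.m b :* # 0)) refl b t) (NonNeg-+ (NonNeg-+ hi 13≤b) (NonNeg-ℕ 11)))
    (NonNeg-by (solve 2 (λ b t → (t :+ # 1) :+ (b :- # 13) :+ # 11 := # 0 :+ F.m b :* # 1 :+ (t :- F.m b :* # 0)) refl b t) (NonNeg-+ (NonNeg-+ lo 13≤b) (NonNeg-ℕ 11)))

  hex₁⁺ : ∀ s → NonNeg s → NonNeg (+ 1 ℤ.- s) → Region b (quad (+ 1) (+ 0) (+ 1) s)
  hex₁⁺ s lo hi = region
    (NonNeg-ℕ 1)
    (NonNeg-ℕ 0)
    (NonNeg-by (solve 1 (λ b → # 0 := # 1 :+ # 0 :- # 1) refl b) (NonNeg-ℕ 0))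
    (NonNeg-by (solve 2 (λ b s → (# 1 :- s) := # 1 :+ b :* # 0 :- s) refl b s) hi)
    (NonNeg-by (solve 2 (λ b s → s :+ # 1 := # 1 :+ b :* # 0 :+ s) refl b s) (NonNeg-+ lo (NonNeg-ℕ 1)))
    (NonNeg-by (solve 2 (λ b s → (# 1 :- s) :+ # 1 := # 1 :+ F.m b :* # 0 :- (s :- # 1)) refl b s) (NonNeg-+ hi (NonNeg-ℕ 1)))
    (NonNeg-by (solve 2 (λ b s → s := # 1 :+ F.m b :* # 0 :+ (s :- # 1)) refl b s) lo)
    (NonNeg-by (solve 2 (λ b s → (# 1 :- s) :+ # 2 :* (b :- # 13) :+ # 25 := # 0 :+ b :* # 1 :- (s :- b :* # 1)) refl b s) (NonNeg-+ (NonNeg-+ hi (NonNeg-* (NonNeg-ℕ 2) 13≤b)) (NonNeg-ℕ 25)))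
    (NonNeg-by (solve 2 (λ b s → s := # 0 :+ b :* # 1 :+ (s :- b :* # 1)) refl b s) lo)
    (NonNeg-by (solve 2 (λ b s → (# 1 :- s) :+ # 2 :* (b :- # 13) :+ # 23 := # 0 :+ F.m b :* # 1 :- (s :- F.m b :* # 1)) refl b s) (NonNeg-+ (NonNeg-+ hi (NonNeg-* (NonNeg-ℕ 2) 13≤b)) (NonNeg-ℕ 23)))
    (NonNeg-by (solve 2 (λ b s → s := # 0 :+ F.m b :* # 1 :+ (s :- F.m b :* # 1)) refl b s) lo)

  hex₁⁻ : ∀ t → NonNeg (t ℤ.+ + 1) → NonNeg (ℤ.- t) → Region b (quad (+ 1) (+ 0) -[1+ 0 ] t)
  hex₁⁻ t lo hi = region
    (NonNeg-ℕ 1)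
    (NonNeg-ℕ 0)
    (NonNeg-by (solve 1 (λ b → # 0 := # 1 :+ # 0 :- # 1) refl b) (NonNeg-ℕ 0))
    (NonNeg-by (solve 2 (λ b t → (:- t) :+ # 1 := # 1 :+ b :* # 0 :- t) refl b t) (NonNeg-+ hi (NonNeg-ℕ 1)))
    (NonNeg-by (solve 2 (λ b t → (t :+ # 1) := # 1 :+ b :* # 0 :+ t) refl b t) lo)
    (NonNeg-by (solve 2 (λ b t → (:- t) := # 1 :+ F.m b :* # 0 :- (t :- con -[1+ 0 ])) refl b t) hi)
    (NonNeg-by (solve 2 (λ b t → (t :+ # 1) :+ # 1 := # 1 :+ F.m b :* # 0 :+ (t :- con -[1+ 0 ])) refl b t) (NonNeg-+ lo (NonNeg-ℕ 1)))
    (NonNeg-by (solve 2 (λ b t → (:- t) := # 0 :+ b :* # 1 :- (t :- b :* con -[1+ 0 ])) refl b t) hi)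
    (NonNeg-by (solve 2 (λ b t → (t :+ # 1) :+ # 2 :* (b :- # 13) :+ # 25 := # 0 :+ b :* # 1 :+ (t :- b :* con -[1+ 0 ])) refl b t) (NonNeg-+ (NonNeg-+ lo (NonNeg-* (NonNeg-ℕ 2) 13≤b)) (NonNeg-ℕ 25)))
    (NonNeg-by (solve 2 (λ b t → (:- t) := # 0 :+ F.m b :* # 1 :- (t :- F.m b :* con -[1+ 0 ])) refl b t) hi)
    (NonNeg-by (solve 2 (λ b t → (t :+ # 1) :+ # 2 :* (b :- # 13) :+ # 23 := # 0 :+ F.m b :* # 1 :+ (t :- F.m b :* con -[1+ 0 ])) refl b t) (NonNeg-+ (NonNeg-+ lo (NonNeg-* (NonNeg-ℕ 2) 13≤b)) (NonNeg-ℕ 23)))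

  -- Deep in the cone one of the four outer lattice points of height 1 with g = 1 can be split off.
  module _ {f g X Y : ℤ} (bad : Bad (quad f g X Y)) (R : Region b (quad f g X Y)) (g≥2 : NonNeg (g ℤ.- + 2)) (f≤g : NonNeg (g ℤ.- f))
    (X≥0 : NonNeg X) (X≤h : NonNeg (f ℤ.+ g ℤ.- X)) (X≡0⇒Y≥0 : X ≡ + 0 → NonNeg Y)
    where
    open Region R hiding (m)
    private
      v = quad f g X Y

      b≥0 : NonNeg b
      b≥0 = NonNeg-by (solve 1 (λ b → (b :- # 13) :+ # 13 := b) refl b) (NonNeg-+ 13≤b (NonNeg-ℕ 13))

      a≥0 : NonNeg (b ℤ.- + 2)
      a≥0 = NonNeg-by (solve 1 (λ b → (b :- # 13) :+ # 11 := b :- # 2) refl b) (NonNeg-+ 13≤b (NonNeg-ℕ 11))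

      m≥0 : NonNeg (b ℤ.- + 1)
      m≥0 = NonNeg-by (solve 1 (λ b → (b :- # 13) :+ # 12 := b :- # 1) refl b) (NonNeg-+ 13≤b (NonNeg-ℕ 12))

      2b-1≥0 : NonNeg (+ 2 ℤ.* b ℤ.- + 1)
      2b-1≥0 = NonNeg-by (solve 1 (λ b → # 2 :* (b :- # 13) :+ # 25 := # 2 :* b :- # 1) refl b) (NonNeg-+ (NonNeg-* (NonNeg-ℕ 2) 13≤b) (NonNeg-ℕ 25))

      2m≥0 : NonNeg (+ 2 ℤ.* b ℤ.- + 2)
      2m≥0 = NonNeg-by (solve 1 (λ b → # 2 :* (b :- # 13) :+ # 24 := # 2 :* b :- # 2) refl b) (NonNeg-+ (NonNeg-* (NonNeg-ℕ 2) 13≤b) (NonNeg-ℕ 24))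

      b+1≥0 : NonNeg (b ℤ.+ + 1)
      b+1≥0 = NonNeg-by (solve 1 (λ b → (b :- # 13) :+ # 14 := b :+ # 1) refl b) (NonNeg-+ 13≤b (NonNeg-ℕ 14))

      b-4≥0 : NonNeg (b ℤ.- + 4)
      b-4≥0 = NonNeg-by (solve 1 (λ b → (b :- # 13) :+ # 9 := b :- # 4) refl b) (NonNeg-+ 13≤b (NonNeg-ℕ 9))

      b-3≥0 : NonNeg (b ℤ.- + 3)
      b-3≥0 = NonNeg-by (solve 1 (λ b → (b :- # 13) :+ # 10 := b :- # 3) refl b) (NonNeg-+ 13≤b (NonNeg-ℕ 10))

      g≥1 : NonNeg (g ℤ.- + 1)
      g≥1 = NonNeg-by (solve 1 (λ g → (g :- # 2) :+ # 1 := g :- # 1) refl g) (NonNeg-+ g≥2 (NonNeg-ℕ 1))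

      -- Near the faces a⁺ and b⁺ the points (0, 1, 1, b) and (0, 1, 1, m) are removed, since both
      -- forms take only the values 0 and 1 on them. The parameters provide the values 2b, 2b - 2, 1
      -- and 2 that a⁻, b⁻, c⁺ and d⁻ take at the first point, the last of them only for X ≤ f.
      module Top (α⁻ : NonNeg (f ℤ.+ b ℤ.* g ℤ.+ Y ℤ.- + 2 ℤ.* b)) (β⁻ : NonNeg (f ℤ.+ Z.m ℤ.* g ℤ.+ (Y ℤ.- X) ℤ.- + 2 ℤ.* b ℤ.+ + 2)) (γ⁺ : NonNeg (g ℤ.+ b ℤ.* f ℤ.- (Y ℤ.- b ℤ.* X) ℤ.- + 1)) (δ⁻ : NonNeg (f ℤ.- X) → NonNeg (g ℤ.+ Z.m ℤ.* f ℤ.+ (Y ℤ.- Z.m ℤ.* X) ℤ.- + 2)) where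
        split⁺ : NonNeg (g ℤ.+ b ℤ.* f ℤ.+ (Y ℤ.- b ℤ.* X) ℤ.- + 1) → ⊥
        split⁺ γ⁻ = decompose bad (quad (+ 0) (+ 1) (+ 1) (Z.m ℤ.+ + 1)) (hex₀′ (+ 1) (NonNeg-ℕ 1) (NonNeg-ℕ 0)) rest
          where
          δ : NonNeg (g ℤ.+ Z.m ℤ.* f ℤ.+ (Y ℤ.- Z.m ℤ.* X) ℤ.- + 2)
          δ with + 0 ℤ.≤? f ℤ.- X
          ... | yes X≤f = δ⁻ X≤f
          -- The forms satisfy d⁻ = c⁻ + (X - f), so here the slack in c⁻ carries over to d⁻.
          ... | no X≰f = let f<X = ¬NonNeg⇒ X≰f in
              NonNeg-by (solve 5 (λ b f g X Y → (g :+ b :* f :+ (Y :- b :* X) :- # 1) :+ (:- (f :- X) :- # 1) := g :+ F.m b :* f :+ (Y :- F.m b :* X) :- # 2) refl b f g X Y) (NonNeg-+ γ⁻ f<X)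
          rest : Region b (v ⊟ quad (+ 0) (+ 1) (+ 1) (Z.m ℤ.+ + 1))
          rest = region
            (NonNeg-by (solve 1 (λ f → f := f :- # 0) refl f) f≥0)
            g≥1
            (NonNeg-by (solve 2 (λ f g → f :+ (g :- # 2) := f :- # 0 :+ (g :- # 1) :- # 1) refl f g) (NonNeg-+ f≥0 g≥2))
            (NonNeg-by (solve 4 (λ b f g Y → (f :+ b :* g :- Y) := f :- # 0 :+ b :* (g :- # 1) :- (Y :- (F.m b :+ # 1))) refl b f g Y) a⁺)
            (NonNeg-by (solve 4 (λ b f g Y → (f :+ b :* g :+ Y :- # 2 :* b) := f :- # 0 :+ b :* (g :- # 1) :+ (Y :- (F.m b :+ # 1))) refl b f g Y) α⁻)
            (NonNeg-by (solve 5 (λ b f g X Y → (f :+ F.m b :* g :- (Y :- X)) := f :- # 0 :+ F.m b :* (g :- # 1) :- (Y :- (F.m b :+ # 1) :- (X :- # 1))) refl b f g X Y) b⁺)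
            (NonNeg-by (solve 5 (λ b f g X Y → (f :+ F.m b :* g :+ (Y :- X) :- # 2 :* b :+ # 2) := f :- # 0 :+ F.m b :* (g :- # 1) :+ (Y :- (F.m b :+ # 1) :- (X :- # 1))) refl b f g X Y) β⁻)
            (NonNeg-by (solve 5 (λ b f g X Y → (g :+ b :* f :- (Y :- b :* X) :- # 1) := g :- # 1 :+ b :* (f :- # 0) :- (Y :- (F.m b :+ # 1) :- b :* (X :- # 1))) refl b f g X Y) γ⁺)
            (NonNeg-by (solve 5 (λ b f g X Y → (g :+ b :* f :+ (Y :- b :* X) :- # 1) := g :- # 1 :+ b :* (f :- # 0) :+ (Y :- (F.m b :+ # 1) :- b :* (X :- # 1))) refl b f g X Y) γ⁻)
            (NonNeg-by (solve 5 (λ b f g X Y → (g :+ F.m b :* f :- (Y :- F.m b :* X)) := g :- # 1 :+ F.m b :* (f :- # 0) :- (Y :- (F.m b :+ # 1) :- F.m b :* (X :- # 1))) refl b f g X Y) d⁺)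
            (NonNeg-by (solve 5 (λ b f g X Y → (g :+ F.m b :* f :+ (Y :- F.m b :* X) :- # 2) := g :- # 1 :+ F.m b :* (f :- # 0) :+ (Y :- (F.m b :+ # 1) :- F.m b :* (X :- # 1))) refl b f g X Y) δ)

        -- Now c⁻ = 0, so the point removed must lie on the face c⁻ as well; (0, 1, 1, m) does.
        split⁻ : NonNeg (ℤ.- (g ℤ.+ b ℤ.* f ℤ.+ (Y ℤ.- b ℤ.* X) ℤ.- + 1) ℤ.- + 1) → ⊥
        split⁻ γ≤0 = decompose bad (quad (+ 0) (+ 1) (+ 1) (Z.m ℤ.+ + 0)) (hex₀′ (+ 0) (NonNeg-ℕ 0) (NonNeg-ℕ 1)) rest
          where
          δ : NonNeg (g ℤ.+ Z.m ℤ.* f ℤ.+ (Y ℤ.- Z.m ℤ.* X) ℤ.- + 1)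
          δ with + 0 ℤ.≤? f ℤ.- X
          ... | yes X≤f = let δ₂ = δ⁻ X≤f in
              NonNeg-by (solve 5 (λ b f g X Y → (g :+ F.m b :* f :+ (Y :- F.m b :* X) :- # 2) :+ # 1 := g :+ F.m b :* f :+ (Y :- F.m b :* X) :- # 1) refl b f g X Y) (NonNeg-+ δ₂ (NonNeg-ℕ 1))
          ... | no X≰f = let f<X = ¬NonNeg⇒ X≰f in
              NonNeg-by (solve 5 (λ b f g X Y → (g :+ b :* f :+ (Y :- b :* X)) :+ (:- (f :- X) :- # 1) := g :+ F.m b :* f :+ (Y :- F.m b :* X) :- # 1) refl b f g X Y) (NonNeg-+ c⁻ f<X)
          rest : Region b (v ⊟ quad (+ 0) (+ 1) (+ 1) (Z.m ℤ.+ + 0))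
          rest = region
            (NonNeg-by (solve 1 (λ f → f := f :- # 0) refl f) f≥0)
            g≥1
            (NonNeg-by (solve 2 (λ f g → f :+ (g :- # 2) := f :- # 0 :+ (g :- # 1) :- # 1) refl f g) (NonNeg-+ f≥0 g≥2))
            (NonNeg-by (solve 5 (λ b f g X Y → (:- (g :+ b :* f :+ (Y :- b :* X) :- # 1) :- # 1) :+ b :* (f :+ g :- X) :+ f :+ (g :- # 1) := f :- # 0 :+ b :* (g :- # 1) :- (Y :- (F.m b :+ # 0))) refl b f g X Y) (NonNeg-+ (NonNeg-+ (NonNeg-+ γ≤0 (NonNeg-* b≥0 X≤h)) f≥0) g≥1))
            (NonNeg-by (solve 4 (λ b f g Y → (f :+ b :* g :+ Y :- # 2 :* b) :+ # 1 := f :- # 0 :+ b :* (g :- # 1) :+ (Y :- (F.m b :+ # 0))) refl b f g Y) (NonNeg-+ α⁻ (NonNeg-ℕ 1)))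
            (NonNeg-by (solve 5 (λ b f g X Y → (:- (g :+ b :* f :+ (Y :- b :* X) :- # 1) :- # 1) :+ (b :- # 1) :* (f :+ g :- X) :+ # 2 :* f :+ (g :- # 1) := f :- # 0 :+ F.m b :* (g :- # 1) :- (Y :- (F.m b :+ # 0) :- (X :- # 1))) refl b f g X Y) (NonNeg-+ (NonNeg-+ (NonNeg-+ γ≤0 (NonNeg-* m≥0 X≤h)) (NonNeg-* (NonNeg-ℕ 2) f≥0)) g≥1))
            (NonNeg-by (solve 5 (λ b f g X Y → (f :+ F.m b :* g :+ (Y :- X) :- # 2 :* b :+ # 2) :+ # 1 := f :- # 0 :+ F.m b :* (g :- # 1) :+ (Y :- (F.m b :+ # 0) :- (X :- # 1))) refl b f g X Y) (NonNeg-+ β⁻ (NonNeg-ℕ 1)))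
            (NonNeg-by (solve 5 (λ b f g X Y → (:- (g :+ b :* f :+ (Y :- b :* X) :- # 1) :- # 1) :+ # 2 :* b :* f :+ # 2 :* (g :- # 1) := g :- # 1 :+ b :* (f :- # 0) :- (Y :- (F.m b :+ # 0) :- b :* (X :- # 1))) refl b f g X Y) (NonNeg-+ (NonNeg-+ γ≤0 (NonNeg-* (NonNeg-* (NonNeg-ℕ 2) b≥0) f≥0)) (NonNeg-* (NonNeg-ℕ 2) g≥1)))
            (NonNeg-by (solve 5 (λ b f g X Y → (g :+ b :* f :+ (Y :- b :* X)) := g :- # 1 :+ b :* (f :- # 0) :+ (Y :- (F.m b :+ # 0) :- b :* (X :- # 1))) refl b f g X Y) c⁻)
            (NonNeg-by (solve 5 (λ b f g X Y → (:- (g :+ b :* f :+ (Y :- b :* X) :- # 1) :- # 1) :+ (f :+ g :- X) :+ (g :- # 1) :+ (# 2 :* b :- # 2) :* f := g :- # 1 :+ F.m b :* (f :- # 0) :- (Y :- (F.m b :+ # 0) :- F.m b :* (X :- # 1))) refl b f g X Y) (NonNeg-+ (NonNeg-+ (NonNeg-+ γ≤0 X≤h) g≥1) (NonNeg-* 2m≥0 f≥0)))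
            (NonNeg-by (solve 5 (λ b f g X Y → (g :+ F.m b :* f :+ (Y :- F.m b :* X) :- # 1) := g :- # 1 :+ F.m b :* (f :- # 0) :+ (Y :- (F.m b :+ # 0) :- F.m b :* (X :- # 1))) refl b f g X Y) δ)

        absurd : ⊥
        absurd with + 0 ℤ.≤? g ℤ.+ b ℤ.* f ℤ.+ (Y ℤ.- b ℤ.* X) ℤ.- + 1
        ... | yes γ⁻ = split⁺ γ⁻
        ... | no γ≤0 = split⁻ (¬NonNeg⇒ γ≤0)

      top-a : NonNeg (b ℤ.- (f ℤ.+ b ℤ.* g ℤ.- Y)) → ⊥
      top-a u = Top.absurd
        (NonNeg-by (solve 4 (λ b f g Y → (b :- (f :+ b :* g :- Y)) :+ # 2 :* f :+ # 2 :* b :* (g :- # 2) :+ b := f :+ b :* g :+ Y :- # 2 :* b) refl b f g Y) (NonNeg-+ (NonNeg-+ (NonNeg-+ u (NonNeg-* (NonNeg-ℕ 2) f≥0)) (NonNeg-* (NonNeg-* (NonNeg-ℕ 2) b≥0) g≥2)) b≥0))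
        (NonNeg-by (solve 5 (λ b f g X Y → (b :- (f :+ b :* g :- Y)) :+ (f :+ g :- X) :+ f :+ (# 2 :* b :- # 2) :* (g :- # 2) :+ (b :- # 2) := f :+ F.m b :* g :+ (Y :- X) :- # 2 :* b :+ # 2) refl b f g X Y) (NonNeg-+ (NonNeg-+ (NonNeg-+ (NonNeg-+ u X≤h) f≥0) (NonNeg-* 2m≥0 g≥2)) a≥0))
        γ
        (λ X≤f → NonNeg-by (solve 5 (λ b f g X Y → (b :- (f :+ b :* g :- Y)) :+ f :+ (b :- # 1) :* (f :- X) :+ (b :+ # 1) :* (g :- # 2) :+ b := g :+ F.m b :* f :+ (Y :- F.m b :* X) :- # 2) refl b f g X Y) (NonNeg-+ (NonNeg-+ (NonNeg-+ (NonNeg-+ u f≥0) (NonNeg-* m≥0 X≤f)) (NonNeg-* b+1≥0 g≥2)) b≥0))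
        where
        γ : NonNeg (g ℤ.+ b ℤ.* f ℤ.- (Y ℤ.- b ℤ.* X) ℤ.- + 1)
        γ with + 0 ℤ.≤? f ℤ.+ X ℤ.- + 1
        ... | yes f+X≥1 = NonNeg-by (solve 5 (λ b f g X Y → (g :+ F.m b :* f :- (Y :- F.m b :* X)) :+ (f :+ X :- # 1) := g :+ b :* f :- (Y :- b :* X) :- # 1) refl b f g X Y) (NonNeg-+ d⁺ f+X≥1)
        -- If f = X = 0, then `d⁺` and `u` give g ≥ Y ≥ b(g - 1), which is impossible for g ≥ 2.
        ... | no f+X≰0 = let f+X≤0 = ¬NonNeg⇒ f+X≰0 in ⊥-elim (¬NonNeg-1 (
            NonNeg-by (solve 5 (λ b f g X Y → (g :+ F.m b :* f :- (Y :- F.m b :* X)) :+ (b :- (f :+ b :* g :- Y)) :+ (b :- # 1) :* (g :- # 2) :+ (b :- # 3) :+ (b :- # 1) :* (:- (f :+ X :- # 1) :- # 1) :+ f := con -[1+ 0 ]) refl b f g X Y) (NonNeg-+ (NonNeg-+ (NonNeg-+ (NonNeg-+ (NonNeg-+ d⁺ u) (NonNeg-* m≥0 g≥2)) b-3≥0) (NonNeg-* m≥0 f+X≤0)) f≥0)))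
      top-b : NonNeg (Z.m ℤ.- (f ℤ.+ Z.m ℤ.* g ℤ.- (Y ℤ.- X))) → ⊥
      top-b u = Top.absurd
        (NonNeg-by (solve 5 (λ b f g X Y → (F.m b :- (f :+ F.m b :* g :- (Y :- X))) :+ # 2 :* f :+ X :+ (# 2 :* b :- # 1) :* (g :- # 2) :+ (b :- # 1) := f :+ b :* g :+ Y :- # 2 :* b) refl b f g X Y) (NonNeg-+ (NonNeg-+ (NonNeg-+ (NonNeg-+ u (NonNeg-* (NonNeg-ℕ 2) f≥0)) X≥0) (NonNeg-* 2b-1≥0 g≥2)) m≥0))
        (NonNeg-by (solve 5 (λ b f g X Y → (F.m b :- (f :+ F.m b :* g :- (Y :- X))) :+ # 2 :* f :+ (# 2 :* b :- # 2) :* (g :- # 2) :+ (b :- # 1) := f :+ F.m b :* g :+ (Y :- X) :- # 2 :* b :+ # 2) refl b f g X Y) (NonNeg-+ (NonNeg-+ (NonNeg-+ u (NonNeg-* (NonNeg-ℕ 2) f≥0)) (NonNeg-* 2m≥0 g≥2)) m≥0))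
        γ
        (λ X≤f → NonNeg-by (solve 5 (λ b f g X Y → (F.m b :- (f :+ F.m b :* g :- (Y :- X))) :+ (b :- # 2) :* (f :- X) :+ # 2 :* f :+ b :* (g :- # 2) :+ (b :- # 1) := g :+ F.m b :* f :+ (Y :- F.m b :* X) :- # 2) refl b f g X Y) (NonNeg-+ (NonNeg-+ (NonNeg-+ (NonNeg-+ u (NonNeg-* a≥0 X≤f)) (NonNeg-* (NonNeg-ℕ 2) f≥0)) (NonNeg-* b≥0 g≥2)) m≥0))
        where
        γ : NonNeg (g ℤ.+ b ℤ.* f ℤ.- (Y ℤ.- b ℤ.* X) ℤ.- + 1)
        γ with + 0 ℤ.≤? f ℤ.+ X ℤ.- + 1
        ... | yes f+X≥1 = NonNeg-by (solve 5 (λ b f g X Y → (g :+ F.m b :* f :- (Y :- F.m b :* X)) :+ (f :+ X :- # 1) := g :+ b :* f :- (Y :- b :* X) :- # 1) refl b f g X Y) (NonNeg-+ d⁺ f+X≥1)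
        ... | no f+X≰0 = let f+X≤0 = ¬NonNeg⇒ f+X≰0 in ⊥-elim (¬NonNeg-1 (
            NonNeg-by (solve 5 (λ b f g X Y → (g :+ F.m b :* f :- (Y :- F.m b :* X)) :+ (F.m b :- (f :+ F.m b :* g :- (Y :- X))) :+ (b :- # 2) :* (g :- # 2) :+ (b :- # 4) :+ (b :- # 2) :* (:- (f :+ X :- # 1) :- # 1) := con -[1+ 0 ]) refl b f g X Y) (NonNeg-+ (NonNeg-+ (NonNeg-+ (NonNeg-+ d⁺ u) (NonNeg-* a≥0 g≥2)) b-4≥0) (NonNeg-* a≥0 f+X≤0))))

      -- Away from the faces a⁺ and b⁺: the hypotheses say a⁺ ≥ b + 1 and b⁺ ≥ m + 1, the values at
      -- (0, 1, 0, -1). That point is removed if c⁺ and d⁺ are at least 2, their values there;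
      -- otherwise (0, 1, 0, 1) is removed.
      module Middle (n₁ : NonNeg (ℤ.- (b ℤ.- (f ℤ.+ b ℤ.* g ℤ.- Y)) ℤ.- + 1)) (n₂ : NonNeg (ℤ.- (Z.m ℤ.- (f ℤ.+ Z.m ℤ.* g ℤ.- (Y ℤ.- X))) ℤ.- + 1)) where
        β⁻ : NonNeg (f ℤ.+ Z.m ℤ.* g ℤ.+ (Y ℤ.- X) ℤ.- (b ℤ.- + 2))
        β⁻ with + 0 ℤ.≤? g ℤ.- f ℤ.+ X ℤ.- + 1
        ... | yes h₁ = NonNeg-by (solve 5 (λ b f g X Y → (g :+ F.m b :* f :+ (Y :- F.m b :* X)) :+ (b :- # 2) :* (g :- f :+ X :- # 1) := f :+ F.m b :* g :+ (Y :- X) :- (b :- # 2)) refl b f g X Y) (NonNeg-+ d⁻ (NonNeg-* a≥0 h₁))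
        -- Here X ≤ f - g ≤ 0, hence X = 0, and the normalised sign of Y is what saves the estimate.
        ... | no h₀ = let h₁ = ¬NonNeg⇒ h₀; Y≥0 = X≡0⇒Y≥0 (X≡0 h₁) in
            NonNeg-by (solve 5 (λ b f g X Y → Y :+ f :+ (b :- # 1) :* (g :- # 1) :+ (g :- f) :+ (:- (g :- f :+ X :- # 1) :- # 1) :+ # 1 := f :+ F.m b :* g :+ (Y :- X) :- (b :- # 2)) refl b f g X Y) (NonNeg-+ (NonNeg-+ (NonNeg-+ (NonNeg-+ (NonNeg-+ Y≥0 f≥0) (NonNeg-* m≥0 g≥1)) f≤g) h₁) (NonNeg-ℕ 1))
          where
          X≡0 : NonNeg (ℤ.- (g ℤ.- f ℤ.+ X ℤ.- + 1) ℤ.- + 1) → X ≡ + 0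
          X≡0 h₁ = ℤP.≤-antisym (NonNeg⇒≤ (NonNeg-by (solve 3 (λ f g X → (:- (g :- f :+ X :- # 1) :- # 1) :+ (g :- f) := # 0 :- X) refl f g X) (NonNeg-+ h₁ f≤g))) X≥0

        down : NonNeg (g ℤ.+ b ℤ.* f ℤ.- (Y ℤ.- b ℤ.* X) ℤ.- + 2) → NonNeg (g ℤ.+ Z.m ℤ.* f ℤ.- (Y ℤ.- Z.m ℤ.* X) ℤ.- + 2) → ⊥
        down γ⁺ δ⁺ = decompose bad (quad (+ 0) (+ 1) (+ 0) -[1+ 0 ]) (hex₀ -[1+ 0 ] (NonNeg-ℕ 0) (NonNeg-ℕ 2)) rest
          where
          rest : Region b (v ⊟ quad (+ 0) (+ 1) (+ 0) -[1+ 0 ])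
          rest = region
            (NonNeg-by (solve 1 (λ f → f := f :- # 0) refl f) f≥0)
            g≥1
            (NonNeg-by (solve 2 (λ f g → f :+ (g :- # 2) := f :- # 0 :+ (g :- # 1) :- # 1) refl f g) (NonNeg-+ f≥0 g≥2))
            (NonNeg-by (solve 4 (λ b f g Y → (:- (b :- (f :+ b :* g :- Y)) :- # 1) := f :- # 0 :+ b :* (g :- # 1) :- (Y :- con -[1+ 0 ])) refl b f g Y) n₁)
            (NonNeg-by (solve 5 (λ b f g X Y → (f :+ F.m b :* g :+ (Y :- X) :- (b :- # 2)) :+ (g :- # 1) :+ X := f :- # 0 :+ b :* (g :- # 1) :+ (Y :- con -[1+ 0 ])) refl b f g X Y) (NonNeg-+ (NonNeg-+ β⁻ g≥1) X≥0))
            (NonNeg-by (solve 5 (λ b f g X Y → (:- (F.m b :- (f :+ F.m b :* g :- (Y :- X))) :- # 1) := f :- # 0 :+ F.m b :* (g :- # 1) :- (Y :- con -[1+ 0 ] :- (X :- # 0))) refl b f g X Y) n₂)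
            (NonNeg-by (solve 5 (λ b f g X Y → (f :+ F.m b :* g :+ (Y :- X) :- (b :- # 2)) := f :- # 0 :+ F.m b :* (g :- # 1) :+ (Y :- con -[1+ 0 ] :- (X :- # 0))) refl b f g X Y) β⁻)
            (NonNeg-by (solve 5 (λ b f g X Y → (g :+ b :* f :- (Y :- b :* X) :- # 2) := g :- # 1 :+ b :* (f :- # 0) :- (Y :- con -[1+ 0 ] :- b :* (X :- # 0))) refl b f g X Y) γ⁺)
            (NonNeg-by (solve 5 (λ b f g X Y → (g :+ b :* f :+ (Y :- b :* X)) := g :- # 1 :+ b :* (f :- # 0) :+ (Y :- con -[1+ 0 ] :- b :* (X :- # 0))) refl b f g X Y) c⁻)
            (NonNeg-by (solve 5 (λ b f g X Y → (g :+ F.m b :* f :- (Y :- F.m b :* X) :- # 2) := g :- # 1 :+ F.m b :* (f :- # 0) :- (Y :- con -[1+ 0 ] :- F.m b :* (X :- # 0))) refl b f g X Y) δ⁺)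
            (NonNeg-by (solve 5 (λ b f g X Y → (g :+ F.m b :* f :+ (Y :- F.m b :* X)) := g :- # 1 :+ F.m b :* (f :- # 0) :+ (Y :- con -[1+ 0 ] :- F.m b :* (X :- # 0))) refl b f g X Y) d⁻)

        up : NonNeg (f ℤ.+ Z.m ℤ.* g ℤ.+ (Y ℤ.- X) ℤ.- b) → NonNeg (g ℤ.+ b ℤ.* f ℤ.+ (Y ℤ.- b ℤ.* X) ℤ.- + 2) → NonNeg (g ℤ.+ Z.m ℤ.* f ℤ.+ (Y ℤ.- Z.m ℤ.* X) ℤ.- + 2) → ⊥
        up β γ⁻ δ⁻ = decompose bad (quad (+ 0) (+ 1) (+ 0) (+ 1)) (hex₀ (+ 1) (NonNeg-ℕ 2) (NonNeg-ℕ 0)) rest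
          where
          rest : Region b (v ⊟ quad (+ 0) (+ 1) (+ 0) (+ 1))
          rest = region
            (NonNeg-by (solve 1 (λ f → f := f :- # 0) refl f) f≥0)
            g≥1
            (NonNeg-by (solve 2 (λ f g → f :+ (g :- # 2) := f :- # 0 :+ (g :- # 1) :- # 1) refl f g) (NonNeg-+ f≥0 g≥2))
            (NonNeg-by (solve 4 (λ b f g Y → (:- (b :- (f :+ b :* g :- Y)) :- # 1) :+ # 2 := f :- # 0 :+ b :* (g :- # 1) :- (Y :- # 1)) refl b f g Y) (NonNeg-+ n₁ (NonNeg-ℕ 2)))
            (NonNeg-by (solve 5 (λ b f g X Y → (f :+ F.m b :* g :+ (Y :- X) :- b) :+ (g :- # 1) :+ X := f :- # 0 :+ b :* (g :- # 1) :+ (Y :- # 1)) refl b f g X Y) (NonNeg-+ (NonNeg-+ β g≥1) X≥0))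
            (NonNeg-by (solve 5 (λ b f g X Y → (:- (F.m b :- (f :+ F.m b :* g :- (Y :- X))) :- # 1) :+ # 2 := f :- # 0 :+ F.m b :* (g :- # 1) :- (Y :- # 1 :- (X :- # 0))) refl b f g X Y) (NonNeg-+ n₂ (NonNeg-ℕ 2)))
            (NonNeg-by (solve 5 (λ b f g X Y → (f :+ F.m b :* g :+ (Y :- X) :- b) := f :- # 0 :+ F.m b :* (g :- # 1) :+ (Y :- # 1 :- (X :- # 0))) refl b f g X Y) β)
            (NonNeg-by (solve 5 (λ b f g X Y → (g :+ b :* f :- (Y :- b :* X)) := g :- # 1 :+ b :* (f :- # 0) :- (Y :- # 1 :- b :* (X :- # 0))) refl b f g X Y) c⁺)
            (NonNeg-by (solve 5 (λ b f g X Y → (g :+ b :* f :+ (Y :- b :* X) :- # 2) := g :- # 1 :+ b :* (f :- # 0) :+ (Y :- # 1 :- b :* (X :- # 0))) refl b f g X Y) γ⁻)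
            (NonNeg-by (solve 5 (λ b f g X Y → (g :+ F.m b :* f :- (Y :- F.m b :* X)) := g :- # 1 :+ F.m b :* (f :- # 0) :- (Y :- # 1 :- F.m b :* (X :- # 0))) refl b f g X Y) d⁺)
            (NonNeg-by (solve 5 (λ b f g X Y → (g :+ F.m b :* f :+ (Y :- F.m b :* X) :- # 2) := g :- # 1 :+ F.m b :* (f :- # 0) :+ (Y :- # 1 :- F.m b :* (X :- # 0))) refl b f g X Y) δ⁻)

        up-c : NonNeg (ℤ.- (g ℤ.+ b ℤ.* f ℤ.- (Y ℤ.- b ℤ.* X) ℤ.- + 2) ℤ.- + 1) → ⊥
        up-c k = up
          (NonNeg-by (solve 5 (λ b f g X Y → (:- (g :+ b :* f :- (Y :- b :* X) :- # 2) :- # 1) :+ (b :+ # 1) :* f :+ (b :- # 1) :* X :+ b :* (g :- # 2) :+ (b :- # 1) := f :+ F.m b :* g :+ (Y :- X) :- b) refl b f g X Y) (NonNeg-+ (NonNeg-+ (NonNeg-+ (NonNeg-+ k (NonNeg-* b+1≥0 f≥0)) (NonNeg-* m≥0 X≥0)) (NonNeg-* b≥0 g≥2)) m≥0))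
          (NonNeg-by (solve 5 (λ b f g X Y → (:- (g :+ b :* f :- (Y :- b :* X) :- # 2) :- # 1) :+ # 2 :* b :* f :+ # 2 :* (g :- # 2) :+ # 1 := g :+ b :* f :+ (Y :- b :* X) :- # 2) refl b f g X Y) (NonNeg-+ (NonNeg-+ (NonNeg-+ k (NonNeg-* (NonNeg-* (NonNeg-ℕ 2) b≥0) f≥0)) (NonNeg-* (NonNeg-ℕ 2) g≥2)) (NonNeg-ℕ 1)))
          (NonNeg-by (solve 5 (λ b f g X Y → (:- (g :+ b :* f :- (Y :- b :* X) :- # 2) :- # 1) :+ # 2 :* (g :- # 2) :+ # 1 :+ (# 2 :* b :- # 1) :* f :+ X := g :+ F.m b :* f :+ (Y :- F.m b :* X) :- # 2) refl b f g X Y) (NonNeg-+ (NonNeg-+ (NonNeg-+ (NonNeg-+ k (NonNeg-* (NonNeg-ℕ 2) g≥2)) (NonNeg-ℕ 1)) (NonNeg-* 2b-1≥0 f≥0)) X≥0))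

        up-d : NonNeg (ℤ.- (g ℤ.+ Z.m ℤ.* f ℤ.- (Y ℤ.- Z.m ℤ.* X) ℤ.- + 2) ℤ.- + 1) → ⊥
        up-d k = up
          (NonNeg-by (solve 5 (λ b f g X Y → (:- (g :+ F.m b :* f :- (Y :- F.m b :* X) :- # 2) :- # 1) :+ b :* f :+ (b :- # 2) :* X :+ b :* (g :- # 2) :+ (b :- # 1) := f :+ F.m b :* g :+ (Y :- X) :- b) refl b f g X Y) (NonNeg-+ (NonNeg-+ (NonNeg-+ (NonNeg-+ k (NonNeg-* b≥0 f≥0)) (NonNeg-* a≥0 X≥0)) (NonNeg-* b≥0 g≥2)) m≥0))
          (NonNeg-by (solve 5 (λ b f g X Y → (:- (g :+ F.m b :* f :- (Y :- F.m b :* X) :- # 2) :- # 1) :+ (g :- f :- X :- # 1) :+ # 2 :* b :* f :+ (g :- # 2) := g :+ b :* f :+ (Y :- b :* X) :- # 2) refl b f g X Y) (NonNeg-+ (NonNeg-+ (NonNeg-+ k gap) (NonNeg-* (NonNeg-* (NonNeg-ℕ 2) b≥0) f≥0)) g≥2))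
          (NonNeg-by (solve 5 (λ b f g X Y → (:- (g :+ F.m b :* f :- (Y :- F.m b :* X) :- # 2) :- # 1) :+ # 2 :* (g :- # 2) :+ # 1 :+ (# 2 :* b :- # 2) :* f := g :+ F.m b :* f :+ (Y :- F.m b :* X) :- # 2) refl b f g X Y) (NonNeg-+ (NonNeg-+ (NonNeg-+ k (NonNeg-* (NonNeg-ℕ 2) g≥2)) (NonNeg-ℕ 1)) (NonNeg-* 2m≥0 f≥0)))
          where
          -- Since b⁺ - d⁺ = a(g - f - X), a large b⁺ together with d⁺ ≤ 1 forces g > f + X.
          gap : NonNeg (g ℤ.- f ℤ.- X ℤ.- + 1)
          gap = NonNeg-cancelˡ Z.a (g ℤ.- f ℤ.- X ℤ.- + 1) (a>0⇒ b 13≤b) (NonNeg-by (solve 5 (λ b f g X Y → (:- (F.m b :- (f :+ F.m b :* g :- (Y :- X))) :- # 1) :+ (:- (g :+ F.m b :* f :- (Y :- F.m b :* X) :- # 2) :- # 1) :+ # 1 := F.a b :* (g :- f :- X :- # 1)) refl b f g X Y) (NonNeg-+ (NonNeg-+ n₂ k) (NonNeg-ℕ 1)))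

        absurd : ⊥
        absurd with + 0 ℤ.≤? g ℤ.+ b ℤ.* f ℤ.- (Y ℤ.- b ℤ.* X) ℤ.- + 2 | + 0 ℤ.≤? g ℤ.+ Z.m ℤ.* f ℤ.- (Y ℤ.- Z.m ℤ.* X) ℤ.- + 2
        ... | yes γ⁺ | yes δ⁺ = down γ⁺ δ⁺
        ... | no γ | _ = up-c (¬NonNeg⇒ γ)
        ... | yes _ | no δ = up-d (¬NonNeg⇒ δ)

    g≥2-absurd : ⊥
    g≥2-absurd with + 0 ℤ.≤? b ℤ.- (f ℤ.+ b ℤ.* g ℤ.- Y) | + 0 ℤ.≤? Z.m ℤ.- (f ℤ.+ Z.m ℤ.* g ℤ.- (Y ℤ.- X))
    ... | yes u | _ = top-a u
    ... | no _ | yes u = top-b u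
    ... | no n₁ | no n₂ = Middle.absurd (¬NonNeg⇒ n₁) (¬NonNeg⇒ n₂)

-- Small norms, the second cone and the exclusion of minimal bad points.

NonNeg-square : ∀ x → NonNeg (x ℤ.* x)
NonNeg-square (+ n) = NonNeg-* (NonNeg-ℕ n) (NonNeg-ℕ n)
NonNeg-square -[1+ n ] = NonNeg-ℕ (suc n ℕ.* suc n)

Pos-cancelˡ : ∀ k x → NonNeg (k ℤ.- + 1) → NonNeg (k ℤ.* x ℤ.- + 1) → NonNeg (x ℤ.- + 1)
Pos-cancelˡ k x k>0 kx>0 with + 0 ℤ.≤? x ℤ.- + 1
... | yes x>0 = x>0
... | no x≯0 = ⊥-elim (¬NonNeg-1 (NonNeg-by
    (solve 2 (λ k x → k :* x :- # 1 :+ ((k :- # 1) :* (:- (x :- # 1) :- # 1) :+ (:- (x :- # 1) :- # 1)) := con -[1+ 0 ]) refl k x)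
    (NonNeg-+ kx>0 (NonNeg-+ (NonNeg-* k>0 (¬NonNeg⇒ x≯0)) (¬NonNeg⇒ x≯0)))))
  where open ℤ-Solver

nonNeg? : ∀ x → NonNeg x ⊎ NonNeg (ℤ.- x ℤ.- + 1)
nonNeg? x with + 0 ℤ.≤? x
... | yes x≥0 = inj₁ x≥0
... | no x≱0 = inj₂ (¬NonNeg⇒ x≱0)

<0⇒≤0 : ∀ x → NonNeg (ℤ.- x ℤ.- + 1) → NonNeg (ℤ.- x)
<0⇒≤0 x h = NonNeg-by (solve 1 (λ x → :- x :- # 1 :+ # 1 := :- x) refl x) (NonNeg-+ h (NonNeg-ℕ 1))
  where open ℤ-Solver

bit-elim : ∀ (P : ℤ → Set) → P (+ 0) → P (+ 1) → ∀ x → NonNeg x → NonNeg (+ 1 ℤ.- x) → P x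
bit-elim P p₀ p₁ (+ 0) _ _ = p₀
bit-elim P p₀ p₁ (+ 1) _ _ = p₁
bit-elim P p₀ p₁ (+ suc (suc n)) _ ()

trit-elim : ∀ (P : ℤ → Set) → P (+ 0) → P (+ 1) → P (+ 2) → ∀ x → NonNeg x → NonNeg (+ 2 ℤ.- x) → P x
trit-elim P p₀ p₁ p₂ (+ 0) _ _ = p₀
trit-elim P p₀ p₁ p₂ (+ 1) _ _ = p₁
trit-elim P p₀ p₁ p₂ (+ 2) _ _ = p₂
trit-elim P p₀ p₁ p₂ (+ suc (suc (suc n))) _ ()

≡1 : ∀ {x} → NonNeg (x ℤ.- + 1) → NonNeg (+ 2 ℤ.- x ℤ.- + 1) → x ≡ + 1
≡1 {x} x≥1 x≤1 = ℤP.≤-antisym (NonNeg⇒≤ (NonNeg-by (solve 1 (λ x → # 2 :- x :- # 1 := # 1 :- x) refl x) x≤1)) (NonNeg⇒≤ x≥1)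
  where open ℤ-Solver

module Contradiction (b : ℤ) (13≤b : NonNeg (b ℤ.- + 13)) (order : LatticeOrder b)
  (norm-* : NormForm-multiplicative b)
  where
  open LatticeOrder order
  open LatticeOrderProperties b 13≤b order
  open TotallyPositiveRegion b 13≤b order
  open CoordinateIdentities b
  open SyntacticFormulas
  open Decomposition b 13≤b order norm-*

  private
    a>0 : NonNeg (Z.a ℤ.- + 1)
    a>0 = a>0⇒ b 13≤b

    b≥0 : NonNeg b
    b≥0 = NonNeg-by (solve 1 (λ b → (b :- # 13) :+ # 13 := b) refl b) (NonNeg-+ 13≤b (NonNeg-ℕ 13))

  small : ∀ {v} → Bad v → NonNeg (16*maxNorm b ℤ.- Z.normForm (Z.coords v)) → ⊥
  small bad n = large bad (NonNeg⇒≤ n)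

  private
    maxNormₚ : ∀ {n} → Polynomial n → Polynomial n
    maxNormₚ b = let open F b in # 16 :* ((r :- # 9) :* (r :- # 9))

    normₚ : ∀ {n} → Polynomial n → Quad (Polynomial n) → Polynomial n
    normₚ b v = let open F b in normForm (coords v)

  -- Here the norm is (r - Y²)².
  small-0 : ∀ Y → NonNeg (Y ℤ.- + 3) → NonNeg (b ℤ.- + 3 ℤ.- Y) → ¬ Bad (quad (+ 1) (+ 1) (+ 0) Y)
  small-0 Y lo hi bad = small bad (NonNeg-by
    -- The factorisation (r - 9)² - (r - Y²)² = (Y² - 9)(2r - 9 - Y²), with equality of the norms at
    -- Y = 3.
    (solve 2 (λ b Y → # 16 :* ((Y :- # 3) :* (Y :- # 3 :+ # 6) :* ((b :- # 3 :- Y) :* ((b :- # 13) :+ (Y :- # 3) :+ # 13) :+ (b :* b :+ # 10 :* (b :- # 13) :+ # 112)))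
       := maxNormₚ b :- normₚ b (quad (# 1) (# 1) (# 0) Y)) refl b Y)
    (NonNeg-* (NonNeg-ℕ 16) (NonNeg-* (NonNeg-* lo (NonNeg-+ lo (NonNeg-ℕ 6)))
      (NonNeg-+ (NonNeg-* hi (NonNeg-+ (NonNeg-+ 13≤b lo) (NonNeg-ℕ 13))) (NonNeg-+ (NonNeg-+ (NonNeg-* b≥0 b≥0) (NonNeg-* (NonNeg-ℕ 10) 13≤b)) (NonNeg-ℕ 112))))))

  -- Let A be the value of `normA`; that of `normE` is E = b - 2Y. The difference is (4(r - 9) -
  -- A)(4(r - 9) + A) + 4qE², where 4(r - 9) - A = E² + b² - 40.
  small-1 : ∀ Y → NonNeg (Y ℤ.- + 3) → NonNeg (b ℤ.- + 3 ℤ.- Y) → ¬ Bad (quad (+ 1) (+ 1) (+ 1) Y)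
  small-1 Y lo hi bad = small bad (NonNeg-by
    (solve 2 (λ b Y → ((b :- # 2 :* Y) :* (b :- # 2 :* Y) :+ ((b :- # 13) :* b :+ # 13 :* (b :- # 13) :+ # 129))
         :* (# 6 :* (b :* b) :+ # 16 :* (b :- # 13) :+ # 176 :+ # 4 :* ((Y :- # 3 :+ # 3) :* (b :- # 3 :- Y :+ # 3)))
         :+ # 4 :* (((b :- # 13) :+ # 11) :* ((b :- # 13) :+ # 15)) :* ((b :- # 2 :* Y) :* (b :- # 2 :* Y))
       := maxNormₚ b :- normₚ b (quad (# 1) (# 1) (# 1) Y)) refl b Y)
    (NonNeg-+ (NonNeg-* (NonNeg-+ sq (NonNeg-+ (NonNeg-+ (NonNeg-* 13≤b b≥0) (NonNeg-* (NonNeg-ℕ 13) 13≤b)) (NonNeg-ℕ 129)))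
        (NonNeg-+ (NonNeg-+ (NonNeg-+ (NonNeg-* (NonNeg-ℕ 6) (NonNeg-* b≥0 b≥0)) (NonNeg-* (NonNeg-ℕ 16) 13≤b)) (NonNeg-ℕ 176))
          (NonNeg-* (NonNeg-ℕ 4) (NonNeg-* (NonNeg-+ lo (NonNeg-ℕ 3)) (NonNeg-+ hi (NonNeg-ℕ 3))))))
      (NonNeg-* (NonNeg-* (NonNeg-ℕ 4) (NonNeg-* (NonNeg-+ 13≤b (NonNeg-ℕ 11)) (NonNeg-+ 13≤b (NonNeg-ℕ 15)))) sq)))
    where
    sq : NonNeg ((b ℤ.- + 2 ℤ.* Y) ℤ.* (b ℤ.- + 2 ℤ.* Y))
    sq = NonNeg-square (b ℤ.- + 2 ℤ.* Y)

  -- The interior points of the cone spanned by 1, ε_p, ε_q and ε_p ε_q, divided by ε_q;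
  -- their norm is (3b - 2 + 2k(a - k))².
  small-T : ∀ k → NonNeg (k ℤ.- + 1) → NonNeg (Z.a ℤ.- k ℤ.- + 1) → ¬ Bad (quad (k ℤ.+ + 2) (+ 0) (k ℤ.+ + 1) (ℤ.- (k ℤ.+ + 1)))
  -- A difference of two squares again. The factor 2 makes room for 4k(a - k) = a² - (a - 2k)²,
  -- which bounds the product k(a - k).
  small-T k lo hi bad = small bad (NonNeg-cancelˡ (+ 2) _ (NonNeg-ℕ 1) (NonNeg-by
    (solve 2 (λ b k → let open F b in # 16 :* (((a :- # 2 :* k) :* (a :- # 2 :* k) :+ ((b :- # 13) :* b :+ # 15 :* (b :- # 13) :+ # 177))
         :* (b :* b :+ # 5 :* (b :- # 13) :+ # 54 :+ # 2 :* ((k :- # 1 :+ # 1) :* (a :- k :- # 1 :+ # 1))))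
       := # 2 :* (maxNormₚ b :- normₚ b (quad (k :+ # 2) (# 0) (k :+ # 1) (:- (k :+ # 1))))) refl b k)
    (NonNeg-* (NonNeg-ℕ 16) (NonNeg-* (NonNeg-+ (NonNeg-square (Z.a ℤ.- + 2 ℤ.* k)) (NonNeg-+ (NonNeg-+ (NonNeg-* 13≤b b≥0) (NonNeg-* (NonNeg-ℕ 15) 13≤b)) (NonNeg-ℕ 177)))
      (NonNeg-+ (NonNeg-+ (NonNeg-+ (NonNeg-* b≥0 b≥0) (NonNeg-* (NonNeg-ℕ 5) 13≤b)) (NonNeg-ℕ 54))
        (NonNeg-* (NonNeg-ℕ 2) (NonNeg-* (NonNeg-+ lo (NonNeg-ℕ 1)) (NonNeg-+ hi (NonNeg-ℕ 1)))))))))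

  -- b² is the norm at the centre of the hexagon, and (r - 9)² - b² = (b² + b - 9)(b² + 3b - 9).
  small-hex₀ : ∀ v N → Z.normForm (Z.coords v) ≡ + 16 ℤ.* N → NonNeg (b ℤ.* b ℤ.- N) → ¬ Bad v
  small-hex₀ v N norm N≤b² bad = small bad (subst (λ z → NonNeg (16*maxNorm b ℤ.- z)) (sym norm) (NonNeg-by
    (solve 2 (λ b N → # 16 :* (b :* b :- N) :+ # 16 :* ((b :* b :+ (b :- # 13) :+ # 4) :* (b :* b :+ # 3 :* (b :- # 13) :+ # 30)) := maxNormₚ b :- # 16 :* N) refl b N)
    (NonNeg-+ (NonNeg-* (NonNeg-ℕ 16) N≤b²) (NonNeg-* (NonNeg-ℕ 16) (NonNeg-* (NonNeg-+ (NonNeg-+ b²≥0 13≤b) (NonNeg-ℕ 4))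
      (NonNeg-+ (NonNeg-+ b²≥0 (NonNeg-* (NonNeg-ℕ 3) 13≤b)) (NonNeg-ℕ 30)))))))
    where
    b²≥0 = NonNeg-* b≥0 b≥0

  private
    -- The lattice coordinates of 1/ε_q, 1, ε_p/ε_q and ε_p.
    g₁ g₂ g₃ g₄ : ℤ⁴
    g₁ = quad (+ 1) (+ 0) (+ 0) -[1+ 0 ]
    g₂ = quad (+ 0) (+ 1) -[1+ 0 ] (ℤ.- b)
    g₃ = Z.E-p g₁
    g₄ = quad (+ 1) (+ 0) (+ 1) (+ 0)

    TP-g₁ : TP (Z.coords g₁)
    TP-g₁ = subst TP (solve₄ 1 (λ b → quad b (# 0) (con -[1+ 0 ]) (# 0) ≐ F.coords b (quad (# 1) (# 0) (# 0) (con -[1+ 0 ]))) refl b) TP-ε-q⁻¹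

    TP-g₂ : TP (Z.coords g₂)
    TP-g₂ = subst TP (solve₄ 1 (λ b → quad (# 2) (# 0) (# 0) (# 0) ≐ F.coords b (quad (# 0) (# 1) (con -[1+ 0 ]) (:- b))) refl b) (TP-rational {+ 2} (NonNeg-ℕ 1))

    TP-g₃ : TP (Z.coords g₃)
    TP-g₃ = TP-* {z = Z.coords g₃} (ε-p·coords g₁) TP-ε-p TP-g₁

    TP-g₄ : TP (Z.coords g₄)
    TP-g₄ = subst TP (solve₄ 1 (λ b → quad (# 2 :* F.m b) (# 2) (# 0) (# 0) ≐ F.coords b (quad (# 1) (# 0) (# 1) (# 0))) refl b) TP-ε-p

    TP-combination : ∀ k l m n {x y z w} → NonNeg (k ℤ.- + 1) → NonNeg l → NonNeg m → NonNeg n → TP x → TP y → TP z → TP w →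
      TP (k Z.⊡ x Z.⊞ l Z.⊡ y Z.⊞ m Z.⊡ z Z.⊞ n Z.⊡ w)
    TP-combination k l m n hk hl hm hn tx ty tz tw = TP-⊞-⊡ n hn (TP-⊞-⊡ m hm (TP-⊞-⊡ l hl (TP-⊡ k hk tx) ty) tz) tw

  -- Beyond the face b⁻ of the cone lies the cone spanned by g₁ , g₂ , g₃ , g₄.  Its coordinates
  -- t₁ , … , t₄ are multiples of 1/a, and minimality makes them all positive.
  module Beyond {f g X Y : ℤ} (bad : Bad (quad f g X Y)) (min : Minimal (quad f g X Y)) (k>0 : NonNeg (ℤ.- (f ℤ.+ Z.m ℤ.* g ℤ.+ (Y ℤ.- X)) ℤ.- + 1)) where
    private
      v = quad f g X Y
      T₁ T₂ T₃ T₄ : ℤ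
      -- These solve a v = T₁g₁ + T₂g₂ + T₃g₃ + T₄g₄; T₃ is the amount by which v violates b⁻.
      T₁ = ℤ.- (Z.a ℤ.* (Y ℤ.+ b ℤ.* g)) ℤ.- Z.m ℤ.* (ℤ.- (f ℤ.+ Z.m ℤ.* g ℤ.+ (Y ℤ.- X)))
      T₂ = Z.a ℤ.* g ℤ.+ (ℤ.- (f ℤ.+ Z.m ℤ.* g ℤ.+ (Y ℤ.- X)))
      T₃ = ℤ.- (f ℤ.+ Z.m ℤ.* g ℤ.+ (Y ℤ.- X))
      T₄ = Z.a ℤ.* (f ℤ.+ Y ℤ.+ b ℤ.* g) ℤ.- (ℤ.- (f ℤ.+ Z.m ℤ.* g ℤ.+ (Y ℤ.- X)))

      g≥0 : NonNeg g
      g≥0 = minimal-q v bad min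
      min-r = minimal-r v bad min
      min-rq = minimal-rq v bad min

      a≥0 : NonNeg Z.a
      a≥0 = NonNeg-by (solve 1 (λ b → (b :- # 13) :+ # 11 := F.a b) refl b) (NonNeg-+ 13≤b (NonNeg-ℕ 11))

      T₁>0 : NonNeg (ℤ.- (Z.a ℤ.* (Y ℤ.+ b ℤ.* g)) ℤ.- Z.m ℤ.* (ℤ.- (f ℤ.+ Z.m ℤ.* g ℤ.+ (Y ℤ.- X))) ℤ.- + 1)
      T₁>0 = NonNeg-by (solve 5 (λ b f g X Y → (b :* (f :+ g) :+ # 2 :* Y :- b :* X) :+ (:- (f :+ F.m b :* g :+ (Y :- X)) :- # 1) := :- (F.a b :* (Y :+ b :* g)) :- F.m b :* (:- (f :+ F.m b :* g :+ (Y :- X))) :- # 1) refl b f g X Y) (NonNeg-+ min-r k>0)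

      T₂>0 : NonNeg (Z.a ℤ.* g ℤ.+ (ℤ.- (f ℤ.+ Z.m ℤ.* g ℤ.+ (Y ℤ.- X))) ℤ.- + 1)
      T₂>0 = NonNeg-by (solve 5 (λ b f g X Y → (F.a b) :* g :+ (:- (f :+ F.m b :* g :+ (Y :- X)) :- # 1) := F.a b :* g :+ (:- (f :+ F.m b :* g :+ (Y :- X))) :- # 1) refl b f g X Y) (NonNeg-+ (NonNeg-* a≥0 g≥0) k>0)

      T₄>0 : NonNeg (Z.a ℤ.* (f ℤ.+ Y ℤ.+ b ℤ.* g) ℤ.- (ℤ.- (f ℤ.+ Z.m ℤ.* g ℤ.+ (Y ℤ.- X))) ℤ.- + 1)
      T₄>0 = NonNeg-by (solve 5 (λ b f g X Y → (b :* f :+ b :* Y :+ (b :* b :- # 2) :* g :- # 2 :* X) :+ (:- (f :+ F.m b :* g :+ (Y :- X)) :- # 1) := F.a b :* (f :+ Y :+ b :* g) :- (:- (f :+ F.m b :* g :+ (Y :- X))) :- # 1) refl b f g X Y) (NonNeg-+ min-rq k>0)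

      nn : ∀ {x} → NonNeg (x ℤ.- + 1) → NonNeg x
      nn {x} h = NonNeg-by (solve 1 (λ x → x :- # 1 :+ # 1 := x) refl x) (NonNeg-+ h (NonNeg-ℕ 1))

      vₚ : ∀ {n} → Polynomial n → Polynomial n → Polynomial n → Polynomial n → Quad (Polynomial n) → Quad (Polynomial n)
      vₚ f g X Y (quad f′ g′ X′ Y′) = quad (f :- f′) (g :- g′) (X :- X′) (Y :- Y′)

      -- The a-fold of the remainder v - g₁ is a combination of the generators with integer
      -- coefficients, hence totally positive, and the factor a is then cancelled. The other three
      -- cases are analogous.
      split₁ : NonNeg (T₁ ℤ.- Z.a) → ⊥
      split₁ h = indecomposable bad g₁ (v ⊟ g₁) TP-g₁ (TP-⊡⁻¹ Z.a (Z.coords (v ⊟ g₁)) a>0 (subst TP (solve₄ 5 (λ b f g X Y → let open F b using (_⊞_; _⊡_; coords) in ((F.a b :* g :+ (:- (f :+ F.m b :* g :+ (Y :- X))))) ⊡ coords (quad (# 0) (# 1) (con -[1+ 0 ]) (:- b)) ⊞ ((:- (F.a b :* (Y :+ b :* g)) :- F.m b :* (:- (f :+ F.m b :* g :+ (Y :- X)))) :- F.a b) ⊡ coords (quad (# 1) (# 0) (# 0) (con -[1+ 0 ])) ⊞ ((:- (f :+ F.m b :* g :+ (Y :- X)))) ⊡ coords (F.E-p b (quad (# 1) (# 0) (# 0) (con -[1+ 0 ]))) ⊞ ((F.a b :* (f :+ Y :+ b :* g) :- (:- (f :+ F.m b :* g :+ (Y :- X))))) ⊡ coords (quad (# 1)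 (# 0) (# 1) (# 0)) ≐ F.a b ⊡ coords (vₚ f g X Y (quad (# 1) (# 0) (# 0) (con -[1+ 0 ])))) refl b f g X Y
        ) (TP-combination T₂ (T₁ ℤ.- Z.a) T₃ T₄ T₂>0 h (nn {T₃} k>0) (nn {T₄} T₄>0) TP-g₂ TP-g₁ TP-g₃ TP-g₄))) (⊟-⊞ v g₁)

      split₂ : NonNeg (T₂ ℤ.- Z.a) → ⊥
      split₂ h = indecomposable bad g₂ (v ⊟ g₂) TP-g₂ (TP-⊡⁻¹ Z.a (Z.coords (v ⊟ g₂)) a>0 (subst TP (solve₄ 5 (λ b f g X Y → let open F b using (_⊞_; _⊡_; coords) in ((:- (F.a b :* (Y :+ b :* g)) :- F.m b :* (:- (f :+ F.m b :* g :+ (Y :- X))))) ⊡ coords (quad (# 1) (# 0) (# 0) (con -[1+ 0 ])) ⊞ ((F.a b :* g :+ (:- (f :+ F.m b :* g :+ (Y :- X)))) :- F.a b) ⊡ coords (quad (# 0) (# 1) (con -[1+ 0 ]) (:- b)) ⊞ ((:- (f :+ F.m b :* g :+ (Y :- X)))) ⊡ coords (F.E-p b (quad (# 1) (# 0) (# 0) (con -[1+ 0 ]))) ⊞ ((F.a b :* (f :+ Y :+ b :* g) :- (:- (f :+ F.m b :* g :+ (Y :- X))))) ⊡ coords (quad (# 1) (# 0) (# 1) (# 0)) ≐ F.a b ⊡ coords (vₚ f g X Y (quad (# 0) (# 1) (con -[1+ 0 ]) (:- b)))) refl b f g X Y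
        ) (TP-combination T₁ (T₂ ℤ.- Z.a) T₃ T₄ T₁>0 h (nn {T₃} k>0) (nn {T₄} T₄>0) TP-g₁ TP-g₂ TP-g₃ TP-g₄))) (⊟-⊞ v g₂)

      split₃ : NonNeg (T₃ ℤ.- Z.a) → ⊥
      split₃ h = indecomposable bad g₃ (v ⊟ g₃) TP-g₃ (TP-⊡⁻¹ Z.a (Z.coords (v ⊟ g₃)) a>0 (subst TP (solve₄ 5 (λ b f g X Y → let open F b using (_⊞_; _⊡_; coords) in ((:- (F.a b :* (Y :+ b :* g)) :- F.m b :* (:- (f :+ F.m b :* g :+ (Y :- X))))) ⊡ coords (quad (# 1) (# 0) (# 0) (con -[1+ 0 ])) ⊞ ((F.a b :* g :+ (:- (f :+ F.m b :* g :+ (Y :- X))))) ⊡ coords (quad (# 0) (# 1) (con -[1+ 0 ]) (:- b)) ⊞ ((:- (f :+ F.m b :* g :+ (Y :- X))) :- F.a b) ⊡ coords (F.E-p b (quad (# 1) (# 0) (# 0) (con -[1+ 0 ]))) ⊞ ((F.a b :* (f :+ Y :+ b :* g) :- (:- (f :+ F.m b :* g :+ (Y :- X))))) ⊡ coords (quad (# 1) (# 0) (# 1) (# 0)) ≐ F.a b ⊡ coords (vₚ f g X Y (F.E-p b (quad (# 1) (# 0) (# 0) (con -[1+ 0 ]))))) refl b f g X Y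
        ) (TP-combination T₁ T₂ (T₃ ℤ.- Z.a) T₄ T₁>0 (nn {T₂} T₂>0) h (nn {T₄} T₄>0) TP-g₁ TP-g₂ TP-g₃ TP-g₄))) (⊟-⊞ v g₃)

      split₄ : NonNeg (T₄ ℤ.- Z.a) → ⊥
      split₄ h = indecomposable bad g₄ (v ⊟ g₄) TP-g₄ (TP-⊡⁻¹ Z.a (Z.coords (v ⊟ g₄)) a>0 (subst TP (solve₄ 5 (λ b f g X Y → let open F b using (_⊞_; _⊡_; coords) in ((:- (F.a b :* (Y :+ b :* g)) :- F.m b :* (:- (f :+ F.m b :* g :+ (Y :- X))))) ⊡ coords (quad (# 1) (# 0) (# 0) (con -[1+ 0 ])) ⊞ ((F.a b :* g :+ (:- (f :+ F.m b :* g :+ (Y :- X))))) ⊡ coords (quad (# 0) (# 1) (con -[1+ 0 ]) (:- b)) ⊞ ((:- (f :+ F.m b :* g :+ (Y :- X)))) ⊡ coords (F.E-p b (quad (# 1) (# 0) (# 0) (con -[1+ 0 ]))) ⊞ ((F.a b :* (f :+ Y :+ b :* g) :- (:- (f :+ F.m b :* g :+ (Y :- X)))) :- F.a b) ⊡ coords (quad (# 1) (# 0) (# 1) (# 0)) ≐ F.a b ⊡ coords (vₚ f g X Y (quad (# 1) (# 0) (# 1) (# 0)))) refl b f g X Y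
        ) (TP-combination T₁ T₂ T₃ (T₄ ℤ.- Z.a) T₁>0 (nn {T₂} T₂>0) (nn {T₃} k>0) h TP-g₁ TP-g₂ TP-g₃ TP-g₄))) (⊟-⊞ v g₄)

      -- Now every Tᵢ lies strictly between 0 and a. But T₂ - T₃ = ag, T₁ + T₃ = as and T₄ + T₃ =
      -- at, which leaves only g = 0 and s = t = 1.
      module Inside (l₁ : NonNeg (ℤ.- (T₁ ℤ.- Z.a) ℤ.- + 1)) (l₂ : NonNeg (ℤ.- (T₂ ℤ.- Z.a) ℤ.- + 1))
        (l₃ : NonNeg (ℤ.- (T₃ ℤ.- Z.a) ℤ.- + 1)) (l₄ : NonNeg (ℤ.- (T₄ ℤ.- Z.a) ℤ.- + 1)) where
        s t : ℤ
        s = ℤ.- (Y ℤ.+ b ℤ.* g ℤ.+ (ℤ.- (f ℤ.+ Z.m ℤ.* g ℤ.+ (Y ℤ.- X))))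
        t = f ℤ.+ Y ℤ.+ b ℤ.* g

        1-g>0 : NonNeg (+ 1 ℤ.- g ℤ.- + 1)
        1-g>0 = Pos-cancelˡ Z.a (+ 1 ℤ.- g) a>0 (NonNeg-by (solve 5 (λ b f g X Y → (:- (F.a b :* g :+ (:- (f :+ F.m b :* g :+ (Y :- X))) :- F.a b) :- # 1) :+ (:- (f :+ F.m b :* g :+ (Y :- X)) :- # 1) :+ # 1 := F.a b :* (# 1 :- g) :- # 1) refl b f g X Y) (NonNeg-+ (NonNeg-+ l₂ k>0) (NonNeg-ℕ 1)))

        s≥1 : NonNeg (ℤ.- (Y ℤ.+ b ℤ.* g ℤ.+ (ℤ.- (f ℤ.+ Z.m ℤ.* g ℤ.+ (Y ℤ.- X)))) ℤ.- + 1)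
        s≥1 = Pos-cancelˡ Z.a (ℤ.- (Y ℤ.+ b ℤ.* g ℤ.+ (ℤ.- (f ℤ.+ Z.m ℤ.* g ℤ.+ (Y ℤ.- X))))) a>0 (NonNeg-by (solve 5 (λ b f g X Y → (:- (F.a b :* (Y :+ b :* g)) :- F.m b :* (:- (f :+ F.m b :* g :+ (Y :- X))) :- # 1) :+ (:- (f :+ F.m b :* g :+ (Y :- X)) :- # 1) :+ # 1 := F.a b :* (:- (Y :+ b :* g :+ (:- (f :+ F.m b :* g :+ (Y :- X))))) :- # 1) refl b f g X Y) (NonNeg-+ (NonNeg-+ T₁>0 k>0) (NonNeg-ℕ 1)))

        s≤1 : NonNeg (+ 2 ℤ.- (ℤ.- (Y ℤ.+ b ℤ.* g ℤ.+ (ℤ.- (f ℤ.+ Z.m ℤ.* g ℤ.+ (Y ℤ.- X))))) ℤ.- + 1)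
        s≤1 = Pos-cancelˡ Z.a (+ 2 ℤ.- (ℤ.- (Y ℤ.+ b ℤ.* g ℤ.+ (ℤ.- (f ℤ.+ Z.m ℤ.* g ℤ.+ (Y ℤ.- X)))))) a>0 (NonNeg-by (solve 5 (λ b f g X Y → (:- (:- (F.a b :* (Y :+ b :* g)) :- F.m b :* (:- (f :+ F.m b :* g :+ (Y :- X))) :- F.a b) :- # 1) :+ (:- (:- (f :+ F.m b :* g :+ (Y :- X)) :- F.a b) :- # 1) :+ # 1 := F.a b :* (# 2 :- (:- (Y :+ b :* g :+ (:- (f :+ F.m b :* g :+ (Y :- X)))))) :- # 1) refl b f g X Y) (NonNeg-+ (NonNeg-+ l₁ l₃) (NonNeg-ℕ 1)))

        t≥1 : NonNeg (f ℤ.+ Y ℤ.+ b ℤ.* g ℤ.- + 1)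
        t≥1 = Pos-cancelˡ Z.a (f ℤ.+ Y ℤ.+ b ℤ.* g) a>0 (NonNeg-by (solve 5 (λ b f g X Y → (F.a b :* (f :+ Y :+ b :* g) :- (:- (f :+ F.m b :* g :+ (Y :- X))) :- # 1) :+ (:- (f :+ F.m b :* g :+ (Y :- X)) :- # 1) :+ # 1 := F.a b :* (f :+ Y :+ b :* g) :- # 1) refl b f g X Y) (NonNeg-+ (NonNeg-+ T₄>0 k>0) (NonNeg-ℕ 1)))

        t≤1 : NonNeg (+ 2 ℤ.- (f ℤ.+ Y ℤ.+ b ℤ.* g) ℤ.- + 1)
        t≤1 = Pos-cancelˡ Z.a (+ 2 ℤ.- (f ℤ.+ Y ℤ.+ b ℤ.* g)) a>0 (NonNeg-by (solve 5 (λ b f g X Y → (:- (F.a b :* (f :+ Y :+ b :* g) :- (:- (f :+ F.m b :* g :+ (Y :- X))) :- F.a b) :- # 1) :+ (:- (:- (f :+ F.m b :* g :+ (Y :- X)) :- F.a b) :- # 1) :+ # 1 := F.a b :* (# 2 :- (f :+ Y :+ b :* g)) :- # 1) refl b f g X Y) (NonNeg-+ (NonNeg-+ l₄ l₃) (NonNeg-ℕ 1)))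

        g≡0 : g ≡ + 0
        g≡0 = ℤP.≤-antisym (NonNeg⇒≤ (NonNeg-by (solve 1 (λ g → # 1 :- g :- # 1 := # 0 :- g) refl g) 1-g>0)) g≥0

        s≡1 : s ≡ + 1
        s≡1 = ≡1 {s} s≥1 s≤1

        t≡1 : t ≡ + 1
        t≡1 = ≡1 {t} t≥1 t≤1

        v≡ : v ≡ quad (T₃ ℤ.+ + 2) (+ 0) (T₃ ℤ.+ + 1) (ℤ.- (T₃ ℤ.+ + 1))
        v≡ = quad-cong
          (trans (solve 5 (λ b f g X Y → f := (:- (f :+ F.m b :* g :+ (Y :- X))) :+ ((:- (Y :+ b :* g :+ (:- (f :+ F.m b :* g :+ (Y :- X))))) :+ (f :+ Y :+ b :* g))) refl b f g X Y) (cong₂ (λ x y → T₃ ℤ.+ (x ℤ.+ y)) s≡1 t≡1))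
          g≡0
          (trans (solve 5 (λ b f g X Y → X := (:- (f :+ F.m b :* g :+ (Y :- X))) :+ (f :+ Y :+ b :* g) :- g) refl b f g X Y) (trans (cong₂ (λ x y → T₃ ℤ.+ x ℤ.- y) t≡1 g≡0) (solve 1 (λ x → x :+ # 1 :- # 0 := x :+ # 1) refl T₃)))
          (trans (solve 5 (λ b f g X Y → Y := :- ((:- (f :+ F.m b :* g :+ (Y :- X))) :+ (:- (Y :+ b :* g :+ (:- (f :+ F.m b :* g :+ (Y :- X)))))) :- b :* g) refl b f g X Y) (trans (cong₂ (λ x y → ℤ.- (T₃ ℤ.+ x) ℤ.- b ℤ.* y) s≡1 g≡0) (solve 2 (λ b x → :- (x :+ # 1) :- b :* # 0 := :- (x :+ # 1)) refl b T₃)))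

        absurd : ⊥
        absurd = small-T T₃ k>0 (NonNeg-by (solve 2 (λ a x → :- (x :- a) :- # 1 := a :- x :- # 1) refl Z.a T₃) l₃) (subst Bad v≡ bad)

    absurd : ⊥
    absurd = [ split₁ , (λ l₁ → [ split₂ , (λ l₂ → [ split₃ , (λ l₃ → [ split₄ , (λ l₄ → Inside.absurd l₁ l₂ l₃ l₄) ]′
      (nonNeg? (T₄ ℤ.- Z.a))) ]′ (nonNeg? (T₃ ℤ.- Z.a))) ]′ (nonNeg? (T₂ ℤ.- Z.a))) ]′ (nonNeg? (T₁ ℤ.- Z.a))

  minimal-b⁻ : ∀ v → Bad v → Minimal v → NonNeg (c₀ v ℤ.+ Z.m ℤ.* c₁ v ℤ.+ (c₃ v ℤ.- c₂ v))
  minimal-b⁻ v bad min = [ id , (λ b⁻<0 → ⊥-elim (Beyond.absurd {c₀ v} {c₁ v} {c₂ v} {c₃ v} bad min b⁻<0)) ]′ (nonNeg? (c₀ v ℤ.+ Z.m ℤ.* c₁ v ℤ.+ (c₃ v ℤ.- c₂ v)))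

  -- The inequalities from `minimal-q`, `minimal-pq` and `minimal-b⁻` are applied to v and to its
  -- images under `S` and `W`, which are again bad and minimal.
  minimal⇒Region : ∀ v → Bad v → Minimal v → Region b v
  minimal⇒Region v@(quad f g X Y) bad min = region
    (minimal-q (Z.W v) badW minW) (minimal-q v bad min) (height>0 v (totallyPositive bad))
    (minimal-pq (Z.S v) badS minS) (minimal-pq v bad min)
    (NonNeg-by (solve 5 (λ b f g X Y → f :+ F.m b :* g :+ (:- Y :- :- X) := f :+ F.m b :* g :- (Y :- X)) refl b f g X Y) (minimal-b⁻ (Z.S v) badS minS))
    (minimal-b⁻ v bad min)
    (minimal-pq (Z.S (Z.W v)) badSW minSW) (minimal-pq (Z.W v) badW minW)
    (NonNeg-by (solve 5 (λ b f g X Y → g :+ F.m b :* f :+ (:- (Y :+ :- (b :* X)) :- :- (:- X)) := g :+ F.m b :* f :- (Y :- F.m b :* X)) refl b f g X Y) (minimal-b⁻ (Z.S (Z.W v)) badSW minSW))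
    (NonNeg-by (solve 5 (λ b f g X Y → g :+ F.m b :* f :+ (Y :+ :- (b :* X) :- :- X) := g :+ F.m b :* f :+ (Y :- F.m b :* X)) refl b f g X Y) (minimal-b⁻ (Z.W v) badW minW))
    where
    badS = Bad-S v bad
    badW = Bad-W v bad
    badSW = Bad-S (Z.W v) badW
    minS = Minimal-S v min
    minW = Minimal-W v min
    minSW = Minimal-S (Z.W v) minW

  module _ (Y : ℤ) where
    private
      v₀ = quad (+ 1) (+ 1) (+ 0) Y
      v₁ = quad (+ 1) (+ 1) (+ 1) Y
      v₂ = quad (+ 1) (+ 1) (+ 2) Y

      rest : ∀ {w w′} → w ≡ w′ → Region b w → Region b w′
      rest refl r = r

    -- On the lines f = g = 1 with X = 0 or X = 1, both ends split into a point with (f, g) = (0, 1)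
    -- and one with (f, g) = (1, 0). Between them, for 3 ≤ Y ≤ b - 3, the norm is small.
    low-0 : NonNeg Y → NonNeg (+ 2 ℤ.- Y) → ¬ Bad v₀
    low-0 lo hi bad = decompose bad (quad (+ 0) (+ 1) (+ 0) (+ 1)) (hex₀ (+ 1) (NonNeg-ℕ 2) (NonNeg-ℕ 0))
      (hex₁ (Y ℤ.- + 1) (NonNeg-by (solve 1 (λ Y → Y := Y :- # 1 :+ # 1) refl Y) lo) (NonNeg-by (solve 1 (λ Y → # 2 :- Y := # 1 :- (Y :- # 1)) refl Y) hi))

    high-0 : NonNeg (Y ℤ.- (b ℤ.- + 2)) → NonNeg (b ℤ.- Y) → ¬ Bad v₀
    high-0 lo hi bad with + 0 ℤ.≤? Z.m ℤ.- Y
    ... | yes Y≤m = decompose bad (quad (+ 0) (+ 1) (+ 1) (Z.m ℤ.+ + 0)) (hex₀′ (+ 0) (NonNeg-ℕ 0) (NonNeg-ℕ 1))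
          (hex₁⁻ (Y ℤ.- (Z.m ℤ.+ + 0)) (NonNeg-by (solve 2 (λ b Y → Y :- (b :- # 2) := Y :- (F.m b :+ # 0) :+ # 1) refl b Y) lo)
            (NonNeg-by (solve 2 (λ b Y → F.m b :- Y := :- (Y :- (F.m b :+ # 0))) refl b Y) Y≤m))
    ... | no Y≰m = decompose bad (quad (+ 0) (+ 1) (+ 1) (Z.m ℤ.+ + 1)) (hex₀′ (+ 1) (NonNeg-ℕ 1) (NonNeg-ℕ 0))
          (hex₁⁻ (Y ℤ.- (Z.m ℤ.+ + 1)) (NonNeg-by (solve 2 (λ b Y → :- (F.m b :- Y) :- # 1 :+ # 1 := Y :- (F.m b :+ # 1) :+ # 1) refl b Y) (NonNeg-+ (¬NonNeg⇒ Y≰m) (NonNeg-ℕ 1)))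
            (NonNeg-by (solve 2 (λ b Y → b :- Y := :- (Y :- (F.m b :+ # 1))) refl b Y) hi))

    low-1 : NonNeg (Y ℤ.+ + 1) → NonNeg (+ 2 ℤ.- Y) → ¬ Bad v₁
    low-1 lo hi bad with + 0 ℤ.≤? ℤ.- Y
    ... | yes Y≤0 = decompose bad (quad (+ 0) (+ 1) (+ 0) Y) (hex₀ Y lo (NonNeg-by (solve 1 (λ Y → :- Y :+ # 1 := # 1 :- Y) refl Y) (NonNeg-+ Y≤0 (NonNeg-ℕ 1))))
          (rest (quad-cong refl refl refl (sym (ℤP.+-inverseʳ Y))) (hex₁⁺ (+ 0) (NonNeg-ℕ 0) (NonNeg-ℕ 1)))
    ... | no Y≰0 = decompose bad (quad (+ 0) (+ 1) (+ 0) (Y ℤ.- + 1))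
          (hex₀ (Y ℤ.- + 1) (NonNeg-by (solve 1 (λ Y → :- (:- Y) :- # 1 :+ # 1 := Y :- # 1 :+ # 1) refl Y) (NonNeg-+ (¬NonNeg⇒ Y≰0) (NonNeg-ℕ 1)))
            (NonNeg-by (solve 1 (λ Y → # 2 :- Y := # 1 :- (Y :- # 1)) refl Y) hi))
          (rest (quad-cong refl refl refl (solve 1 (λ Y → # 1 := Y :- (Y :- # 1)) refl Y)) (hex₁⁺ (+ 1) (NonNeg-ℕ 1) (NonNeg-ℕ 0)))

    high-1 : NonNeg (Y ℤ.- (b ℤ.- + 2)) → NonNeg (b ℤ.+ + 1 ℤ.- Y) → ¬ Bad v₁
    high-1 lo hi bad with + 0 ℤ.≤? b ℤ.- Y
    ... | yes Y≤b = decompose bad (quad (+ 0) (+ 1) (+ 1) (Z.m ℤ.+ + 0)) (hex₀′ (+ 0) (NonNeg-ℕ 0) (NonNeg-ℕ 1))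
          (hex₁ (Y ℤ.- (Z.m ℤ.+ + 0)) (NonNeg-by (solve 2 (λ b Y → Y :- (b :- # 2) := Y :- (F.m b :+ # 0) :+ # 1) refl b Y) lo)
            (NonNeg-by (solve 2 (λ b Y → b :- Y := # 1 :- (Y :- (F.m b :+ # 0))) refl b Y) Y≤b))
    ... | no Y≰b = decompose bad (quad (+ 0) (+ 1) (+ 1) (Z.m ℤ.+ + 1)) (hex₀′ (+ 1) (NonNeg-ℕ 1) (NonNeg-ℕ 0))
          (hex₁ (Y ℤ.- (Z.m ℤ.+ + 1)) (NonNeg-by (solve 2 (λ b Y → :- (b :- Y) :- # 1 :+ # 2 := Y :- (F.m b :+ # 1) :+ # 1) refl b Y) (NonNeg-+ (¬NonNeg⇒ Y≰b) (NonNeg-ℕ 2)))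
            (NonNeg-by (solve 2 (λ b Y → b :+ # 1 :- Y := # 1 :- (Y :- (F.m b :+ # 1))) refl b Y) hi))

    -- The line X = 2 meets the cone only for m ≤ Y ≤ b + 1, so short a range that every point on it
    -- splits.
    all-2 : NonNeg (Y ℤ.- Z.m) → NonNeg (b ℤ.+ + 1 ℤ.- Y) → ¬ Bad v₂
    all-2 lo hi bad with + 0 ℤ.≤? b ℤ.- Y
    ... | yes Y≤b = decompose bad (quad (+ 0) (+ 1) (+ 1) (Z.m ℤ.+ + 0)) (hex₀′ (+ 0) (NonNeg-ℕ 0) (NonNeg-ℕ 1))
          (hex₁⁺ (Y ℤ.- (Z.m ℤ.+ + 0)) (NonNeg-by (solve 2 (λ b Y → Y :- F.m b := Y :- (F.m b :+ # 0)) refl b Y) lo)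
            (NonNeg-by (solve 2 (λ b Y → b :- Y := # 1 :- (Y :- (F.m b :+ # 0))) refl b Y) Y≤b))
    ... | no Y≰b = decompose bad (quad (+ 0) (+ 1) (+ 1) (Z.m ℤ.+ + 1)) (hex₀′ (+ 1) (NonNeg-ℕ 1) (NonNeg-ℕ 0))
          (hex₁⁺ (Y ℤ.- (Z.m ℤ.+ + 1)) (NonNeg-by (solve 2 (λ b Y → :- (b :- Y) :- # 1 :+ # 1 := Y :- (F.m b :+ # 1)) refl b Y) (NonNeg-+ (¬NonNeg⇒ Y≰b) (NonNeg-ℕ 1)))
            (NonNeg-by (solve 2 (λ b Y → b :+ # 1 :- Y := # 1 :- (Y :- (F.m b :+ # 1))) refl b Y) hi))

    center-0 : NonNeg Y → NonNeg (b ℤ.- Y) → ¬ Bad v₀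
    center-0 lo hi bad with + 0 ℤ.≤? + 2 ℤ.- Y | + 0 ℤ.≤? b ℤ.- + 3 ℤ.- Y
    ... | yes Y≤2 | _ = low-0 lo Y≤2 bad
    ... | no Y≰2 | yes Y≤ = small-0 Y (NonNeg-by (solve 1 (λ Y → :- (# 2 :- Y) :- # 1 := Y :- # 3) refl Y) (¬NonNeg⇒ Y≰2)) Y≤ bad
    ... | no _ | no Y≰ = high-0 (NonNeg-by (solve 2 (λ b Y → :- (b :- # 3 :- Y) :- # 1 := Y :- (b :- # 2)) refl b Y) (¬NonNeg⇒ Y≰)) hi bad

    center-1 : NonNeg (Y ℤ.+ + 1) → NonNeg (b ℤ.+ + 1 ℤ.- Y) → ¬ Bad v₁
    center-1 lo hi bad with + 0 ℤ.≤? + 2 ℤ.- Y | + 0 ℤ.≤? b ℤ.- + 3 ℤ.- Y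
    ... | yes Y≤2 | _ = low-1 lo Y≤2 bad
    ... | no Y≰2 | yes Y≤ = small-1 Y (NonNeg-by (solve 1 (λ Y → :- (# 2 :- Y) :- # 1 := Y :- # 3) refl Y) (¬NonNeg⇒ Y≰2)) Y≤ bad
    ... | no _ | no Y≰ = high-1 (NonNeg-by (solve 2 (λ b Y → :- (b :- # 3 :- Y) :- # 1 := Y :- (b :- # 2)) refl b Y) (¬NonNeg⇒ Y≰)) hi bad

  private
    b²-1≥0 : NonNeg (b ℤ.* b ℤ.- + 1)
    b²-1≥0 = NonNeg-by (solve 1 (λ b → b :* (b :- # 13) :+ # 13 :* (b :- # 13) :+ # 168 := b :* b :- # 1) refl b)
      (NonNeg-+ (NonNeg-+ (NonNeg-* b≥0 13≤b) (NonNeg-* (NonNeg-ℕ 13) 13≤b)) (NonNeg-ℕ 168))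

    b²-4≥0 : NonNeg (b ℤ.* b ℤ.- + 4)
    b²-4≥0 = NonNeg-by (solve 1 (λ b → b :* (b :- # 13) :+ # 13 :* (b :- # 13) :+ # 165 := b :* b :- # 4) refl b)
      (NonNeg-+ (NonNeg-+ (NonNeg-* b≥0 13≤b) (NonNeg-* (NonNeg-ℕ 13) 13≤b)) (NonNeg-ℕ 165))

    -- Points of height 1 are excluded by their norms and not by splitting: on this hexagon the
    -- norms are b² at the centre and 1 or 4 at the vertices.
    hex₀-0 : ∀ Y → NonNeg Y → NonNeg (+ 1 ℤ.- Y) → ¬ Bad (quad (+ 0) (+ 1) (+ 0) Y)
    hex₀-0 = bit-elim (λ Y → ¬ Bad (quad (+ 0) (+ 1) (+ 0) Y))
      (small-hex₀ (quad (+ 0) (+ 1) (+ 0) (+ 0)) (b ℤ.* b) (solve 1 (λ b → normₚ b (quad (# 0) (# 1) (# 0) (# 0)) := # 16 :* (b :* b)) refl b)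
        (NonNeg-by (sym (ℤP.+-inverseʳ (b ℤ.* b))) (NonNeg-ℕ 0)))
      (small-hex₀ (quad (+ 0) (+ 1) (+ 0) (+ 1)) (+ 1) (solve 1 (λ b → normₚ b (quad (# 0) (# 1) (# 0) (# 1)) := # 16 :* # 1) refl b) b²-1≥0)

    hex₀-1 : ∀ s → NonNeg s → NonNeg (+ 1 ℤ.- s) → ¬ Bad (quad (+ 0) (+ 1) (+ 1) (Z.m ℤ.+ s))
    hex₀-1 = bit-elim (λ s → ¬ Bad (quad (+ 0) (+ 1) (+ 1) (Z.m ℤ.+ s)))
      (small-hex₀ (quad (+ 0) (+ 1) (+ 1) (Z.m ℤ.+ + 0)) (+ 4) (solve 1 (λ b → normₚ b (quad (# 0) (# 1) (# 1) (F.m b :+ # 0)) := # 16 :* # 4) refl b) b²-4≥0)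
      (small-hex₀ (quad (+ 0) (+ 1) (+ 1) (Z.m ℤ.+ + 1)) (+ 1) (solve 1 (λ b → normₚ b (quad (# 0) (# 1) (# 1) (F.m b :+ # 1)) := # 16 :* # 1) refl b) b²-1≥0)

    NormalizedRegion : ℤ⁴ → Set
    NormalizedRegion v = Bad v → Region b v → NonNeg (c₀ v ℤ.+ c₁ v ℤ.- c₂ v) → (c₂ v ≡ + 0 → NonNeg (c₃ v)) → ⊥

    f≡0-absurd : ∀ X Y → NonNeg X → NormalizedRegion (quad (+ 0) (+ 1) X Y)
    f≡0-absurd X Y X≥0 bad R X≤1 = bit-elim (λ X → Bad (quad (+ 0) (+ 1) X Y) → Region b (quad (+ 0) (+ 1) X Y) → (X ≡ + 0 → NonNeg Y) → ⊥)
      (λ bad R Y≥0 → hex₀-0 Y (Y≥0 refl) (NonNeg-by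
        (solve 2 (λ b Y → # 1 :+ F.m b :* # 0 :- (Y :- F.m b :* # 0) := # 1 :- Y) refl b Y) (Region.d⁺ R)) bad)
      (λ bad R _ → hex₀-1 (Y ℤ.- Z.m)
        (NonNeg-by (solve 2 (λ b Y → # 1 :+ b :* # 0 :+ (Y :- b :* # 1) := Y :- F.m b) refl b Y) (Region.c⁻ R))
        (NonNeg-by (solve 2 (λ b Y → # 0 :+ b :* # 1 :- Y := # 1 :- (Y :- F.m b)) refl b Y) (Region.a⁺ R))
        (subst Bad (quad-cong refl refl refl (solve 2 (λ m Y → Y := m :+ (Y :- m)) refl Z.m Y)) bad))
      X X≥0 X≤1 bad R

    f≡1-absurd : ∀ X Y → NonNeg X → NormalizedRegion (quad (+ 1) (+ 1) X Y)
    f≡1-absurd X Y X≥0 bad R X≤2 = trit-elim (λ X → Bad (quad (+ 1) (+ 1) X Y) → Region b (quad (+ 1) (+ 1) X Y) → (X ≡ + 0 → NonNeg Y) → ⊥)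
      (λ bad R Y≥0 → center-0 Y (Y≥0 refl) (NonNeg-by
        (solve 2 (λ b Y → # 1 :+ F.m b :* # 1 :- (Y :- # 0) := b :- Y) refl b Y) (Region.b⁺ R)) bad)
      (λ bad R _ → center-1 Y
        (NonNeg-by (solve 2 (λ b Y → # 1 :+ b :* # 1 :+ (Y :- b :* # 1) := Y :+ # 1) refl b Y) (Region.c⁻ R))
        (NonNeg-by (solve 2 (λ b Y → # 1 :+ b :* # 1 :- Y := b :+ # 1 :- Y) refl b Y) (Region.a⁺ R)) bad)
      (λ bad R _ → all-2 Y
        (NonNeg-by (solve 2 (λ b Y → # 1 :+ b :* # 1 :+ (Y :- b :* # 2) := Y :- F.m b) refl b Y) (Region.c⁻ R))
        (NonNeg-by (solve 2 (λ b Y → # 1 :+ b :* # 1 :- Y := b :+ # 1 :- Y) refl b Y) (Region.a⁺ R)) bad)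
      X X≥0 X≤2 bad R

    g≤1-absurd : ∀ f g X Y → NonNeg f → NonNeg g → NonNeg (+ 1 ℤ.- g) → NonNeg (g ℤ.- f) → NonNeg X → NormalizedRegion (quad f g X Y)
    g≤1-absurd f g X Y f≥0 g≥0 g≤1 f≤g X≥0 = bit-elim (λ g → NonNeg (g ℤ.- f) → NormalizedRegion (quad f g X Y))
      (λ f≤0 _ R _ _ → ¬NonNeg-1 (NonNeg-by (solve 1 (λ f → f :+ # 0 :- # 1 :+ (# 0 :- f) := con -[1+ 0 ]) refl f) (NonNeg-+ (Region.f+g≥1 R) f≤0)))
      (λ f≤1 → bit-elim (λ f → NormalizedRegion (quad f (+ 1) X Y)) (f≡0-absurd X Y X≥0) (f≡1-absurd X Y X≥0) f f≥0 f≤1)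
      g g≥0 g≤1 f≤g

    normalized-absurd : ∀ v → Bad v → Minimal v → NonNeg (c₁ v ℤ.- c₀ v) → NonNeg (c₂ v) → (c₂ v ≡ + 0 → NonNeg (c₃ v)) → ⊥
    normalized-absurd v bad min f≤g X≥0 X≡0⇒Y≥0 =
      [ (λ g≥2 → g≥2-absurd {f} {g} {X} {Y} bad R g≥2 f≤g X≥0 X≤h X≡0⇒Y≥0)
      , (λ g<2 → g≤1-absurd f g X Y (Region.f≥0 R) (Region.g≥0 R) (NonNeg-by (solve 1 (λ g → :- (g :- # 2) :- # 1 := # 1 :- g) refl g) g<2) f≤g X≥0 bad R X≤h X≡0⇒Y≥0)
      ]′ (nonNeg? (g ℤ.- + 2))
      where
      open Quad v renaming (c₀ to f; c₁ to g; c₂ to X; c₃ to Y)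
      R : Region b v
      R = minimal⇒Region v bad min
      X≤h : NonNeg (f ℤ.+ g ℤ.- X)
      X≤h = minimal-p (Z.S v) (Bad-S v bad) (Minimal-S v min)

    -- Since `S` negates X and Y together, the pair may be assumed lexicographically nonnegative: X
    -- > 0, or X = 0 and Y ≥ 0.
    f≤g-absurd : ∀ v → Bad v → Minimal v → NonNeg (c₁ v ℤ.- c₀ v) → ⊥
    f≤g-absurd v bad min f≤g =
      [ (λ X≥0 → [ (λ X≤0 → [ (λ Y≥0 → direct X≥0 (λ _ → Y≥0)) , (λ Y<0 → mirrored X≤0 (λ _ → <0⇒≤0 (c₃ v) Y<0)) ]′ (nonNeg? (c₃ v)))
          , (λ X>0 → direct X≥0 (λ X≡0 → ⊥-elim (¬NonNeg-1 (subst (λ z → NonNeg (ℤ.- (ℤ.- z) ℤ.- + 1)) X≡0 X>0)))) ]′ (nonNeg? (ℤ.- c₂ v)))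
      , (λ X<0 → mirrored (<0⇒≤0 (c₂ v) X<0) (λ -X≡0 → ⊥-elim (¬NonNeg-1 (subst (λ z → NonNeg (z ℤ.- + 1)) -X≡0 X<0))))
      ]′ (nonNeg? (c₂ v))
      where
      direct : NonNeg (c₂ v) → (c₂ v ≡ + 0 → NonNeg (c₃ v)) → ⊥
      direct = normalized-absurd v bad min f≤g
      mirrored : NonNeg (ℤ.- c₂ v) → (ℤ.- c₂ v ≡ + 0 → NonNeg (ℤ.- c₃ v)) → ⊥
      mirrored = normalized-absurd (Z.S v) (Bad-S v bad) (Minimal-S v min) f≤g

    minimal-absurd : ∀ v → Bad v → Minimal v → ⊥
    minimal-absurd v bad min =
      [ f≤g-absurd v bad min
      , (λ g<f → f≤g-absurd (Z.W v) (Bad-W v bad) (Minimal-W v min) (NonNeg-by (solve 2 (λ f g → :- (g :- f) := f :- g) refl (c₀ v) (c₁ v)) (<0⇒≤0 (c₁ v ℤ.- c₀ v) g<f)))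
      ]′ (nonNeg? (c₁ v ℤ.- c₀ v))

    -- No minimal point has to be found. The goal is absurdity, so v may be treated as minimal: a
    -- bad point of smaller height is refuted by the induction hypothesis.
    descent : ∀ n v → NonNeg (+ n ℤ.- height v) → Bad v → ⊥
    descent zero v h≤0 bad = ¬NonNeg-1 (NonNeg-by (solve 1 (λ h → # 0 :- h :+ (h :- # 1) := con -[1+ 0 ]) refl (height v)) (NonNeg-+ h≤0 (height>0 v (totallyPositive bad))))
    descent (suc n) v h≤n bad = minimal-absurd v bad λ w badw →
      [ id , (λ h′<h → ⊥-elim (descent n w (NonNeg-by
            (solve 3 (λ n h h′ → # 1 :+ n :- h :+ (:- (h′ :- h) :- # 1) := n :- h′) refl (+ n) (height v) (height w))
            (NonNeg-+ h≤n h′<h)) badw)) ]′ (nonNeg? (height w ℤ.- height v))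

  no-bad : ∀ v → ¬ Bad v
  no-bad v bad = descent ℤ.∣ height v ∣ v (≤⇒NonNeg (i≤∣i∣ (height v))) bad
    where
    i≤∣i∣ : ∀ i → i ℤ.≤ + ℤ.∣ i ∣
    i≤∣i∣ (+ n) = ℤP.≤-refl
    i≤∣i∣ -[1+ n ] = ℤ.-≤+

  -- The inequality is decidable, so refuting its negation is enough.
  indecomposable⇒normForm≤ : ∀ v → TP (Z.coords v) → (∀ w w′ → TP (Z.coords w) → TP (Z.coords w′) → v ≡ w Z.⊞ w′ → ⊥) →
    Z.normForm (Z.coords v) ℤ.≤ 16*maxNorm b
  indecomposable⇒normForm≤ v tv indec = decidable-stable (Z.normForm (Z.coords v) ℤ.≤? 16*maxNorm b)
    λ large → no-bad v record { totallyPositive = tv ; indecomposable = indec ; large = large }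

-- The norm as a quartic form with integer coefficients.

module NormIdentities (R : CommutativeRing 0ℓ 0ℓ) where
  open CommutativeRing R using (Carrier; _+_; _*_; -_; _≈_; 0#; 1#; +-cong; *-cong; *-identityˡ) renaming (refl to ≈-refl; trans to trans′)
  open IntegerCoefficients R

  pairConjugates : ∀ t x y z w → t * (t * (t * (x * y * z * w))) ≈ (t * ((t * x) * z)) * ((t * y) * w)
  pairConjugates = solve 5 (λ t x y z w → t :* (t :* (t :* (x :* y :* z :* w))) := (t :* ((t :* x) :* z)) :* ((t :* y) :* w)) ≈-refl

  scaleProduct : ∀ t x y → t * (t * (t * (t * (t * (t * (t * (x * y))))))) ≈ (t * (t * (t * (t * x)))) * (t * (t * (t * y)))
  scaleProduct = solve 3 (λ t x y → t :* (t :* (t :* (t :* (t :* (t :* (t :* (x :* y))))))) := (t :* (t :* (t :* (t :* x)))) :* (t :* (t :* (t :* y)))) ≈-refl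

  -- α is a root of (x² - (α + β)x + αβ)(x² - sx + d).
  quartic : ∀ α β s d → (((1# * α + - ((α + β) + s)) * α + ((α * β + d) + (α + β) * s)) * α + - ((α + β) * d + s * (α * β))) * α + α * β * d ≈ 0#
  quartic α β s d = trans′ (+-cong (*-cong (+-cong (*-cong (+-cong (*-cong (+-cong (*-identityˡ α) ≈-refl) ≈-refl) ≈-refl) ≈-refl) ≈-refl) ≈-refl) ≈-refl)
    (solve 4 (λ α β s d → (((α :+ :- ((α :+ β) :+ s)) :* α :+ ((α :* β :+ d) :+ (α :+ β) :* s)) :* α :+ :- ((α :+ β) :* d :+ s :* (α :* β))) :* α :+ α :* β :* d := # 0) ≈-refl α β s d)

-- The field enters only through an abstract ring, which keeps its operations from being unfolded.
module NormForm (b : ℤ) {K : Set} {_+K_ _*K_ : K → K → K} { -K_ : K → K} {0K 1K : K} (isCR : IsCommutativeRing _≡_ _+K_ _*K_ -K_ 0K 1K)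
  (κ : ℤ⁴ → K) (κ-* : ∀ x y z → IsProduct b x y z → κ x *K κ y ≡ κ z)
  where
  open SyntacticFormulas
  module Z = Formulas ℤ-operations b

  private
    K-ring : CommutativeRing 0ℓ 0ℓ
    K-ring = record { isCommutativeRing = isCR }
    module KI = NormIdentities K-ring

  norm : ℤ⁴ → K
  norm x = ((κ x *K κ (flip true false x)) *K κ (flip false true x)) *K κ (flip false false x)

  -- The number 2, since quadruples carry a factor 1/2.
  two : K
  two = κ (rational (+ 4))

  two-κ : ∀ x → two *K κ x ≡ κ (+ 2 Z.⊡ x)
  two-κ x = κ-* (rational (+ 4)) x (+ 2 Z.⊡ x) (CoordinateIdentities.rational·⊡ b (+ 2) x)

  two-κ-* : ∀ x y → (two *K κ x) *K κ y ≡ κ (Z.twiceProduct x y)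
  two-κ-* x y = trans (cong (_*K κ y) (two-κ x)) (κ-* (+ 2 Z.⊡ x) y (Z.twiceProduct x y) (CoordinateIdentities.twiceProduct-2⊡ b x y))

  private
    relative : ∀ x → Z.twiceProduct x (flip false true x) ≡ quad (Z.normA x) (+ 0) (+ 2 ℤ.* Z.normE x) (+ 0)
    relative (quad x₀ x₁ x₂ x₃) = solve₄ 5 (λ b x₀ x₁ x₂ x₃ → let open F b; x = quad x₀ x₁ x₂ x₃ in twiceProduct x (negate₁₃ x) ≐ quad (normA x) (# 0) (# 2 :* normE x) (# 0)) refl b x₀ x₁ x₂ x₃

    relative′ : ∀ x → Z.twiceProduct (flip true false x) (flip false false x) ≡ quad (Z.normA x) (+ 0) (ℤ.- (+ 2 ℤ.* Z.normE x)) (+ 0)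
    relative′ (quad x₀ x₁ x₂ x₃) = solve₄ 5 (λ b x₀ x₁ x₂ x₃ → let open F b; x = quad x₀ x₁ x₂ x₃ in twiceProduct (negate₂₃ x) (negate₁₂ x) ≐ quad (normA x) (# 0) (:- (# 2 :* normE x)) (# 0)) refl b x₀ x₁ x₂ x₃

    absolute : ∀ A E → Z.twiceProduct (quad A (+ 0) (+ 2 ℤ.* E) (+ 0)) (quad A (+ 0) (ℤ.- (+ 2 ℤ.* E)) (+ 0)) ≡ rational (A ℤ.* A ℤ.+ ℤ.- (+ 4 ℤ.* Z.q ℤ.* (E ℤ.* E)))
    absolute A E = solve₄ 3 (λ b A E → let open F b in twiceProduct (quad A (# 0) (# 2 :* E) (# 0)) (quad A (# 0) (:- (# 2 :* E)) (# 0)) ≐ quad (A :* A :+ :- (# 4 :* q :* (E :* E))) (# 0) (# 0) (# 0)) refl b A E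

  -- Every product formed by `twiceProduct` costs one factor 2: one for each of the two conjugate
  -- relative norms and one for their product.
  8*norm : ∀ x → two *K (two *K (two *K norm x)) ≡ κ (rational (Z.normForm x))
  8*norm x = begin
    two *K (two *K (two *K norm x))
      ≡⟨ KI.pairConjugates two (κ x) (κ (flip true false x)) (κ (flip false true x)) (κ (flip false false x)) ⟩
    (two *K ((two *K κ x) *K κ (flip false true x))) *K ((two *K κ (flip true false x)) *K κ (flip false false x))
      ≡⟨ cong₂ (λ u w → (two *K u) *K w) (trans (two-κ-* x (flip false true x)) (cong κ (relative x)))
           (trans (two-κ-* (flip true false x) (flip false false x)) (cong κ (relative′ x))) ⟩
    (two *K κ (quad (Z.normA x) (+ 0) (+ 2 ℤ.* Z.normE x) (+ 0))) *K κ (quad (Z.normA x) (+ 0) (ℤ.- (+ 2 ℤ.* Z.normE x)) (+ 0))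
      ≡⟨ trans (two-κ-* (quad (Z.normA x) (+ 0) (+ 2 ℤ.* Z.normE x) (+ 0)) (quad (Z.normA x) (+ 0) (ℤ.- (+ 2 ℤ.* Z.normE x)) (+ 0))) (cong κ (absolute (Z.normA x) (Z.normE x))) ⟩
    κ (rational (Z.normForm x)) ∎
    where open ≡-Reasoning

  private
    rational-product : ∀ s t → Z.twiceProduct (rational s) (rational t) ≡ rational (s ℤ.* t)
    rational-product s t = solve₄ 3 (λ b s t → let open F b in twiceProduct (quad s (# 0) (# 0) (# 0)) (quad t (# 0) (# 0) (# 0)) ≐ quad (s :* t) (# 0) (# 0) (# 0)) refl b s t

  -- Transported from the multiplicativity of the field norm, which avoids expanding an identity of
  -- degree 4 in each of x and y.
  normForm-* : (∀ {s t} → κ (rational s) ≡ κ (rational t) → s ≡ t) →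
    (∀ x y z → κ x *K κ y ≡ κ z → norm z ≡ norm x *K norm y) →
    ∀ x y z → Z.twiceProduct x y ≡ + 2 Z.⊡ z → + 16 ℤ.* Z.normForm z ≡ Z.normForm x ℤ.* Z.normForm y
  normForm-* κ-injective norm-* x y z eq = κ-injective (begin
    κ (rational (+ 16 ℤ.* nz))
      ≡⟨ cong κ (quad-cong (solve 1 (λ n → # 16 :* n := # 2 :* (# 2 :* (# 2 :* (# 2 :* n)))) refl nz) refl refl refl) ⟩
    κ (+ 2 Z.⊡ (+ 2 Z.⊡ (+ 2 Z.⊡ (+ 2 Z.⊡ rational nz))))
      ≡⟨ sym (two⁴ (rational nz)) ⟩
    two *K (two *K (two *K (two *K κ (rational nz))))
      ≡⟨ cong (λ u → two *K (two *K (two *K (two *K u)))) (sym (8*norm z)) ⟩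
    two *K (two *K (two *K (two *K (two *K (two *K (two *K norm z))))))
      ≡⟨ cong (λ u → two *K (two *K (two *K (two *K (two *K (two *K (two *K u))))))) (norm-* x y z (κ-* x y z eq)) ⟩
    two *K (two *K (two *K (two *K (two *K (two *K (two *K (norm x *K norm y)))))))
      ≡⟨ KI.scaleProduct two (norm x) (norm y) ⟩
    (two *K (two *K (two *K (two *K norm x)))) *K (two *K (two *K (two *K norm y)))
      ≡⟨ cong₂ (λ u w → (two *K u) *K w) (8*norm x) (8*norm y) ⟩
    (two *K κ (rational nx)) *K κ (rational ny)
      ≡⟨ trans (two-κ-* (rational nx) (rational ny)) (cong κ (rational-product nx ny)) ⟩
    κ (rational (nx ℤ.* ny)) ∎)
    where
    open ≡-Reasoning
    nx = Z.normForm x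
    ny = Z.normForm y
    nz = Z.normForm z
    two⁴ : ∀ w → two *K (two *K (two *K (two *K κ w))) ≡ κ (+ 2 Z.⊡ (+ 2 Z.⊡ (+ 2 Z.⊡ (+ 2 Z.⊡ w))))
    two⁴ w = trans (cong (λ u → two *K (two *K (two *K u))) (two-κ w)) (trans (cong (λ u → two *K (two *K u)) (two-κ (+ 2 Z.⊡ w)))
      (trans (cong (two *K_) (two-κ (+ 2 Z.⊡ (+ 2 Z.⊡ w)))) (two-κ (+ 2 Z.⊡ (+ 2 Z.⊡ (+ 2 Z.⊡ w))))))

module FieldNorm (b : ℤ) (p q : ℚ)
  (p≡ : p ≡ ℤtoℚ ((b ℤ.+ -[1+ 1 ]) ℤ.* b)) (q≡ : q ≡ ℤtoℚ ((b ℤ.+ -[1+ 1 ]) ℤ.* (b ℤ.+ + 2)))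
  (a≢0 : ℤtoℚ (b ℤ.+ -[1+ 1 ]) ≢ 0ℚ) (theory : BiquadraticTheory p q)
  where
  open Biquad p q
  open Embedding b p q p≡ q≡ a≢0
  open BiquadraticTheory theory
  module Z = Formulas ℤ-operations b

  private
    module A = NormForm b K-isCR κ κ-*

    normK-κ : ∀ x → normK (κ x) ≡ A.norm x
    normK-κ x = cong₂ _*K_ (cong₂ _*K_ (cong₂ _*K_ (conj-κ true true x) (conj-κ true false x)) (conj-κ false true x)) (conj-κ false false x)

    κ-rational-injective : ∀ {s t} → κ (rational s) ≡ κ (rational t) → s ≡ t
    κ-rational-injective {s} {t} eq = ℤtoℚ-injective (begin
      ℤtoℚ s                            ≡⟨ sym (double s) ⟩
      ℤtoℚ (+ 2) ℚ.* (½ ℚ.* ℤtoℚ s)     ≡⟨ cong (λ x → ℤtoℚ (+ 2) ℚ.* re (fst x)) eq ⟩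
      ℤtoℚ (+ 2) ℚ.* (½ ℚ.* ℤtoℚ t)     ≡⟨ double t ⟩
      ℤtoℚ t                            ∎)
      where
      open ≡-Reasoning
      double : ∀ s → ℤtoℚ (+ 2) ℚ.* (½ ℚ.* ℤtoℚ s) ≡ ℤtoℚ s
      double s = trans (sym (ℚP.*-assoc (ℤtoℚ (+ 2)) ½ (ℤtoℚ s))) (ℚP.*-identityˡ (ℤtoℚ s))

    norm-* : ∀ x y z → κ x *K κ y ≡ κ z → A.norm z ≡ A.norm x *K A.norm y
    norm-* x y z eq = begin
      A.norm z                      ≡⟨ sym (normK-κ z) ⟩
      normK (κ z)                   ≡⟨ cong normK {κ z} {κ x *K κ y} (sym eq) ⟩
      normK (κ x *K κ y)            ≡⟨ normK-* (κ x) (κ y) ⟩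
      normK (κ x) *K normK (κ y)    ≡⟨ cong₂ _*K_ {normK (κ x)} {A.norm x} {normK (κ y)} {A.norm y} (normK-κ x) (normK-κ y) ⟩
      A.norm x *K A.norm y          ∎
      where open ≡-Reasoning

  normForm-* : ∀ x y z → Z.twiceProduct x y ≡ + 2 Z.⊡ z → + 16 ℤ.* Z.normForm z ≡ Z.normForm x ℤ.* Z.normForm y
  normForm-* = A.normForm-* κ-rational-injective norm-*

  private
    re-two : ∀ y → re (fst (A.two *K y)) ≡ ℤtoℚ (+ 2) ℚ.* re (fst y)
    re-two ⟪ ⟨ x , y ⟩ , ⟨ z , w ⟩ ⟫ = trans (cong (λ u → ℤtoℚ (+ 2) ℚ.* x ℚ.+ 0ℚ ℚ.* y ℚ.* p ℚ.+ ((0ℚ ℚ.* z ℚ.+ u ℚ.* w ℚ.* p) ℚ.* q ℚ.+ (0ℚ ℚ.* w ℚ.+ u ℚ.* z) ℚ.* 0ℚ ℚ.* p)) (ℚP.*-zeroʳ (½ ℚ.* 1/a)))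
      (solve 7 (λ t x y z w p q → t :* x :+ o :* y :* p :+ ((o :* z :+ o :* w :* p) :* q :+ (o :* w :+ o :* z) :* o :* p) := t :* x) refl (ℤtoℚ (+ 2)) x y z w p q)
      where
      open ℚ-Solver
      o : ∀ {n} → Polynomial n
      o = # 0

    scale : ∀ t n y₁ y₂ y₃ → y₁ ≡ t ℚ.* n → y₂ ≡ t ℚ.* y₁ → y₃ ≡ t ℚ.* y₂ → t ℚ.* y₃ ≡ t ℚ.* t ℚ.* t ℚ.* t ℚ.* n
    scale t n _ _ _ refl refl refl = solve 2 (λ t n → t :* (t :* (t :* (t :* n))) := t :* t :* t :* t :* n) refl t n
      where open ℚ-Solver

  16*N : ∀ x → ℤtoℚ (+ 16) ℚ.* N (κ x) ≡ ℤtoℚ (Z.normForm x)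
  16*N x = begin
    ℤtoℚ (+ 16) ℚ.* N (κ x)
      ≡⟨ cong (λ y → ℤtoℚ (+ 16) ℚ.* re (fst y)) (normK-κ x) ⟩
    ℤtoℚ (+ 16) ℚ.* re (fst n)
      ≡⟨ sym (scale t (re (fst n)) (re (fst (A.two *K n))) (re (fst (A.two *K (A.two *K n)))) (re (fst (A.two *K (A.two *K (A.two *K n))))) (re-two n) (re-two (A.two *K n)) (re-two (A.two *K (A.two *K n)))) ⟩
    t ℚ.* re (fst (A.two *K (A.two *K (A.two *K n))))
      ≡⟨ cong (λ y → t ℚ.* re (fst y)) (A.8*norm x) ⟩
    t ℚ.* (½ ℚ.* ℤtoℚ (Z.normForm x))
      ≡⟨ trans (sym (ℚP.*-assoc t ½ (ℤtoℚ (Z.normForm x)))) (ℚP.*-identityˡ (ℤtoℚ (Z.normForm x))) ⟩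
    ℤtoℚ (Z.normForm x) ∎
    where
    open ≡-Reasoning
    t = ℤtoℚ (+ 2)
    n = A.norm x

-- Lattice points are algebraic integers.

module CharacteristicPolynomial (b : ℤ) {K : Set} {_+K_ _*K_ : K → K → K} { -K_ : K → K} {0K 1K : K} (isCR : IsCommutativeRing _≡_ _+K_ _*K_ -K_ 0K 1K)
  (κ : ℤ⁴ → K) (κ-* : ∀ x y z → IsProduct b x y z → κ x *K κ y ≡ κ z)
  (κ-⊞ : ∀ x y → κ x +K κ y ≡ κ (Formulas._⊞_ ℤ-operations b x y)) (κ-0 : κ (rational (+ 0)) ≡ 0K)
  where
  open SyntacticFormulas
  module Z = Formulas ℤ-operations b

  private
    R : CommutativeRing 0ℓ 0ℓ
    R = record { isCommutativeRing = isCR }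
    module KI = NormIdentities R
    open import Algebra.Properties.Group (CommutativeRing.+-group R) using (inverseʳ-unique)

    κ-neg : ∀ s → κ (rational (ℤ.- s)) ≡ -K κ (rational s)
    κ-neg s = inverseʳ-unique (κ (rational s)) (κ (rational (ℤ.- s)))
      (trans (κ-⊞ (rational s) (rational (ℤ.- s))) (trans (cong (λ z → κ (rational z)) (ℤP.+-inverseʳ s)) κ-0))

  -- `A≡` makes the relative norm equal to (G + E√q)/2 with G ≡ E modulo 2, and `1-q≡4w` says q ≡ 1
  -- modulo 4. Together they make the absolute norm an integer.
  module _ (x : ℤ⁴) (H w : ℤ) (A≡ : Z.normA x ≡ + 2 ℤ.* (+ 2 ℤ.* H ℤ.+ Z.normE x)) (1-q≡4w : + 1 ℤ.- Z.q ≡ + 4 ℤ.* w) where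
    private
      x₀ = c₀ x
      x₁ = c₁ x
      x₂ = c₂ x
      x₃ = c₃ x
      E = Z.normE x
      G = + 2 ℤ.* H ℤ.+ E
      α β τ τ′ ν ν′ : K
      α = κ x
      β = κ (flip false true x)
      τ = κ (quad (+ 2 ℤ.* x₀) (+ 0) (+ 2 ℤ.* x₂) (+ 0))
      τ′ = κ (quad (+ 2 ℤ.* x₀) (+ 0) (ℤ.- (+ 2 ℤ.* x₂)) (+ 0))
      ν = κ (quad G (+ 0) E (+ 0))
      ν′ = κ (quad G (+ 0) (ℤ.- E) (+ 0))

    -- The coefficients of (x² - τx + ν)(x² - τ′x + ν′), where τ = α + β and ν = αβ are the trace
    -- and norm relative to ℚ(√q) and the prime stands for √q ↦ -√q.
    k₁ k₂ k₃ k₄ : ℤ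
    k₁ = ℤ.- (+ 2 ℤ.* x₀)
    k₂ = G ℤ.+ (x₀ ℤ.* x₀ ℤ.- Z.q ℤ.* (x₂ ℤ.* x₂))
    k₃ = ℤ.- (x₀ ℤ.* G ℤ.- Z.q ℤ.* (x₂ ℤ.* E))
    k₄ = H ℤ.* H ℤ.+ H ℤ.* E ℤ.+ w ℤ.* (E ℤ.* E)

    int : ℤ → K
    int z = κ (rational (+ 2 ℤ.* z))

    private
      o : ∀ {n} → Polynomial n
      o = # 0

      α+β : α +K β ≡ τ
      α+β = trans (κ-⊞ x (flip false true x)) (cong κ (quad-cong
        (solve 1 (λ x → x :+ x := # 2 :* x) refl x₀) (ℤP.+-inverseʳ x₁)
        (solve 1 (λ x → x :+ x := # 2 :* x) refl x₂) (ℤP.+-inverseʳ x₃)))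

      αβ : α *K β ≡ ν
      αβ = κ-* x (flip false true x) (quad G (+ 0) E (+ 0)) (quad-cong
        (trans (solve 5 (λ b x₀ x₁ x₂ x₃ → let open F b; x = quad x₀ x₁ x₂ x₃ in c₀ (twiceProduct x (negate₁₃ x)) := normA x) refl b x₀ x₁ x₂ x₃) A≡)
        (solve 5 (λ b x₀ x₁ x₂ x₃ → let open F b; x = quad x₀ x₁ x₂ x₃ in c₁ (twiceProduct x (negate₁₃ x)) := o) refl b x₀ x₁ x₂ x₃)
        (solve 5 (λ b x₀ x₁ x₂ x₃ → let open F b; x = quad x₀ x₁ x₂ x₃ in c₂ (twiceProduct x (negate₁₃ x)) := # 2 :* normE x) refl b x₀ x₁ x₂ x₃)
        (solve 5 (λ b x₀ x₁ x₂ x₃ → let open F b; x = quad x₀ x₁ x₂ x₃ in c₃ (twiceProduct x (negate₁₃ x)) := o) refl b x₀ x₁ x₂ x₃))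

      e₁ : int k₁ ≡ -K ((α +K β) +K τ′)
      e₁ = begin
        κ (rational (+ 2 ℤ.* ℤ.- (+ 2 ℤ.* x₀)))        ≡⟨ cong (λ z → κ (rational z)) (solve 1 (λ x → # 2 :* :- (# 2 :* x) := :- (# 2 :* x :+ # 2 :* x)) refl x₀) ⟩
        κ (rational (ℤ.- (+ 2 ℤ.* x₀ ℤ.+ + 2 ℤ.* x₀))) ≡⟨ κ-neg _ ⟩
        -K κ (rational (+ 2 ℤ.* x₀ ℤ.+ + 2 ℤ.* x₀))    ≡⟨ cong (λ z → -K κ (quad (+ 2 ℤ.* x₀ ℤ.+ + 2 ℤ.* x₀) (+ 0) z (+ 0))) (sym (ℤP.+-inverseʳ (+ 2 ℤ.* x₂))) ⟩
        -K κ (quad (+ 2 ℤ.* x₀ ℤ.+ + 2 ℤ.* x₀) (+ 0) (+ 2 ℤ.* x₂ ℤ.+ ℤ.- (+ 2 ℤ.* x₂)) (+ 0)) ≡⟨ cong -K_ (sym (κ-⊞ (quad (+ 2 ℤ.* x₀) (+ 0) (+ 2 ℤ.* x₂) (+ 0)) (quad (+ 2 ℤ.* x₀) (+ 0) (ℤ.- (+ 2 ℤ.* x₂)) (+ 0)))) ⟩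
        -K (τ +K τ′)                                   ≡⟨ cong (λ u → -K (u +K τ′)) (sym α+β) ⟩
        -K ((α +K β) +K τ′)                            ∎
        where open ≡-Reasoning

      ττ′ : τ *K τ′ ≡ int (x₀ ℤ.* x₀ ℤ.- Z.q ℤ.* (x₂ ℤ.* x₂))
      ττ′ = κ-* _ _ _ (solve₄ 3 (λ b x y → let open F b in twiceProduct (quad (# 2 :* x) o (# 2 :* y) o) (quad (# 2 :* x) o (:- (# 2 :* y)) o) ≐ quad (# 2 :* (# 2 :* (x :* x :- q :* (y :* y)))) o o o) refl b x₀ x₂)

      ν+ν′ : ν +K ν′ ≡ int G
      ν+ν′ = trans (κ-⊞ _ _) (cong κ (quad-cong (solve 1 (λ x → x :+ x := # 2 :* x) refl G) refl (ℤP.+-inverseʳ E) refl))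

      e₂ : int k₂ ≡ ((α *K β) +K ν′) +K ((α +K β) *K τ′)
      e₂ = begin
        κ (rational (+ 2 ℤ.* (G ℤ.+ t)))               ≡⟨ cong (λ z → κ (rational z)) (ℤP.*-distribˡ-+ (+ 2) G t) ⟩
        κ (rational (+ 2 ℤ.* G ℤ.+ + 2 ℤ.* t))         ≡⟨ sym (κ-⊞ (rational (+ 2 ℤ.* G)) (rational (+ 2 ℤ.* t))) ⟩
        int G +K int t                                 ≡⟨ cong₂ _+K_ (sym ν+ν′) (sym ττ′) ⟩
        (ν +K ν′) +K (τ *K τ′)                         ≡⟨ cong₂ (λ u z → (u +K ν′) +K (z *K τ′)) (sym αβ) (sym α+β) ⟩
        ((α *K β) +K ν′) +K ((α +K β) *K τ′)           ∎
        where
        open ≡-Reasoning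
        t = x₀ ℤ.* x₀ ℤ.- Z.q ℤ.* (x₂ ℤ.* x₂)

      s = x₀ ℤ.* G ℤ.- Z.q ℤ.* (x₂ ℤ.* E)
      t = x₂ ℤ.* G ℤ.- x₀ ℤ.* E

      τν′ : τ *K ν′ ≡ κ (quad s (+ 0) t (+ 0))
      τν′ = κ-* _ _ _ (solve₄ 5 (λ b x y G E → let open F b in twiceProduct (quad (# 2 :* x) o (# 2 :* y) o) (quad G o (:- E) o) ≐ quad (# 2 :* (x :* G :- q :* (y :* E))) o (# 2 :* (y :* G :- x :* E)) o) refl b x₀ x₂ G E)

      τ′ν : τ′ *K ν ≡ κ (quad s (+ 0) (ℤ.- t) (+ 0))
      τ′ν = κ-* _ _ _ (solve₄ 5 (λ b x y G E → let open F b in twiceProduct (quad (# 2 :* x) o (:- (# 2 :* y)) o) (quad G o E o) ≐ quad (# 2 :* (x :* G :- q :* (y :* E))) o (# 2 :* :- (y :* G :- x :* E)) o) refl b x₀ x₂ G E)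

      e₃ : int k₃ ≡ -K (((α +K β) *K ν′) +K (τ′ *K (α *K β)))
      e₃ = begin
        κ (rational (+ 2 ℤ.* ℤ.- s))                   ≡⟨ cong (λ z → κ (rational z)) (solve 1 (λ x → # 2 :* :- x := :- (x :+ x)) refl s) ⟩
        κ (rational (ℤ.- (s ℤ.+ s)))                   ≡⟨ κ-neg _ ⟩
        -K κ (rational (s ℤ.+ s))                      ≡⟨ cong (λ z → -K κ (quad (s ℤ.+ s) (+ 0) z (+ 0))) (sym (ℤP.+-inverseʳ t)) ⟩
        -K κ (quad (s ℤ.+ s) (+ 0) (t ℤ.+ ℤ.- t) (+ 0)) ≡⟨ cong -K_ (sym (κ-⊞ (quad s (+ 0) t (+ 0)) (quad s (+ 0) (ℤ.- t) (+ 0)))) ⟩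
        -K (κ (quad s (+ 0) t (+ 0)) +K κ (quad s (+ 0) (ℤ.- t) (+ 0))) ≡⟨ cong -K_ (cong₂ _+K_ (sym τν′) (sym τ′ν)) ⟩
        -K ((τ *K ν′) +K (τ′ *K ν))                    ≡⟨ cong₂ (λ u z → -K ((u *K ν′) +K (τ′ *K z))) (sym α+β) (sym αβ) ⟩
        -K (((α +K β) *K ν′) +K (τ′ *K (α *K β)))      ∎
        where open ≡-Reasoning

      e₄ : int k₄ ≡ (α *K β) *K ν′
      e₄ = sym (trans (cong (_*K ν′) αβ) (κ-* _ _ _ (quad-cong
        (trans (solve 3 (λ b H E → let open F b in c₀ (twiceProduct (quad (# 2 :* H :+ E) o E o) (quad (# 2 :* H :+ E) o (:- E) o))
            := # 4 :* (H :* H :+ H :* E) :+ (# 1 :- q) :* (E :* E)) refl b H E)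
          (trans (cong (λ z → + 4 ℤ.* (H ℤ.* H ℤ.+ H ℤ.* E) ℤ.+ z ℤ.* (E ℤ.* E)) 1-q≡4w)
            (solve 3 (λ w H E → # 4 :* (H :* H :+ H :* E) :+ # 4 :* w :* (E :* E) := # 2 :* (# 2 :* (H :* H :+ H :* E :+ w :* (E :* E)))) refl w H E)))
        (solve 3 (λ b G E → let open F b in c₁ (twiceProduct (quad G o E o) (quad G o (:- E) o)) := o) refl b G E)
        (solve 3 (λ b G E → let open F b in c₂ (twiceProduct (quad G o E o) (quad G o (:- E) o)) := o) refl b G E)
        (solve 3 (λ b G E → let open F b in c₃ (twiceProduct (quad G o E o) (quad G o (:- E) o)) := o) refl b G E))))

    root : (((((((1K *K α) +K int k₁) *K α) +K int k₂) *K α) +K int k₃) *K α) +K int k₄ ≡ 0K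
    root = trans (cong₂ (λ u z → (((((((1K *K α) +K u) *K α) +K z) *K α) +K int k₃) *K α) +K int k₄) e₁ e₂)
      (trans (cong₂ (λ u z → (((((((1K *K α) +K (-K ((α +K β) +K τ′))) *K α) +K (((α *K β) +K ν′) +K ((α +K β) *K τ′))) *K α) +K u) *K α) +K z) e₃ e₄)
        (KI.quartic α β τ′ ν′))

module LatticeIntegers (n : ℤ) (p q : ℚ)
  (p≡ : p ≡ ℤtoℚ ((+ 2 ℤ.* n ℤ.+ + 1 ℤ.+ -[1+ 1 ]) ℤ.* (+ 2 ℤ.* n ℤ.+ + 1)))
  (q≡ : q ≡ ℤtoℚ ((+ 2 ℤ.* n ℤ.+ + 1 ℤ.+ -[1+ 1 ]) ℤ.* (+ 2 ℤ.* n ℤ.+ + 1 ℤ.+ + 2)))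
  (a≢0 : ℤtoℚ (+ 2 ℤ.* n ℤ.+ + 1 ℤ.+ -[1+ 1 ]) ≢ 0ℚ) (theory : BiquadraticTheory p q)
  where
  open Biquad p q
  b : ℤ
  b = + 2 ℤ.* n ℤ.+ + 1
  open Embedding b p q p≡ q≡ a≢0
  open BiquadraticTheory theory
  open SyntacticFormulas
  module Z = Formulas ℤ-operations b

  private
    κ-0 : κ (rational (+ 0)) ≡ 0K
    κ-0 = cong₂ ⟪_,_⟫ refl (cong₂ ⟨_,_⟩ refl (ℚP.*-zeroʳ (½ ℚ.* 1/a)))

    κ-int : ∀ z → κ (rational (+ 2 ℤ.* z)) ≡ ℤtoK z
    κ-int z = cong₂ ⟪_,_⟫ (cong₂ ⟨_,_⟩ (trans (cong (½ ℚ.*_) (ℤtoℚ-* (+ 2) z)) (trans (sym (ℚP.*-assoc ½ (ℤtoℚ (+ 2)) (ℤtoℚ z))) (ℚP.*-identityˡ (ℤtoℚ z)))) refl)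
      (cong₂ ⟨_,_⟩ refl (ℚP.*-zeroʳ (½ ℚ.* 1/a)))

    module C = CharacteristicPolynomial b K-isCR κ κ-* κ-⊞ κ-0

    integral : ∀ x → (∃ λ k₁ → ∃ λ k₂ → ∃ λ k₃ → ∃ λ k₄ →
      (((1K *K κ x +K κ (rational (+ 2 ℤ.* k₁))) *K κ x +K κ (rational (+ 2 ℤ.* k₂))) *K κ x +K κ (rational (+ 2 ℤ.* k₃))) *K κ x +K κ (rational (+ 2 ℤ.* k₄)) ≡ 0K) → InOK (κ x)
    integral x (k₁ , k₂ , k₃ , k₄ , eq) = (k₁ ∷ k₂ ∷ k₃ ∷ k₄ ∷ []) ,
      trans (cong₂ (λ u w → (((1K *K κ x +K u) *K κ x +K w) *K κ x +K ℤtoK k₃) *K κ x +K ℤtoK k₄) (sym (κ-int k₁)) (sym (κ-int k₂)))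
        (trans (cong₂ (λ u w → (((1K *K κ x +K κ (rational (+ 2 ℤ.* k₁))) *K κ x +K κ (rational (+ 2 ℤ.* k₂))) *K κ x +K u) *K κ x +K w) (sym (κ-int k₃)) (sym (κ-int k₄))) eq)

    Hₚ : ∀ {k} (n A B C D : Polynomial k) → Polynomial k
    Hₚ n A B C D = let b = # 2 :* n :+ # 1 in
      A :* A :+ C :* C :* (n :* n :+ n :- # 1) :- F.p b :* (B :* B) :- (F.p b :- b) :* (B :* D) :- b :* n :* (D :* D)

  -- Modulo 4 both p and r are 3 and q is 1, so integrality amounts to x₀ ≡ x₂ and x₁ ≡ x₃ modulo 2.
  -- The numbers A, B, C, D parametrise the quadruples with this property.
  InOK-half : ∀ A B C D → InOK (κ (quad (+ 2 ℤ.* A ℤ.+ C) (+ 2 ℤ.* B ℤ.+ D) C D))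
  InOK-half A B C D = integral x (C.k₁ x H w A≡ q≡4 , C.k₂ x H w A≡ q≡4 , C.k₃ x H w A≡ q≡4 , C.k₄ x H w A≡ q≡4 , C.root x H w A≡ q≡4)
    where
    x = quad (+ 2 ℤ.* A ℤ.+ C) (+ 2 ℤ.* B ℤ.+ D) C D
    H = A ℤ.* A ℤ.+ C ℤ.* C ℤ.* (n ℤ.* n ℤ.+ n ℤ.- + 1) ℤ.- Z.p ℤ.* (B ℤ.* B) ℤ.- (Z.p ℤ.- b) ℤ.* (B ℤ.* D) ℤ.- b ℤ.* n ℤ.* (D ℤ.* D)
    w = + 1 ℤ.- n ℤ.- n ℤ.* n
    A≡ : Z.normA x ≡ + 2 ℤ.* (+ 2 ℤ.* H ℤ.+ Z.normE x)
    A≡ = solve 5 (λ n A B C D → let open F (# 2 :* n :+ # 1); x = quad (# 2 :* A :+ C) (# 2 :* B :+ D) C D in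
      normA x := # 2 :* (# 2 :* Hₚ n A B C D :+ normE x)) refl n A B C D
    q≡4 : + 1 ℤ.- Z.q ≡ + 4 ℤ.* w
    q≡4 = solve 1 (λ n → # 1 :- F.q (# 2 :* n :+ # 1) := # 4 :* (# 1 :- n :- n :* n)) refl n

  InOK-coords : ∀ v → InOK (κ (Z.coords v))
  InOK-coords (quad f g X Y) = subst (λ x → InOK (κ x)) (quad-cong
    (solve 5 (λ n f g X Y → let b = # 2 :* n :+ # 1 in # 2 :* (b :* f :+ b :* n :* g :- X :+ n :* Y) :+ (b :* g :+ Y) := c₀ (F.coords b (quad f g X Y))) refl n f g X Y)
    (solve 5 (λ n f g X Y → let b = # 2 :* n :+ # 1 in # 2 :* (g :+ X) :+ (f :+ F.m b :* g :+ :- X :+ Y) := c₁ (F.coords b (quad f g X Y))) refl n f g X Y)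
    (refl {x = b ℤ.* g ℤ.+ Y}) (refl {x = f ℤ.+ Z.m ℤ.* g ℤ.+ ℤ.- X ℤ.+ Y}))
    (InOK-half (b ℤ.* f ℤ.+ b ℤ.* n ℤ.* g ℤ.- X ℤ.+ n ℤ.* Y) (g ℤ.+ X) (b ℤ.* g ℤ.+ Y) (f ℤ.+ Z.m ℤ.* g ℤ.+ ℤ.- X ℤ.+ Y))

  -- The change between the two bases is unimodular, so solving for f, g, X, Y requires no division.
  half⇒coords : ∀ A B C D → ∃ λ v → Z.coords v ≡ quad (+ 2 ℤ.* A ℤ.+ C) (+ 2 ℤ.* B ℤ.+ D) C D
  half⇒coords A B C D = quad (B ℤ.+ D ℤ.- C) g (B ℤ.- g) (C ℤ.- b ℤ.* g) , solve₄ 5 (λ n A B C D → v n A B C D ≐ quad (# 2 :* A :+ C) (# 2 :* B :+ D) C D) refl n A B C D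
    where
    g = A ℤ.- Z.a ℤ.* B ℤ.+ n ℤ.* C ℤ.- + 2 ℤ.* n ℤ.* D ℤ.- (B ℤ.+ D ℤ.- C)
    v : ∀ {k} (n A B C D : Polynomial k) → Quad (Polynomial k)
    v n A B C D = let b = # 2 :* n :+ # 1; g = A :- F.a b :* B :+ n :* C :- # 2 :* n :* D :- (B :+ D :- C) in
      F.coords b (quad (B :+ D :- C) g (B :- g) (C :- b :* g))

-- Algebraic integers are lattice points.

-- Instead of integrality itself we use that the powers of α have a common
-- denominator: this property is visibly closed under sums.
module AlmostIntegral {K : Set} {_+_ _*_ : K → K → K} { -_ : K → K} {0# 1# : K} (isCR : IsCommutativeRing _≡_ _+_ _*_ -_ 0# 1#)
  (L : K → Set) (L-+ : ∀ {x y} → L x → L y → L (x + y)) (L-* : ∀ {x y} → L x → L y → L (x * y)) (L-neg : ∀ {x} → L x → L (- x)) (L-0 : L 0#)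
  (int : ℤ → K) (L-int : ∀ c → L (int c))
  (Denominator : K → Set) (Denominator-* : ∀ {x y} → Denominator x → Denominator y → Denominator (x * y)) (Denominator⇒L : ∀ {x} → Denominator x → L x)
  (clear : ∀ x → ∃ λ d → Denominator d × L (d * x))
  where

  private
    R : CommutativeRing 0ℓ 0ℓ
    R = record { isCommutativeRing = isCR }
    open CommutativeRing R using (*-assoc; *-identityʳ; zeroˡ; zeroʳ)
    open IntegerCoefficients R

  _^_ : K → ℕ → K
  α ^ zero = 1#
  α ^ suc k = α * (α ^ k)

  AI : K → Set
  AI α = ∃ λ d → Denominator d × ∀ k → L (d * (α ^ k))

  AI-* : ∀ {α β} → AI α → AI β → AI (α * β)
  AI-* {α} {β} (d , hd , ld) (e , he , le) = d * e , Denominator-* hd he , λ k → subst L (eq k) (L-* (ld k) (le k))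
    where
    ^-* : ∀ k → (α * β) ^ k ≡ (α ^ k) * (β ^ k)
    ^-* zero = sym (*-identityʳ 1#)
    ^-* (suc k) = trans (cong ((α * β) *_) (^-* k)) (solve 4 (λ a b c d → a :* b :* (c :* d) := a :* c :* (b :* d)) refl α β (α ^ k) (β ^ k))
    eq : ∀ k → (d * (α ^ k)) * (e * (β ^ k)) ≡ (d * e) * ((α * β) ^ k)
    eq k = trans (solve 4 (λ d a e b → d :* a :* (e :* b) := d :* e :* (a :* b)) refl d (α ^ k) e (β ^ k)) (cong ((d * e) *_) (sym (^-* k)))

  AI-+ : ∀ {α β} → AI α → AI β → AI (α + β)
  AI-+ {α} {β} (d , hd , ld) (e , he , le) = d * e , Denominator-* hd he , λ k →
      subst L (cong ((d * e) *_) (trans (cong (((α + β) ^ k) *_) (*-identityʳ 1#)) (*-identityʳ _))) (mixed k 0 0)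
    where
    -- The extra exponents i and j let (α + β) ^ (k + 1) fall into two instances for k, in place of
    -- the binomial theorem.
    mixed : ∀ k i j → L ((d * e) * (((α + β) ^ k) * ((α ^ i) * (β ^ j))))
    mixed zero i j = subst L (trans (solve 4 (λ d a e b → d :* a :* (e :* b) := d :* e :* (a :* b)) refl d (α ^ i) e (β ^ j))
      (cong ((d * e) *_) (sym (CommutativeRing.*-identityˡ R _)))) (L-* (ld i) (le j))
    mixed (suc k) i j = subst L (solve 6 (λ s a b x y z → s :* (z :* (a :* x :* y)) :+ s :* (z :* (x :* (b :* y))) := s :* ((a :+ b) :* z :* (x :* y))) refl (d * e) α β (α ^ i) (β ^ j) ((α + β) ^ k))
      (L-+ (mixed k (suc i) j) (mixed k i (suc j)))

  AI-map : (φ : K → K) → (∀ x y → φ (x * y) ≡ φ x * φ y) → φ 1# ≡ 1# → (∀ {x} → L x → L (φ x)) → (∀ {d} → Denominator d → φ d ≡ d) →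
    ∀ {α} → AI α → AI (φ α)
  AI-map φ φ-* φ-1 φ-L φ-D {α} (d , hd , l) = d , hd , λ k → subst L (trans (φ-* d (α ^ k)) (cong₂ _*_ (φ-D hd) (φ-^ k))) (φ-L (l k))
    where
    φ-^ : ∀ k → φ (α ^ k) ≡ φ α ^ k
    φ-^ zero = φ-1
    φ-^ (suc k) = trans (φ-* α (α ^ k)) (cong (φ α *_) (φ-^ k))

  AI-ℚ : (ρ : ℚ → K) → (∀ x y → ρ x * ρ y ≡ ρ (x ℚ.* y)) → ρ 1ℚ ≡ 1# →
    ∀ {x} → AI (ρ x) → ∃ λ d → Denominator d × ∀ k → L (d * ρ (x ^ℚ k))
  AI-ℚ ρ ρ-* ρ-1 {x} (d , hd , l) = d , hd , λ k → subst (λ y → L (d * y)) (ρ-^ k) (l k)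
    where
    ρ-^ : ∀ k → ρ x ^ k ≡ ρ (x ^ℚ k)
    ρ-^ zero = sym ρ-1
    ρ-^ (suc k) = trans (cong (ρ x *_) (ρ-^ k)) (ρ-* x (x ^ℚ k))

  horner : K → K → List ℤ → K
  horner α acc [] = acc
  horner α acc (c ∷ cs) = horner α ((acc * α) + int c) cs

  -- A common denominator of finitely many initial powers works for all, because the monic equation
  -- expresses each later power through earlier ones without introducing new denominators.
  root⇒AI : ∀ cs α → horner α 1# cs ≡ 0# → AI α
  root⇒AI cs α eq = d , hd , λ k → below k k (ℕP.m<n+m k {m} m>0′ )
    where
    -- The degree is `length cs`; the successor keeps the initial range nonempty even for the empty
    -- list.
    m = suc (length cs)
    m>0′ : 0 ℕ.< m
    m>0′ = ℕ.s≤s ℕ.z≤n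
    common : ∀ k → ∃ λ d → Denominator d × ∀ i → i ℕ.< k → L (d * (α ^ i))
    common zero = proj₁ (clear 1#) , proj₁ (proj₂ (clear 1#)) , λ i ()
    common (suc k) with common k | clear (α ^ k)
    ... | d , hd , ld | e , he , le = d * e , Denominator-* hd he , bounded
      where
      bounded : ∀ i → i ℕ.< suc k → L ((d * e) * (α ^ i))
      bounded i (ℕ.s≤s i≤k) with ℕP.m≤n⇒m<n∨m≡n i≤k
      ... | inj₁ i<k = subst L (solve 3 (λ d e a → e :* (d :* a) := d :* e :* a) refl d e (α ^ i)) (L-* (Denominator⇒L he) (ld i i<k))
      ... | inj₂ refl = subst L (sym (*-assoc d e (α ^ k))) (L-* (Denominator⇒L hd) le)
    d = proj₁ (common m)
    hd = proj₁ (proj₂ (common m))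
    -- Horner's rule unrolled: the leading term is the whole value minus multiples of lower powers,
    -- and these are already known to lie in `L` after multiplication by d.
    leading : ∀ cs acc j → (∀ i → i ℕ.< length cs ℕ.+ j → L (d * (α ^ i))) → L ((d * horner α acc cs) * (α ^ j)) → L ((d * acc) * (α ^ (length cs ℕ.+ j)))
    leading [] acc j h l = l
    leading (c ∷ cs) acc j h l = subst L
      (solve 5 (λ d a x c y → d :* (a :* x :+ c) :* y :+ :- (c :* (d :* y)) := d :* a :* (x :* y)) refl d acc α (int c) (α ^ (length cs ℕ.+ j)))
      (L-+ (leading cs ((acc * α) + int c) j (λ i i< → h i (ℕP.m≤n⇒m≤1+n i<)) l) (L-neg (L-* (L-int c) (h (length cs ℕ.+ j) (ℕP.n<1+n (length cs ℕ.+ j))))))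
    below : ∀ k i → i ℕ.< m ℕ.+ k → L (d * (α ^ i))
    below zero i i<m = proj₂ (proj₂ (common m)) i (subst (i ℕ.<_) (ℕP.+-identityʳ m) i<m)
    below (suc k) i i< with ℕP.m≤n⇒m<n∨m≡n (ℕP.≤-pred (subst (i ℕ.<_) (ℕP.+-suc m k) i<))
    ... | inj₁ i<m+k = below k i i<m+k
    -- The power α ^ (m + k) is the leading term of the equation multiplied by α ^ (k + 1).
    ... | inj₂ refl = subst L (cong (_* (α ^ (m ℕ.+ k))) (*-identityʳ d)) (subst (λ e → L ((d * 1#) * (α ^ e))) (ℕP.+-suc (length cs) k)
          (leading cs 1# (suc k) (λ i i< → below k i (subst (i ℕ.<_) (ℕP.+-suc (length cs) k) i<))
            (subst L (sym (trans (cong (λ z → (d * z) * (α ^ suc k)) eq) (trans (cong (_* (α ^ suc k)) (zeroʳ d)) (zeroˡ _)))) L-0)))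

parity : ∀ z → (∃ λ k → z ≡ + 2 ℤ.* k) ⊎ (∃ λ k → z ≡ + 2 ℤ.* k ℤ.+ + 1)
parity (+ n) with parityℕ n
  where
  parityℕ : ∀ n → (∃ λ k → + n ≡ + 2 ℤ.* + k) ⊎ (∃ λ k → + n ≡ + 2 ℤ.* + k ℤ.+ + 1)
  parityℕ zero = inj₁ (0 , refl)
  parityℕ (suc n) with parityℕ n
  ... | inj₁ (k , e) = inj₂ (k , trans (ℤP.+-comm (+ 1) (+ n)) (cong (ℤ._+ + 1) e))
  ... | inj₂ (k , e) = inj₁ (suc k , trans (cong (λ z → + 1 ℤ.+ z) e) (solve 1 (λ k → # 1 :+ (# 2 :* k :+ # 1) := # 2 :* (# 1 :+ k)) refl (+ k)))
    where open ℤ-Solver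
... | inj₁ (k , e) = inj₁ (+ k , e)
... | inj₂ (k , e) = inj₂ (+ k , e)
parity -[1+ n ] with parity (+ suc n)
... | inj₁ (k , e) = inj₁ (ℤ.- k , trans (cong ℤ.-_ e) (ℤP.neg-distribʳ-* (+ 2) k))
... | inj₂ (k , e) = inj₂ (ℤ.- k ℤ.- + 1 , trans (cong ℤ.-_ e) (solve 1 (λ k → :- (# 2 :* k :+ # 1) := # 2 :* (:- k :- # 1) :+ # 1) refl k))
  where open ℤ-Solver

2k≢1 : ∀ k → + 2 ℤ.* k ≢ + 1
2k≢1 k e with ∣1⇒≡1 (divides {2} {1} ℤ.∣ k ∣ (trans (cong ℤ.∣_∣ (trans (sym e) (ℤP.*-comm (+ 2) k))) (ℤP.abs-* k (+ 2))))
... | ()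

module _ where
  open ℤ-Solver

  private
    isolate : ∀ x y k → x ≡ y → x ℤ.- y ℤ.+ k ≡ k
    isolate x .x k refl = solve 2 (λ x k → x :- x :+ k := k) refl x k

  -- If u - v were odd, then u + v would be odd as well, and so would u² - v².
  sameParity : ∀ u v h → u ℤ.* u ℤ.- v ℤ.* v ≡ + 4 ℤ.* h → ∃ λ k → u ≡ v ℤ.+ + 2 ℤ.* k
  sameParity u v h e with parity (u ℤ.- v)
  ... | inj₁ (k , e′) = k , trans (solve 2 (λ u v → u := v :+ (u :- v)) refl u v) (cong (λ z → v ℤ.+ z) e′)
  ... | inj₂ (k , e′) = ⊥-elim (2k≢1 (+ 2 ℤ.* h ℤ.- + 2 ℤ.* (k ℤ.* k) ℤ.- + 2 ℤ.* k ℤ.- (+ 2 ℤ.* k ℤ.+ + 1) ℤ.* v) (begin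
      + 2 ℤ.* (+ 2 ℤ.* h ℤ.- + 2 ℤ.* (k ℤ.* k) ℤ.- + 2 ℤ.* k ℤ.- (+ 2 ℤ.* k ℤ.+ + 1) ℤ.* v)
        ≡⟨ solve 3 (λ h k v → # 2 :* (# 2 :* h :- # 2 :* (k :* k) :- # 2 :* k :- (# 2 :* k :+ # 1) :* v)
             := # 4 :* h :- ((v :+ (# 2 :* k :+ # 1)) :* (v :+ (# 2 :* k :+ # 1)) :- v :* v) :+ # 1) refl h k v ⟩
      + 4 ℤ.* h ℤ.- ((v ℤ.+ (+ 2 ℤ.* k ℤ.+ + 1)) ℤ.* (v ℤ.+ (+ 2 ℤ.* k ℤ.+ + 1)) ℤ.- v ℤ.* v) ℤ.+ + 1
        ≡⟨ isolate (+ 4 ℤ.* h) _ (+ 1) (trans (sym e) (cong (λ z → z ℤ.* z ℤ.- v ℤ.* v) u≡)) ⟩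
      + 1 ∎))
    where
    open ≡-Reasoning
    u≡ : u ≡ v ℤ.+ (+ 2 ℤ.* k ℤ.+ + 1)
    u≡ = trans (solve 2 (λ u v → u := v :+ (u :- v)) refl u v) (cong (λ z → v ℤ.+ z) e′)

  -- Squares are 0 or 1 modulo 4.
  evenSquares : ∀ u v h → u ℤ.* u ℤ.+ v ℤ.* v ≡ + 4 ℤ.* h → (∃ λ i → u ≡ + 2 ℤ.* i) × (∃ λ j → v ≡ + 2 ℤ.* j)
  evenSquares u v h e with parity u | parity v
  ... | inj₁ u-even | inj₁ v-even = u-even , v-even
  ... | inj₁ (i , refl) | inj₂ (j , refl) = ⊥-elim (2k≢1 (+ 2 ℤ.* h ℤ.- + 2 ℤ.* (i ℤ.* i) ℤ.- + 2 ℤ.* (j ℤ.* j) ℤ.- + 2 ℤ.* j)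
      (trans (solve 3 (λ h i j → # 2 :* (# 2 :* h :- # 2 :* (i :* i) :- # 2 :* (j :* j) :- # 2 :* j)
        := # 4 :* h :- (# 2 :* i :* (# 2 :* i) :+ (# 2 :* j :+ # 1) :* (# 2 :* j :+ # 1)) :+ # 1) refl h i j)
        (isolate (+ 4 ℤ.* h) _ (+ 1) (sym e))))
  ... | inj₂ (i , refl) | inj₁ (j , refl) = ⊥-elim (2k≢1 (+ 2 ℤ.* h ℤ.- + 2 ℤ.* (i ℤ.* i) ℤ.- + 2 ℤ.* (j ℤ.* j) ℤ.- + 2 ℤ.* i)
      (trans (solve 3 (λ h i j → # 2 :* (# 2 :* h :- # 2 :* (i :* i) :- # 2 :* (j :* j) :- # 2 :* i)
        := # 4 :* h :- ((# 2 :* i :+ # 1) :* (# 2 :* i :+ # 1) :+ # 2 :* j :* (# 2 :* j)) :+ # 1) refl h i j)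
        (isolate (+ 4 ℤ.* h) _ (+ 1) (sym e))))
  ... | inj₂ (i , refl) | inj₂ (j , refl) = ⊥-elim (2k≢1 (h ℤ.- (i ℤ.* i) ℤ.- i ℤ.- (j ℤ.* j) ℤ.- j)
      (ℤP.*-cancelˡ-≡ (+ 2) _ _ (trans (solve 3 (λ h i j → # 2 :* (# 2 :* (h :- i :* i :- i :- j :* j :- j))
        := # 4 :* h :- ((# 2 :* i :+ # 1) :* (# 2 :* i :+ # 1) :+ (# 2 :* j :+ # 1) :* (# 2 :* j :+ # 1)) :+ # 2) refl h i j)
        (isolate (+ 4 ℤ.* h) _ (+ 2) (sym e)))))

Integral-+ : ∀ {x y} → Integral x → Integral y → Integral (x ℚ.+ y)
Integral-+ (m , refl) (n , refl) = m ℤ.+ n , sym (ℤtoℚ-+ m n)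

Integral-* : ∀ {x y} → Integral x → Integral y → Integral (x ℚ.* y)
Integral-* (m , refl) (n , refl) = m ℤ.* n , sym (ℤtoℚ-* m n)

Integral-neg : ∀ {x} → Integral x → Integral (ℚ.- x)
Integral-neg (m , refl) = ℤ.- m , sym (ℤtoℚ-neg m)

-- Squarefreeness of d clears the denominator of 4y.
quadraticInteger : ∀ d → SquareFree d → ∀ x y X → ℤtoℚ (+ 4) ℚ.* x ≡ ℤtoℚ X → Integral (ℤtoℚ (+ 4) ℚ.* (x ℚ.* x) ℚ.+ ℚ.- (ℤtoℚ (+ 4) ℚ.* (y ℚ.* y ℚ.* ℕtoℚ d))) →
  ∃ λ Y → ∃ λ M → ℤtoℚ (+ 4) ℚ.* y ≡ ℤtoℚ Y × X ℤ.* X ℤ.- + d ℤ.* (Y ℤ.* Y) ≡ + 4 ℤ.* M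
quadraticInteger d sf x y X 4x≡X (M , norm≡M) = Y , M , 4y≡Y , ℤtoℚ-injective (begin
    ℤtoℚ (X ℤ.* X ℤ.- + d ℤ.* (Y ℤ.* Y))
      ≡⟨ trans (ℤtoℚ-+ (X ℤ.* X) (ℤ.- (+ d ℤ.* (Y ℤ.* Y)))) (cong₂ ℚ._+_ (ℤtoℚ-* X X) (trans (ℤtoℚ-neg (+ d ℤ.* (Y ℤ.* Y))) (cong ℚ.-_ (trans (ℤtoℚ-* (+ d) (Y ℤ.* Y)) (cong (ℕtoℚ d ℚ.*_) (ℤtoℚ-* Y Y)))))) ⟩
    ℤtoℚ X ℚ.* ℤtoℚ X ℚ.+ ℚ.- (ℕtoℚ d ℚ.* (ℤtoℚ Y ℚ.* ℤtoℚ Y))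
      ≡⟨ cong₂ (λ u v → u ℚ.* u ℚ.+ ℚ.- (ℕtoℚ d ℚ.* (v ℚ.* v))) (sym 4x≡X) (sym 4y≡Y) ⟩
    (four ℚ.* x) ℚ.* (four ℚ.* x) ℚ.+ ℚ.- (ℕtoℚ d ℚ.* ((four ℚ.* y) ℚ.* (four ℚ.* y)))
      ≡⟨ solve 4 (λ t x y d → t :* x :* (t :* x) :- d :* (t :* y :* (t :* y)) := t :* (t :* (x :* x) :- t :* (y :* y :* d))) refl four x y (ℕtoℚ d) ⟩
    four ℚ.* (four ℚ.* (x ℚ.* x) ℚ.+ ℚ.- (four ℚ.* (y ℚ.* y ℚ.* ℕtoℚ d)))
      ≡⟨ cong (four ℚ.*_) norm≡M ⟩
    four ℚ.* ℤtoℚ M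
      ≡⟨ sym (ℤtoℚ-* (+ 4) M) ⟩
    ℤtoℚ (+ 4 ℤ.* M) ∎)
  where
  open ≡-Reasoning
  open ℚ-Solver
  four = ℤtoℚ (+ 4)
  4y-integral : Integral (four ℚ.* y)
  4y-integral = ℚ-integrallyClosed-√ (four ℚ.* y) d sf (subst Integral
    (solve 4 (λ t x y d → t :* x :* (t :* x) :- t :* (t :* (x :* x) :- t :* (y :* y :* d)) := t :* y :* (t :* y) :* d) refl four x y (ℕtoℚ d))
    (Integral-+ (Integral-* (X , 4x≡X) (X , 4x≡X)) (Integral-neg (Integral-* (+ 4 , refl) (M , norm≡M)))))
  Y = proj₁ 4y-integral
  4y≡Y = proj₂ 4y-integral

module EvalMonic (p q : ℚ) where
  open Biquad p q

  horner : Kel → Kel → List ℤ → Kel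
  horner α acc [] = acc
  horner α acc (c ∷ cs) = horner α (acc *K α +K ℤtoK c) cs

  horner-unique : ∀ α (go : Kel → List ℤ → Kel) → (∀ acc → go acc [] ≡ acc) →
    (∀ acc c cs → go acc (c ∷ cs) ≡ go (acc *K α +K ℤtoK c) cs) → ∀ acc cs → go acc cs ≡ horner α acc cs
  horner-unique α go nil cons acc [] = nil acc
  horner-unique α go nil cons acc (c ∷ cs) = trans (cons acc c cs) (horner-unique α go nil cons (acc *K α +K ℤtoK c) cs)

  -- The local function of evalMonic cannot be named; go is solved to it by unification.
  mutual
    go : List ℤ → Kel → Kel → List ℤ → Kel
    go = _

    evalMonic-horner : ∀ cs α → evalMonic cs α ≡ horner α 1K cs
    evalMonic-horner [] α = refl
    evalMonic-horner (c ∷ cs) α with c ∷ cs | 1K *K α +K ℤtoK c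
    ... | cs₀ | acc = horner-unique α (go cs₀ α) (λ _ → refl) (λ _ _ _ → refl) acc cs

module AlgebraicIntegers (p q : ℚ) (p-integral : Integral p) (q-integral : Integral q) (theory : BiquadraticTheory p q) where
  open Biquad p q
  open BiquadraticTheory theory
  open ℚ-Solver

  ρ : ℚ → Kel
  ρ x = ⟪ ⟨ x , 0ℚ ⟩ , 𝟘 ⟫

  ρ-* : ∀ s a b c e → ρ s *K ⟪ ⟨ a , b ⟩ , ⟨ c , e ⟩ ⟫ ≡ ⟪ ⟨ s ℚ.* a , s ℚ.* b ⟩ , ⟨ s ℚ.* c , s ℚ.* e ⟩ ⟫
  ρ-* s a b c e = cong₂ ⟪_,_⟫
    (cong₂ ⟨_,_⟩
      (solve 7 (λ s a b c e p q → s :* a :+ o :* b :* p :+ ((o :* c :+ o :* e :* p) :* q :+ (o :* e :+ o :* c) :* o :* p) := s :* a) refl s a b c e p q)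
      (solve 7 (λ s a b c e p q → s :* b :+ o :* a :+ ((o :* c :+ o :* e :* p) :* o :+ (o :* e :+ o :* c) :* q) := s :* b) refl s a b c e p q))
    (cong₂ ⟨_,_⟩
      (solve 6 (λ s a b c e p → s :* c :+ o :* e :* p :+ (o :* a :+ o :* b :* p) := s :* c) refl s a b c e p)
      (solve 5 (λ s a b c e → s :* e :+ o :* c :+ (o :* b :+ o :* a) := s :* e) refl s a b c e))
    where
    o : ∀ {n} → Polynomial n
    o = # 0

  -- The subring ℤ[√p, √q], in which denominators are measured.
  record L (x : Kel) : Set where
    constructor integral
    field
      i₀ : Integral (re (fst x))
      i₁ : Integral (im (fst x))
      i₂ : Integral (re (snd x))
      i₃ : Integral (im (snd x))

  private
    0-integral : Integral 0ℚ
    0-integral = + 0 , refl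

    L-+ : ∀ {x y} → L x → L y → L (x +K y)
    L-+ {⟪ ⟨ _ , _ ⟩ , ⟨ _ , _ ⟩ ⟫} {⟪ ⟨ _ , _ ⟩ , ⟨ _ , _ ⟩ ⟫} (integral a b c d) (integral e f g h) =
      integral (Integral-+ a e) (Integral-+ b f) (Integral-+ c g) (Integral-+ d h)

    re-⊗ : ∀ {a b c e} → Integral a → Integral b → Integral c → Integral e → Integral (a ℚ.* c ℚ.+ b ℚ.* e ℚ.* p)
    re-⊗ a b c e = Integral-+ (Integral-* a c) (Integral-* (Integral-* b e) p-integral)

    im-⊗ : ∀ {a b c e} → Integral a → Integral b → Integral c → Integral e → Integral (a ℚ.* e ℚ.+ b ℚ.* c)
    im-⊗ a b c e = Integral-+ (Integral-* a e) (Integral-* b c)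

    L-* : ∀ {x y} → L x → L y → L (x *K y)
    L-* {⟪ ⟨ _ , _ ⟩ , ⟨ _ , _ ⟩ ⟫} {⟪ ⟨ _ , _ ⟩ , ⟨ _ , _ ⟩ ⟫} (integral a b c d) (integral e f g h) = integral
      (Integral-+ (re-⊗ a b e f) (re-⊗ (re-⊗ c d g h) (im-⊗ c d g h) q-integral 0-integral))
      (Integral-+ (im-⊗ a b e f) (im-⊗ (re-⊗ c d g h) (im-⊗ c d g h) q-integral 0-integral))
      (Integral-+ (re-⊗ a b g h) (re-⊗ c d e f))
      (Integral-+ (im-⊗ a b g h) (im-⊗ c d e f))

    L-ρ : ∀ D → L (ρ (ℤtoℚ D))
    L-ρ D = integral (D , refl) 0-integral 0-integral 0-integral

    K-ring : CommutativeRing 0ℓ 0ℓ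
    K-ring = record { isCommutativeRing = K-isCR }

    -K≡ : ∀ x → -K x ≡ ρ (ℤtoℚ -[1+ 0 ]) *K x
    -K≡ x@(⟪ ⟨ a , b ⟩ , ⟨ c , e ⟩ ⟫) = sym (inverseʳ-unique x (ρ (ℤtoℚ -[1+ 0 ]) *K x) (trans (cong (x +K_) (ρ-* (ℤtoℚ -[1+ 0 ]) a b c e))
      (cong₂ ⟪_,_⟫ (cong₂ ⟨_,_⟩ (z a) (z b)) (cong₂ ⟨_,_⟩ (z c) (z e)))))
      where
      open import Algebra.Properties.Group (CommutativeRing.+-group K-ring) using (inverseʳ-unique)
      z : ∀ a → a ℚ.+ ℤtoℚ -[1+ 0 ] ℚ.* a ≡ 0ℚ
      z a = solve 1 (λ a → a :+ con -[1+ 0 ] :* a := # 0) refl a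

    L-neg : ∀ {x} → L x → L (-K x)
    L-neg {x} l = subst L (sym (-K≡ x)) (L-* (L-ρ -[1+ 0 ]) l)

    Denominator : Kel → Set
    Denominator x = ∃ λ D → D ≢ + 0 × x ≡ ρ (ℤtoℚ D)

    Denominator-* : ∀ {x y} → Denominator x → Denominator y → Denominator (x *K y)
    Denominator-* {_} {_} (D , D≢0 , refl) (E , E≢0 , refl) = D ℤ.* E , DE≢0 ,
      trans (ρ-* (ℤtoℚ D) (ℤtoℚ E) 0ℚ 0ℚ 0ℚ) (cong₂ ⟪_,_⟫ (cong₂ ⟨_,_⟩ (sym (ℤtoℚ-* D E)) (ℚP.*-zeroʳ (ℤtoℚ D))) (cong₂ ⟨_,_⟩ (ℚP.*-zeroʳ (ℤtoℚ D)) (ℚP.*-zeroʳ (ℤtoℚ D))))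
      where
      DE≢0 : D ℤ.* E ≢ + 0
      DE≢0 e = [ D≢0 , E≢0 ]′ (ℤP.i*j≡0⇒i≡0∨j≡0 D e)

    Denominator⇒L : ∀ {x} → Denominator x → L x
    Denominator⇒L (D , _ , refl) = L-ρ D

    clear : ∀ x → ∃ λ d → Denominator d × L (d *K x)
    clear ⟪ ⟨ a , b ⟩ , ⟨ c , e ⟩ ⟫ = ρ (ℤtoℚ D) , (D , D≢0 , refl) , subst L (sym (ρ-* (ℤtoℚ D) a b c e)) (integral
        (subst Integral (trans (solve 5 (λ a s t u v → (t :* u :* v) :* (a :* s) := s :* t :* u :* v :* a) refl a s t u v) (cong (ℚ._* a) (sym D≡))) (mult (fraction a)))
        (subst Integral (trans (solve 5 (λ a s t u v → (s :* u :* v) :* (a :* t) := s :* t :* u :* v :* a) refl b s t u v) (cong (ℚ._* b) (sym D≡))) (mult′ (fraction b)))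
        (subst Integral (trans (solve 5 (λ a s t u v → (s :* t :* v) :* (a :* u) := s :* t :* u :* v :* a) refl c s t u v) (cong (ℚ._* c) (sym D≡))) (mult″ (fraction c)))
        (subst Integral (trans (solve 5 (λ a s t u v → (s :* t :* u) :* (a :* v) := s :* t :* u :* v :* a) refl e s t u v) (cong (ℚ._* e) (sym D≡))) (mult‴ (fraction e))))
      where
      D = ℚ.↧ a ℤ.* ℚ.↧ b ℤ.* ℚ.↧ c ℤ.* ℚ.↧ e
      s = ℤtoℚ (ℚ.↧ a)
      t = ℤtoℚ (ℚ.↧ b)
      u = ℤtoℚ (ℚ.↧ c)
      v = ℤtoℚ (ℚ.↧ e)
      D≡ : ℤtoℚ D ≡ s ℚ.* t ℚ.* u ℚ.* v
      D≡ = trans (ℤtoℚ-* (ℚ.↧ a ℤ.* ℚ.↧ b ℤ.* ℚ.↧ c) (ℚ.↧ e)) (cong (ℚ._* v) (trans (ℤtoℚ-* (ℚ.↧ a ℤ.* ℚ.↧ b) (ℚ.↧ c)) (cong (ℚ._* u) (ℤtoℚ-* (ℚ.↧ a) (ℚ.↧ b)))))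
      D≢0 : D ≢ + 0
      D≢0 ()
      product₃ : ∀ x y z w → Integral w → Integral (ℤtoℚ x ℚ.* ℤtoℚ y ℚ.* ℤtoℚ z ℚ.* w)
      product₃ x y z w h = Integral-* (Integral-* (Integral-* (x , refl) (y , refl)) (z , refl)) h
      mult : a ℚ.* s ≡ ℤtoℚ (ℚ.↥ a) → Integral (t ℚ.* u ℚ.* v ℚ.* (a ℚ.* s))
      mult h = product₃ (ℚ.↧ b) (ℚ.↧ c) (ℚ.↧ e) (a ℚ.* s) (ℚ.↥ a , h)
      mult′ : b ℚ.* t ≡ ℤtoℚ (ℚ.↥ b) → Integral (s ℚ.* u ℚ.* v ℚ.* (b ℚ.* t))
      mult′ h = product₃ (ℚ.↧ a) (ℚ.↧ c) (ℚ.↧ e) (b ℚ.* t) (ℚ.↥ b , h)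
      mult″ : c ℚ.* u ≡ ℤtoℚ (ℚ.↥ c) → Integral (s ℚ.* t ℚ.* v ℚ.* (c ℚ.* u))
      mult″ h = product₃ (ℚ.↧ a) (ℚ.↧ b) (ℚ.↧ e) (c ℚ.* u) (ℚ.↥ c , h)
      mult‴ : e ℚ.* v ≡ ℤtoℚ (ℚ.↥ e) → Integral (s ℚ.* t ℚ.* u ℚ.* (e ℚ.* v))
      mult‴ h = product₃ (ℚ.↧ a) (ℚ.↧ b) (ℚ.↧ c) (e ℚ.* v) (ℚ.↥ e , h)

  open AlmostIntegral K-isCR L (λ {x} {y} → L-+ {x} {y}) (λ {x} {y} → L-* {x} {y}) (λ {x} → L-neg {x}) (L-ρ (+ 0)) ℤtoK L-ρ
    Denominator (λ {x} {y} → Denominator-* {x} {y}) (λ {x} → Denominator⇒L {x}) clear public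

  private
    horner≡ : ∀ α acc cs → EvalMonic.horner p q α acc cs ≡ horner α acc cs
    horner≡ α acc [] = refl
    horner≡ α acc (c ∷ cs) = horner≡ α (acc *K α +K ℤtoK c) cs

  InOK⇒AI : ∀ {α} → InOK α → AI α
  InOK⇒AI {α} (cs , eq) = root⇒AI cs α (trans (sym (trans (EvalMonic.evalMonic-horner p q cs α) (horner≡ α 1K cs))) eq)

  private
    L-conj : ∀ e₁ e₂ {x} → L x → L (conj e₁ e₂ x)
    L-conj e₁ e₂ {⟪ ⟨ _ , _ ⟩ , ⟨ _ , _ ⟩ ⟫} (integral a b c d) = integral a (sign e₁ b) (sign e₂ c) (sign e₁ (sign e₂ d))
      where
      sign : ∀ e {x} → Integral x → Integral (sgn e x)
      sign true h = h
      sign false h = Integral-neg h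

    conj-ρ : ∀ e₁ e₂ x → conj e₁ e₂ (ρ x) ≡ ρ x
    conj-ρ true true x = refl
    conj-ρ true false x = refl
    conj-ρ false true x = refl
    conj-ρ false false x = refl

    conj-D : ∀ e₁ e₂ {d} → Denominator d → conj e₁ e₂ d ≡ d
    conj-D e₁ e₂ {d} (D , _ , d≡) = trans (cong (conj e₁ e₂) d≡) (trans (conj-ρ e₁ e₂ (ℤtoℚ D)) (sym d≡))

    ρρ : ∀ s t → ρ s *K ρ t ≡ ρ (s ℚ.* t)
    ρρ s t = trans (ρ-* s t 0ℚ 0ℚ 0ℚ) (cong₂ ⟪_,_⟫ (cong₂ ⟨_,_⟩ refl (ℚP.*-zeroʳ s)) (cong₂ ⟨_,_⟩ (ℚP.*-zeroʳ s) (ℚP.*-zeroʳ s)))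

  AI-conj : ∀ e₁ e₂ α → AI α → AI (conj e₁ e₂ α)
  AI-conj e₁ e₂ α = AI-map (conj e₁ e₂) (conj-* e₁ e₂) (conj-ρ e₁ e₂ 1ℚ) (λ {x} → L-conj e₁ e₂ {x}) (λ {d} → conj-D e₁ e₂ {d}) {α}

  AI-rational : ∀ x → AI (ρ x) → Integral x
  AI-rational x h = bounded (AI-ℚ ρ ρρ refl {x} h)
    where
    bounded : (∃ λ d → Denominator d × ∀ k → L (d *K ρ (x ^ℚ k))) → Integral x
    bounded (d , (D , D≢0 , d≡) , l) = boundedDenominator⇒Integral x D D≢0 λ k →
      L.i₀ (subst L (trans (cong (_*K ρ (x ^ℚ k)) d≡) (ρρ (ℤtoℚ D) (x ^ℚ k))) (l k))

-- For each quadratic subfield, the sum of α and its conjugate over that subfield is an integer of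
-- the subfield, and its own trace and norm are rational. They control the irrational coordinates of
-- α one at a time.
module TracesAndNorms (p q : ℚ) (x y z w : ℚ) where
  open Biquad p q
  open ℚ-Solver

  private
    α : Kel
    α = ⟪ ⟨ x , y ⟩ , ⟨ z , w ⟩ ⟫

    ρ : ℚ → Kel
    ρ x = ⟪ ⟨ x , 0ℚ ⟩ , 𝟘 ⟫

    four = ℤtoℚ (+ 4)

    Kel-cong : ∀ {a a′ b b′ c c′ d d′} → a ≡ a′ → b ≡ b′ → c ≡ c′ → d ≡ d′ → ⟪ ⟨ a , b ⟩ , ⟨ c , d ⟩ ⟫ ≡ ⟪ ⟨ a′ , b′ ⟩ , ⟨ c′ , d′ ⟩ ⟫
    Kel-cong refl refl refl refl = refl

    _:*K_ : ∀ {n} → Quad (Polynomial n) → Quad (Polynomial n) → Polynomial n → Polynomial n → Quad (Polynomial n)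
    _:*K_ (quad a b c d) (quad a′ b′ c′ d′) p q = quad
      (a :* a′ :+ b :* b′ :* p :+ ((c :* c′ :+ d :* d′ :* p) :* q :+ (c :* d′ :+ d :* c′) :* # 0 :* p))
      (a :* b′ :+ b :* a′ :+ ((c :* c′ :+ d :* d′ :* p) :* # 0 :+ (c :* d′ :+ d :* c′) :* q))
      (a :* c′ :+ b :* d′ :* p :+ (c :* a′ :+ d :* b′ :* p))
      (a :* d′ :+ b :* c′ :+ (c :* b′ :+ d :* a′))

  module OverP where
    t u : Kel
    t = α +K conj true false α
    u = conj false true t

    trace : t +K u ≡ ρ (four ℚ.* x)
    trace = Kel-cong (solve 1 (λ x → x :+ x :+ (x :+ x) := # 4 :* x) refl x)
      (solve 1 (λ y → y :+ y :+ :- (y :+ y) := # 0) refl y)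
      (solve 1 (λ z → z :+ :- z :+ (z :+ :- z) := # 0) refl z)
      (solve 1 (λ w → w :+ :- w :+ :- (w :+ :- w) := # 0) refl w)

    norm : t *K u ≡ ρ (four ℚ.* (x ℚ.* x) ℚ.+ ℚ.- (four ℚ.* (y ℚ.* y ℚ.* p)))
    norm = Kel-cong
      (solve 6 (λ x y z w p q → c₀ (s x y z w p q) := # 4 :* (x :* x) :+ :- (# 4 :* (y :* y :* p))) refl x y z w p q)
      (solve 6 (λ x y z w p q → c₁ (s x y z w p q) := # 0) refl x y z w p q)
      (solve 6 (λ x y z w p q → c₂ (s x y z w p q) := # 0) refl x y z w p q)
      (solve 6 (λ x y z w p q → c₃ (s x y z w p q) := # 0) refl x y z w p q)
      where
      s : ∀ {n} (x y z w p q : Polynomial n) → Quad (Polynomial n)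
      s x y z w = quad (x :+ x) (y :+ y) (z :+ :- z) (w :+ :- w) :*K quad (x :+ x) (:- (y :+ y)) (z :+ :- z) (:- (w :+ :- w))

  module OverQ where
    t u : Kel
    t = α +K conj false true α
    u = conj true false t

    norm : t *K u ≡ ρ (four ℚ.* (x ℚ.* x) ℚ.+ ℚ.- (four ℚ.* (z ℚ.* z ℚ.* q)))
    norm = Kel-cong
      (solve 6 (λ x y z w p q → c₀ (s x y z w p q) := # 4 :* (x :* x) :+ :- (# 4 :* (z :* z :* q))) refl x y z w p q)
      (solve 6 (λ x y z w p q → c₁ (s x y z w p q) := # 0) refl x y z w p q)
      (solve 6 (λ x y z w p q → c₂ (s x y z w p q) := # 0) refl x y z w p q)
      (solve 6 (λ x y z w p q → c₃ (s x y z w p q) := # 0) refl x y z w p q)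
      where
      s : ∀ {n} (x y z w p q : Polynomial n) → Quad (Polynomial n)
      s x y z w = quad (x :+ x) (y :+ :- y) (z :+ z) (w :+ :- w) :*K quad (x :+ x) (y :+ :- y) (:- (z :+ z)) (:- (w :+ :- w))

  module OverR where
    t u : Kel
    t = α +K conj false false α
    u = conj true false t

    norm : t *K u ≡ ρ (four ℚ.* (x ℚ.* x) ℚ.+ ℚ.- (four ℚ.* (w ℚ.* w ℚ.* (p ℚ.* q))))
    norm = Kel-cong
      (solve 6 (λ x y z w p q → c₀ (s x y z w p q) := # 4 :* (x :* x) :+ :- (# 4 :* (w :* w :* (p :* q)))) refl x y z w p q)
      (solve 6 (λ x y z w p q → c₁ (s x y z w p q) := # 0) refl x y z w p q)
      (solve 6 (λ x y z w p q → c₂ (s x y z w p q) := # 0) refl x y z w p q)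
      (solve 6 (λ x y z w p q → c₃ (s x y z w p q) := # 0) refl x y z w p q)
      where
      s : ∀ {n} (x y z w p q : Polynomial n) → Quad (Polynomial n)
      s x y z w = quad (x :+ x) (y :+ :- y) (z :+ :- z) (w :+ :- :- w) :*K quad (x :+ x) (y :+ :- y) (:- (z :+ :- z)) (:- (w :+ :- :- w))

  -- The sums to the subfields bound the denominators by 2 but do not see the parity conditions of
  -- the lattice. The norm P′ + Q′√q to ℚ(√q) supplies these.
  module RelativeNorm where
    P′ Q′ : ℚ
    P′ = x ℚ.* x ℚ.+ ℚ.- (y ℚ.* y ℚ.* p) ℚ.+ z ℚ.* z ℚ.* q ℚ.+ ℚ.- (w ℚ.* w ℚ.* (p ℚ.* q))
    Q′ = ℤtoℚ (+ 2) ℚ.* (x ℚ.* z ℚ.+ ℚ.- (y ℚ.* w ℚ.* p))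

    t u : Kel
    t = α *K conj false true α
    u = conj true false t

    t≡ : t ≡ ⟪ ⟨ P′ , 0ℚ ⟩ , ⟨ Q′ , 0ℚ ⟩ ⟫
    t≡ = Kel-cong
      (solve 6 (λ x y z w p q → c₀ (s x y z w p q) := x :* x :+ :- (y :* y :* p) :+ z :* z :* q :+ :- (w :* w :* (p :* q))) refl x y z w p q)
      (solve 6 (λ x y z w p q → c₁ (s x y z w p q) := # 0) refl x y z w p q)
      (solve 6 (λ x y z w p q → c₂ (s x y z w p q) := # 2 :* (x :* z :+ :- (y :* w :* p))) refl x y z w p q)
      (solve 6 (λ x y z w p q → c₃ (s x y z w p q) := # 0) refl x y z w p q)
      where
      s : ∀ {n} (x y z w p q : Polynomial n) → Quad (Polynomial n)
      s x y z w = quad x y z w :*K quad x (:- y) z (:- w)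

    u≡ : u ≡ ⟪ ⟨ P′ , 0ℚ ⟩ , ⟨ ℚ.- Q′ , 0ℚ ⟩ ⟫
    u≡ = cong (conj true false) t≡

    trace : t +K u ≡ ρ (P′ ℚ.+ P′)
    trace = trans (cong₂ _+K_ t≡ u≡) (Kel-cong refl refl (ℚP.+-inverseʳ Q′) refl)

    norm : t *K u ≡ ρ (P′ ℚ.* P′ ℚ.+ ℚ.- (Q′ ℚ.* Q′ ℚ.* q))
    norm = trans (cong₂ _*K_ t≡ u≡) (Kel-cong
      (solve 4 (λ a c p q → c₀ (s a c p q) := a :* a :+ :- (c :* c :* q)) refl P′ Q′ p q)
      (solve 4 (λ a c p q → c₁ (s a c p q) := # 0) refl P′ Q′ p q)
      (solve 4 (λ a c p q → c₂ (s a c p q) := # 0) refl P′ Q′ p q)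
      (solve 4 (λ a c p q → c₃ (s a c p q) := # 0) refl P′ Q′ p q))
      where
      s : ∀ {n} (a c p q : Polynomial n) → Quad (Polynomial n)
      s a c = quad a (# 0) c (# 0) :*K quad a (# 0) (:- c) (# 0)

module IntegerCoordinates (n : ℤ) (p q : ℚ)
  (p≡ : p ≡ ℤtoℚ ((+ 2 ℤ.* n ℤ.+ + 1 ℤ.+ -[1+ 1 ]) ℤ.* (+ 2 ℤ.* n ℤ.+ + 1)))
  (q≡ : q ≡ ℤtoℚ ((+ 2 ℤ.* n ℤ.+ + 1 ℤ.+ -[1+ 1 ]) ℤ.* (+ 2 ℤ.* n ℤ.+ + 1 ℤ.+ + 2)))
  (a≢0 : ℤtoℚ (+ 2 ℤ.* n ℤ.+ + 1 ℤ.+ -[1+ 1 ]) ≢ 0ℚ) (theory : BiquadraticTheory p q)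
  (P Q R : ℕ) (P-squareFree : SquareFree P) (Q-squareFree : SquareFree Q) (R-squareFree : SquareFree R)
  (P≡ : + P ≡ (+ 2 ℤ.* n ℤ.+ + 1 ℤ.+ -[1+ 1 ]) ℤ.* (+ 2 ℤ.* n ℤ.+ + 1))
  (Q≡ : + Q ≡ (+ 2 ℤ.* n ℤ.+ + 1 ℤ.+ -[1+ 1 ]) ℤ.* (+ 2 ℤ.* n ℤ.+ + 1 ℤ.+ + 2))
  (R≡ : + R ≡ (+ 2 ℤ.* n ℤ.+ + 1) ℤ.* (+ 2 ℤ.* n ℤ.+ + 1 ℤ.+ + 2))
  where
  open Biquad p q
  open LatticeIntegers n p q p≡ q≡ a≢0 theory using (b; half⇒coords)
  open Embedding b p q p≡ q≡ a≢0
  module Z = Formulas ℤ-operations b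
  open AlgebraicIntegers p q (Z.p , p≡) (Z.q , q≡) theory

  private
    four = ℤtoℚ (+ 4)
    aℚ = ℤtoℚ Z.a

    Integral-by : ∀ {x y} → x ≡ y → Integral x → Integral y
    Integral-by = subst Integral

    pq≡ : ∀ w → w ℚ.* w ℚ.* (p ℚ.* q) ≡ (aℚ ℚ.* w) ℚ.* (aℚ ℚ.* w) ℚ.* ℕtoℚ R
    pq≡ w = begin
      w ℚ.* w ℚ.* (p ℚ.* q)
        ≡⟨ cong (w ℚ.* w ℚ.*_) (cong₂ ℚ._*_ (trans p≡ (ℤtoℚ-* Z.a b)) (trans q≡ (ℤtoℚ-* Z.a Z.c))) ⟩
      w ℚ.* w ℚ.* ((aℚ ℚ.* ℤtoℚ b) ℚ.* (aℚ ℚ.* ℤtoℚ Z.c))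
        ≡⟨ ℚ-Solver.solve 4 (λ w a b c → w ℚ-Solver.:* w ℚ-Solver.:* ((a ℚ-Solver.:* b) ℚ-Solver.:* (a ℚ-Solver.:* c)) ℚ-Solver.:= (a ℚ-Solver.:* w) ℚ-Solver.:* (a ℚ-Solver.:* w) ℚ-Solver.:* (b ℚ-Solver.:* c)) refl w aℚ (ℤtoℚ b) (ℤtoℚ Z.c) ⟩
      (aℚ ℚ.* w) ℚ.* (aℚ ℚ.* w) ℚ.* (ℤtoℚ b ℚ.* ℤtoℚ Z.c)
        ≡⟨ cong ((aℚ ℚ.* w) ℚ.* (aℚ ℚ.* w) ℚ.*_) (trans (sym (ℤtoℚ-* b Z.c)) (cong ℤtoℚ (sym R≡))) ⟩
      (aℚ ℚ.* w) ℚ.* (aℚ ℚ.* w) ℚ.* ℕtoℚ R ∎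
      where open ≡-Reasoning

    halves : ∀ x X X′ → four ℚ.* x ≡ ℤtoℚ X → X ≡ + 2 ℤ.* X′ → x ≡ ½ ℚ.* ℤtoℚ X′
    halves x X X′ 4x≡X X≡2X′ = begin
      x                                    ≡⟨ sym (ℚP.*-identityˡ x) ⟩
      1ℚ ℚ.* x                             ≡⟨ ℚP.*-assoc (½ ℚ.* ½) four x ⟩
      ½ ℚ.* ½ ℚ.* (four ℚ.* x)             ≡⟨ cong (½ ℚ.* ½ ℚ.*_) (trans 4x≡X (trans (cong ℤtoℚ X≡2X′) (ℤtoℚ-* (+ 2) X′))) ⟩
      ½ ℚ.* ½ ℚ.* (ℤtoℚ (+ 2) ℚ.* ℤtoℚ X′) ≡⟨ sym (ℚP.*-assoc (½ ℚ.* ½) (ℤtoℚ (+ 2)) (ℤtoℚ X′)) ⟩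
      ½ ℚ.* ℤtoℚ X′                        ∎
      where open ≡-Reasoning

  -- (X , Y , Z₀ , W) are the coordinates of 2α.
  module Parity (X Y Z₀ W A₁ M : ℤ) (A≡ : Z.normA (quad X Y Z₀ W) ≡ + 2 ℤ.* A₁)
    (norm : A₁ ℤ.* A₁ ℤ.- Z.q ℤ.* (Z.normE (quad X Y Z₀ W) ℤ.* Z.normE (quad X Y Z₀ W)) ≡ + 4 ℤ.* M) where
    open SyntacticFormulas
    private
      E = Z.normE (quad X Y Z₀ W)
      bₚ : ∀ {k} → Polynomial k → Polynomial k
      bₚ n = # 2 :* n :+ # 1

      A₁≡E : ∃ λ k → A₁ ≡ E ℤ.+ + 2 ℤ.* k
      -- Since q ≡ 1 modulo 4, the hypothesis `norm` gives A₁² ≡ E² modulo 4.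
      A₁≡E = sameParity A₁ E (M ℤ.+ (n ℤ.* n ℤ.+ n ℤ.- + 1) ℤ.* (E ℤ.* E)) (begin
        A₁ ℤ.* A₁ ℤ.- E ℤ.* E
          ≡⟨ solve 3 (λ n A E → A :* A :- E :* E := (A :* A :- F.q (bₚ n) :* (E :* E)) :+ # 4 :* ((n :* n :+ n :- # 1) :* (E :* E))) refl n A₁ E ⟩
        (A₁ ℤ.* A₁ ℤ.- Z.q ℤ.* (E ℤ.* E)) ℤ.+ + 4 ℤ.* ((n ℤ.* n ℤ.+ n ℤ.- + 1) ℤ.* (E ℤ.* E))
          ≡⟨ cong (ℤ._+ + 4 ℤ.* ((n ℤ.* n ℤ.+ n ℤ.- + 1) ℤ.* (E ℤ.* E))) norm ⟩
        + 4 ℤ.* M ℤ.+ + 4 ℤ.* ((n ℤ.* n ℤ.+ n ℤ.- + 1) ℤ.* (E ℤ.* E))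
          ≡⟨ sym (ℤP.*-distribˡ-+ (+ 4) M ((n ℤ.* n ℤ.+ n ℤ.- + 1) ℤ.* (E ℤ.* E))) ⟩
        + 4 ℤ.* (M ℤ.+ (n ℤ.* n ℤ.+ n ℤ.- + 1) ℤ.* (E ℤ.* E)) ∎)
        where open ≡-Reasoning

      k = proj₁ A₁≡E

      h : ℤ
      h = k ℤ.- (n ℤ.* n ℤ.+ n ℤ.- + 1) ℤ.* (Z₀ ℤ.* Z₀) ℤ.+ n ℤ.* n ℤ.* (Y ℤ.* Y) ℤ.+ (n ℤ.+ + 1) ℤ.* (n ℤ.+ + 1) ℤ.* (W ℤ.* W) ℤ.- n ℤ.* (Y ℤ.* W)

      -- Modulo 4 the form normA - 2 normE is (X - Z₀)² + (Y + W)², and it equals 2(A₁ - E), which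
      -- is divisible by 4.
      squares : (X ℤ.- Z₀) ℤ.* (X ℤ.- Z₀) ℤ.+ (Y ℤ.+ W) ℤ.* (Y ℤ.+ W) ≡ + 4 ℤ.* h
      squares = begin
        (X ℤ.- Z₀) ℤ.* (X ℤ.- Z₀) ℤ.+ (Y ℤ.+ W) ℤ.* (Y ℤ.+ W)
          ≡⟨ solve 5 (λ n X Y Z W → let x = quad X Y Z W in (X :- Z) :* (X :- Z) :+ (Y :+ W) :* (Y :+ W)
               := F.normA (bₚ n) x :- # 2 :* F.normE (bₚ n) x
                 :+ # 4 :* (:- ((n :* n :+ n :- # 1) :* (Z :* Z)) :+ n :* n :* (Y :* Y) :+ (n :+ # 1) :* (n :+ # 1) :* (W :* W) :- n :* (Y :* W))) refl n X Y Z₀ W ⟩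
        Z.normA (quad X Y Z₀ W) ℤ.- + 2 ℤ.* E ℤ.+ + 4 ℤ.* rest
          ≡⟨ cong (λ z → z ℤ.- + 2 ℤ.* E ℤ.+ + 4 ℤ.* rest) (trans A≡ (cong (+ 2 ℤ.*_) (proj₂ A₁≡E))) ⟩
        + 2 ℤ.* (E ℤ.+ + 2 ℤ.* k) ℤ.- + 2 ℤ.* E ℤ.+ + 4 ℤ.* rest
          ≡⟨ solve 6 (λ E k a b c d → # 2 :* (E :+ # 2 :* k) :- # 2 :* E :+ # 4 :* (:- a :+ b :+ c :- d) := # 4 :* (k :- a :+ b :+ c :- d)) refl
               E k ((n ℤ.* n ℤ.+ n ℤ.- + 1) ℤ.* (Z₀ ℤ.* Z₀)) (n ℤ.* n ℤ.* (Y ℤ.* Y)) ((n ℤ.+ + 1) ℤ.* (n ℤ.+ + 1) ℤ.* (W ℤ.* W)) (n ℤ.* (Y ℤ.* W)) ⟩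
        + 4 ℤ.* h ∎
        where
        open ≡-Reasoning
        rest = ℤ.- ((n ℤ.* n ℤ.+ n ℤ.- + 1) ℤ.* (Z₀ ℤ.* Z₀)) ℤ.+ n ℤ.* n ℤ.* (Y ℤ.* Y) ℤ.+ (n ℤ.+ + 1) ℤ.* (n ℤ.+ + 1) ℤ.* (W ℤ.* W) ℤ.- n ℤ.* (Y ℤ.* W)

      even : (∃ λ i → X ℤ.- Z₀ ≡ + 2 ℤ.* i) × (∃ λ j → Y ℤ.+ W ≡ + 2 ℤ.* j)
      even = evenSquares (X ℤ.- Z₀) (Y ℤ.+ W) h squares

      finish : (∃ λ i → X ℤ.- Z₀ ≡ + 2 ℤ.* i) × (∃ λ j → Y ℤ.+ W ≡ + 2 ℤ.* j) → ∃ λ v → Z.coords v ≡ quad X Y Z₀ W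
      finish ((i , X-Z≡) , (j , Y+W≡)) = proj₁ (half⇒coords i (j ℤ.- W) Z₀ W) , trans (proj₂ (half⇒coords i (j ℤ.- W) Z₀ W))
        (quad-cong (trans (cong (ℤ._+ Z₀) (sym X-Z≡)) (solve 2 (λ X Z → X :- Z :+ Z := X) refl X Z₀))
          (trans (solve 2 (λ j W → # 2 :* (j :- W) :+ W := # 2 :* j :- W) refl j W) (trans (cong (ℤ._- W) (sym Y+W≡)) (solve 2 (λ Y W → Y :+ W :- W := Y) refl Y W)))
          refl refl)

    lattice : ∃ λ v → Z.coords v ≡ quad X Y Z₀ W
    lattice = finish even

  module Halved (x y z w : ℚ) (X′ Y′ Z′ W′ A₁ M : ℤ) (x≡ : x ≡ ½ ℚ.* ℤtoℚ X′) (y≡ : y ≡ ½ ℚ.* ℤtoℚ Y′) (z≡ : z ≡ ½ ℚ.* ℤtoℚ Z′) (aw≡ : aℚ ℚ.* w ≡ ½ ℚ.* ℤtoℚ W′)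
    (2P′≡A₁ : TracesAndNorms.RelativeNorm.P′ p q x y z w ℚ.+ TracesAndNorms.RelativeNorm.P′ p q x y z w ≡ ℤtoℚ A₁)
    (norm≡M : TracesAndNorms.RelativeNorm.P′ p q x y z w ℚ.* TracesAndNorms.RelativeNorm.P′ p q x y z w ℚ.+ ℚ.- (TracesAndNorms.RelativeNorm.Q′ p q x y z w ℚ.* TracesAndNorms.RelativeNorm.Q′ p q x y z w ℚ.* q) ≡ ℤtoℚ M)
    where
    open TracesAndNorms.RelativeNorm p q x y z w using (P′; Q′)
    private
      module S = ℚ-Solver
      two = ℤtoℚ (+ 2)
      E : ℤ
      E = Z.normE (quad X′ Y′ Z′ W′)

      w≡ : w ≡ ½ ℚ.* 1/a ℚ.* ℤtoℚ W′
      w≡ = begin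
        w                                ≡⟨ sym (ℚP.*-identityˡ w) ⟩
        1ℚ ℚ.* w                         ≡⟨ cong (ℚ._* w) (sym (ℚP.*-inverseˡ aℚ)) ⟩
        1/a ℚ.* aℚ ℚ.* w                 ≡⟨ ℚP.*-assoc 1/a aℚ w ⟩
        1/a ℚ.* (aℚ ℚ.* w)               ≡⟨ cong (1/a ℚ.*_) aw≡ ⟩
        1/a ℚ.* (½ ℚ.* ℤtoℚ W′)          ≡⟨ sym (ℚP.*-assoc 1/a ½ (ℤtoℚ W′)) ⟩
        1/a ℚ.* ½ ℚ.* ℤtoℚ W′            ≡⟨ cong (ℚ._* ℤtoℚ W′) (ℚP.*-comm 1/a ½) ⟩
        ½ ℚ.* 1/a ℚ.* ℤtoℚ W′            ∎
        where open ≡-Reasoning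

      α≡κ : ⟪ ⟨ x , y ⟩ , ⟨ z , w ⟩ ⟫ ≡ κ (quad X′ Y′ Z′ W′)
      α≡κ = cong₂ ⟪_,_⟫ (cong₂ ⟨_,_⟩ x≡ y≡) (cong₂ ⟨_,_⟩ z≡ w≡)

      double : ∀ x X → x ≡ ½ ℚ.* ℤtoℚ X → ℤtoℚ X ≡ two ℚ.* x
      double x X e = sym (trans (cong (two ℚ.*_) e) (trans (sym (ℚP.*-assoc two ½ (ℤtoℚ X))) (ℚP.*-identityˡ (ℤtoℚ X))))

      term : ∀ d D s S → ℤtoℚ d ≡ D → ℤtoℚ s ≡ S → ℤtoℚ (d ℤ.* (s ℤ.* s)) ≡ D ℚ.* (S ℚ.* S)
      term d D s S d≡ s≡ = trans (ℤtoℚ-* d (s ℤ.* s)) (cong₂ ℚ._*_ d≡ (trans (ℤtoℚ-* s s) (cong₂ ℚ._*_ s≡ s≡)))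

      normA≡ : ℤtoℚ (Z.normA (quad X′ Y′ Z′ W′)) ≡ two ℚ.* (P′ ℚ.+ P′)
      normA≡ = begin
        ℤtoℚ (X′ ℤ.* X′ ℤ.+ ℤ.- (Z.p ℤ.* (Y′ ℤ.* Y′)) ℤ.+ Z.q ℤ.* (Z′ ℤ.* Z′) ℤ.+ ℤ.- (Z.r ℤ.* (W′ ℤ.* W′)))
          ≡⟨ trans (ℤtoℚ-+ (X′ ℤ.* X′ ℤ.+ ℤ.- (Z.p ℤ.* (Y′ ℤ.* Y′)) ℤ.+ Z.q ℤ.* (Z′ ℤ.* Z′)) (ℤ.- (Z.r ℤ.* (W′ ℤ.* W′))))
               (cong₂ ℚ._+_ (trans (ℤtoℚ-+ (X′ ℤ.* X′ ℤ.+ ℤ.- (Z.p ℤ.* (Y′ ℤ.* Y′))) (Z.q ℤ.* (Z′ ℤ.* Z′)))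
                 (cong₂ ℚ._+_ (trans (ℤtoℚ-+ (X′ ℤ.* X′) (ℤ.- (Z.p ℤ.* (Y′ ℤ.* Y′)))) (cong₂ ℚ._+_ (trans (ℤtoℚ-* X′ X′) (cong₂ ℚ._*_ (double x X′ x≡) (double x X′ x≡)))
                     (trans (ℤtoℚ-neg (Z.p ℤ.* (Y′ ℤ.* Y′))) (cong ℚ.-_ (term Z.p p Y′ (two ℚ.* y) (sym p≡) (double y Y′ y≡))))))
                   (term Z.q q Z′ (two ℚ.* z) (sym q≡) (double z Z′ z≡))))
                 (trans (ℤtoℚ-neg (Z.r ℤ.* (W′ ℤ.* W′))) (cong ℚ.-_ (term Z.r (ℕtoℚ R) W′ (two ℚ.* (aℚ ℚ.* w)) (cong ℤtoℚ (sym R≡)) (double (aℚ ℚ.* w) W′ aw≡))))) ⟩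
        two ℚ.* x ℚ.* (two ℚ.* x) ℚ.+ ℚ.- (p ℚ.* (two ℚ.* y ℚ.* (two ℚ.* y))) ℚ.+ q ℚ.* (two ℚ.* z ℚ.* (two ℚ.* z)) ℚ.+ ℚ.- (ℕtoℚ R ℚ.* (two ℚ.* (aℚ ℚ.* w) ℚ.* (two ℚ.* (aℚ ℚ.* w))))
          ≡⟨ S.solve 7 (λ x y z aw p q r → S.con (+ 2) S.:* x S.:* (S.con (+ 2) S.:* x) S.:+ S.:- (p S.:* (S.con (+ 2) S.:* y S.:* (S.con (+ 2) S.:* y))) S.:+ q S.:* (S.con (+ 2) S.:* z S.:* (S.con (+ 2) S.:* z)) S.:+ S.:- (r S.:* (S.con (+ 2) S.:* aw S.:* (S.con (+ 2) S.:* aw)))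
               S.:= S.con (+ 2) S.:* ((x S.:* x S.:+ S.:- (y S.:* y S.:* p) S.:+ z S.:* z S.:* q S.:+ S.:- (aw S.:* aw S.:* r)) S.:+ (x S.:* x S.:+ S.:- (y S.:* y S.:* p) S.:+ z S.:* z S.:* q S.:+ S.:- (aw S.:* aw S.:* r)))) refl x y z (aℚ ℚ.* w) p q (ℕtoℚ R) ⟩
        two ℚ.* (P″ (aℚ ℚ.* w ℚ.* (aℚ ℚ.* w) ℚ.* ℕtoℚ R) ℚ.+ P″ (aℚ ℚ.* w ℚ.* (aℚ ℚ.* w) ℚ.* ℕtoℚ R))
          ≡⟨ cong (λ s → two ℚ.* (P″ s ℚ.+ P″ s)) (sym (pq≡ w)) ⟩
        two ℚ.* (P′ ℚ.+ P′) ∎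
        where
        open ≡-Reasoning
        P″ : ℚ → ℚ
        P″ s = x ℚ.* x ℚ.+ ℚ.- (y ℚ.* y ℚ.* p) ℚ.+ z ℚ.* z ℚ.* q ℚ.+ ℚ.- s

      normE≡ : ℤtoℚ (Z.normE (quad X′ Y′ Z′ W′)) ≡ two ℚ.* Q′
      normE≡ = begin
        ℤtoℚ (X′ ℤ.* Z′ ℤ.+ ℤ.- (b ℤ.* (Y′ ℤ.* W′)))
          ≡⟨ trans (ℤtoℚ-+ (X′ ℤ.* Z′) (ℤ.- (b ℤ.* (Y′ ℤ.* W′)))) (cong₂ ℚ._+_ (trans (ℤtoℚ-* X′ Z′) (cong₂ ℚ._*_ (double x X′ x≡) (double z Z′ z≡)))
               (trans (ℤtoℚ-neg (b ℤ.* (Y′ ℤ.* W′))) (cong ℚ.-_ (trans (ℤtoℚ-* b (Y′ ℤ.* W′)) (cong (ℤtoℚ b ℚ.*_) (trans (ℤtoℚ-* Y′ W′) (cong₂ ℚ._*_ (double y Y′ y≡) (double (aℚ ℚ.* w) W′ aw≡)))))))) ⟩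
        two ℚ.* x ℚ.* (two ℚ.* z) ℚ.+ ℚ.- (ℤtoℚ b ℚ.* (two ℚ.* y ℚ.* (two ℚ.* (aℚ ℚ.* w))))
          ≡⟨ S.solve 6 (λ x y z w a b → S.con (+ 2) S.:* x S.:* (S.con (+ 2) S.:* z) S.:+ S.:- (b S.:* (S.con (+ 2) S.:* y S.:* (S.con (+ 2) S.:* (a S.:* w))))
               S.:= S.con (+ 2) S.:* (S.con (+ 2) S.:* (x S.:* z S.:+ S.:- (y S.:* w S.:* (a S.:* b))))) refl x y z w aℚ (ℤtoℚ b) ⟩
        two ℚ.* (two ℚ.* (x ℚ.* z ℚ.+ ℚ.- (y ℚ.* w ℚ.* (aℚ ℚ.* ℤtoℚ b))))
          ≡⟨ cong (λ d → two ℚ.* (two ℚ.* (x ℚ.* z ℚ.+ ℚ.- (y ℚ.* w ℚ.* d)))) (sym (trans p≡ (ℤtoℚ-* Z.a b))) ⟩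
        two ℚ.* Q′ ∎
        where open ≡-Reasoning

      A≡2A₁ : Z.normA (quad X′ Y′ Z′ W′) ≡ + 2 ℤ.* A₁
      A≡2A₁ = ℤtoℚ-injective (trans normA≡ (trans (cong (two ℚ.*_) (2P′≡A₁)) (sym (ℤtoℚ-* (+ 2) A₁))))

      norm≡4M : A₁ ℤ.* A₁ ℤ.- Z.q ℤ.* (E ℤ.* E) ≡ + 4 ℤ.* M
      norm≡4M = ℤtoℚ-injective (begin
        ℤtoℚ (A₁ ℤ.* A₁ ℤ.- Z.q ℤ.* (E ℤ.* E))
          ≡⟨ trans (ℤtoℚ-+ (A₁ ℤ.* A₁) (ℤ.- (Z.q ℤ.* (E ℤ.* E)))) (cong₂ ℚ._+_ (trans (ℤtoℚ-* A₁ A₁) (cong₂ ℚ._*_ (sym (2P′≡A₁)) (sym (2P′≡A₁))))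
               (trans (ℤtoℚ-neg (Z.q ℤ.* (E ℤ.* E))) (cong ℚ.-_ (term Z.q q E (two ℚ.* Q′) (sym q≡) normE≡)))) ⟩
        (P′ ℚ.+ P′) ℚ.* (P′ ℚ.+ P′) ℚ.+ ℚ.- (q ℚ.* (two ℚ.* Q′ ℚ.* (two ℚ.* Q′)))
          ≡⟨ S.solve 3 (λ P Q q → (P S.:+ P) S.:* (P S.:+ P) S.:+ S.:- (q S.:* (S.con (+ 2) S.:* Q S.:* (S.con (+ 2) S.:* Q))) S.:= S.con (+ 4) S.:* (P S.:* P S.:+ S.:- (Q S.:* Q S.:* q))) refl P′ Q′ q ⟩
        four ℚ.* (P′ ℚ.* P′ ℚ.+ ℚ.- (Q′ ℚ.* Q′ ℚ.* q))
          ≡⟨ trans (cong (four ℚ.*_) (norm≡M)) (sym (ℤtoℚ-* (+ 4) M)) ⟩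
        ℤtoℚ (+ 4 ℤ.* M) ∎)
        where open ≡-Reasoning

      v-lattice : ∃ λ v → Z.coords v ≡ quad X′ Y′ Z′ W′
      v-lattice = Parity.lattice X′ Y′ Z′ W′ A₁ M A≡2A₁ norm≡4M

    lattice : ∃ λ v → ⟪ ⟨ x , y ⟩ , ⟨ z , w ⟩ ⟫ ≡ κ (Z.coords v)
    lattice = proj₁ v-lattice , trans α≡κ (cong κ (sym (proj₂ v-lattice)))

  -- As p ≡ r ≡ 3 modulo 4, two of the norm equations become sums of two squares divisible by 4, so
  -- X, Y and W are even. As q ≡ 1, the third gives the parity of Z₀ only once X is known to be
  -- even.
  module Evenness (X Y Z₀ W Mp Mq Mr : ℤ) (norm-p : X ℤ.* X ℤ.- + P ℤ.* (Y ℤ.* Y) ≡ + 4 ℤ.* Mp)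
    (norm-q : X ℤ.* X ℤ.- + Q ℤ.* (Z₀ ℤ.* Z₀) ≡ + 4 ℤ.* Mq) (norm-r : X ℤ.* X ℤ.- + R ℤ.* (W ℤ.* W) ≡ + 4 ℤ.* Mr) where
    private
      open SyntacticFormulas
      bₚ : ∀ {k} → Polynomial k → Polynomial k
      bₚ n = # 2 :* n :+ # 1

    even-p : (∃ λ i → X ≡ + 2 ℤ.* i) × (∃ λ j → Y ≡ + 2 ℤ.* j)
    even-p = evenSquares X Y (Mp ℤ.+ n ℤ.* n ℤ.* (Y ℤ.* Y)) (begin
      X ℤ.* X ℤ.+ Y ℤ.* Y
        ≡⟨ solve 3 (λ n X Y → X :* X :+ Y :* Y := X :* X :- F.p (bₚ n) :* (Y :* Y) :+ # 4 :* (n :* n :* (Y :* Y))) refl n X Y ⟩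
      X ℤ.* X ℤ.- Z.p ℤ.* (Y ℤ.* Y) ℤ.+ + 4 ℤ.* (n ℤ.* n ℤ.* (Y ℤ.* Y))
        ≡⟨ cong (ℤ._+ + 4 ℤ.* (n ℤ.* n ℤ.* (Y ℤ.* Y))) (trans (cong (λ d → X ℤ.* X ℤ.- d ℤ.* (Y ℤ.* Y)) (sym P≡)) norm-p) ⟩
      + 4 ℤ.* Mp ℤ.+ + 4 ℤ.* (n ℤ.* n ℤ.* (Y ℤ.* Y))
        ≡⟨ sym (ℤP.*-distribˡ-+ (+ 4) Mp (n ℤ.* n ℤ.* (Y ℤ.* Y))) ⟩
      + 4 ℤ.* (Mp ℤ.+ n ℤ.* n ℤ.* (Y ℤ.* Y)) ∎)
      where open ≡-Reasoning

    even-r : (∃ λ i → X ≡ + 2 ℤ.* i) × (∃ λ j → W ≡ + 2 ℤ.* j)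
    even-r = evenSquares X W (Mr ℤ.+ (n ℤ.+ + 1) ℤ.* (n ℤ.+ + 1) ℤ.* (W ℤ.* W)) (begin
      X ℤ.* X ℤ.+ W ℤ.* W
        ≡⟨ solve 3 (λ n X Y → X :* X :+ Y :* Y := X :* X :- F.r (bₚ n) :* (Y :* Y) :+ # 4 :* ((n :+ # 1) :* (n :+ # 1) :* (Y :* Y))) refl n X W ⟩
      X ℤ.* X ℤ.- Z.r ℤ.* (W ℤ.* W) ℤ.+ + 4 ℤ.* ((n ℤ.+ + 1) ℤ.* (n ℤ.+ + 1) ℤ.* (W ℤ.* W))
        ≡⟨ cong (ℤ._+ + 4 ℤ.* ((n ℤ.+ + 1) ℤ.* (n ℤ.+ + 1) ℤ.* (W ℤ.* W))) (trans (cong (λ d → X ℤ.* X ℤ.- d ℤ.* (W ℤ.* W)) (sym R≡)) norm-r) ⟩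
      + 4 ℤ.* Mr ℤ.+ + 4 ℤ.* ((n ℤ.+ + 1) ℤ.* (n ℤ.+ + 1) ℤ.* (W ℤ.* W))
        ≡⟨ sym (ℤP.*-distribˡ-+ (+ 4) Mr ((n ℤ.+ + 1) ℤ.* (n ℤ.+ + 1) ℤ.* (W ℤ.* W))) ⟩
      + 4 ℤ.* (Mr ℤ.+ (n ℤ.+ + 1) ℤ.* (n ℤ.+ + 1) ℤ.* (W ℤ.* W)) ∎)
      where open ≡-Reasoning

    even-q : ∀ X′ → X ≡ + 2 ℤ.* X′ → (∃ λ i → Z₀ ≡ + 2 ℤ.* i) × (∃ λ j → + 0 ≡ + 2 ℤ.* j)
    -- A single square is treated as a sum of two with second term 0.
    even-q X′ X≡ = evenSquares Z₀ (+ 0) (X′ ℤ.* X′ ℤ.- Mq ℤ.- (n ℤ.* n ℤ.+ n ℤ.- + 1) ℤ.* (Z₀ ℤ.* Z₀)) (begin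
      Z₀ ℤ.* Z₀ ℤ.+ + 0 ℤ.* + 0
        ≡⟨ solve 3 (λ n X Z → Z :* Z :+ # 0 :* # 0 := X :* X :- (X :* X :- F.q (bₚ n) :* (Z :* Z)) :- # 4 :* ((n :* n :+ n :- # 1) :* (Z :* Z))) refl n X Z₀ ⟩
      X ℤ.* X ℤ.- (X ℤ.* X ℤ.- Z.q ℤ.* (Z₀ ℤ.* Z₀)) ℤ.- + 4 ℤ.* ((n ℤ.* n ℤ.+ n ℤ.- + 1) ℤ.* (Z₀ ℤ.* Z₀))
        ≡⟨ cong₂ (λ s t → s ℤ.* s ℤ.- t ℤ.- + 4 ℤ.* ((n ℤ.* n ℤ.+ n ℤ.- + 1) ℤ.* (Z₀ ℤ.* Z₀))) X≡ (trans (cong (λ d → X ℤ.* X ℤ.- d ℤ.* (Z₀ ℤ.* Z₀)) (sym Q≡)) norm-q) ⟩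
      + 2 ℤ.* X′ ℤ.* (+ 2 ℤ.* X′) ℤ.- + 4 ℤ.* Mq ℤ.- + 4 ℤ.* ((n ℤ.* n ℤ.+ n ℤ.- + 1) ℤ.* (Z₀ ℤ.* Z₀))
        ≡⟨ solve 3 (λ X M t → # 2 :* X :* (# 2 :* X) :- # 4 :* M :- # 4 :* t := # 4 :* (X :* X :- M :- t)) refl X′ Mq ((n ℤ.* n ℤ.+ n ℤ.- + 1) ℤ.* (Z₀ ℤ.* Z₀)) ⟩
      + 4 ℤ.* (X′ ℤ.* X′ ℤ.- Mq ℤ.- (n ℤ.* n ℤ.+ n ℤ.- + 1) ℤ.* (Z₀ ℤ.* Z₀)) ∎)
      where open ≡-Reasoning

  module _ (x y z w : ℚ) (α∈OK : InOK ⟪ ⟨ x , y ⟩ , ⟨ z , w ⟩ ⟫) where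
    private
      open TracesAndNorms p q x y z w
      open RelativeNorm using (P′; Q′)
      α : Kel
      α = ⟪ ⟨ x , y ⟩ , ⟨ z , w ⟩ ⟫

      Lattice : Set
      Lattice = ∃ λ v → ⟪ ⟨ x , y ⟩ , ⟨ z , w ⟩ ⟫ ≡ κ (Z.coords v)

      AI-α : AI α
      AI-α = InOK⇒AI {α} α∈OK

      AI-tp : AI OverP.t
      AI-tp = AI-+ {α} {conj true false α} AI-α (AI-conj true false α AI-α)

      AI-tq : AI OverQ.t
      AI-tq = AI-+ {α} {conj false true α} AI-α (AI-conj false true α AI-α)

      AI-tr : AI OverR.t
      AI-tr = AI-+ {α} {conj false false α} AI-α (AI-conj false false α AI-α)

      AI-t : AI RelativeNorm.t
      AI-t = AI-* {α} {conj false true α} AI-α (AI-conj false true α AI-α)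

      AI-u : AI RelativeNorm.u
      AI-u = AI-conj true false RelativeNorm.t AI-t

      4x-integral : Integral (four ℚ.* x)
      4x-integral = AI-rational (four ℚ.* x) (subst AI OverP.trace (AI-+ {OverP.t} {OverP.u} AI-tp (AI-conj false true OverP.t AI-tp)))

      2P′-integral : Integral (RelativeNorm.P′ ℚ.+ RelativeNorm.P′)
      2P′-integral = AI-rational _ (subst AI RelativeNorm.trace (AI-+ {RelativeNorm.t} {RelativeNorm.u} AI-t AI-u))

      norm-integral : Integral (RelativeNorm.P′ ℚ.* RelativeNorm.P′ ℚ.+ ℚ.- (RelativeNorm.Q′ ℚ.* RelativeNorm.Q′ ℚ.* q))
      norm-integral = AI-rational _ (subst AI RelativeNorm.norm (AI-* {RelativeNorm.t} {RelativeNorm.u} AI-t AI-u))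

      p-norm : Integral (four ℚ.* (x ℚ.* x) ℚ.+ ℚ.- (four ℚ.* (y ℚ.* y ℚ.* ℕtoℚ P)))
      p-norm = Integral-by (cong (λ d → four ℚ.* (x ℚ.* x) ℚ.+ ℚ.- (four ℚ.* (y ℚ.* y ℚ.* d))) (trans p≡ (cong ℤtoℚ (sym P≡))))
        (AI-rational (four ℚ.* (x ℚ.* x) ℚ.+ ℚ.- (four ℚ.* (y ℚ.* y ℚ.* p))) (subst AI OverP.norm (AI-* {OverP.t} {OverP.u} AI-tp (AI-conj false true OverP.t AI-tp))))

      q-norm : Integral (four ℚ.* (x ℚ.* x) ℚ.+ ℚ.- (four ℚ.* (z ℚ.* z ℚ.* ℕtoℚ Q)))
      q-norm = Integral-by (cong (λ d → four ℚ.* (x ℚ.* x) ℚ.+ ℚ.- (four ℚ.* (z ℚ.* z ℚ.* d))) (trans q≡ (cong ℤtoℚ (sym Q≡))))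
        (AI-rational (four ℚ.* (x ℚ.* x) ℚ.+ ℚ.- (four ℚ.* (z ℚ.* z ℚ.* q))) (subst AI OverQ.norm (AI-* {OverQ.t} {OverQ.u} AI-tq (AI-conj true false OverQ.t AI-tq))))

      r-norm : Integral (four ℚ.* (x ℚ.* x) ℚ.+ ℚ.- (four ℚ.* ((aℚ ℚ.* w) ℚ.* (aℚ ℚ.* w) ℚ.* ℕtoℚ R)))
      r-norm = Integral-by (cong (λ d → four ℚ.* (x ℚ.* x) ℚ.+ ℚ.- (four ℚ.* d)) (pq≡ w))
        (AI-rational (four ℚ.* (x ℚ.* x) ℚ.+ ℚ.- (four ℚ.* (w ℚ.* w ℚ.* (p ℚ.* q)))) (subst AI OverR.norm (AI-* {OverR.t} {OverR.u} AI-tr (AI-conj true false OverR.t AI-tr))))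

      QuadraticData : ℕ → ℚ → ℤ → Set
      QuadraticData d y X = ∃ λ Y → ∃ λ M → four ℚ.* y ≡ ℤtoℚ Y × X ℤ.* X ℤ.- + d ℤ.* (Y ℤ.* Y) ≡ + 4 ℤ.* M

      assemble : ∀ X → four ℚ.* x ≡ ℤtoℚ X → QuadraticData P y X → QuadraticData Q z X → QuadraticData R (aℚ ℚ.* w) X →
        Integral (P′ ℚ.+ P′) → Integral (P′ ℚ.* P′ ℚ.+ ℚ.- (Q′ ℚ.* Q′ ℚ.* q)) → Lattice
      assemble X 4x≡X (Y , Mp , 4y≡Y , norm-p) (Z₀ , Mq , 4z≡Z , norm-q) (W , Mr , 4w≡W , norm-r) (A₁ , 2P′≡A₁) (M , norm≡M) = halve even-p even-r
        where
        open Evenness X Y Z₀ W Mp Mq Mr norm-p norm-q norm-r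
        halve : (∃ λ i → X ≡ + 2 ℤ.* i) × (∃ λ j → Y ≡ + 2 ℤ.* j) → (∃ λ i → X ≡ + 2 ℤ.* i) × (∃ λ j → W ≡ + 2 ℤ.* j) → Lattice
        halve ((X′ , X≡) , (Y′ , Y≡)) (_ , (W′ , W≡)) = finish (even-q X′ X≡)
          where
          finish : (∃ λ i → Z₀ ≡ + 2 ℤ.* i) × (∃ λ j → + 0 ≡ + 2 ℤ.* j) → Lattice
          finish ((Z′ , Z≡) , _) = Halved.lattice x y z w X′ Y′ Z′ W′ A₁ M (halves x X X′ 4x≡X X≡) (halves y Y Y′ 4y≡Y Y≡) (halves z Z₀ Z′ 4z≡Z Z≡)
            (halves (aℚ ℚ.* w) W W′ 4w≡W W≡) 2P′≡A₁ norm≡M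

      quadratic : Integral (four ℚ.* x) → Lattice
      quadratic (X , 4x≡X) = assemble X 4x≡X (quadraticInteger P P-squareFree x y X 4x≡X p-norm) (quadraticInteger Q Q-squareFree x z X 4x≡X q-norm)
        (quadraticInteger R R-squareFree x (aℚ ℚ.* w) X 4x≡X r-norm) 2P′-integral norm-integral

    InOK⇒lattice : ∃ λ v → ⟪ ⟨ x , y ⟩ , ⟨ z , w ⟩ ⟫ ≡ κ (Z.coords v)
    InOK⇒lattice = quadratic 4x-integral

-- From the lattice back to the field, and the bound in terms of n.

module Conclusion (n : ℤ) (13≤b : NonNeg (+ 2 ℤ.* n ℤ.+ + 1 ℤ.- + 13)) (p q : ℚ)
  (p≡ : p ≡ ℤtoℚ ((+ 2 ℤ.* n ℤ.+ + 1 ℤ.+ -[1+ 1 ]) ℤ.* (+ 2 ℤ.* n ℤ.+ + 1)))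
  (q≡ : q ≡ ℤtoℚ ((+ 2 ℤ.* n ℤ.+ + 1 ℤ.+ -[1+ 1 ]) ℤ.* (+ 2 ℤ.* n ℤ.+ + 1 ℤ.+ + 2)))
  (theory : BiquadraticTheory p q)
  (P Q R : ℕ) (P-squareFree : SquareFree P) (Q-squareFree : SquareFree Q) (R-squareFree : SquareFree R)
  (P≡ : + P ≡ (+ 2 ℤ.* n ℤ.+ + 1 ℤ.+ -[1+ 1 ]) ℤ.* (+ 2 ℤ.* n ℤ.+ + 1))
  (Q≡ : + Q ≡ (+ 2 ℤ.* n ℤ.+ + 1 ℤ.+ -[1+ 1 ]) ℤ.* (+ 2 ℤ.* n ℤ.+ + 1 ℤ.+ + 2))
  (R≡ : + R ≡ (+ 2 ℤ.* n ℤ.+ + 1) ℤ.* (+ 2 ℤ.* n ℤ.+ + 1 ℤ.+ + 2))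
  where
  open Biquad p q

  private
    b : ℤ
    b = + 2 ℤ.* n ℤ.+ + 1
    module Z = Formulas ℤ-operations b
    nonzero : ℤtoℚ (b ℤ.+ -[1+ 1 ]) ≢ 0ℚ
    nonzero = a≢0 b 13≤b p q p≡ q≡ theory
    open Embedding b p q p≡ q≡ nonzero using (κ; κ-⊞)
    open FieldNorm b p q p≡ q≡ nonzero theory using (normForm-*; 16*N)
    open LatticeIntegers n p q p≡ q≡ nonzero theory using (InOK-coords)
    open CoordinateIdentities b using (coords-⊞)

  maxNorm : ℤ
  maxNorm = (Z.r ℤ.- + 9) ℤ.* (Z.r ℤ.- + 9)

  private
    normForm≤⇒N≤ : ∀ x → Z.normForm x ℤ.≤ + 16 ℤ.* maxNorm → N (κ x) ≤ℚ ℤtoℚ maxNorm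
    normForm≤⇒N≤ x le = ℚP.*-cancelˡ-≤-pos (ℤtoℚ (+ 16)) (subst₂ _≤ℚ_ (sym (16*N x)) (ℤtoℚ-* (+ 16) maxNorm) (ℤtoℚ-≤ le))

    lattice-bound : ∀ v → Indecomposable (κ (Z.coords v)) → N (κ (Z.coords v)) ≤ℚ ℤtoℚ maxNorm
    lattice-bound v ((_ , tp) , indecomposable) = normForm≤⇒N≤ (Z.coords v)
      (Contradiction.indecomposable⇒normForm≤ b 13≤b (latticeOrder b 13≤b p q p≡ q≡ theory) normForm-* v tp λ w w′ tw tw′ eq →
        indecomposable (κ (Z.coords w) , κ (Z.coords w′) , (InOK-coords w , tw) , (InOK-coords w′ , tw′) ,
          trans (cong (λ v → κ (Z.coords v)) eq) (trans (cong κ (coords-⊞ w w′)) (sym (κ-⊞ (Z.coords w) (Z.coords w′))))))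

    bound-along : ∀ {α} → (∃ λ v → α ≡ κ (Z.coords v)) → Indecomposable α → N α ≤ℚ ℤtoℚ maxNorm
    bound-along {α} (v , eq) ind = subst (λ α → N α ≤ℚ ℤtoℚ maxNorm) (sym eq) (lattice-bound v (subst Indecomposable eq ind))

  norm-bound : ∀ α → Indecomposable α → N α ≤ℚ ℤtoℚ maxNorm
  norm-bound α@(⟪ ⟨ x , y ⟩ , ⟨ z , w ⟩ ⟫) ind = bound-along {α}
    (IntegerCoordinates.InOK⇒lattice n p q p≡ q≡ nonzero theory P Q R P-squareFree Q-squareFree R-squareFree P≡ Q≡ R≡ x y z w (proj₁ (proj₁ ind))) ind

open import Data.Nat using (_≤_; _+_; _*_; _∸_)

product≢1 : ∀ x y → NonNeg (x ℤ.- + 2) → NonNeg (y ℤ.- + 1) → x ℤ.* y ≢ + 1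
product≢1 x y x≥2 y≥1 eq = ¬NonNeg-1 (subst (λ z → NonNeg (z ℤ.- + 2)) eq (NonNeg-by
  (solve 2 (λ x y → (x :- # 2) :* (y :- # 1) :+ (x :- # 2) :+ # 2 :* (y :- # 1) := x :* y :- # 2) refl x y)
  (NonNeg-+ (NonNeg-+ (NonNeg-* x≥2 y≥1) x≥2) (NonNeg-* (NonNeg-ℕ 2) y≥1))))
  where open ℤ-Solver

module NormBound (n : ℤ) (13≤b : NonNeg (+ 2 ℤ.* n ℤ.+ + 1 ℤ.- + 13)) (p q : ℚ)
  (P Q R : ℕ) (P-squareFree : SquareFree P) (Q-squareFree : SquareFree Q) (R-squareFree : SquareFree R)
  (p≡P : p ≡ ℕtoℚ P) (q≡Q : q ≡ ℕtoℚ Q)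
  (P≡ : + P ≡ (+ 2 ℤ.* n ℤ.+ + 1 ℤ.+ -[1+ 1 ]) ℤ.* (+ 2 ℤ.* n ℤ.+ + 1))
  (Q≡ : + Q ≡ (+ 2 ℤ.* n ℤ.+ + 1 ℤ.+ -[1+ 1 ]) ℤ.* (+ 2 ℤ.* n ℤ.+ + 1 ℤ.+ + 2))
  (R≡ : + R ≡ (+ 2 ℤ.* n ℤ.+ + 1) ℤ.* (+ 2 ℤ.* n ℤ.+ + 1 ℤ.+ + 2))
  where

  private
    a b c : ℤ
    b = + 2 ℤ.* n ℤ.+ + 1
    a = b ℤ.+ -[1+ 1 ]
    c = b ℤ.+ + 2

    a≥2 : NonNeg (a ℤ.- + 2)
    a≥2 = NonNeg-by (solve 1 (λ b → b :- # 13 :+ # 9 := b :+ con -[1+ 1 ] :- # 2) refl b) (NonNeg-+ 13≤b (NonNeg-ℕ 9))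
      where open ℤ-Solver
    b≥2 : NonNeg (b ℤ.- + 2)
    b≥2 = NonNeg-by (solve 1 (λ b → b :- # 13 :+ # 11 := b :- # 2) refl b) (NonNeg-+ 13≤b (NonNeg-ℕ 11))
      where open ℤ-Solver
    c>0 : NonNeg (c ℤ.- + 1)
    c>0 = NonNeg-by (solve 1 (λ b → b :- # 13 :+ # 14 := b :+ # 2 :- # 1) refl b) (NonNeg-+ 13≤b (NonNeg-ℕ 14))
      where open ℤ-Solver
    a>0 : NonNeg (a ℤ.- + 1)
    a>0 = a>0⇒ b 13≤b
    b>0 : NonNeg (b ℤ.- + 1)
    b>0 = b>0⇒ b 13≤b

    p≡ : p ≡ ℤtoℚ (a ℤ.* b)
    p≡ = trans p≡P (cong ℤtoℚ P≡)
    q≡ : q ≡ ℤtoℚ (a ℤ.* c)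
    q≡ = trans q≡Q (cong ℤtoℚ Q≡)

    nonsquare : ∀ M d → SquareFree M → M ≢ 1 → d ≡ ℕtoℚ M → Nonsquare d
    nonsquare M d sf M≢1 eq = subst Nonsquare (sym eq) (squareFree⇒nonsquare M sf M≢1)

    pq≡a²r : p ℚ.* q ≡ ℤtoℚ a ℚ.* ℤtoℚ a ℚ.* ℤtoℚ (b ℤ.* c)
    pq≡a²r = begin
      p ℚ.* q                                        ≡⟨ cong₂ ℚ._*_ p≡ q≡ ⟩
      ℤtoℚ (a ℤ.* b) ℚ.* ℤtoℚ (a ℤ.* c)              ≡⟨ sym (ℤtoℚ-* (a ℤ.* b) (a ℤ.* c)) ⟩
      ℤtoℚ (a ℤ.* b ℤ.* (a ℤ.* c))                   ≡⟨ cong ℤtoℚ (solve 3 (λ a b c → a :* b :* (a :* c) := a :* a :* (b :* c)) refl a b c) ⟩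
      ℤtoℚ (a ℤ.* a ℤ.* (b ℤ.* c))                   ≡⟨ trans (ℤtoℚ-* (a ℤ.* a) (b ℤ.* c)) (cong (ℚ._* ℤtoℚ (b ℤ.* c)) (ℤtoℚ-* a a)) ⟩
      ℤtoℚ a ℚ.* ℤtoℚ a ℚ.* ℤtoℚ (b ℤ.* c)           ∎
      where
      open ≡-Reasoning
      open ℤ-Solver

    theory : BiquadraticTheory p q
    theory = biquadraticTheory p q (ℤtoℚ (b ℤ.* c)) (ℤtoℚ a)
      (subst (0ℚ ℚ.<_) (sym p≡) (ℤtoℚ-< {+ 0} {a ℤ.* b} (Pos⇒< (a ℤ.* b) (Pos-*-ℤ a b a>0 b>0))))
      (subst (0ℚ ℚ.<_) (sym q≡) (ℤtoℚ-< {+ 0} {a ℤ.* c} (Pos⇒< (a ℤ.* c) (Pos-*-ℤ a c a>0 c>0))))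
      (nonsquare P p P-squareFree (λ P≡1 → product≢1 a b a≥2 b>0 (trans (sym P≡) (cong +_ P≡1))) p≡P)
      (nonsquare Q q Q-squareFree (λ Q≡1 → product≢1 a c a≥2 c>0 (trans (sym Q≡) (cong +_ Q≡1))) q≡Q)
      (nonsquare R (ℤtoℚ (b ℤ.* c)) R-squareFree (λ R≡1 → product≢1 b c b≥2 c>0 (trans (sym R≡) (cong +_ R≡1))) (cong ℤtoℚ (sym R≡)))
      (λ a≡0 → ℤP.<-irrefl (sym (ℤtoℚ-injective {a} {+ 0} a≡0)) (Pos⇒< a a>0))
      pq≡a²r

  open Conclusion n 13≤b p q p≡ q≡ theory P Q R P-squareFree Q-squareFree R-squareFree P≡ Q≡ R≡ public

-- In terms of n the square root of the bound is r - 9 = 4n² + 8n - 6.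
maxNorm-expand : ∀ n → let b = + 2 ℤ.* + n ℤ.+ + 1 in
  (b ℤ.* (b ℤ.+ + 2) ℤ.- + 9) ℤ.* (b ℤ.* (b ℤ.+ + 2) ℤ.- + 9) ≡ + (16 * n * n * n * n + 64 * n * n * n + 16 * n * n + 36) -ℤ + (96 * n)
maxNorm-expand n = trans
  (solve 1 (λ n → let b = # 2 :* n :+ # 1; r = b :* (b :+ # 2) in (r :- # 9) :* (r :- # 9)
    := # 16 :* n :* n :* n :* n :+ # 64 :* n :* n :* n :+ # 16 :* n :* n :+ # 36 :- # 96 :* n) refl (+ n))
  (cong₂ ℤ._-_ (cong (ℤ._+ + 36) (cong₂ ℤ._+_ (cong₂ ℤ._+_ (sym (*n (16 * n * n * n) (*n (16 * n * n) (*n (16 * n) (ℤP.pos-* 16 n))))) (sym (*n (64 * n * n) (*n (64 * n) (ℤP.pos-* 64 n)))))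
    (sym (*n (16 * n) (ℤP.pos-* 16 n))))) (sym (ℤP.pos-* 96 n)))
  where
  open ℤ-Solver
  *n : ∀ k {z} → + k ≡ z → + (k * n) ≡ z ℤ.* + n
  *n k eq = trans (ℤP.pos-* k n) (cong (ℤ._* + n) eq)

theorem1p3 : (n : ℕ) → 6 ≤ n →
    SquareFree ((2 * n ∸ 1) * (2 * n + 1)) →
    SquareFree ((2 * n ∸ 1) * (2 * n + 3)) →
    SquareFree ((2 * n + 1) * (2 * n + 3)) →
    (α : Kel) →
    Biquad.Indecomposable (ℕtoℚ ((2 * n ∸ 1) * (2 * n + 1))) (ℕtoℚ ((2 * n ∸ 1) * (2 * n + 3))) α →
    Biquad.N (ℕtoℚ ((2 * n ∸ 1) * (2 * n + 1))) (ℕtoℚ ((2 * n ∸ 1) * (2 * n + 3))) α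
    ≤ℚ ℤtoℚ (+ (16 * n * n * n * n + 64 * n * n * n + 16 * n * n + 36) -ℤ + (96 * n))
theorem1p3 n 6≤n P-squareFree Q-squareFree R-squareFree α ind =
  subst (λ z → Biquad.N (ℕtoℚ P) (ℕtoℚ Q) α ≤ℚ ℤtoℚ z) (maxNorm-expand n)
    (NormBound.norm-bound (+ n) 13≤b (ℕtoℚ P) (ℕtoℚ Q) P Q ((2 * n + 1) * (2 * n + 3)) P-squareFree Q-squareFree R-squareFree refl refl
      (trans (ℤP.pos-* (2 * n ∸ 1) (2 * n + 1)) (cong₂ ℤ._*_ +a +b))
      (trans (ℤP.pos-* (2 * n ∸ 1) (2 * n + 3)) (cong₂ ℤ._*_ +a +c))
      (trans (ℤP.pos-* (2 * n + 1) (2 * n + 3)) (cong₂ ℤ._*_ +b +c)) α ind)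
  where
  open ℤ-Solver
  P Q : ℕ
  P = (2 * n ∸ 1) * (2 * n + 1)
  Q = (2 * n ∸ 1) * (2 * n + 3)

  +b : + (2 * n + 1) ≡ + 2 ℤ.* + n ℤ.+ + 1
  +b = cong (ℤ._+ + 1) (ℤP.pos-* 2 n)

  +c : + (2 * n + 3) ≡ + 2 ℤ.* + n ℤ.+ + 1 ℤ.+ + 2
  +c = trans (cong (ℤ._+ + 3) (ℤP.pos-* 2 n)) (solve 1 (λ x → x :+ # 3 := x :+ # 1 :+ # 2) refl (+ 2 ℤ.* + n))

  1≤2n : 1 ≤ 2 * n
  1≤2n = ℕP.≤-trans (ℕP.≤-trans (ℕ.s≤s ℕ.z≤n) 6≤n) (ℕP.m≤n*m n 2)

  +a : + (2 * n ∸ 1) ≡ + 2 ℤ.* + n ℤ.+ + 1 ℤ.+ -[1+ 1 ]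
  +a = trans (sym (ℤP.⊖-≥ 1≤2n)) (trans (sym (ℤP.m-n≡m⊖n (2 * n) 1)) (trans (cong (ℤ._- + 1) (ℤP.pos-* 2 n))
    (solve 1 (λ x → x :- # 1 := x :+ # 1 :+ con -[1+ 1 ]) refl (+ 2 ℤ.* + n))))

  13≤b : NonNeg (+ 2 ℤ.* + n ℤ.+ + 1 ℤ.- + 13)
  13≤b = NonNeg-by (solve 1 (λ n → # 2 :* (n :- # 6) := # 2 :* n :+ # 1 :- # 13) refl (+ n))
    (NonNeg-* (NonNeg-ℕ 2) (≤⇒NonNeg (ℤ.+≤+ 6≤n)))
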